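{- The vector species $\mathbf{cf}$ (defined in the context), equipped with the product maps $\mu_A$ and coproduct maps $\Delta_A$ defined in the context, is a connected Hopf monoid.
   Context: Fix a prime power $q$ and the finite field $\mathbb{F}_q$. For a finite set $I$, $\mathrm{Mat}(I)$ is the set of $I$-indexed matrices $(x_{i,j})_{i,j\in I}$ over $\mathbb{F}_q$, $\mathrm{GL}(I)$ the invertible ones, $1_I$ the identity. A partial order of $I$ is a reflexive, antisymmetric, transitive relation $\pi\subseteq I\times I$; a total order is a partial order in which any two elements are comparable; $\mathcal{T}[I]$ denotes the set of total orders of $I$. For a relation $\pi\subseteq I\times I$ containing the diagonal, the pattern group is $\mathrm{UT}(\pi)=\{X\in\mathrm{GL}(I): (X-1_I)_{i,j}\neq 0 \text{ only if } (i,j)\in\pi\}$ (a group when $\pi$ is a partial order). For $J\subseteq I$, $\pi|_J=\pi\cap(J\times J)$. For disjoint $I_1,I_2$ and partial orders $\pi_r$ of $I_r$, the ordinal sum is $\pi_1\star\pi_2=\pi_1\sqcup\pi_2\sqcup(I_1\times I_2)$ (associative). A bijection $\sigma:I\to J$ induces the group isomorphism $\sigma:\mathrm{GL}(I)\to\mathrm{GL}(J)$ relabelling indices, $(\sigma X)_{\sigma(i),\sigma(j)}=X_{i,j}$, restricting to $\mathrm{UT}(\tau)\cong\mathrm{UT}({}^\sigma\tau)$ where ${}^\sigma\tau=\{(\sigma(i),\sigma(j)):(i,j)\in\tau\}$. A set composition $A=(A_1,\dots,A_\ell)$ of $I$ (written $A\vDash I$) is a sequence of pairwise disjoint nonempty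 sets with union $I$. For $C\vDash I$ and $J\subseteq I$, $C|_J$ is $(C_1\cap J,\dots,C_\ell\cap J)$ with empty sets removed; concatenation $A\cdot B$ of compositions of disjoint sets is juxtaposition. $B$ refines $A$ if $B=B|_{A_1}\cdots B|_{A_\ell}$. The Tits product is $A\wedge B=B|_{A_1}\cdots B|_{A_{\ell(A)}}$. Define $\mathrm{Asc}(A)=\bigsqcup_{r<s}A_r\times A_s$ and $\mathrm{Eq}(A)=\bigsqcup_r A_r\times A_r$. For $\tau\in\mathcal{T}[I]$ define the subgroups $\mathrm{UL}(\tau,A)=\mathrm{UT}(\tau\cap\mathrm{Eq}(A))$, $\mathrm{UR}(\tau,A)=\mathrm{UT}(\{(i,i):i\in I\}\cup(\tau\cap\mathrm{Asc}(A)))$, $\mathrm{UP}(\tau,A)=\mathrm{UT}(\tau\cap(\mathrm{Eq}(A)\cup\mathrm{Asc}(A)))$. Note $\mathrm{UL}(\tau,A)=\mathrm{UT}(\tau|_{A_1})\oplus\cdots\oplus\mathrm{UT}(\tau|_{A_\ell})$ (block-diagonal embedding), so $\mathsf{cf}(\mathrm{UL}(\tau,A))\cong\bigotimes_r\mathsf{cf}(\mathrm{UT}(\tau|_{A_r}))$, and $\mathrm{UP}(\tau,A)=\mathrm{UL}(\tau,A)\ltimes\mathrm{UR}(\tau,A)$. For a finite group $G$, $\mathsf{cf}(G)$ is the space of complex class functions. For $K\le G$: $\mathrm{Res}^G_K$ is restriction and $\mathrm{Ind}^G_K\psi(g)=\frac{1}{|K|}\sum_{x\in G,\,xgx^{ -1}\in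 K}\psi(xgx^{ -1})$. For $G=K/H$: $\mathrm{Inf}^K_G\psi=\psi\circ(\text{projection})$ and $\mathrm{Def}^K_G\psi(gH)=\frac1{|H|}\sum_{h\in H}\psi(gh)$; when $K=G\ltimes H$ these are viewed as maps between $\mathsf{cf}(G)$ and $\mathsf{cf}(K)$. Define $\mathrm{Resf}^{\mathrm{UT}(\tau)}_{\mathrm{UL}(\tau,A)}=\mathrm{Def}^{\mathrm{UP}(\tau,A)}_{\mathrm{UL}(\tau,A)}\circ\mathrm{Res}^{\mathrm{UT}(\tau)}_{\mathrm{UP}(\tau,A)}$. If $\mathrm{Asc}(A)\subseteq\tau$ then $\mathrm{UT}(\tau)=\mathrm{UL}(\tau,A)\ltimes\mathrm{UR}(\tau,A)$ and $\mathrm{Inf}^{\mathrm{UT}(\tau)}_{\mathrm{UL}(\tau,A)}$ is defined. A vector species is a functor $\mathbf{a}$ from finite sets with bijections to finite-dimensional complex vector spaces; connected if $\mathbf{a}[\emptyset]=\mathbb{C}$; write $\mathbf{a}(A)=\mathbf{a}[A_1]\otimes\cdots\otimes\mathbf{a}[A_\ell]$. A connected Hopf monoid is a connected species $\mathbf{h}$ with linear maps $\mu_A:\mathbf{h}(A)\to\mathbf{h}[I]$, $\Delta_A:\mathbf{h}[I]\to\mathbf{h}(A)$ for all $A\vDash I$ such that: (associativity/coassociativity) for $B$ refining $A$, $\mu_A\circ(\mu_{B|_{A_1}}\otimes\cdots\otimes\mu_{B|_{A_\ell}})=\mu_B$ and $(\Delta_{B|_{A_1}}\otimes\cdots\otimes\Delta_{B|_{A_\ell}})\circ\Delta_A=\Delta_B$;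 (compatibility) for all $A,B\vDash I$, $\Delta_B\circ\mu_A=(\mu_{A|_{B_1}}\otimes\cdots\otimes\mu_{A|_{B_{\ell(B)}}})\circ\beta\circ(\Delta_{B|_{A_1}}\otimes\cdots\otimes\Delta_{B|_{A_{\ell(A)}}})$, where $\beta:\mathbf{h}(A\wedge B)\to\mathbf{h}(B\wedge A)$ rearranges tensor factors; (naturality) for every bijection $\sigma:I\to J$, with ${}^\sigma A=(\sigma(A_1),\dots,\sigma(A_\ell))$, $\mathbf{h}[\sigma]\circ\mu_A=\mu_{{}^\sigma A}\circ\bigotimes_r\mathbf{h}[\sigma|_{A_r}]$ and $\bigotimes_r\mathbf{h}[\sigma|_{A_r}]\circ\Delta_A=\Delta_{{}^\sigma A}\circ\mathbf{h}[\sigma]$. The species $\mathbf{cf}$: $\mathbf{cf}[I]=\bigoplus_{\tau\in\mathcal{T}[I]}\mathsf{cf}(\mathrm{UT}(\tau))$ and, for a bijection $\sigma:I\to J$, $\mathbf{cf}[\sigma]$ sends $\psi\in\mathsf{cf}(\mathrm{UT}(\tau))$ to $\psi\circ\sigma^{ -1}\in\mathsf{cf}(\mathrm{UT}({}^\sigma\tau))$. Thus $\mathbf{cf}(A)=\bigoplus_{\tau_r\in\mathcal{T}[A_r]}\mathsf{cf}(\mathrm{UT}(\tau_1)\oplus\cdots\oplus\mathrm{UT}(\tau_\ell))$. The product $\mu_A$ maps the summand indexed by $(\tau_1,\dots,\tau_\ell)$ via $\mathrm{Inf}^{\mathrm{UT}(\phi)}_{\mathrm{UL}(\phi,A)}$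 where $\phi=\tau_1\star\cdots\star\tau_\ell$ (so $\mathrm{UL}(\phi,A)=\mathrm{UT}(\tau_1)\oplus\cdots\oplus\mathrm{UT}(\tau_\ell)$). The coproduct $\Delta_A$ maps the summand $\mathsf{cf}(\mathrm{UT}(\phi))$, $\phi\in\mathcal{T}[I]$, via $\mathrm{Resf}^{\mathrm{UT}(\phi)}_{\mathrm{UL}(\phi,A)}$ into $\mathsf{cf}(\mathrm{UT}(\phi|_{A_1})\oplus\cdots\oplus\mathrm{UT}(\phi|_{A_\ell}))$.
   Formalization: The pattern group UT(π) is taken to be unipotent (all diagonal entries equal to 1); read literally with reflexive π, the given formula leaves the diagonal free, and then UP = UL ⋉ UR fails for q > 2 and inflation and deflation are undefined. -}

module Defs where

open import Algebra.Bundles using (CommutativeMonoid; CommutativeRing; Group)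
import Algebra.Definitions
open import Algebra.Module.Bundles.Raw using (RawLeftModule)
import Algebra.Module.Construct.TensorUnit as TensorUnit
open import Algebra.Module.Morphism.Structures using (module LeftModuleMorphisms)
open import Algebra.Module.Structures using (IsLeftModule)
open import Algebra.Morphism.Structures using (module GroupMorphisms)
import Algebra.Properties.CommutativeMonoid.Sum as Sum
import Algebra.Properties.Group as GroupProperties
import Algebra.Properties.Semiring.Sum as SemiringSum
open import Data.Bool.Base using (Bool; true; false; if_then_else_; T; _∧_)
import Data.Bool.Properties as Bool
open import Data.Empty using (⊥; ⊥-elim)
open import Data.Fin.Base as Fin using (Fin; zero; suc; finToFun; funToFin)
import Data.Fin.Properties as Fin
open import Data.Integer.Base using (+_)
open import Data.List.Base as List using (List; []; _∷_; allFin; concatMap; filter)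
open import Data.List.Membership.Propositional using (_∈_)
open import Data.List.Membership.Propositional.Properties
  using (∈-map⁺; ∈-map⁻; ∈-concatMap⁺; ∈-filter⁺; ∈-filter⁻; ∈-allFin; ∈-lookup)
import Data.List.Relation.Unary.All as All
import Data.List.Relation.Unary.All.Properties as All
open import Data.List.Relation.Unary.AllPairs using (AllPairs; []; _∷_)
import Data.List.Relation.Unary.AllPairs as AllPairs
import Data.List.Relation.Unary.AllPairs.Properties as AllPairs
open import Data.List.Relation.Unary.Any as Any using (Any)
import Data.List.Relation.Unary.Any.Properties as Any
open import Data.List.Relation.Unary.Unique.Propositional using (Unique)
import Data.List.Relation.Unary.Unique.Propositional.Properties as Unique
open import Data.Nat.Base as ℕ using (ℕ; zero; suc)
import Data.Nat.Properties as ℕ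
open import Data.Product.Base as Product using (Σ; ∃-syntax; Σ-syntax; _×_; _,_; proj₁; proj₂)
open import Data.Rational.Base as ℚ using (ℚ; 0ℚ; 1ℚ; ½)
import Data.Rational.Properties as ℚ
open import Data.Rational.Solver using (module +-*-Solver)
open import Data.Sum.Base using (_⊎_; inj₁; inj₂; [_,_]′)
open import Data.Unit.Base using (tt)
open import Function.Base using (id; _∘_)
open import Function.Bundles using (Inverse; Equivalence; _↔_; mk↔ₛ′; mk⇔)
import Function.Construct.Composition as Compose
open import Function.Construct.Identity using (↔-id)
import Function.Construct.Symmetry as Symmetry
open import Level using (0ℓ)
open import Relation.Binary.Bundles using (Setoid)
open import Relation.Binary.PropositionalEquality as ≡ using (_≡_; refl; _≗_)
import Relation.Binary.Reasoning.Setoid as SetoidReasoning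
open import Relation.Binary.Structures using (IsPartialOrder; IsTotalOrder)
open import Relation.Nullary.Decidable as Dec using (Dec; yes; no; does; T?)
open import Relation.Nullary.Negation using (¬_)
open import Relation.Binary.Definitions using (tri<; tri≈; tri>)

dist : ℚ → ℚ → ℚ
dist x y = ℚ.∣ x ℚ.- y ∣

-- Real numbers are Cauchy sequences of rationals, equal when their difference
-- tends to zero. Here and below, records without eta and copattern definitions
-- keep the type checker from unfolding the operations.
record ℝ : Set where
  no-eta-equality
  field
    seq    : ℕ → ℚ
    cauchy : ∀ ε → 0ℚ ℚ.< ε →
             ∃[ N ] ∀ m n → N ℕ.≤ m → N ℕ.≤ n → dist (seq m) (seq n) ℚ.< ε

open ℝ

infix 4 _≈ᴿ_

record _≈ᴿ_ (x y : ℝ) : Set where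
  constructor mk≈ᴿ
  field
    close : ∀ ε → 0ℚ ℚ.< ε → ∃[ N ] ∀ n → N ℕ.≤ n → dist (seq x n) (seq y n) ℚ.< ε

open _≈ᴿ_

private

  dist-refl : ∀ x → dist x x ≡ 0ℚ
  dist-refl x = ≡.cong ℚ.∣_∣ (ℚ.+-inverseʳ x)

  dist-sym : ∀ x y → dist x y ≡ dist y x
  dist-sym x y = begin
    ℚ.∣ x ℚ.- y ∣         ≡⟨ ≡.cong ℚ.∣_∣ (solve 2 (λ x y → x :- y := :- (y :- x)) refl x y) ⟩
    ℚ.∣ ℚ.- (y ℚ.- x) ∣   ≡⟨ ℚ.∣-p∣≡∣p∣ (y ℚ.- x) ⟩
    ℚ.∣ y ℚ.- x ∣         ∎
    where open ≡.≡-Reasoning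
          open +-*-Solver

  module _ {ε : ℚ} (0<ε : 0ℚ ℚ.< ε) where

    0<½ε : 0ℚ ℚ.< ½ ℚ.* ε
    0<½ε = ≡.subst (ℚ._< ½ ℚ.* ε) (ℚ.*-zeroʳ ½) (ℚ.*-monoʳ-<-pos ½ 0<ε)

    ½ε+½ε≡ε : ½ ℚ.* ε ℚ.+ ½ ℚ.* ε ≡ ε
    ½ε+½ε≡ε = ≡.trans (≡.sym (ℚ.*-distribʳ-+ ε ½ ½)) (ℚ.*-identityˡ ε)

    halves : ∀ {a b c} → a ℚ.≤ b ℚ.+ c → b ℚ.< ½ ℚ.* ε → c ℚ.< ½ ℚ.* ε → a ℚ.< ε
    halves a≤b+c b< c< =
      ℚ.≤-<-trans a≤b+c (≡.subst (_ ℚ.<_) ½ε+½ε≡ε (ℚ.+-mono-< b< c<))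

  dist-triangle : ∀ x y z → dist x z ℚ.≤ dist x y ℚ.+ dist y z
  dist-triangle x y z = ≡.subst (ℚ._≤ dist x y ℚ.+ dist y z)
    (≡.cong ℚ.∣_∣ (solve 3 (λ x y z → (x :- y) :+ (y :- z) := x :- z) refl x y z))
    (ℚ.∣p+q∣≤∣p∣+∣q∣ (x ℚ.- y) (y ℚ.- z))
    where open +-*-Solver

  dist-+ : ∀ a b c d → dist (a ℚ.+ b) (c ℚ.+ d) ℚ.≤ dist a c ℚ.+ dist b d
  dist-+ a b c d = ≡.subst (ℚ._≤ dist a c ℚ.+ dist b d)
    (≡.cong ℚ.∣_∣ (solve 4 (λ a b c d → (a :- c) :+ (b :- d) := (a :+ b) :- (c :+ d)) refl a b c d))
    (ℚ.∣p+q∣≤∣p∣+∣q∣ (a ℚ.- c) (b ℚ.- d))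
    where open +-*-Solver

  dist-neg : ∀ a b → dist (ℚ.- a) (ℚ.- b) ≡ dist a b
  dist-neg a b = ≡.trans
    (≡.cong ℚ.∣_∣ (solve 2 (λ a b → (:- a) :- (:- b) := :- (a :- b)) refl a b))
    (ℚ.∣-p∣≡∣p∣ (a ℚ.- b))
    where open +-*-Solver

  dist-* : ∀ a b c d → dist (a ℚ.* b) (c ℚ.* d) ℚ.≤ ℚ.∣ a ∣ ℚ.* dist b d ℚ.+ ℚ.∣ d ∣ ℚ.* dist a c
  dist-* a b c d = begin
    ℚ.∣ a ℚ.* b ℚ.- c ℚ.* d ∣
      ≡⟨ ≡.cong ℚ.∣_∣ (solve 4 (λ a b c d → a :* b :- c :* d := a :* (b :- d) :+ d :* (a :- c)) refl a b c d) ⟩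
    ℚ.∣ a ℚ.* (b ℚ.- d) ℚ.+ d ℚ.* (a ℚ.- c) ∣
      ≤⟨ ℚ.∣p+q∣≤∣p∣+∣q∣ (a ℚ.* (b ℚ.- d)) (d ℚ.* (a ℚ.- c)) ⟩
    ℚ.∣ a ℚ.* (b ℚ.- d) ∣ ℚ.+ ℚ.∣ d ℚ.* (a ℚ.- c) ∣
      ≡⟨ ≡.cong₂ ℚ._+_ (ℚ.∣p*q∣≡∣p∣*∣q∣ a (b ℚ.- d)) (ℚ.∣p*q∣≡∣p∣*∣q∣ d (a ℚ.- c)) ⟩
    ℚ.∣ a ∣ ℚ.* dist b d ℚ.+ ℚ.∣ d ∣ ℚ.* dist a c ∎
    where open ℚ.≤-Reasoning
          open +-*-Solver

  -- For B > 0 and ε > 0 some δ > 0 has Bδ ≤ ½ε.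
  scale : ∀ B ε → 0ℚ ℚ.< B → 0ℚ ℚ.< ε →
          ∃[ δ ] 0ℚ ℚ.< δ × (∀ a t → ℚ.∣ a ∣ ℚ.< B → ℚ.∣ t ∣ ℚ.< δ →
                             ℚ.∣ a ∣ ℚ.* ℚ.∣ t ∣ ℚ.< ½ ℚ.* ε)
  scale B ε 0<B 0<ε = δ , 0<δ , bound
    where
    instance
      B-pos : ℚ.Positive B
      B-pos = ℚ.positive 0<B
      B-nonZero : ℚ.NonZero B
      B-nonZero = ℚ.pos⇒nonZero B
    1/B-pos : ℚ.Positive (ℚ.1/ B)
    1/B-pos = ℚ.1/pos⇒pos B
    δ = ℚ.1/ B ℚ.* (½ ℚ.* ε)
    0<δ : 0ℚ ℚ.< δ
    0<δ = ≡.subst (ℚ._< δ) (ℚ.*-zeroʳ (ℚ.1/ B))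
            (ℚ.*-monoʳ-<-pos (ℚ.1/ B) {{1/B-pos}} (0<½ε 0<ε))
    Bδ : B ℚ.* δ ≡ ½ ℚ.* ε
    Bδ = ≡.trans (≡.sym (ℚ.*-assoc B (ℚ.1/ B) (½ ℚ.* ε)))
          (≡.trans (≡.cong (ℚ._* (½ ℚ.* ε)) (ℚ.*-inverseʳ B)) (ℚ.*-identityˡ (½ ℚ.* ε)))
    bound : ∀ a t → ℚ.∣ a ∣ ℚ.< B → ℚ.∣ t ∣ ℚ.< δ → ℚ.∣ a ∣ ℚ.* ℚ.∣ t ∣ ℚ.< ½ ℚ.* ε
    bound a t a<B t<δ = begin-strict
      ℚ.∣ a ∣ ℚ.* ℚ.∣ t ∣  ≤⟨ ℚ.*-monoʳ-≤-nonNeg ℚ.∣ t ∣ {{ℚ.∣-∣-nonNeg t}} (ℚ.<⇒≤ a<B) ⟩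
      B ℚ.* ℚ.∣ t ∣        <⟨ ℚ.*-monoʳ-<-pos B t<δ ⟩
      B ℚ.* δ              ≡⟨ Bδ ⟩
      ½ ℚ.* ε              ∎
      where open ℚ.≤-Reasoning

  bounded : (x : ℝ) → ∃[ B ] 0ℚ ℚ.< B × ∃[ N ] ∀ n → N ℕ.≤ n → ℚ.∣ seq x n ∣ ℚ.< B
  bounded x = B , 0<B , N , bound
    where
    0<1 : 0ℚ ℚ.< 1ℚ
    0<1 = ℚ.positive⁻¹ 1ℚ
    N = proj₁ (cauchy x 1ℚ 0<1)
    B = 1ℚ ℚ.+ ℚ.∣ seq x N ∣
    0<B : 0ℚ ℚ.< B
    0<B = ℚ.+-mono-<-≤ 0<1 (ℚ.0≤∣p∣ (seq x N))
    bound : ∀ n → N ℕ.≤ n → ℚ.∣ seq x n ∣ ℚ.< B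
    bound n N≤n = begin-strict
      ℚ.∣ seq x n ∣
        ≡⟨ ≡.cong ℚ.∣_∣ (solve 2 (λ a b → a := (a :- b) :+ b) refl (seq x n) (seq x N)) ⟩
      ℚ.∣ (seq x n ℚ.- seq x N) ℚ.+ seq x N ∣
        ≤⟨ ℚ.∣p+q∣≤∣p∣+∣q∣ (seq x n ℚ.- seq x N) (seq x N) ⟩
      dist (seq x n) (seq x N) ℚ.+ ℚ.∣ seq x N ∣
        <⟨ ℚ.+-monoˡ-< ℚ.∣ seq x N ∣ (proj₂ (cauchy x 1ℚ 0<1) n N N≤n ℕ.≤-refl) ⟩
      B ∎
      where open ℚ.≤-Reasoning
            open +-*-Solver

  ⊔-left : ∀ {m n k} → m ℕ.⊔ n ℕ.≤ k → m ℕ.≤ k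
  ⊔-left {m} {n} = ℕ.≤-trans (ℕ.m≤m⊔n m n)

  ⊔-right : ∀ {m n k} → m ℕ.⊔ n ℕ.≤ k → n ℕ.≤ k
  ⊔-right {m} {n} = ℕ.≤-trans (ℕ.m≤n⊔m m n)

  termwise : ∀ {x y} → (∀ n → seq x n ≡ seq y n) → x ≈ᴿ y
  termwise {x} {y} eq = mk≈ᴿ λ ε 0<ε → 0 , λ n _ →
    ≡.subst (ℚ._< ε)
      (≡.sym (≡.trans (≡.cong (λ z → dist z (seq y n)) (eq n)) (dist-refl (seq y n)))) 0<ε

constᴿ : ℚ → ℝ
seq    (constᴿ p) _ = p
cauchy (constᴿ p) ε 0<ε = 0 , λ _ _ _ _ → ≡.subst (ℚ._< ε) (≡.sym (dist-refl p)) 0<ε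

infixl 6 _+ᴿ_
infixl 7 _*ᴿ_
infix  8 -ᴿ_

_+ᴿ_ : ℝ → ℝ → ℝ
seq    (x +ᴿ y) n = seq x n ℚ.+ seq y n
cauchy (x +ᴿ y) ε 0<ε =
  let (M , x-close) = cauchy x (½ ℚ.* ε) (0<½ε 0<ε)
      (N , y-close) = cauchy y (½ ℚ.* ε) (0<½ε 0<ε)
  in M ℕ.⊔ N , λ m n p q → halves 0<ε
       (dist-+ (seq x m) (seq y m) (seq x n) (seq y n))
       (x-close m n (⊔-left p) (⊔-left q))
       (y-close m n (⊔-right {M} p) (⊔-right {M} q))

-ᴿ_ : ℝ → ℝ
seq    (-ᴿ x) n = ℚ.- seq x n
cauchy (-ᴿ x) ε 0<ε =
  let (N , x-close) = cauchy x ε 0<ε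
  in N , λ m n p q → ≡.subst (ℚ._< ε) (≡.sym (dist-neg (seq x m) (seq x n))) (x-close m n p q)

_*ᴿ_ : ℝ → ℝ → ℝ
seq    (x *ᴿ y) n = seq x n ℚ.* seq y n
cauchy (x *ᴿ y) ε 0<ε =
  let (B , 0<B , M , x-bound)  = bounded x
      (C , 0<C , N , y-bound)  = bounded y
      (δ , 0<δ , δ-scale)      = scale B ε 0<B 0<ε
      (η , 0<η , η-scale)      = scale C ε 0<C 0<ε
      (M′ , x-close)           = cauchy x η 0<η
      (N′ , y-close)           = cauchy y δ 0<δ
  in (M ℕ.⊔ N) ℕ.⊔ (M′ ℕ.⊔ N′) , λ m n p q → halves 0<ε
       (dist-* (seq x m) (seq y m) (seq x n) (seq y n))
       (δ-scale (seq x m) _ (x-bound m (⊔-left (⊔-left p)))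
         (y-close m n (⊔-right {M′} (⊔-right {M ℕ.⊔ N} p)) (⊔-right {M′} (⊔-right {M ℕ.⊔ N} q))))
       (η-scale (seq y n) _ (y-bound n (⊔-right {M} (⊔-left q)))
         (x-close m n (⊔-left (⊔-right {M ℕ.⊔ N} p)) (⊔-left (⊔-right {M ℕ.⊔ N} q))))

private

  ≈ᴿ-refl : ∀ {x} → x ≈ᴿ x
  ≈ᴿ-refl = termwise λ _ → refl

  ≈ᴿ-sym : ∀ {x y} → x ≈ᴿ y → y ≈ᴿ x
  ≈ᴿ-sym {x} {y} x≈y = mk≈ᴿ λ ε 0<ε →
    let (N , xy-close) = close x≈y ε 0<ε
    in N , λ n p → ≡.subst (ℚ._< ε) (dist-sym (seq x n) (seq y n)) (xy-close n p)

  ≈ᴿ-trans : ∀ {x y z} → x ≈ᴿ y → y ≈ᴿ z → x ≈ᴿ z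
  ≈ᴿ-trans {x} {y} {z} x≈y y≈z = mk≈ᴿ λ ε 0<ε →
    let (M , xy-close) = close x≈y (½ ℚ.* ε) (0<½ε 0<ε)
        (N , yz-close) = close y≈z (½ ℚ.* ε) (0<½ε 0<ε)
    in M ℕ.⊔ N , λ n p → halves 0<ε (dist-triangle (seq x n) (seq y n) (seq z n))
         (xy-close n (⊔-left p)) (yz-close n (⊔-right {M} p))

  +ᴿ-cong : ∀ {x x′ y y′} → x ≈ᴿ x′ → y ≈ᴿ y′ → x +ᴿ y ≈ᴿ x′ +ᴿ y′
  +ᴿ-cong {x} {x′} {y} {y′} x≈x′ y≈y′ = mk≈ᴿ λ ε 0<ε →
    let (M , x-close) = close x≈x′ (½ ℚ.* ε) (0<½ε 0<ε)
        (N , y-close) = close y≈y′ (½ ℚ.* ε) (0<½ε 0<ε)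
    in M ℕ.⊔ N , λ n p → halves 0<ε (dist-+ (seq x n) (seq y n) (seq x′ n) (seq y′ n))
         (x-close n (⊔-left p)) (y-close n (⊔-right {M} p))

  -ᴿ-cong : ∀ {x x′} → x ≈ᴿ x′ → -ᴿ x ≈ᴿ -ᴿ x′
  -ᴿ-cong {x} {x′} x≈x′ = mk≈ᴿ λ ε 0<ε →
    let (N , x-close) = close x≈x′ ε 0<ε
    in N , λ n p → ≡.subst (ℚ._< ε) (≡.sym (dist-neg (seq x n) (seq x′ n))) (x-close n p)

  *ᴿ-cong : ∀ {x x′ y y′} → x ≈ᴿ x′ → y ≈ᴿ y′ → x *ᴿ y ≈ᴿ x′ *ᴿ y′
  *ᴿ-cong {x} {x′} {y} {y′} x≈x′ y≈y′ = mk≈ᴿ λ ε 0<ε →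
    let (B , 0<B , M , x-bound)   = bounded x
        (C , 0<C , N , y′-bound)  = bounded y′
        (δ , 0<δ , δ-scale)       = scale B ε 0<B 0<ε
        (η , 0<η , η-scale)       = scale C ε 0<C 0<ε
        (M′ , x-close)            = close x≈x′ η 0<η
        (N′ , y-close)            = close y≈y′ δ 0<δ
    in (M ℕ.⊔ N) ℕ.⊔ (M′ ℕ.⊔ N′) , λ n p → halves 0<ε
         (dist-* (seq x n) (seq y n) (seq x′ n) (seq y′ n))
         (δ-scale (seq x n) _ (x-bound n (⊔-left (⊔-left p)))
           (y-close n (⊔-right {M′} (⊔-right {M ℕ.⊔ N} p))))
         (η-scale (seq y′ n) _ (y′-bound n (⊔-right {M} (⊔-left p)))
           (x-close n (⊔-left (⊔-right {M ℕ.⊔ N} p))))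

  module _ where

    open Algebra.Definitions _≈ᴿ_

    +ᴿ-assoc : Associative _+ᴿ_
    +ᴿ-assoc x y z = termwise λ n → ℚ.+-assoc (seq x n) (seq y n) (seq z n)

    +ᴿ-comm : Commutative _+ᴿ_
    +ᴿ-comm x y = termwise λ n → ℚ.+-comm (seq x n) (seq y n)

    +ᴿ-identityˡ : LeftIdentity (constᴿ 0ℚ) _+ᴿ_
    +ᴿ-identityˡ x = termwise λ n → ℚ.+-identityˡ (seq x n)

    +ᴿ-identityʳ : RightIdentity (constᴿ 0ℚ) _+ᴿ_
    +ᴿ-identityʳ x = termwise λ n → ℚ.+-identityʳ (seq x n)

    +ᴿ-inverseˡ : LeftInverse (constᴿ 0ℚ) -ᴿ_ _+ᴿ_
    +ᴿ-inverseˡ x = termwise λ n → ℚ.+-inverseˡ (seq x n)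

    +ᴿ-inverseʳ : RightInverse (constᴿ 0ℚ) -ᴿ_ _+ᴿ_
    +ᴿ-inverseʳ x = termwise λ n → ℚ.+-inverseʳ (seq x n)

infix 4 _≈ᶜ_
infixl 6 _+ᶜ_
infixl 7 _*ᶜ_
infix 8 -ᶜ_

record Complex : Set where
  no-eta-equality
  field
    re im : ℝ

open Complex public

record _≈ᶜ_ (z w : Complex) : Set where
  constructor _,_
  field
    re-≈ : re z ≈ᴿ re w
    im-≈ : im z ≈ᴿ im w

open _≈ᶜ_

_+ᶜ_ : Complex → Complex → Complex
re (z +ᶜ w) = re z +ᴿ re w
im (z +ᶜ w) = im z +ᴿ im w

-ᶜ_ : Complex → Complex
re (-ᶜ z) = -ᴿ re z
im (-ᶜ z) = -ᴿ im z

_*ᶜ_ : Complex → Complex → Complex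
re (z *ᶜ w) = re z *ᴿ re w +ᴿ (-ᴿ (im z *ᴿ im w))
im (z *ᶜ w) = re z *ᴿ im w +ᴿ im z *ᴿ re w

rational : ℚ → Complex
re (rational p) = constᴿ p
im (rational p) = constᴿ 0ℚ

private module _ where

  open Algebra.Definitions _≈ᶜ_
  open +-*-Solver

  *ᶜ-assoc : Associative _*ᶜ_
  *ᶜ-assoc x y z =
    termwise (λ n → solve 6 (λ a b c d e f →
      (a :* c :+ (:- (b :* d))) :* e :+ (:- ((a :* d :+ b :* c) :* f)) :=
      a :* (c :* e :+ (:- (d :* f))) :+ (:- (b :* (c :* f :+ d :* e)))) refl
      (seq (re x) n) (seq (im x) n) (seq (re y) n) (seq (im y) n) (seq (re z) n) (seq (im z) n)) ,
    termwise (λ n → solve 6 (λ a b c d e f →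
      (a :* c :+ (:- (b :* d))) :* f :+ (a :* d :+ b :* c) :* e :=
      a :* (c :* f :+ d :* e) :+ b :* (c :* e :+ (:- (d :* f)))) refl
      (seq (re x) n) (seq (im x) n) (seq (re y) n) (seq (im y) n) (seq (re z) n) (seq (im z) n))

  *ᶜ-comm : Commutative _*ᶜ_
  *ᶜ-comm x y =
    termwise (λ n → solve 4 (λ a b c d →
      a :* c :+ (:- (b :* d)) := c :* a :+ (:- (d :* b))) refl
      (seq (re x) n) (seq (im x) n) (seq (re y) n) (seq (im y) n)) ,
    termwise (λ n → solve 4 (λ a b c d → a :* d :+ b :* c := c :* b :+ d :* a) refl
      (seq (re x) n) (seq (im x) n) (seq (re y) n) (seq (im y) n))

  *ᶜ-identityˡ : LeftIdentity (rational 1ℚ) _*ᶜ_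
  *ᶜ-identityˡ x =
    termwise (λ n → solve 2 (λ a b → con 1ℚ :* a :+ (:- (con 0ℚ :* b)) := a) refl
      (seq (re x) n) (seq (im x) n)) ,
    termwise (λ n → solve 2 (λ a b → con 1ℚ :* b :+ con 0ℚ :* a := b) refl
      (seq (re x) n) (seq (im x) n))

  *ᶜ-distribˡ-+ᶜ : _*ᶜ_ DistributesOverˡ _+ᶜ_
  *ᶜ-distribˡ-+ᶜ x y z =
    termwise (λ n → solve 6 (λ a b c d e f →
      a :* (c :+ e) :+ (:- (b :* (d :+ f))) :=
      (a :* c :+ (:- (b :* d))) :+ (a :* e :+ (:- (b :* f)))) refl
      (seq (re x) n) (seq (im x) n) (seq (re y) n) (seq (im y) n) (seq (re z) n) (seq (im z) n)) ,
    termwise (λ n → solve 6 (λ a b c d e f →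
      a :* (d :+ f) :+ b :* (c :+ e) := (a :* d :+ b :* c) :+ (a :* f :+ b :* e)) refl
      (seq (re x) n) (seq (im x) n) (seq (re y) n) (seq (im y) n) (seq (re z) n) (seq (im z) n))

  ≈ᶜ-trans : ∀ {x y z} → x ≈ᶜ y → y ≈ᶜ z → x ≈ᶜ z
  ≈ᶜ-trans p q = ≈ᴿ-trans (re-≈ p) (re-≈ q) , ≈ᴿ-trans (im-≈ p) (im-≈ q)

  +ᶜ-cong : ∀ {x x′ y y′} → x ≈ᶜ x′ → y ≈ᶜ y′ → x +ᶜ y ≈ᶜ x′ +ᶜ y′
  +ᶜ-cong p q = +ᴿ-cong (re-≈ p) (re-≈ q) , +ᴿ-cong (im-≈ p) (im-≈ q)

  *ᶜ-identityʳ : RightIdentity (rational 1ℚ) _*ᶜ_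
  *ᶜ-identityʳ x = ≈ᶜ-trans (*ᶜ-comm x (rational 1ℚ)) (*ᶜ-identityˡ x)

  *ᶜ-distribʳ-+ᶜ : _*ᶜ_ DistributesOverʳ _+ᶜ_
  *ᶜ-distribʳ-+ᶜ x y z =
    ≈ᶜ-trans (*ᶜ-comm (y +ᶜ z) x)
      (≈ᶜ-trans (*ᶜ-distribˡ-+ᶜ x y z) (+ᶜ-cong (*ᶜ-comm x y) (*ᶜ-comm x z)))

ℂ : CommutativeRing 0ℓ 0ℓ
ℂ = record
  { Carrier = Complex
  ; _≈_     = _≈ᶜ_
  ; _+_     = _+ᶜ_
  ; _*_     = _*ᶜ_
  ; -_      = -ᶜ_
  ; 0#      = rational 0ℚ
  ; 1#      = rational 1ℚ
  ; isCommutativeRing = record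
    { isRing = record
      { +-isAbelianGroup = record
        { isGroup = record
          { isMonoid = record
            { isSemigroup = record
              { isMagma = record
                { isEquivalence = record
                  { refl  = ≈ᴿ-refl , ≈ᴿ-refl
                  ; sym   = λ p → ≈ᴿ-sym (re-≈ p) , ≈ᴿ-sym (im-≈ p)
                  ; trans = ≈ᶜ-trans
                  }
                ; ∙-cong = +ᶜ-cong
                }
              ; assoc = λ x y z → +ᴿ-assoc (re x) (re y) (re z) , +ᴿ-assoc (im x) (im y) (im z)
              }
            ; identity = (λ x → +ᴿ-identityˡ (re x) , +ᴿ-identityˡ (im x))
                       , (λ x → +ᴿ-identityʳ (re x) , +ᴿ-identityʳ (im x))
            }
          ; inverse = (λ x → +ᴿ-inverseˡ (re x) , +ᴿ-inverseˡ (im x))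
                    , (λ x → +ᴿ-inverseʳ (re x) , +ᴿ-inverseʳ (im x))
          ; ⁻¹-cong = λ p → -ᴿ-cong (re-≈ p) , -ᴿ-cong (im-≈ p)
          }
        ; comm = λ x y → +ᴿ-comm (re x) (re y) , +ᴿ-comm (im x) (im y)
        }
      ; *-cong = λ p q →
          +ᴿ-cong (*ᴿ-cong (re-≈ p) (re-≈ q)) (-ᴿ-cong (*ᴿ-cong (im-≈ p) (im-≈ q))) ,
          +ᴿ-cong (*ᴿ-cong (re-≈ p) (im-≈ q)) (*ᴿ-cong (im-≈ p) (re-≈ q))
      ; *-assoc    = *ᶜ-assoc
      ; *-identity = *ᶜ-identityˡ , *ᶜ-identityʳ
      ; distrib    = *ᶜ-distribˡ-+ᶜ , *ᶜ-distribʳ-+ᶜ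
      }
    ; *-comm = *ᶜ-comm
    }
  }

module ℂ = CommutativeRing ℂ

count : ∀ {n} → (Fin n → Bool) → ℕ
count {zero}  p = 0
count {suc n} p = if p zero then suc (count (p ∘ suc)) else count (p ∘ suc)

pickFrom : ∀ {n} (p : Fin (suc n) → Bool) (b : Bool) → p zero ≡ b →
           (Fin (count (p ∘ suc)) → Σ[ i ∈ Fin n ] T (p (suc i))) →
           Fin (if b then suc (count (p ∘ suc)) else count (p ∘ suc)) →
           Σ[ i ∈ Fin (suc n) ] T (p i)
pickFrom p true  eq rec zero    = zero , ≡.subst T (≡.sym eq) tt
pickFrom p true  eq rec (suc k) = Product.map suc id (rec k)
pickFrom p false eq rec k       = Product.map suc id (rec k)

pick : ∀ {n} (p : Fin n → Bool) → Fin (count p) → Σ[ i ∈ Fin n ] T (p i)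
pick {suc n} p = pickFrom p (p zero) refl (pick (p ∘ suc))

rank-zero : ∀ {c} b → T b → Fin (if b then suc c else c)
rank-zero true _ = zero

rank-suc : ∀ {c} b → Fin c → Fin (if b then suc c else c)
rank-suc true  k = suc k
rank-suc false k = k

rankFrom : ∀ {n} (p : Fin (suc n) → Bool) (b : Bool) → p zero ≡ b →
           (∀ i → T (p (suc i)) → Fin (count (p ∘ suc))) →
           ∀ i → T (p i) → Fin (if b then suc (count (p ∘ suc)) else count (p ∘ suc))
rankFrom p b eq rec zero    t = rank-zero b (≡.subst T eq t)
rankFrom p b eq rec (suc i) t = rank-suc b (rec i t)

rank : ∀ {n} (p : Fin n → Bool) i → T (p i) → Fin (count p)
rank {suc n} p = rankFrom p (p zero) refl (rank (p ∘ suc))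

pick-rank : ∀ {n} (p : Fin n → Bool) i t → proj₁ (pick p (rank p i t)) ≡ i
pick-rank {suc n} p = go (p zero) refl
  where
  go : ∀ b eq i t →
       proj₁ (pickFrom p b eq (pick (p ∘ suc)) (rankFrom p b eq (rank (p ∘ suc)) i t)) ≡ i
  go true  eq zero    t = refl
  go false eq zero    t = ⊥-elim (≡.subst T eq t)
  go true  eq (suc i) t = ≡.cong suc (pick-rank (p ∘ suc) i t)
  go false eq (suc i) t = ≡.cong suc (pick-rank (p ∘ suc) i t)

rank-pick : ∀ {n} (p : Fin n → Bool) k t → rank p (proj₁ (pick p k)) t ≡ k
rank-pick {suc n} p = go (p zero) refl
  where
  go : ∀ b eq k t →
       rankFrom p b eq (rank (p ∘ suc)) (proj₁ (pickFrom p b eq (pick (p ∘ suc)) k)) t ≡ k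
  go true  eq zero    t with ≡.subst T eq t
  ... | _ = refl
  go true  eq (suc k) t = ≡.cong suc (rank-pick (p ∘ suc) k t)
  go false eq k       t = rank-pick (p ∘ suc) k t

record Finite (S : Setoid 0ℓ 0ℓ) : Set where
  no-eta-equality
  field
    size        : ℕ
    enumeration : Inverse S (≡.setoid (Fin size))

  open Setoid S
  open Inverse enumeration public using () renaming
    ( to to index; from to element; to-cong to index-cong
    ; strictlyInverseˡ to index-element; strictlyInverseʳ to element-index )

  index-injective : ∀ {x y} → index x ≡ index y → x ≈ y
  index-injective {x} {y} eq =
    trans (sym (element-index x)) (trans (reflexive (≡.cong element eq)) (element-index y))

  _≈?_ : ∀ x y → Dec (x ≈ y)
  x ≈? y = Dec.map′ index-injective index-cong (index x Fin.≟ index y)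

  module _ {P : Carrier → Set} (resp : ∀ {x y} → x ≈ y → P x → P y) (P? : ∀ x → Dec (P x)) where

    any? : Dec (∃[ x ] P x)
    any? = Dec.map′ (λ (k , p) → element k , p)
                    (λ (x , p) → index x , resp (sym (element-index x)) p)
                    (Fin.any? (P? ∘ element))

    all? : Dec (∀ x → P x)
    all? = Dec.map′ (λ p x → resp (element-index x) (p (index x)))
                    (λ p k → p (element k))
                    (Fin.all? (P? ∘ element))

open Finite public using (size; enumeration; index; element; index-cong; index-element; element-index; index-injective)
open Finite using (_≈?_; any?; all?)

module _ {S S′ : Setoid 0ℓ 0ℓ} (F : Finite S) where

  private
    module S  = Setoid S
    module S′ = Setoid S′

  -- S′ embeds in S as the elements satisfying P.
  finite-subset : (P : S.Carrier → Bool) (P-cong : ∀ {x y} → x S.≈ y → P x ≡ P y)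
                  (f : S′.Carrier → S.Carrier) →
                  (∀ {x y} → x S′.≈ y → f x S.≈ f y) →
                  (∀ {x y} → f x S.≈ f y → x S′.≈ y) →
                  (∀ x → T (P (f x))) →
                  (lift : ∀ x → T (P x) → S′.Carrier) → (∀ x t → f (lift x t) S.≈ x) →
                  Finite S′
  finite-subset P P-cong f f-cong f-injective f-in lift f-lift = record
    { size = count p
    ; enumeration = record
      { to        = to
      ; from      = from
      ; to-cong   = to-cong
      ; from-cong = λ { refl → S′.refl }
      ; inverse   = (λ { {k} {x} eq → ≡.trans (to-cong eq) (to-from k) })
                  , (λ { {x} {k} refl → from-to x })
      }
    }
    where
    p : Fin (size F) → Bool
    p = P ∘ element F
    f-in′ : ∀ x → T (p (index F (f x)))
    f-in′ x = ≡.subst T (P-cong (S.sym (element-index F (f x)))) (f-in x)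
    to : S′.Carrier → Fin (count p)
    to x = rank p (index F (f x)) (f-in′ x)
    from : Fin (count p) → S′.Carrier
    from k = lift (element F (proj₁ (pick p k))) (proj₂ (pick p k))
    rank-cong : ∀ {i j} → i ≡ j → ∀ t u → rank p i t ≡ rank p j u
    rank-cong {i} refl t u = ≡.cong (rank p i) (Bool.T-irrelevant t u)
    to-cong : ∀ {x y} → x S′.≈ y → to x ≡ to y
    to-cong {x} {y} x≈y = rank-cong (index-cong F (f-cong x≈y)) (f-in′ x) (f-in′ y)
    index-f-from : ∀ k → index F (f (from k)) ≡ proj₁ (pick p k)
    index-f-from k = ≡.trans (index-cong F (f-lift _ (proj₂ (pick p k)))) (index-element F _)
    to-from : ∀ k → to (from k) ≡ k
    to-from k = ≡.trans
      (rank-cong (index-f-from k) (f-in′ (from k)) (proj₂ (pick p k)))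
      (rank-pick p k (proj₂ (pick p k)))
    from-to : ∀ x → from (to x) S′.≈ x
    from-to x = f-injective (S.trans (f-lift _ (proj₂ (pick p (to x))))
      (S.trans (S.reflexive (≡.cong (element F) (pick-rank p (index F (f x)) (f-in′ x))))
               (element-index F (f x))))

finite-functions : ∀ {A : Set} {S : Setoid 0ℓ 0ℓ} → Finite (≡.setoid A) → Finite S →
                   Finite (record { Carrier = A → Setoid.Carrier S
                                  ; _≈_ = λ f g → ∀ a → Setoid._≈_ S (f a) (g a)
                                  ; isEquivalence = record
                                    { refl  = λ _ → Setoid.refl S
                                    ; sym   = λ p a → Setoid.sym S (p a)
                                    ; trans = λ p q a → Setoid.trans S (p a) (q a) } })
finite-functions {A} {S} FA FS = record
  { size = size FS ℕ.^ size FA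
  ; enumeration = record
    { to        = to
    ; from      = from
    ; to-cong   = to-cong
    ; from-cong = λ { refl _ → S.refl }
    ; inverse   = (λ {k} {f} eq → ≡.trans (to-cong eq) (to-from k))
                , (λ { {f} refl → from-to f })
    }
  }
  where
  module S = Setoid S
  to : (A → S.Carrier) → Fin (size FS ℕ.^ size FA)
  to f = funToFin (λ k → index FS (f (element FA k)))
  from : Fin (size FS ℕ.^ size FA) → A → S.Carrier
  from k a = element FS (finToFun k (index FA a))
  funToFin-cong : ∀ {m n} {f g : Fin m → Fin n} → f ≗ g → funToFin f ≡ funToFin g
  funToFin-cong {zero}  eq = refl
  funToFin-cong {suc m} eq = ≡.cong₂ Fin.combine (eq zero) (funToFin-cong (eq ∘ suc))
  to-cong : ∀ {f g} → (∀ a → f a S.≈ g a) → to f ≡ to g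
  to-cong f≈g = funToFin-cong (λ k → index-cong FS (f≈g (element FA k)))
  to-from : ∀ k → to (from k) ≡ k
  to-from k = ≡.trans
    (funToFin-cong λ i → ≡.trans (index-element FS _) (≡.cong (finToFun k) (index-element FA i)))
    (Fin.funToFin-finToFin {size FA} {size FS} k)
  from-to : ∀ f a → from (to f) a S.≈ f a
  from-to f a = S.trans
    (S.reflexive (≡.cong (element FS) (Fin.finToFun-funToFin _ (index FA a))))
    (S.trans (element-index FS _) (S.reflexive (≡.cong f (element-index FA a))))

module FiniteSum (M : CommutativeMonoid 0ℓ 0ℓ) where

  open CommutativeMonoid M renaming (Carrier to A; _≈_ to _≈ᴬ_; refl to reflᴬ; sym to symᴬ; trans to transᴬ)
  open Sum M public using (sum; sum-cong-≋; sum-permute; ∑-comm; ∑-distrib-+)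

  ∑ : {S : Setoid 0ℓ 0ℓ} → Finite S → (Setoid.Carrier S → A) → A
  ∑ F f = sum (f ∘ element F)

  ∑-reindex : {S S′ : Setoid 0ℓ 0ℓ} (F : Finite S) (F′ : Finite S′) (e : Inverse S S′) →
              (f : Setoid.Carrier S′ → A) → (∀ {x y} → Setoid._≈_ S′ x y → f x ≈ᴬ f y) →
              ∑ F (f ∘ Inverse.to e) ≈ᴬ ∑ F′ f
  ∑-reindex {S} {S′} F F′ e f f-cong = symᴬ (transᴬ
    (sum-permute (f ∘ element F′) π)
    (sum-cong-≋ λ k → f-cong (element-index F′ (Inverse.to e (element F k)))))
    where
    π : Fin (size F) ↔ Fin (size F′)
    π = Compose.inverse (Symmetry.inverse (enumeration F))
          (Compose.inverse e (enumeration F′))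

  sum-pick : ∀ {n} (p : Fin n → Bool) (f : Fin n → A) →
             sum (λ k → f (proj₁ (pick p k))) ≈ᴬ sum (λ i → if p i then f i else ε)
  sum-pick {zero}  p f = reflᴬ
  sum-pick {suc n} p f = go (p zero) refl
    where
    go : ∀ b (eq : p zero ≡ b) →
         sum (λ k → f (proj₁ (pickFrom p b eq (pick (p ∘ suc)) k))) ≈ᴬ
         (if b then f zero else ε) ∙ sum (λ i → if p (suc i) then f (suc i) else ε)
    go true  eq = ∙-congˡ (sum-pick (p ∘ suc) (f ∘ suc))
    go false eq = transᴬ (sum-pick (p ∘ suc) (f ∘ suc)) (symᴬ (identityˡ _))

record FinSet : Set₁ where
  no-eta-equality
  field
    ∣_∣    : Set
    finite : Finite (≡.setoid ∣_∣)

open FinSet public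

infix 4 _≃_ _≐_

record _≃_ (I J : FinSet) : Set where
  no-eta-equality
  field
    bijection : ∣ I ∣ ↔ ∣ J ∣

  open Inverse bijection public using (to; from) renaming
    (strictlyInverseˡ to to-from; strictlyInverseʳ to from-to)

open _≃_ public

id-≃ : {I : FinSet} → I ≃ I
bijection id-≃ = ↔-id _

sym-≃ : {I J : FinSet} → I ≃ J → J ≃ I
bijection (sym-≃ σ) = Symmetry.↔-sym (bijection σ)

_∘-≃_ : {I J K : FinSet} → J ≃ K → I ≃ J → I ≃ K
bijection (τ ∘-≃ σ) = bijection τ Compose.↔-∘ bijection σ

record Subset (I : FinSet) : Set where
  no-eta-equality
  infix 5 _∋_
  field
    _∋_ : ∣ I ∣ → Bool

open Subset public

_≐_ : {I : FinSet} → Subset I → Subset I → Set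
S ≐ S′ = ∀ i → (S ∋ i) ≡ (S′ ∋ i)

Σ-T-≡ : {A : Set} {p : A → Bool} {x y : Σ A (T ∘ p)} → proj₁ x ≡ proj₁ y → x ≡ y
Σ-T-≡ {x = a , t} {y = .a , u} refl = ≡.cong (a ,_) (Bool.T-irrelevant t u)

⟦_⟧ : {I : FinSet} → Subset I → FinSet
∣ ⟦_⟧ {I} S ∣     = Σ[ i ∈ ∣ I ∣ ] T (S ∋ i)
finite (⟦_⟧ {I} S) =
  finite-subset (finite I) (S ∋_) (≡.cong (S ∋_)) proj₁ (≡.cong proj₁) Σ-T-≡ proj₂
    _,_ (λ _ _ → refl)

module _ (I : FinSet) where

  ∃? : {P : ∣ I ∣ → Set} → (∀ i → Dec (P i)) → Dec (∃[ i ] P i)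
  ∃? {P} = any? (finite I) (≡.subst P)

  ∀? : {P : ∣ I ∣ → Set} → (∀ i → Dec (P i)) → Dec (∀ i → P i)
  ∀? {P} = all? (finite I) (≡.subst P)

  _≟_ : (i j : ∣ I ∣) → Dec (i ≡ j)
  _≟_ = _≈?_ (finite I)

-- The restriction of a bijection to corresponding subsets; with the identity
-- bijection, the canonical identification of equal subsets.
restrict-≃ : {I J : FinSet} (σ : I ≃ J) {S : Subset I} {S′ : Subset J} →
             (∀ i → (S ∋ i) ≡ (S′ ∋ to σ i)) → ⟦ S ⟧ ≃ ⟦ S′ ⟧
bijection (restrict-≃ σ {S} {S′} eq) = mk↔ₛ′
  (λ (i , t) → to σ i , ≡.subst T (eq i) t)
  (λ (j , t) → from σ j ,
     ≡.subst T (≡.sym (≡.trans (eq (from σ j)) (≡.cong (S′ ∋_) (to-from σ j)))) t)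
  (λ (j , t) → Σ-T-≡ (to-from σ j))
  (λ (i , t) → Σ-T-≡ (from-to σ i))

same-≃ : {I : FinSet} {S S′ : Subset I} → S ≐ S′ → ⟦ S ⟧ ≃ ⟦ S′ ⟧
same-≃ = restrict-≃ id-≃

infix 6 _∣∩_

-- S ∩ J as a subset of J
_∣∩_ : {I : FinSet} → Subset I → (J : Subset I) → Subset ⟦ J ⟧
(S ∣∩ J) ∋ (i , _) = S ∋ i

-- S ⊆ J as a subset of I
image : {I : FinSet} (J : Subset I) → Subset ⟦ J ⟧ → Subset I
image J S ∋ i with T? (J ∋ i)
... | yes p = S ∋ (i , p)
... | no  _ = false

module _ {I : FinSet} (J : Subset I) (S : Subset ⟦ J ⟧) where

  image⁺ : ∀ i (p : T (J ∋ i)) → T (S ∋ (i , p)) → T (image J S ∋ i)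
  image⁺ i p t with T? (J ∋ i)
  ... | yes q = ≡.subst (λ p → T (S ∋ (i , p))) (Bool.T-irrelevant p q) t
  ... | no ¬p = ⊥-elim (¬p p)

  image⁻ : ∀ i → T (image J S ∋ i) → Σ[ p ∈ T (J ∋ i) ] T (S ∋ (i , p))
  image⁻ i t with T? (J ∋ i)
  ... | yes p = p , t

  image-≃ : ⟦ S ⟧ ≃ ⟦ image J S ⟧
  bijection image-≃ = mk↔ₛ′
    (λ ((i , p) , t) → i , image⁺ i p t)
    (λ (i , t) → let (p , u) = image⁻ i t in (i , p) , u)
    (λ _ → Σ-T-≡ refl)
    (λ _ → Σ-T-≡ (Σ-T-≡ refl))

lookup-injective : ∀ {A : Set} {xs : List A} → Unique xs →
                   ∀ {k l} → List.lookup xs k ≡ List.lookup xs l → k ≡ l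
lookup-injective (_  ∷ _)   {zero}  {zero}  _  = refl
lookup-injective (x∉ ∷ _)   {zero}  {suc l} eq = ⊥-elim (All.lookup x∉ (∈-lookup l) eq)
lookup-injective (x∉ ∷ _)   {suc k} {zero}  eq = ⊥-elim (All.lookup x∉ (∈-lookup k) (≡.sym eq))
lookup-injective (_  ∷ xs!) {suc k} {suc l} eq = ≡.cong suc (lookup-injective xs! eq)

record Composition (I : FinSet) : Set where
  no-eta-equality
  field
    length   : ℕ
    block    : Fin length → Subset I
    nonempty : ∀ r → ∃[ i ] T (block r ∋ i)
    disjoint : ∀ {r s i} → T (block r ∋ i) → T (block s ∋ i) → r ≡ s
    covers   : ∀ i → ∃[ r ] T (block r ∋ i)

  blockOf : ∣ I ∣ → Fin length
  blockOf i = proj₁ (covers i)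

  blockOf-unique : ∀ {r i} → T (block r ∋ i) → blockOf i ≡ r
  blockOf-unique {i = i} = disjoint (proj₂ (covers i))

open Composition public

infix 4 _≈ᴷ_

record _≈ᴷ_ {I : FinSet} (A B : Composition I) : Set where
  field
    length-≡ : length A ≡ length B
    block-≐  : ∀ r → block A r ≐ block B (Fin.cast length-≡ r)

open _≈ᴷ_ public

-- (σ(A₁) , … , σ(A_ℓ))
transport : {I J : FinSet} → I ≃ J → Composition I → Composition J
length   (transport σ A) = length A
block    (transport σ A) r ∋ j = block A r ∋ from σ j
nonempty (transport σ A) r =
  let (i , p) = nonempty A r
  in to σ i , ≡.subst (λ i → T (block A r ∋ i)) (≡.sym (from-to σ i)) p
disjoint (transport σ A) = disjoint A
covers   (transport σ A) j = covers A (from σ j)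

-- σ restricted to A_r → σ(A_r)
transport-≃ : {I J : FinSet} (σ : I ≃ J) (A : Composition I) → ∀ r →
              ⟦ block A r ⟧ ≃ ⟦ block (transport σ A) r ⟧
transport-≃ σ A r = restrict-≃ σ (λ i → ≡.cong (block A r ∋_) (≡.sym (from-to σ i)))

module _ {I : FinSet} (C : Composition I) (J : Subset I) where

  meets? : ∀ r → Dec (∃[ i ] T (block C r ∣∩ J ∋ i))
  meets? r = ∃? ⟦ J ⟧ (λ i → T? (block C r ∣∩ J ∋ i))

  meeting : List (Fin (length C))
  meeting = filter meets? (allFin (length C))

  -- C|_J: the nonempty intersections of blocks of C with J, in order
  infix 6 _∣_

  _∣_ : Composition ⟦ J ⟧
  length   _∣_ = List.length meeting
  block    _∣_ k = block C (List.lookup meeting k) ∣∩ J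
  nonempty _∣_ k = proj₂ (∈-filter⁻ meets? {xs = allFin (length C)} (∈-lookup k))
  disjoint _∣_ p q = lookup-injective (Unique.filter⁺ meets? (Unique.allFin⁺ _)) (disjoint C p q)
  covers   _∣_ (i , i∈J) =
    let (r , i∈r) = covers C i
        r∈ = ∈-filter⁺ meets? (∈-allFin r) ((i , i∈J) , i∈r)
    in Any.index r∈ , ≡.subst (λ r → T (block C r ∋ i)) (Any.lookup-index r∈) i∈r

-- The concatenation D₁ ⋯ D_ℓ of compositions of the blocks of A; pairs lists,
-- in lexicographic order, the positions (r , s) of the s-th block of D_r.
module _ {I : FinSet} (A : Composition I) (D : ∀ r → Composition ⟦ block A r ⟧) where

  Position : Set
  Position = Σ[ r ∈ Fin (length A) ] Fin (length (D r))

  pairs : List Position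
  pairs = concatMap (λ r → List.map (r ,_) (allFin (length (D r)))) (allFin (length A))

  pairs-unique : Unique pairs
  pairs-unique = Unique.concat⁺
    (All.map⁺ (All.universal (λ r → Unique.map⁺ (λ { refl → refl }) (Unique.allFin⁺ _)) _))
    (AllPairs.map⁺ (AllPairs.map (λ r≢s {_} (p , q) → r≢s (same-row p q)) (Unique.allFin⁺ _)))
    where
    same-row : ∀ {r s x} → x ∈ List.map (r ,_) (allFin (length (D r))) →
               x ∈ List.map (s ,_) (allFin (length (D s))) → r ≡ s
    same-row p q with ∈-map⁻ _ p | ∈-map⁻ _ q
    ... | _ , _ , refl | _ , _ , refl = refl

  pair∈ : ∀ x → x ∈ pairs
  pair∈ (r , s) = ∈-concatMap⁺ (λ r → List.map (r ,_) (allFin (length (D r))))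
    (Any.map (λ { refl → ∈-map⁺ (r ,_) (∈-allFin s) }) (∈-allFin r))

  position : Fin (List.length pairs) → Position
  position = List.lookup pairs

  index-of : Position → Fin (List.length pairs)
  index-of x = Any.index (pair∈ x)

  position-index-of : ∀ x → x ≡ position (index-of x)
  position-index-of x = Any.lookup-index (pair∈ x)

  disjoint-positions : ∀ {r s r′ s′ i} →
    Σ[ p ∈ T (block A r ∋ i) ] T (block (D r) s ∋ (i , p)) →
    Σ[ p ∈ T (block A r′ ∋ i) ] T (block (D r′) s′ ∋ (i , p)) → (r , s) ≡ (r′ , s′)
  disjoint-positions {r} {s} {r′} {s′} {i} (p , t) (q , u) with disjoint A p q
  ... | refl = ≡.cong (r ,_)
    (disjoint (D r) t (≡.subst (λ p → T (block (D r) s′ ∋ (i , p))) (Bool.T-irrelevant q p) u))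

  concatenation : Composition I
  length   concatenation = List.length pairs
  block    concatenation k = let (r , s) = position k in image (block A r) (block (D r) s)
  nonempty concatenation k =
    let (r , s) = position k
        ((i , p) , t) = nonempty (D r) s
    in i , image⁺ (block A r) (block (D r) s) i p t
  disjoint concatenation {k} {l} {i} p q =
    let (r , s)   = position k
        (r′ , s′) = position l
    in lookup-injective pairs-unique
         (disjoint-positions (image⁻ (block A r) (block (D r) s) i p)
                             (image⁻ (block A r′) (block (D r′) s′) i q))
  covers   concatenation i =
    let (r , i∈r) = covers A i
        (s , i∈s) = covers (D r) (i , i∈r)
    in index-of (r , s) ,
       ≡.subst (λ (r , s) → T (image (block A r) (block (D r) s) ∋ i)) (position-index-of (r , s))
         (image⁺ (block A r) (block (D r) s) i i∈r i∈s)

module _ {I : FinSet} where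

  -- The Tits product
  infixl 7 _∧ᵗ_

  _∧ᵗ_ : Composition I → Composition I → Composition I
  A ∧ᵗ B = concatenation A (λ r → B ∣ block A r)

  _Refines_ : Composition I → Composition I → Set
  B Refines A = B ≈ᴷ A ∧ᵗ B

  image-∣∩ : (S J : Subset I) → ∀ i → (image J (S ∣∩ J) ∋ i) ≡ (J ∋ i) ∧ (S ∋ i)
  image-∣∩ S J i with T? (J ∋ i)
  ... | yes p = ≡.sym (≡.cong (_∧ (S ∋ i)) (Equivalence.to Bool.T-≡ p))
  ... | no ¬p = ≡.sym (≡.cong (_∧ (S ∋ i)) (≢true⇒false ¬p))
    where
    ≢true⇒false : ∀ {b} → ¬ T b → b ≡ false
    ≢true⇒false {false} _  = refl
    ≢true⇒false {true}  ¬t = ⊥-elim (¬t tt)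

  -- The blocks of A ∧ B are the nonempty intersections A_r ∩ B_s.
  ∧ᵗ-block⁻ : (A B : Composition I) → ∀ k → ∃[ r ] ∃[ s ]
              (∀ i → (block (A ∧ᵗ B) k ∋ i) ≡ (block A r ∋ i) ∧ (block B s ∋ i))
  ∧ᵗ-block⁻ A B k = r , s , image-∣∩ (block B s) (block A r)
    where
    r = proj₁ (position A (λ r → B ∣ block A r) k)
    s = List.lookup (meeting B (block A r)) (proj₂ (position A (λ r → B ∣ block A r) k))

  ∧ᵗ-block⁺ : (A B : Composition I) → ∀ {r s i} → T (block A r ∋ i) → T (block B s ∋ i) →
              ∃[ k ] (∀ i → (block (A ∧ᵗ B) k ∋ i) ≡ (block A r ∋ i) ∧ (block B s ∋ i))
  ∧ᵗ-block⁺ A B {r} {s} {i} i∈r i∈s = k , λ j → begin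
    (block (A ∧ᵗ B) k ∋ j)
      ≡⟨ ≡.cong (λ (r , t) → image (block A r) (block (B ∣ block A r) t) ∋ j)
           (≡.sym (position-index-of A D (r , Any.index s∈))) ⟩
    (image (block A r) (block B (List.lookup (meeting B (block A r)) (Any.index s∈)) ∣∩ block A r) ∋ j)
      ≡⟨ ≡.cong (λ s → image (block A r) (block B s ∣∩ block A r) ∋ j)
           (≡.sym (Any.lookup-index s∈)) ⟩
    (image (block A r) (block B s ∣∩ block A r) ∋ j)
      ≡⟨ image-∣∩ (block B s) (block A r) j ⟩
    (block A r ∋ j) ∧ (block B s ∋ j) ∎
    where
    open ≡.≡-Reasoning
    D = λ r → B ∣ block A r
    s∈ : s ∈ meeting B (block A r)
    s∈ = ∈-filter⁺ (meets? B (block A r)) (∈-allFin s) ((i , i∈r) , i∈s)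
    k = index-of A D (r , Any.index s∈)

  -- Every block of B ∧ A is a block of A ∧ B.
  ∧ᵗ-swap : (A B : Composition I) → ∀ l → ∃[ k ] block (A ∧ᵗ B) k ≐ block (B ∧ᵗ A) l
  ∧ᵗ-swap A B l = k , λ j → begin
    (block (A ∧ᵗ B) k ∋ j)              ≡⟨ proj₂ found j ⟩
    (block A r ∋ j) ∧ (block B s ∋ j)   ≡⟨ Bool.∧-comm (block A r ∋ j) (block B s ∋ j) ⟩
    (block B s ∋ j) ∧ (block A r ∋ j)   ≡⟨ ≡.sym (proj₂ (proj₂ (∧ᵗ-block⁻ B A l)) j) ⟩
    (block (B ∧ᵗ A) l ∋ j)              ∎
    where
    open ≡.≡-Reasoning
    s = proj₁ (∧ᵗ-block⁻ B A l)
    r = proj₁ (proj₂ (∧ᵗ-block⁻ B A l))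
    i = proj₁ (nonempty (B ∧ᵗ A) l)
    i∈ : T ((block B s ∋ i) ∧ (block A r ∋ i))
    i∈ = ≡.subst T (proj₂ (proj₂ (∧ᵗ-block⁻ B A l)) i) (proj₂ (nonempty (B ∧ᵗ A) l))
    found : ∃[ k ] (∀ j → (block (A ∧ᵗ B) k ∋ j) ≡ (block A r ∋ j) ∧ (block B s ∋ j))
    found = ∧ᵗ-block⁺ A B (proj₂ (Equivalence.to Bool.T-∧ i∈)) (proj₁ (Equivalence.to Bool.T-∧ i∈))
    k = proj₁ found

Mod : Set₁
Mod = RawLeftModule ℂ.Carrier 0ℓ 0ℓ

module Mod (M : Mod) = RawLeftModule M

infix 4 _≅_

record _≅_ (M N : Mod) : Set where
  open LeftModuleMorphisms M N
  field
    fun                     : Mod.Carrierᴹ M → Mod.Carrierᴹ N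
    isLeftModuleIsomorphism : IsLeftModuleIsomorphism fun

IsLinear : (M N : Mod) → (Mod.Carrierᴹ M → Mod.Carrierᴹ N) → Set
IsLinear M N = LeftModuleMorphisms.IsLeftModuleHomomorphism M N

IsLinearIso : (M N : Mod) → (Mod.Carrierᴹ M → Mod.Carrierᴹ N) → Set
IsLinearIso M N = LeftModuleMorphisms.IsLeftModuleIsomorphism M N

IsVectorSpace : Mod → Set
IsVectorSpace M = IsLeftModule ℂ.ring _≈ᴹ_ _+ᴹ_ 0ᴹ -ᴹ_ _*ₗ_
  where open Mod M

ℂ^_ : ℕ → Mod
ℂ^ n = record
  { Carrierᴹ = Fin n → ℂ.Carrier
  ; _≈ᴹ_     = λ v w → ∀ k → v k ℂ.≈ w k
  ; _+ᴹ_     = λ v w k → v k ℂ.+ w k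
  ; _*ₗ_     = λ c v k → c ℂ.* v k
  ; 0ᴹ       = λ _ → ℂ.0#
  ; -ᴹ_      = λ v k → ℂ.- v k
  }

FiniteDimensional : Mod → Set
FiniteDimensional M = ∃[ n ] ℂ^ n ≅ M

ℂ¹ : Mod
ℂ¹ = TensorUnit.rawLeftModule {R = ℂ.rawRing}

module _ {X : Set} (M : X → Mod) where

  infixl 6 _⊕_
  infixl 7 _·_
  infix  4 _∼_

  data Tensor : Set where
    pure : (∀ x → Mod.Carrierᴹ (M x)) → Tensor
    _⊕_  : Tensor → Tensor → Tensor
    _·_  : ℂ.Carrier → Tensor → Tensor
    ⊖_   : Tensor → Tensor
    𝟘    : Tensor

  -- The least congruence making Tensor a vector space and pure multilinear
  data _∼_ : Tensor → Tensor → Set where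
    ∼-refl  : ∀ {t} → t ∼ t
    ∼-sym   : ∀ {t u} → t ∼ u → u ∼ t
    ∼-trans : ∀ {t u v} → t ∼ u → u ∼ v → t ∼ v

    ⊕-cong : ∀ {t t′ u u′} → t ∼ t′ → u ∼ u′ → t ⊕ u ∼ t′ ⊕ u′
    ·-cong : ∀ {c d t u} → c ℂ.≈ d → t ∼ u → c · t ∼ d · u
    ⊖-cong : ∀ {t u} → t ∼ u → ⊖ t ∼ ⊖ u

    ⊕-assoc     : ∀ t u v → (t ⊕ u) ⊕ v ∼ t ⊕ (u ⊕ v)
    ⊕-comm      : ∀ t u → t ⊕ u ∼ u ⊕ t
    ⊕-identityˡ : ∀ t → 𝟘 ⊕ t ∼ t
    ⊖-inverseˡ  : ∀ t → (⊖ t) ⊕ t ∼ 𝟘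
    ·-distribˡ  : ∀ c t u → c · (t ⊕ u) ∼ c · t ⊕ c · u
    ·-distribʳ  : ∀ c d t → (c ℂ.+ d) · t ∼ c · t ⊕ d · t
    ·-assoc     : ∀ c d t → (c ℂ.* d) · t ∼ c · (d · t)
    ·-identityˡ : ∀ t → ℂ.1# · t ∼ t

    pure-cong : ∀ {m n} → (∀ x → Mod._≈ᴹ_ (M x) (m x) (n x)) → pure m ∼ pure n
    pure-+    : ∀ x (m n p : ∀ x → Mod.Carrierᴹ (M x)) →
                Mod._≈ᴹ_ (M x) (p x) (Mod._+ᴹ_ (M x) (m x) (n x)) →
                (∀ y → ¬ y ≡ x → Mod._≈ᴹ_ (M y) (p y) (m y) × Mod._≈ᴹ_ (M y) (p y) (n y)) →
                pure p ∼ pure m ⊕ pure n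
    pure-·    : ∀ x c (m p : ∀ x → Mod.Carrierᴹ (M x)) →
                Mod._≈ᴹ_ (M x) (p x) (Mod._*ₗ_ (M x) c (m x)) →
                (∀ y → ¬ y ≡ x → Mod._≈ᴹ_ (M y) (p y) (m y)) →
                pure p ∼ c · pure m

  ⨂ : Mod
  ⨂ = record
    { Carrierᴹ = Tensor
    ; _≈ᴹ_     = _∼_
    ; _+ᴹ_     = _⊕_
    ; _*ₗ_     = _·_
    ; 0ᴹ       = 𝟘
    ; -ᴹ_      = ⊖_
    }

-- The linear extension of a (multilinear) function of pure tensors
module _ {X : Set} {M : X → Mod} (N : Mod) where

  open Mod N

  extend : ((∀ x → Mod.Carrierᴹ (M x)) → Carrierᴹ) → Tensor M → Carrierᴹ
  extend f (pure m) = f m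
  extend f (t ⊕ u)  = extend f t +ᴹ extend f u
  extend f (c · t)  = c *ₗ extend f t
  extend f (⊖ t)    = -ᴹ extend f t
  extend f 𝟘        = 0ᴹ

⨂-map : {X : Set} {M N : X → Mod} →
        (∀ x → Mod.Carrierᴹ (M x) → Mod.Carrierᴹ (N x)) → Tensor M → Tensor N
⨂-map f = extend (⨂ _) (λ m → pure (λ x → f x (m x)))

-- The isomorphism (m₁ ⊗ ⋯) ⊗ (n₁ ⊗ ⋯) ⊗ ⋯ ↦ m₁ ⊗ ⋯ ⊗ n₁ ⊗ ⋯
module _ where

  Flat : ∀ {n} {S : Fin n → Set} → (∀ r → S r → Mod) → Σ (Fin n) S → Mod
  Flat M (r , s) = M r s

  join : ∀ {n} {S : Fin (suc n) → Set} (M : ∀ r → S r → Mod) →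
         Tensor (M zero) → Tensor (Flat (λ r → M (suc r))) → Tensor (Flat M)
  join M = λ t u → extend (⨂ (Flat M)) (λ m → extend (⨂ (Flat M)) (λ n → pure (cons m n)) u) t
    where
    cons : (∀ s → Mod.Carrierᴹ (M zero s)) →
           (∀ x → Mod.Carrierᴹ (Flat (λ r → M (suc r)) x)) → ∀ x → Mod.Carrierᴹ (Flat M x)
    cons m n (zero  , s) = m s
    cons m n (suc r , s) = n (r , s)

  flattenPure : ∀ {n} {S : Fin n → Set} (M : ∀ r → S r → Mod) →
                (∀ r → Tensor (M r)) → Tensor (Flat M)
  flattenPure {zero}  M t = pure (λ { (() , _) })
  flattenPure {suc n} M t = join M (t zero) (flattenPure (λ r → M (suc r)) (λ r → t (suc r)))

  flatten : ∀ {n} {S : Fin n → Set} (M : ∀ r → S r → Mod) →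
            Tensor (λ r → ⨂ (M r)) → Tensor {Σ (Fin n) S} (λ (r , s) → M r s)
  flatten M = extend (⨂ _) (flattenPure M)

record RawSpecies : Set₁ where
  field
    obj : FinSet → Mod
    map : {I J : FinSet} → I ≃ J → Mod.Carrierᴹ (obj I) → Mod.Carrierᴹ (obj J)

  factors : {I : FinSet} (A : Composition I) → Fin (length A) → Mod
  factors A r = obj ⟦ block A r ⟧

  -- h(A)
  obj⊗ : {I : FinSet} → Composition I → Mod
  obj⊗ A = ⨂ (factors A)

open RawSpecies public using (obj; obj⊗)

record IsVectorSpecies (h : RawSpecies) : Set₁ where
  open RawSpecies h using (map)
  field
    isVectorSpace     : ∀ I → IsVectorSpace (obj h I)
    finiteDimensional : ∀ I → FiniteDimensional (obj h I)
    map-linear        : ∀ {I J} (σ : I ≃ J) → IsLinear (obj h I) (obj h J) (map σ)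
    map-cong          : ∀ {I J} {σ τ : I ≃ J} → (∀ i → to σ i ≡ to τ i) →
                        ∀ x → Mod._≈ᴹ_ (obj h J) (map σ x) (map τ x)
    map-id            : ∀ {I} x → Mod._≈ᴹ_ (obj h I) (map id-≃ x) x
    map-∘             : ∀ {I J K} (τ : J ≃ K) (σ : I ≃ J) x →
                        Mod._≈ᴹ_ (obj h K) (map (τ ∘-≃ σ) x) (map τ (map σ x))

IsConnected : RawSpecies → Set₁
IsConnected h = ∀ I → ¬ ∣ I ∣ → ℂ¹ ≅ obj h I

-- Canonical identifications between the spaces h(A)
module Rearrangement (h : RawSpecies) {I : FinSet} where

  open RawSpecies h using (map; factors)

  -- Permutes tensor factors when A and B have the same blocks in some order.
  rearrange : (A B : Composition I) → (∀ l → ∃[ k ] block A k ≐ block B l) →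
              Mod.Carrierᴹ (obj⊗ h A) → Mod.Carrierᴹ (obj⊗ h B)
  rearrange A B match = extend (obj⊗ h B)
    (λ m → pure (λ l → let (k , eq) = match l in map (same-≃ eq) (m k)))

  relabel : {A B : Composition I} → A ≈ᴷ B → Mod.Carrierᴹ (obj⊗ h B) → Mod.Carrierᴹ (obj⊗ h A)
  relabel {A} {B} e = rearrange B A
    (λ k → Fin.cast (length-≡ e) k , λ i → ≡.sym (block-≐ e k i))

  β : (A B : Composition I) → Mod.Carrierᴹ (obj⊗ h (A ∧ᵗ B)) → Mod.Carrierᴹ (obj⊗ h (B ∧ᵗ A))
  β A B = rearrange (A ∧ᵗ B) (B ∧ᵗ A) (∧ᵗ-swap A B)

  module _ (A : Composition I) (D : ∀ r → Composition ⟦ block A r ⟧) where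

    nested : Mod
    nested = ⨂ (λ r → obj⊗ h (D r))

    merge : Mod.Carrierᴹ nested → Mod.Carrierᴹ (obj⊗ h (concatenation A D))
    merge t = extend (obj⊗ h (concatenation A D))
      (λ m → pure (λ k → let (r , s) = position A D k in
                         map (image-≃ (block A r) (block (D r) s)) (m (r , s))))
      (flatten (λ r → factors (D r)) t)

    split : Mod.Carrierᴹ (obj⊗ h (concatenation A D)) → Mod.Carrierᴹ nested
    split = extend nested (λ m → pure (λ r → pure (λ s →
      map (sym-≃ (image-≃ (block A r) (block (D r) s)))
        (≡.subst (λ (r , s) → Mod.Carrierᴹ (obj h ⟦ image (block A r) (block (D r) s) ⟧))
          (≡.sym (position-index-of A D (r , s)))
          (m (index-of A D (r , s)))))))

module _ (h : RawSpecies)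
         (μ : ∀ {I} (A : Composition I) → Mod.Carrierᴹ (obj⊗ h A) → Mod.Carrierᴹ (obj h I))
         (Δ : ∀ {I} (A : Composition I) → Mod.Carrierᴹ (obj h I) → Mod.Carrierᴹ (obj⊗ h A))
         where

  open RawSpecies h using (map)
  open Rearrangement h

  Linear : Set₁
  Linear = ∀ {I} (A : Composition I) →
    IsLinear (obj⊗ h A) (obj h I) (μ A) × IsLinear (obj h I) (obj⊗ h A) (Δ A)

  -- μ_A and Δ_A respect equality of compositions.
  Extensional : Set₁
  Extensional = ∀ {I} {A B : Composition I} (e : A ≈ᴷ B) →
    (∀ t → Mod._≈ᴹ_ (obj h I) (μ A (relabel e t)) (μ B t)) ×
    (∀ x → Mod._≈ᴹ_ (obj⊗ h A) (Δ A x) (relabel e (Δ B x)))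

  Associative : Set₁
  Associative = ∀ {I} (A B : Composition I) (e : B Refines A) →
    ∀ (t : Mod.Carrierᴹ (nested A (λ r → B ∣ block A r))) →
    Mod._≈ᴹ_ (obj h I)
      (μ A (⨂-map (λ r → μ (B ∣ block A r)) t))
      (μ B (relabel e (merge A (λ r → B ∣ block A r) t)))

  Coassociative : Set₁
  Coassociative = ∀ {I} (A B : Composition I) (e : B Refines A) →
    ∀ (x : Mod.Carrierᴹ (obj h I)) →
    Mod._≈ᴹ_ (obj⊗ h B)
      (relabel e (merge A (λ r → B ∣ block A r) (⨂-map (λ r → Δ (B ∣ block A r)) (Δ A x))))
      (Δ B x)

  Compatible : Set₁
  Compatible = ∀ {I} (A B : Composition I) (t : Mod.Carrierᴹ (obj⊗ h A)) →
    Mod._≈ᴹ_ (obj⊗ h B)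
      (Δ B (μ A t))
      (⨂-map (λ s → μ (A ∣ block B s))
        (split B (λ s → A ∣ block B s)
          (β A B
            (merge A (λ r → B ∣ block A r)
              (⨂-map (λ r → Δ (B ∣ block A r)) t)))))

  μ-Natural : Set₁
  μ-Natural = ∀ {I J} (σ : I ≃ J) (A : Composition I) (t : Mod.Carrierᴹ (obj⊗ h A)) →
    Mod._≈ᴹ_ (obj h J)
      (map σ (μ A t))
      (μ (transport σ A) (⨂-map (λ r → map (transport-≃ σ A r)) t))

  Δ-Natural : Set₁
  Δ-Natural = ∀ {I J} (σ : I ≃ J) (A : Composition I) (x : Mod.Carrierᴹ (obj h I)) →
    Mod._≈ᴹ_ (obj⊗ h (transport σ A))
      (⨂-map (λ r → map (transport-≃ σ A r)) (Δ A x))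
      (Δ (transport σ A) (map σ x))

  IsConnectedHopfMonoid : Set₁
  IsConnectedHopfMonoid =
    IsVectorSpecies h × IsConnected h × Linear × Extensional ×
    Associative × Coassociative × Compatible × μ-Natural × Δ-Natural

record FiniteGroup : Set₁ where
  no-eta-equality
  field
    group   : Group 0ℓ 0ℓ
    finiteᴳ : Finite (Group.setoid group)

  open Group group public

  order : ℕ
  order = size finiteᴳ

  instance
    order-nonZero : ℕ.NonZero order
    order-nonZero = Fin.nonZeroIndex (index finiteᴳ ε)

open FiniteGroup using (finiteᴳ)

infix 4 _⟶_

record _⟶_ (K G : FiniteGroup) : Set where
  no-eta-equality
  private
    module K = FiniteGroup K
    module G = FiniteGroup G
  open GroupMorphisms K.rawGroup G.rawGroup
  field
    fun                 : K.Carrier → G.Carrier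
    isGroupHomomorphism : IsGroupHomomorphism fun

  open IsGroupHomomorphism isGroupHomomorphism public

open _⟶_ public using (fun)

module _ {K G : FiniteGroup} where

  private
    module K = FiniteGroup K
    module G = FiniteGroup G

  multiplicative : (f : K.Carrier → G.Carrier) → (∀ {x y} → x K.≈ y → f x G.≈ f y) →
                   (∀ x y → f (x K.∙ y) G.≈ f x G.∙ f y) → K ⟶ G
  fun (multiplicative f f-cong f-∙) = f
  _⟶_.isGroupHomomorphism (multiplicative f f-cong f-∙) = record
    { isMonoidHomomorphism = record
      { isMagmaHomomorphism = record
        { isRelHomomorphism = record { cong = f-cong }
        ; homo = f-∙
        }
      ; ε-homo = f-ε
      }
    ; ⁻¹-homo = λ x → inverseˡ-unique (f (x K.⁻¹)) (f x)
        (G.trans (G.sym (f-∙ (x K.⁻¹) x)) (G.trans (f-cong (K.inverseˡ x)) f-ε))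
    }
    where
    open GroupProperties G.group
    f-ε : f K.ε G.≈ G.ε
    f-ε = identityˡ-unique (f K.ε) (f K.ε)
      (G.trans (G.sym (f-∙ K.ε K.ε)) (f-cong (K.identityˡ K.ε)))

infixr 9 _∘-⟶_

_∘-⟶_ : {K G H : FiniteGroup} → G ⟶ H → K ⟶ G → K ⟶ H
_∘-⟶_ {H = H} g f = multiplicative (fun g ∘ fun f) (λ eq → g.⟦⟧-cong (f.⟦⟧-cong eq))
  (λ x y → FiniteGroup.trans H (g.⟦⟧-cong (f.homo x y)) (g.homo (fun f x) (fun f y)))
  where
  module g = _⟶_ g
  module f = _⟶_ f

record ClassFunction (G : FiniteGroup) : Set where
  no-eta-equality
  open FiniteGroup G
  field
    value     : Carrier → ℂ.Carrier
    cong      : ∀ {x y} → x ≈ y → value x ℂ.≈ value y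
    invariant : ∀ x g → value (x ∙ g ∙ x ⁻¹) ℂ.≈ value g

open ClassFunction public using (value; invariant) renaming (cong to value-cong)

module _ {G : FiniteGroup} where

  infixl 6 _+ᶠ_
  infixl 7 _·ᶠ_ _*ᶠ_

  0ᶠ 1ᶠ : ClassFunction G
  value      0ᶠ _   = ℂ.0#
  value-cong 0ᶠ _   = ℂ.refl
  invariant  0ᶠ _ _ = ℂ.refl
  value      1ᶠ _   = ℂ.1#
  value-cong 1ᶠ _   = ℂ.refl
  invariant  1ᶠ _ _ = ℂ.refl

  _+ᶠ_ _*ᶠ_ : ClassFunction G → ClassFunction G → ClassFunction G
  value      (ψ +ᶠ χ) g   = value ψ g ℂ.+ value χ g
  value-cong (ψ +ᶠ χ) eq  = ℂ.+-cong (value-cong ψ eq) (value-cong χ eq)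
  invariant  (ψ +ᶠ χ) x g = ℂ.+-cong (invariant ψ x g) (invariant χ x g)
  value      (ψ *ᶠ χ) g   = value ψ g ℂ.* value χ g
  value-cong (ψ *ᶠ χ) eq  = ℂ.*-cong (value-cong ψ eq) (value-cong χ eq)
  invariant  (ψ *ᶠ χ) x g = ℂ.*-cong (invariant ψ x g) (invariant χ x g)

  _·ᶠ_ : ℂ.Carrier → ClassFunction G → ClassFunction G
  value      (c ·ᶠ ψ) g   = c ℂ.* value ψ g
  value-cong (c ·ᶠ ψ) eq  = ℂ.*-congˡ (value-cong ψ eq)
  invariant  (c ·ᶠ ψ) x g = ℂ.*-congˡ (invariant ψ x g)

  -ᶠ_ : ClassFunction G → ClassFunction G
  value      (-ᶠ ψ) g   = ℂ.- value ψ g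
  value-cong (-ᶠ ψ) eq  = ℂ.-‿cong (value-cong ψ eq)
  invariant  (-ᶠ ψ) x g = ℂ.-‿cong (invariant ψ x g)

  ∑ᶠ ∏ᶠ : ∀ {n} → (Fin n → ClassFunction G) → ClassFunction G
  ∑ᶠ {zero}  ψ = 0ᶠ
  ∑ᶠ {suc n} ψ = ψ zero +ᶠ ∑ᶠ (ψ ∘ suc)
  ∏ᶠ {zero}  ψ = 1ᶠ
  ∏ᶠ {suc n} ψ = ψ zero *ᶠ ∏ᶠ (ψ ∘ suc)

pullback : {K G : FiniteGroup} → K ⟶ G → ClassFunction G → ClassFunction K
value      (pullback f ψ) k  = value ψ (fun f k)
value-cong (pullback f ψ) eq = value-cong ψ (_⟶_.⟦⟧-cong f eq)
invariant  (pullback {K} {G} f ψ) x k = ℂ.trans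
  (value-cong ψ (G.trans (f.homo (x K.∙ k) (x K.⁻¹)) (G.∙-cong (f.homo x k) (f.⁻¹-homo x))))
  (invariant ψ (fun f x) (fun f k))
  where
  module K = FiniteGroup K
  module G = FiniteGroup G
  module f = _⟶_ f

Res : {K G : FiniteGroup} → K ⟶ G → ClassFunction G → ClassFunction K
Res = pullback

-- K = G ⋉ H, where ι and κ include G and H in K, and π : K → G is the
-- projection with kernel H
record SemidirectProduct (K G H : FiniteGroup) : Set where
  no-eta-equality
  private
    module K = FiniteGroup K
    module G = FiniteGroup G
    module H = FiniteGroup H
  field
    ι           : G ⟶ K
    κ           : H ⟶ K
    π           : K ⟶ G
    π-ι         : ∀ g → fun π (fun ι g) G.≈ g
    κ-injective : ∀ {h h′} → fun κ h K.≈ fun κ h′ → h H.≈ h′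
    π-κ         : ∀ h → fun π (fun κ h) G.≈ G.ε
    kernel      : ∀ k → fun π k G.≈ G.ε → ∃[ h ] fun κ h K.≈ k

1/_ : (n : ℕ) .{{_ : ℕ.NonZero n}} → ℂ.Carrier
1/ n = rational (+ 1 ℚ./ n)

module ℂSum = FiniteSum ℂ.+-commutativeMonoid

module _ {K G H : FiniteGroup} (S : SemidirectProduct K G H) where

  open SemidirectProduct S
  private
    module K = FiniteGroup K
    module G = FiniteGroup G
    module H = FiniteGroup H
    module ι = _⟶_ ι
    module κ = _⟶_ κ
    module π = _⟶_ π

  Inf : ClassFunction G → ClassFunction K
  Inf = pullback π

  private

    module Conjugation (x : G.Carrier) where

      open SetoidReasoning G.setoid

      in-kernel : ∀ h → fun π (fun ι x K.∙ fun κ h K.∙ fun ι x K.⁻¹) G.≈ G.ε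
      in-kernel h = begin
        fun π (fun ι x K.∙ fun κ h K.∙ fun ι x K.⁻¹)
          ≈⟨ π.homo (fun ι x K.∙ fun κ h) (fun ι x K.⁻¹) ⟩
        fun π (fun ι x K.∙ fun κ h) G.∙ fun π (fun ι x K.⁻¹)
          ≈⟨ G.∙-cong (π.homo (fun ι x) (fun κ h)) (π.⁻¹-homo (fun ι x)) ⟩
        (fun π (fun ι x) G.∙ fun π (fun κ h)) G.∙ fun π (fun ι x) G.⁻¹
          ≈⟨ G.∙-congʳ (G.∙-congˡ (π-κ h)) ⟩
        (fun π (fun ι x) G.∙ G.ε) G.∙ fun π (fun ι x) G.⁻¹
          ≈⟨ G.∙-congʳ (G.identityʳ (fun π (fun ι x))) ⟩
        fun π (fun ι x) G.∙ fun π (fun ι x) G.⁻¹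
          ≈⟨ G.inverseʳ (fun π (fun ι x)) ⟩
        G.ε ∎

      conj : H.Carrier → H.Carrier
      conj h = proj₁ (kernel _ (in-kernel h))

      κ-conj : ∀ h → fun κ (conj h) K.≈ fun ι x K.∙ fun κ h K.∙ fun ι x K.⁻¹
      κ-conj h = proj₂ (kernel _ (in-kernel h))

      conj-cong : ∀ {h h′} → h H.≈ h′ → conj h H.≈ conj h′
      conj-cong {h} {h′} eq = κ-injective (K.trans (κ-conj h)
        (K.trans (K.∙-congʳ (K.∙-congˡ (κ.⟦⟧-cong eq))) (K.sym (κ-conj h′))))

    open Conjugation

    conj-inverse : ∀ x y → x G.∙ y G.≈ G.ε → ∀ h → conj x (conj y h) H.≈ h
    conj-inverse x y xy≈ε h = κ-injective (begin
      fun κ (conj x (conj y h))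
        ≈⟨ κ-conj x (conj y h) ⟩
      X K.∙ fun κ (conj y h) K.∙ X K.⁻¹
        ≈⟨ K.∙-congʳ (K.∙-congˡ (κ-conj y h)) ⟩
      X K.∙ (Y K.∙ fun κ h K.∙ Y K.⁻¹) K.∙ X K.⁻¹
        ≈⟨ K.∙-congʳ (K.trans (K.∙-congˡ (K.assoc Y (fun κ h) (Y K.⁻¹))) (K.sym (K.assoc X Y _))) ⟩
      (X K.∙ Y) K.∙ (fun κ h K.∙ Y K.⁻¹) K.∙ X K.⁻¹
        ≈⟨ K.∙-congʳ (K.∙-congʳ XY≈ε) ⟩
      K.ε K.∙ (fun κ h K.∙ Y K.⁻¹) K.∙ X K.⁻¹
        ≈⟨ K.∙-congʳ (K.identityˡ _) ⟩
      (fun κ h K.∙ Y K.⁻¹) K.∙ X K.⁻¹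
        ≈⟨ K.assoc (fun κ h) (Y K.⁻¹) (X K.⁻¹) ⟩
      fun κ h K.∙ (Y K.⁻¹ K.∙ X K.⁻¹)
        ≈⟨ K.∙-congˡ (K.trans (K.sym (⁻¹-anti-homo-∙ X Y)) (K.trans (K.⁻¹-cong XY≈ε) ε⁻¹≈ε)) ⟩
      fun κ h K.∙ K.ε
        ≈⟨ K.identityʳ (fun κ h) ⟩
      fun κ h ∎)
      where
      open SetoidReasoning K.setoid
      open GroupProperties K.group
      X = fun ι x
      Y = fun ι y
      XY≈ε : X K.∙ Y K.≈ K.ε
      XY≈ε = K.trans (K.sym (ι.homo x y)) (K.trans (ι.⟦⟧-cong xy≈ε) ι.ε-homo)

    conjugation : G.Carrier → Inverse H.setoid H.setoid
    conjugation x = record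
      { to        = conj x
      ; from      = conj (x G.⁻¹)
      ; to-cong   = conj-cong x
      ; from-cong = conj-cong (x G.⁻¹)
      ; inverse   =
          (λ {h} {k} eq → H.trans (conj-cong x eq) (conj-inverse x (x G.⁻¹) (G.inverseʳ x) h)) ,
          (λ {h} {k} eq → H.trans (conj-cong (x G.⁻¹) eq) (conj-inverse (x G.⁻¹) x (G.inverseˡ x) h))
      }

  Def : ClassFunction K → ClassFunction G
  value      (Def ψ) g =
    (1/ H.order) ℂ.* ℂSum.∑ (finiteᴳ H) (λ h → value ψ (fun ι g K.∙ fun κ h))
  value-cong (Def ψ) eq = ℂ.*-congˡ (ℂSum.sum-cong-≋ λ k →
    value-cong ψ (K.∙-congʳ {fun κ (element (finiteᴳ H) k)} (ι.⟦⟧-cong eq)))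
  invariant  (Def ψ) x g = ℂ.*-congˡ (ℂ.trans
    (ℂSum.sum-cong-≋ λ k → move x g (element (finiteᴳ H) k))
    (ℂSum.∑-reindex (finiteᴳ H) (finiteᴳ H) (conjugation (x G.⁻¹))
      (λ h → value ψ (fun ι g K.∙ fun κ h))
      (λ eq → value-cong ψ (K.∙-congˡ (κ.⟦⟧-cong eq)))))
    where
    move : ∀ x g h → value ψ (fun ι (x G.∙ g G.∙ x G.⁻¹) K.∙ fun κ h) ℂ.≈
                     value ψ (fun ι g K.∙ fun κ (conj (x G.⁻¹) h))
    move x g h = ℂ.trans (value-cong ψ eq)
      (invariant ψ X (fun ι g K.∙ fun κ (conj (x G.⁻¹) h)))
      where
      open SetoidReasoning K.setoid
      X = fun ι x
      g′ = fun ι g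
      h′ = fun κ h
      X⁻¹ = fun ι (x G.⁻¹)
      eq : fun ι (x G.∙ g G.∙ x G.⁻¹) K.∙ fun κ h K.≈
           X K.∙ (g′ K.∙ fun κ (conj (x G.⁻¹) h)) K.∙ X K.⁻¹
      eq = begin
        fun ι (x G.∙ g G.∙ x G.⁻¹) K.∙ h′
          ≈⟨ K.∙-congʳ (K.trans (ι.homo (x G.∙ g) (x G.⁻¹)) (K.∙-congʳ (ι.homo x g))) ⟩
        ((X K.∙ g′) K.∙ X⁻¹) K.∙ h′
          ≈⟨ K.sym (K.identityʳ _) ⟩
        ((X K.∙ g′) K.∙ X⁻¹) K.∙ h′ K.∙ K.ε
          ≈⟨ K.∙-congˡ (K.sym (K.inverseˡ X⁻¹)) ⟩
        ((X K.∙ g′) K.∙ X⁻¹) K.∙ h′ K.∙ (X⁻¹ K.⁻¹ K.∙ X⁻¹)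
          ≈⟨ regroup X g′ X⁻¹ h′ (X⁻¹ K.⁻¹) ⟩
        X K.∙ (g′ K.∙ (X⁻¹ K.∙ h′ K.∙ X⁻¹ K.⁻¹)) K.∙ X⁻¹
          ≈⟨ K.∙-cong (K.∙-congˡ (K.∙-congˡ (K.sym (κ-conj (x G.⁻¹) h)))) (ι.⁻¹-homo x) ⟩
        X K.∙ (g′ K.∙ fun κ (conj (x G.⁻¹) h)) K.∙ X K.⁻¹ ∎
        where
        regroup : ∀ a b c d e → ((a K.∙ b) K.∙ c) K.∙ d K.∙ (e K.∙ c) K.≈
                                a K.∙ (b K.∙ (c K.∙ d K.∙ e)) K.∙ c
        regroup a b c d e = K.trans (K.sym (K.assoc (((a K.∙ b) K.∙ c) K.∙ d) e c))
          (K.∙-congʳ (K.trans (K.∙-congʳ (K.assoc (a K.∙ b) c d))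
            (K.trans (K.assoc (a K.∙ b) (c K.∙ d) e) (K.assoc a b (c K.∙ d K.∙ e)))))

does⁺ : {A : Set} (a? : Dec A) → A → T (does a?)
does⁺ a? a = Equivalence.from Bool.T-≡ (Dec.dec-true a? a)

does⁻ : {A : Set} (a? : Dec A) → T (does a?) → A
does⁻ (yes a) _ = a

record FiniteField (q : ℕ) : Set₁ where
  field
    commutativeRing : CommutativeRing 0ℓ 0ℓ

  open CommutativeRing commutativeRing public

  field
    0≉1                    : ¬ 0# ≈ 1#
    multiplicative-inverse : ∀ x → ¬ x ≈ 0# → ∃[ y ] x * y ≈ 1#
    elements               : Inverse setoid (≡.setoid (Fin q))

  finiteᶠ : Finite setoid
  finiteᶠ = record { size = q ; enumeration = elements }

module _ {S : Setoid 0ℓ 0ℓ} (F : Finite S) (f : Setoid.Carrier S → Setoid.Carrier S) where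

  open Setoid S using (_≈_)

  injective⇒surjective : (∀ {x y} → f x ≈ f y → x ≈ y) → ∀ y → ∃[ x ] f x ≈ y
  injective⇒surjective f-injective y =
    let (k , eq) = onto g g-injective (index F y) in element F k , index-injective F eq
    where
    g : Fin (size F) → Fin (size F)
    g k = index F (f (element F k))
    g-injective : ∀ {k l} → g k ≡ g l → k ≡ l
    g-injective {k} {l} eq = ≡.trans (≡.sym (index-element F k))
      (≡.trans (index-cong F (f-injective (index-injective F eq))) (index-element F l))
    onto : ∀ {n} (g : Fin n → Fin n) → (∀ {k l} → g k ≡ g l → k ≡ l) → ∀ l → ∃[ k ] g k ≡ l
    onto {suc n} g g-inj l with Fin.any? (λ k → g k Fin.≟ l)
    ... | yes found = found
    ... | no ¬found = ⊥-elim (ℕ.<-irrefl refl (Fin.injective⇒≤ {f = h} h-injective))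
      where
      l≢ : ∀ k → ¬ l ≡ g k
      l≢ k eq = ¬found (k , ≡.sym eq)
      h : Fin (suc n) → Fin n
      h k = Fin.punchOut (l≢ k)
      h-injective : ∀ {k k′} → h k ≡ h k′ → k ≡ k′
      h-injective {k} {k′} eq = g-inj (Fin.punchOut-injective (l≢ k) (l≢ k′) eq)

record PartialOrder (I : FinSet) : Set where
  no-eta-equality
  field
    rel            : ∣ I ∣ → ∣ I ∣ → Bool
    isPartialOrder : IsPartialOrder _≡_ (λ i j → T (rel i j))

record TotalOrder (I : FinSet) : Set where
  no-eta-equality
  field
    rel          : ∣ I ∣ → ∣ I ∣ → Bool
    isTotalOrder : IsTotalOrder _≡_ (λ i j → T (rel i j))

infix 4 _∈ᴾ_ _∈ᵀ_ _⊆ᴾ_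

_∈ᴾ_ : {I : FinSet} → ∣ I ∣ × ∣ I ∣ → PartialOrder I → Set
(i , j) ∈ᴾ π = T (PartialOrder.rel π i j)

_∈ᵀ_ : {I : FinSet} → ∣ I ∣ × ∣ I ∣ → TotalOrder I → Set
(i , j) ∈ᵀ τ = T (TotalOrder.rel τ i j)

_⊆ᴾ_ : {I : FinSet} → PartialOrder I → PartialOrder I → Set
π ⊆ᴾ ρ = ∀ i j → (i , j) ∈ᴾ π → (i , j) ∈ᴾ ρ

toPartial : {I : FinSet} → TotalOrder I → PartialOrder I
PartialOrder.rel            (toPartial τ) = TotalOrder.rel τ
PartialOrder.isPartialOrder (toPartial τ) = IsTotalOrder.isPartialOrder (TotalOrder.isTotalOrder τ)

module PatternGroups {q : ℕ} (𝔽 : FiniteField q) where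

  private
    module 𝔽 = FiniteField 𝔽
  open 𝔽 using (_≈_; _+_; _*_; -_; 0#; 1#; finiteᶠ)
  private
    module 𝔽Sum = SemiringSum 𝔽.semiring
  open FiniteSum 𝔽.+-commutativeMonoid using (∑; ∑-reindex; sum-pick)

  _≈?0 : ∀ x → Dec (x ≈ 0#)
  x ≈?0 = _≈?_ finiteᶠ x 0#

  module Matrices (I : FinSet) where

    Mat : Set
    Mat = ∣ I ∣ → ∣ I ∣ → 𝔽.Carrier

    infix  4 _≋_
    infixl 7 _⊡_

    _≋_ : Mat → Mat → Set
    X ≋ Y = ∀ i j → X i j ≈ Y i j

    _⊡_ : Mat → Mat → Mat
    (X ⊡ Y) i j = ∑ (finite I) (λ k → X i k * Y k j)

    𝟙 : Mat
    𝟙 i j = if does (_≟_ I i j) then 1# else 0#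

    mat-setoid : Setoid 0ℓ 0ℓ
    mat-setoid = record
      { Carrier = Mat
      ; _≈_     = _≋_
      ; isEquivalence = record
        { refl  = λ i j → 𝔽.refl
        ; sym   = λ p i j → 𝔽.sym (p i j)
        ; trans = λ p q i j → 𝔽.trans (p i j) (q i j)
        }
      }

    module ≋ = Setoid mat-setoid

    finite-matrices : Finite mat-setoid
    finite-matrices = finite-functions (finite I) (finite-functions (finite I) finiteᶠ)

    𝟙-off : ∀ {i j} → ¬ i ≡ j → 𝟙 i j ≈ 0#
    𝟙-off {i} {j} i≢j = 𝔽.reflexive
      (≡.cong (λ b → if b then 1# else 0#) (Dec.dec-false (_≟_ I i j) i≢j))

    𝟙-on : ∀ i → 𝟙 i i ≈ 1#
    𝟙-on i = 𝔽.reflexive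
      (≡.cong (λ b → if b then 1# else 0#) (Dec.dec-true (_≟_ I i i) refl))

    ∑-cong : {f g : ∣ I ∣ → 𝔽.Carrier} → (∀ k → f k ≈ g k) → ∑ (finite I) f ≈ ∑ (finite I) g
    ∑-cong f≈g = 𝔽Sum.sum-cong-≋ λ k → f≈g (element (finite I) k)

    ∑-zero : {f : ∣ I ∣ → 𝔽.Carrier} → (∀ k → f k ≈ 0#) → ∑ (finite I) f ≈ 0#
    ∑-zero f≈0 = 𝔽.trans (∑-cong f≈0) (𝔽Sum.sum-replicate-zero (size (finite I)))

    ∑-single : ∀ {f : ∣ I ∣ → 𝔽.Carrier} i → (∀ k → ¬ k ≡ i → f k ≈ 0#) → ∑ (finite I) f ≈ f i
    ∑-single {f} i f≈0 = 𝔽.trans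
      (single (f ∘ element (finite I)) (index (finite I) i)
        (λ k k≢ → f≈0 _ (λ eq → k≢ (≡.trans (≡.sym (index-element (finite I) k)) (index-cong (finite I) eq)))))
      (𝔽.reflexive (≡.cong f (element-index (finite I) i)))
      where
      single : ∀ {n} (t : Fin n → 𝔽.Carrier) k → (∀ l → ¬ l ≡ k → t l ≈ 0#) → 𝔽Sum.sum t ≈ t k
      single {suc n} t k t≈0 = 𝔽.trans (𝔽Sum.sum-remove {i = k} t)
        (𝔽.trans (𝔽.+-congˡ (𝔽.trans (𝔽Sum.sum-cong-≋ λ l → t≈0 (Fin.punchIn k l) (Fin.punchInᵢ≢i k l))
                                       (𝔽Sum.sum-replicate-zero n)))
                 (𝔽.+-identityʳ (t k)))

    ⊡-cong : ∀ {X X′ Y Y′} → X ≋ X′ → Y ≋ Y′ → X ⊡ Y ≋ X′ ⊡ Y′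
    ⊡-cong p q i j = ∑-cong (λ k → 𝔽.*-cong (p i k) (q k j))

    ⊡-assoc : ∀ X Y Z → (X ⊡ Y) ⊡ Z ≋ X ⊡ (Y ⊡ Z)
    ⊡-assoc X Y Z i j = begin
      ∑ F (λ k → ∑ F (λ l → X i l * Y l k) * Z k j)
        ≈⟨ ∑-cong (λ k → 𝔽Sum.*-distribʳ-sum (Z k j) (λ l → X i (element F l) * Y (element F l) k)) ⟩
      ∑ F (λ k → ∑ F (λ l → X i l * Y l k * Z k j))
        ≈⟨ 𝔽Sum.∑-comm (λ k l → X i (element F l) * Y (element F l) (element F k) * Z (element F k) j) ⟩
      ∑ F (λ l → ∑ F (λ k → X i l * Y l k * Z k j))
        ≈⟨ ∑-cong (λ l → ∑-cong (λ k → 𝔽.*-assoc (X i l) (Y l k) (Z k j))) ⟩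
      ∑ F (λ l → ∑ F (λ k → X i l * (Y l k * Z k j)))
        ≈⟨ ∑-cong (λ l → 𝔽.sym (𝔽Sum.*-distribˡ-sum (X i l) (λ k → Y l (element F k) * Z (element F k) j))) ⟩
      ∑ F (λ l → X i l * ∑ F (λ k → Y l k * Z k j)) ∎
      where
      open SetoidReasoning 𝔽.setoid
      F = finite I

    ⊡-identityˡ : ∀ X → 𝟙 ⊡ X ≋ X
    ⊡-identityˡ X i j = 𝔽.trans
      (∑-single i (λ k k≢i → 𝔽.trans (𝔽.*-congʳ (𝟙-off (k≢i ∘ ≡.sym))) (𝔽.zeroˡ (X k j))))
      (𝔽.trans (𝔽.*-congʳ (𝟙-on i)) (𝔽.*-identityˡ (X i j)))

    ⊡-identityʳ : ∀ X → X ⊡ 𝟙 ≋ X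
    ⊡-identityʳ X i j = 𝔽.trans
      (∑-single j (λ k k≢j → 𝔽.trans (𝔽.*-congˡ (𝟙-off k≢j)) (𝔽.zeroʳ (X i k))))
      (𝔽.trans (𝔽.*-congˡ (𝟙-on j)) (𝔽.*-identityʳ (X i j)))

    record Invertible (X : Mat) : Set where
      field
        inv      : Mat
        inverseʳ : X ⊡ inv ≋ 𝟙
        inverseˡ : inv ⊡ X ≋ 𝟙

    invertible? : ∀ X → Dec (Invertible X)
    invertible? X = Dec.map′
      (λ (Y , p , q) → record { inv = Y ; inverseʳ = p ; inverseˡ = q })
      (λ r → let open Invertible r in inv , inverseʳ , inverseˡ)
      (any? finite-matrices
        (λ Y≋Y′ (p , q) →
          (λ i j → 𝔽.trans (⊡-cong (≋.refl {X}) (≋.sym Y≋Y′) i j) (p i j)) ,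
          (λ i j → 𝔽.trans (⊡-cong (≋.sym Y≋Y′) (≋.refl {X}) i j) (q i j)))
        (λ Y → _≈?_ finite-matrices (X ⊡ Y) 𝟙 Dec.×-dec _≈?_ finite-matrices (Y ⊡ X) 𝟙))

  open Matrices using (Mat)

  -- (X - 1)_{ij} ≠ 0 only if i ≠ j and (i , j) ∈ π. Orders are reflexive here,
  -- but the matrices of UT(π) are unipotent: a diagonal entry differing from 1
  -- is excluded, as UP = UL ⋉ UR requires.
  HasPattern : {I : FinSet} → PartialOrder I → Mat I → Set
  HasPattern {I} π X = ∀ i j → ¬ X i j + - 𝟙 i j ≈ 0# → ¬ i ≡ j × (i , j) ∈ᴾ π
    where open Matrices I

  private
    difference : ∀ {x y} → x + - y ≈ 0# → x ≈ y
    difference {x} {y} eq = begin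
      x               ≈⟨ 𝔽.+-identityʳ x ⟨
      x + 0#          ≈⟨ 𝔽.+-congˡ (𝔽.-‿inverseˡ y) ⟨
      x + (- y + y)   ≈⟨ 𝔽.+-assoc x (- y) y ⟨
      (x + - y) + y   ≈⟨ 𝔽.+-congʳ eq ⟩
      0# + y          ≈⟨ 𝔽.+-identityˡ y ⟩
      y               ∎
      where open SetoidReasoning 𝔽.setoid

    difference⁻ : ∀ {x y} → x ≈ y → x + - y ≈ 0#
    difference⁻ {x} {y} eq = 𝔽.trans (𝔽.+-congʳ eq) (𝔽.-‿inverseʳ y)

  module Pattern {I : FinSet} (π : PartialOrder I) where

    open Matrices I hiding (Mat)
    open PartialOrder π
    module π = IsPartialOrder isPartialOrder

    agrees : ∀ {X} → HasPattern π X → ∀ {i j} → ¬ (¬ i ≡ j × (i , j) ∈ᴾ π) → X i j ≈ 𝟙 i j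
    agrees {X} X∈ {i} {j} ∉π with (X i j + - 𝟙 i j) ≈?0
    ... | yes eq = difference eq
    ... | no neq = ⊥-elim (∉π (X∈ i j neq))

    vanishes : ∀ {X} → HasPattern π X → ∀ {i j} → ¬ (i , j) ∈ᴾ π → X i j ≈ 0#
    vanishes X∈ ∉π = 𝔽.trans (agrees X∈ (∉π ∘ proj₂)) (𝟙-off (∉π ∘ π.reflexive))

    unipotent : ∀ {X} → HasPattern π X → ∀ i → X i i ≈ 1#
    unipotent X∈ i = 𝔽.trans (agrees X∈ (λ (i≢i , _) → i≢i refl)) (𝟙-on i)

    hasPattern : ∀ {X} → (∀ {i j} → ¬ (i , j) ∈ᴾ π → X i j ≈ 0#) → (∀ i → X i i ≈ 1#) → HasPattern π X
    hasPattern {X} X≈0 X≈1 i j neq = i≢j , ∈π (T? (rel i j))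
      where
      i≢j : ¬ i ≡ j
      i≢j refl = neq (difference⁻ (𝔽.trans (X≈1 i) (𝔽.sym (𝟙-on i))))
      ∈π : Dec ((i , j) ∈ᴾ π) → (i , j) ∈ᴾ π
      ∈π (yes t) = t
      ∈π (no ∉π) = ⊥-elim (neq (difference⁻ (𝔽.trans (X≈0 ∉π) (𝔽.sym (𝟙-off i≢j)))))

    hasPattern? : ∀ X → Dec (HasPattern π X)
    hasPattern? X = ∀? I λ i → ∀? I λ j →
      Dec.¬? ((X i j + - 𝟙 i j) ≈?0) Dec.→-dec (Dec.¬? (_≟_ I i j) Dec.×-dec T? (rel i j))

    hasPattern-cong : ∀ {X Y} → X ≋ Y → HasPattern π X → HasPattern π Y
    hasPattern-cong X≋Y X∈ i j neq = X∈ i j λ eq → neq (𝔽.trans (𝔽.+-congʳ (𝔽.sym (X≋Y i j))) eq)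

    𝟙-hasPattern : HasPattern π 𝟙
    𝟙-hasPattern i j neq = ⊥-elim (neq (𝔽.-‿inverseʳ (𝟙 i j)))

    ⊡-hasPattern : ∀ {X Y} → HasPattern π X → HasPattern π Y → HasPattern π (X ⊡ Y)
    ⊡-hasPattern {X} {Y} X∈ Y∈ = hasPattern
      (λ ∉π → ∑-zero λ k → term k λ p q → ∉π (π.trans p q))
      (λ i → 𝔽.trans (∑-single i (λ k k≢i → term k λ p q → k≢i (π.antisym q p)))
               (𝔽.trans (𝔽.*-cong (unipotent X∈ i) (unipotent Y∈ i)) (𝔽.*-identityˡ 1#)))
      where
      term : ∀ {i j} k → ((i , k) ∈ᴾ π → (k , j) ∈ᴾ π → ⊥) → X i k * Y k j ≈ 0#
      term {i} {j} k no-path with T? (rel i k)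
      ... | yes ik∈π = 𝔽.trans (𝔽.*-congˡ (vanishes Y∈ (no-path ik∈π))) (𝔽.zeroʳ (X i k))
      ... | no  ik∉π = 𝔽.trans (𝔽.*-congʳ (vanishes X∈ ik∉π)) (𝔽.zeroˡ (Y k j))

    private

      pattern-setoid : Setoid 0ℓ 0ℓ
      pattern-setoid = record
        { Carrier = Σ (Mat I) (HasPattern π)
        ; _≈_ = λ X Y → proj₁ X ≋ proj₁ Y
        ; isEquivalence = record { refl = ≋.refl ; sym = ≋.sym ; trans = ≋.trans }
        }

      finite-pattern : Finite pattern-setoid
      finite-pattern = finite-subset finite-matrices
        (λ X → does (hasPattern? X))
        (λ {X} {Y} X≋Y → Dec.does-⇔ (Equivalent X≋Y) (hasPattern? X) (hasPattern? Y))
        proj₁ id id (λ (X , X∈) → does⁺ (hasPattern? X) X∈)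
        (λ X X∈ → X , does⁻ (hasPattern? X) X∈)
        (λ _ _ → ≋.refl)
        where
        Equivalent = λ {X} {Y} (X≋Y : X ≋ Y) →
          mk⇔ (hasPattern-cong X≋Y) (hasPattern-cong {Y} {X} (≋.sym X≋Y))

    -- As there are finitely many matrices with pattern π, multiplication by
    -- an invertible one permutes them, so its inverse has pattern π.
    inv-hasPattern : ∀ {X} (X⁻¹ : Invertible X) → HasPattern π X → HasPattern π (Invertible.inv X⁻¹)
    inv-hasPattern {X} X⁻¹ X∈ = hasPattern-cong Y≋inv Y∈
      where
      open Invertible X⁻¹
      open SetoidReasoning mat-setoid
      cancel : ∀ Y → inv ⊡ (X ⊡ Y) ≋ Y
      cancel Y = begin
        inv ⊡ (X ⊡ Y)   ≈⟨ ⊡-assoc inv X Y ⟨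
        (inv ⊡ X) ⊡ Y   ≈⟨ ⊡-cong inverseˡ (≋.refl {Y}) ⟩
        𝟙 ⊡ Y           ≈⟨ ⊡-identityˡ Y ⟩
        Y               ∎
      solution : ∃[ Y ] X ⊡ proj₁ Y ≋ 𝟙
      solution = injective⇒surjective finite-pattern
        (λ (Y , Y∈) → X ⊡ Y , ⊡-hasPattern X∈ Y∈)
        (λ {Y} {Y′} eq → ≋.trans (≋.sym (cancel (proj₁ Y)))
          (≋.trans (⊡-cong (≋.refl {inv}) eq) (cancel (proj₁ Y′))))
        (𝟙 , 𝟙-hasPattern)
      Y = proj₁ (proj₁ solution)
      Y∈ = proj₂ (proj₁ solution)
      Y≋inv : Y ≋ inv
      Y≋inv = begin
        Y               ≈⟨ cancel Y ⟨
        inv ⊡ (X ⊡ Y)   ≈⟨ ⊡-cong (≋.refl {inv}) (proj₂ solution) ⟩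
        inv ⊡ 𝟙         ≈⟨ ⊡-identityʳ inv ⟩
        inv             ∎

  record UTElement {I : FinSet} (π : PartialOrder I) : Set where
    no-eta-equality
    field
      mat        : Mat I
      invertible : Matrices.Invertible I mat
      pattern-π  : HasPattern π mat

    open Matrices.Invertible invertible public

  open UTElement

  module _ {I : FinSet} (π : PartialOrder I) where

    open Matrices I hiding (Mat)
    open Pattern π

    private

      _∙_ : UTElement π → UTElement π → UTElement π
      mat        (X ∙ Y) = mat X ⊡ mat Y
      invertible (X ∙ Y) = record
        { inv      = inv Y ⊡ inv X
        ; inverseʳ = cancel (mat X) (mat Y) (inv Y) (inv X) (inverseʳ Y) (inverseʳ X)
        ; inverseˡ = cancel (inv Y) (inv X) (mat X) (mat Y) (inverseˡ X) (inverseˡ Y)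
        }
        where
        open SetoidReasoning mat-setoid
        cancel : ∀ A B C D → B ⊡ C ≋ 𝟙 → A ⊡ D ≋ 𝟙 → (A ⊡ B) ⊡ (C ⊡ D) ≋ 𝟙
        cancel A B C D p q = begin
          (A ⊡ B) ⊡ (C ⊡ D)   ≈⟨ ⊡-assoc A B (C ⊡ D) ⟩
          A ⊡ (B ⊡ (C ⊡ D))   ≈⟨ ⊡-cong (≋.refl {A}) (⊡-assoc B C D) ⟨
          A ⊡ ((B ⊡ C) ⊡ D)   ≈⟨ ⊡-cong (≋.refl {A}) (⊡-cong p (≋.refl {D})) ⟩
          A ⊡ (𝟙 ⊡ D)         ≈⟨ ⊡-cong (≋.refl {A}) (⊡-identityˡ D) ⟩
          A ⊡ D               ≈⟨ q ⟩
          𝟙                   ∎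
      pattern-π  (X ∙ Y) = ⊡-hasPattern (pattern-π X) (pattern-π Y)

      ε : UTElement π
      mat        ε = 𝟙
      invertible ε = record { inv = 𝟙 ; inverseʳ = ⊡-identityˡ 𝟙 ; inverseˡ = ⊡-identityˡ 𝟙 }
      pattern-π  ε = 𝟙-hasPattern

      _⁻¹ : UTElement π → UTElement π
      mat        (X ⁻¹) = inv X
      invertible (X ⁻¹) = record { inv = mat X ; inverseʳ = inverseˡ X ; inverseˡ = inverseʳ X }
      pattern-π  (X ⁻¹) = inv-hasPattern (invertible X) (pattern-π X)

      _≈ᵁ_ : UTElement π → UTElement π → Set
      X ≈ᵁ Y = mat X ≋ mat Y

      ⁻¹-cong : ∀ {X Y} → X ≈ᵁ Y → (X ⁻¹) ≈ᵁ (Y ⁻¹)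
      ⁻¹-cong {X} {Y} X≈Y = begin
        inv X                     ≈⟨ ⊡-identityʳ (inv X) ⟨
        inv X ⊡ 𝟙                 ≈⟨ ⊡-cong (≋.refl {inv X}) (inverseʳ Y) ⟨
        inv X ⊡ (mat Y ⊡ inv Y)   ≈⟨ ⊡-assoc (inv X) (mat Y) (inv Y) ⟨
        (inv X ⊡ mat Y) ⊡ inv Y   ≈⟨ ⊡-cong (⊡-cong (≋.refl {inv X}) X≈Y) (≋.refl {inv Y}) ⟨
        (inv X ⊡ mat X) ⊡ inv Y   ≈⟨ ⊡-cong (inverseˡ X) (≋.refl {inv Y}) ⟩
        𝟙 ⊡ inv Y                 ≈⟨ ⊡-identityˡ (inv Y) ⟩
        inv Y                     ∎
        where open SetoidReasoning mat-setoid

      UT-group : Group 0ℓ 0ℓ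
      UT-group = record
        { Carrier = UTElement π
        ; _≈_     = _≈ᵁ_
        ; _∙_     = _∙_
        ; ε       = ε
        ; _⁻¹     = _⁻¹
        ; isGroup = record
          { isMonoid = record
            { isSemigroup = record
              { isMagma = record
                { isEquivalence = record
                  { refl  = λ {X} → ≋.refl {mat X}
                  ; sym   = λ {X} {Y} → ≋.sym {mat X} {mat Y}
                  ; trans = λ {X} {Y} {Z} → ≋.trans {mat X} {mat Y} {mat Z}
                  }
                ; ∙-cong = λ {X} {X′} {Y} {Y′} → ⊡-cong {mat X} {mat X′} {mat Y} {mat Y′}
                }
              ; assoc = λ X Y Z → ⊡-assoc (mat X) (mat Y) (mat Z)
              }
            ; identity = (λ X → ⊡-identityˡ (mat X)) , (λ X → ⊡-identityʳ (mat X))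
            }
          ; inverse = inverseˡ , inverseʳ
          ; ⁻¹-cong = λ {X} {Y} → ⁻¹-cong {X} {Y}
          }
        }

      InUT : Mat I → Set
      InUT X = Invertible X × HasPattern π X

      inUT? : ∀ X → Dec (InUT X)
      inUT? X = invertible? X Dec.×-dec hasPattern? X

      inUT-cong : ∀ {X Y} → X ≋ Y → InUT X → InUT Y
      inUT-cong {X} {Y} X≋Y (X⁻¹ , X∈) = record
        { inv      = X⁻¹.inv
        ; inverseʳ = ≋.trans (⊡-cong (≋.sym X≋Y) (≋.refl {X⁻¹.inv})) X⁻¹.inverseʳ
        ; inverseˡ = ≋.trans (⊡-cong (≋.refl {X⁻¹.inv}) (≋.sym X≋Y)) X⁻¹.inverseˡ
        } , hasPattern-cong X≋Y X∈
        where module X⁻¹ = Invertible X⁻¹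

    UT : FiniteGroup
    FiniteGroup.group   UT = UT-group
    FiniteGroup.finiteᴳ UT = finite-subset finite-matrices
      (λ X → does (inUT? X))
      (λ {X} {Y} X≋Y → Dec.does-⇔
        (mk⇔ (inUT-cong {X} {Y} X≋Y) (inUT-cong {Y} {X} (≋.sym X≋Y))) (inUT? X) (inUT? Y))
      mat id id
      (λ X → does⁺ (inUT? (mat X)) (invertible X , pattern-π X))
      (λ X X∈ → let (X⁻¹ , X∈π) = does⁻ (inUT? X) X∈ in
        record { mat = X ; invertible = X⁻¹ ; pattern-π = X∈π })
      (λ _ _ → ≋.refl)

T-ext : ∀ {a b} → (T a → T b) → (T b → T a) → a ≡ b
T-ext {false} {false} _ _ = refl
T-ext {false} {true}  _ g = ⊥-elim (g tt)
T-ext {true}  {false} f _ = ⊥-elim (f tt)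
T-ext {true}  {true}  _ _ = refl

module _ {I : FinSet} {R : ∣ I ∣ → ∣ I ∣ → Set} (R? : ∀ i j → Dec (R i j)) where

  partialOrder : IsPartialOrder _≡_ R → PartialOrder I
  PartialOrder.rel            (partialOrder isPO) i j = does (R? i j)
  PartialOrder.isPartialOrder (partialOrder isPO) = record
    { isPreorder = record
      { isEquivalence = ≡.isEquivalence
      ; reflexive = λ {i} {j} eq → does⁺ (R? i j) (R.reflexive eq)
      ; trans     = λ {i} {j} {k} p q → does⁺ (R? i k) (R.trans (does⁻ (R? i j) p) (does⁻ (R? j k) q))
      }
    ; antisym = λ {i} {j} p q → R.antisym (does⁻ (R? i j) p) (does⁻ (R? j i) q)
    }
    where module R = IsPartialOrder isPO

  totalOrder : IsTotalOrder _≡_ R → TotalOrder I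
  TotalOrder.rel          (totalOrder isTO) i j = does (R? i j)
  TotalOrder.isTotalOrder (totalOrder isTO) = record
    { isPartialOrder = PartialOrder.isPartialOrder (partialOrder (IsTotalOrder.isPartialOrder isTO))
    ; total = λ i j → [ (λ p → inj₁ (does⁺ (R? i j) p)) , (λ p → inj₂ (does⁺ (R? j i) p)) ]′
                        (IsTotalOrder.total isTO i j)
    }

total-orders : FinSet → Setoid 0ℓ 0ℓ
total-orders I = record
  { Carrier = TotalOrder I
  ; _≈_     = λ τ τ′ → ∀ i j → TotalOrder.rel τ i j ≡ TotalOrder.rel τ′ i j
  ; isEquivalence = record
    { refl  = λ i j → refl
    ; sym   = λ p i j → ≡.sym (p i j)
    ; trans = λ p q i j → ≡.trans (p i j) (q i j)
    }
  }

module _ {I : FinSet} where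

  infix 4 _≈ᵀ_

  _≈ᵀ_ : TotalOrder I → TotalOrder I → Set
  _≈ᵀ_ = Setoid._≈_ (total-orders I)

  private

    Rel : Set
    Rel = ∣ I ∣ → ∣ I ∣ → Bool

    rel-setoid : Setoid 0ℓ 0ℓ
    rel-setoid = record
      { Carrier = Rel
      ; _≈_     = λ R S → ∀ i j → R i j ≡ S i j
      ; isEquivalence = record
        { refl  = λ i j → refl
        ; sym   = λ p i j → ≡.sym (p i j)
        ; trans = λ p q i j → ≡.trans (p i j) (q i j)
        }
      }

    finite-Bool : Finite (≡.setoid Bool)
    finite-Bool = record { size = 2 ; enumeration = Symmetry.inverse Fin.2↔Bool }

    finite-rel : Finite rel-setoid
    finite-rel = finite-functions (finite I) (finite-functions (finite I) finite-Bool)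

    isTotalOrder? : (R : Rel) → Dec (IsTotalOrder _≡_ (λ i j → T (R i j)))
    isTotalOrder? R = Dec.map′
      (λ (refl′ , trans , antisym , total) → record
        { isPartialOrder = record
          { isPreorder = record
            { isEquivalence = ≡.isEquivalence
            ; reflexive = λ { refl → refl′ _ }
            ; trans     = λ {i} {j} {k} → trans i j k
            }
          ; antisym = λ {i} {j} → antisym i j
          }
        ; total = total
        })
      (λ isTO → let open IsTotalOrder isTO using (reflexive; trans; antisym; total) in
        (λ i → reflexive refl) , (λ i j k → trans) , (λ i j → antisym) , total)
      (∀? I (λ i → T? (R i i)) Dec.×-dec
       ∀? I (λ i → ∀? I λ j → ∀? I λ k → T? (R i j) Dec.→-dec (T? (R j k) Dec.→-dec T? (R i k))) Dec.×-dec
       ∀? I (λ i → ∀? I λ j → T? (R i j) Dec.→-dec (T? (R j i) Dec.→-dec _≟_ I i j)) Dec.×-dec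
       ∀? I (λ i → ∀? I λ j → T? (R i j) Dec.⊎-dec T? (R j i)))

    isTotalOrder-cong : ∀ {R S : Rel} → (∀ i j → R i j ≡ S i j) →
                        IsTotalOrder _≡_ (λ i j → T (R i j)) → IsTotalOrder _≡_ (λ i j → T (S i j))
    isTotalOrder-cong {R} {S} R≡S isTO = record
      { isPartialOrder = record
        { isPreorder = record
          { isEquivalence = ≡.isEquivalence
          ; reflexive = λ eq → fwd (reflexive eq)
          ; trans     = λ p q → fwd (trans (bwd p) (bwd q))
          }
        ; antisym = λ p q → antisym (bwd p) (bwd q)
        }
      ; total = λ i j → [ inj₁ ∘ fwd , inj₂ ∘ fwd ]′ (total i j)
      }
      where
      open IsTotalOrder isTO
      fwd : ∀ {i j} → T (R i j) → T (S i j)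
      fwd {i} {j} = ≡.subst T (R≡S i j)
      bwd : ∀ {i j} → T (S i j) → T (R i j)
      bwd {i} {j} = ≡.subst T (≡.sym (R≡S i j))

  finite-total-orders : Finite (total-orders I)
  finite-total-orders = finite-subset finite-rel
    (λ R → does (isTotalOrder? R))
    (λ {R} {S} R≡S → Dec.does-⇔
      (mk⇔ (isTotalOrder-cong {R} {S} R≡S) (isTotalOrder-cong {S} {R} (λ i j → ≡.sym (R≡S i j))))
      (isTotalOrder? R) (isTotalOrder? S))
    TotalOrder.rel id id
    (λ τ → does⁺ (isTotalOrder? (TotalOrder.rel τ)) (TotalOrder.isTotalOrder τ))
    (λ R isTO → record { rel = R ; isTotalOrder = does⁻ (isTotalOrder? R) isTO })
    (λ _ _ i j → refl)

  -- φ|_J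
  infix 6 _∣ᵀ_

  _∣ᵀ_ : TotalOrder I → (J : Subset I) → TotalOrder ⟦ J ⟧
  TotalOrder.rel          (φ ∣ᵀ J) (i , _) (j , _) = TotalOrder.rel φ i j
  TotalOrder.isTotalOrder (φ ∣ᵀ J) = record
    { isPartialOrder = record
      { isPreorder = record
        { isEquivalence = ≡.isEquivalence
        ; reflexive = λ { refl → φ.reflexive refl }
        ; trans     = φ.trans
        }
      ; antisym = λ p q → Σ-T-≡ (φ.antisym p q)
      }
    ; total = λ (i , _) (j , _) → φ.total i j
    }
    where module φ = IsTotalOrder (TotalOrder.isTotalOrder φ)

-- {(σ(i) , σ(j)) : (i , j) ∈ τ}
transportᵀ : {I J : FinSet} → I ≃ J → TotalOrder I → TotalOrder J
TotalOrder.rel          (transportᵀ σ τ) i j = TotalOrder.rel τ (from σ i) (from σ j)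
TotalOrder.isTotalOrder (transportᵀ σ τ) = record
  { isPartialOrder = record
    { isPreorder = record
      { isEquivalence = ≡.isEquivalence
      ; reflexive = λ { refl → τ.reflexive refl }
      ; trans     = τ.trans
      }
    ; antisym = λ {i} {j} p q →
        ≡.trans (≡.sym (to-from σ i)) (≡.trans (≡.cong (to σ) (τ.antisym p q)) (to-from σ j))
    }
  ; total = λ i j → τ.total (from σ i) (from σ j)
  }
  where module τ = IsTotalOrder (TotalOrder.isTotalOrder τ)

module _ {I : FinSet} (A : Composition I) where

  Asc Eq : ∣ I ∣ → ∣ I ∣ → Set
  Asc i j = blockOf A i Fin.< blockOf A j
  Eq  i j = blockOf A i ≡ blockOf A j

  -- Families (τ₁ , … , τ_ℓ) of total orders of the blocks
  BlockOrders : Set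
  BlockOrders = ∀ r → TotalOrder ⟦ block A r ⟧

  block-orders : Setoid 0ℓ 0ℓ
  block-orders = record
    { Carrier = BlockOrders
    ; _≈_     = λ τ τ′ → ∀ r → τ r ≈ᵀ τ′ r
    ; isEquivalence = record
      { refl  = λ r i j → refl
      ; sym   = λ p r i j → ≡.sym (p r i j)
      ; trans = λ p q r i j → ≡.trans (p r i j) (q r i j)
      }
    }

  restrictᵀ : TotalOrder I → BlockOrders
  restrictᵀ φ r = φ ∣ᵀ block A r

  -- The ordinal sum τ₁ ⋆ ⋯ ⋆ τ_ℓ
  module _ (τ : BlockOrders) where

    Within : ∣ I ∣ → ∣ I ∣ → Set
    Within i j = ∃[ r ] Σ[ p ∈ T (block A r ∋ i) ] Σ[ q ∈ T (block A r ∋ j) ] ((i , p) , (j , q)) ∈ᵀ τ r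

    Star : ∣ I ∣ → ∣ I ∣ → Set
    Star i j = Within i j ⊎ Asc i j

    private

      Σ-T? : ∀ {b} {P : T b → Set} → (∀ t → Dec (P t)) → Dec (Σ (T b) P)
      Σ-T? {false} P? = no proj₁
      Σ-T? {true}  P? = Dec.map′ (tt ,_) proj₂ (P? tt)

      star-dec : ∀ i j → Dec (Star i j)
      star-dec i j =
        Fin.any? (λ r → Σ-T? λ p → Σ-T? λ q → T? (TotalOrder.rel (τ r) (i , p) (j , q)))
        Dec.⊎-dec Fin._<?_ (blockOf A i) (blockOf A j)

    within-Eq : ∀ {i j} → Within i j → Eq i j
    within-Eq (r , p , q , _) = ≡.trans (blockOf-unique A p) (≡.sym (blockOf-unique A q))

    within⁻ : ∀ {i j r} → Within i j → (p : T (block A r ∋ i)) (q : T (block A r ∋ j)) →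
              ((i , p) , (j , q)) ∈ᵀ τ r
    within⁻ {i} {j} {r} (r′ , p′ , q′ , t) p q with disjoint A p′ p
    ... | refl = ≡.subst₂ (λ p q → ((i , p) , (j , q)) ∈ᵀ τ r)
                   (Bool.T-irrelevant p′ p) (Bool.T-irrelevant q′ q) t

    private

      module τ r = IsTotalOrder (TotalOrder.isTotalOrder (τ r))

      isTotalOrder-Star : IsTotalOrder _≡_ Star
      isTotalOrder-Star = record
        { isPartialOrder = record
          { isPreorder = record
            { isEquivalence = ≡.isEquivalence
            ; reflexive = λ { {i} refl → let (r , p) = covers A i in
                inj₁ (r , p , p , τ.reflexive r refl) }
            ; trans = trans
            }
          ; antisym = antisym
          }
        ; total = total
        }
        where
        trans : ∀ {i j k} → Star i j → Star j k → Star i k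
        trans (inj₁ ij@(r , p , q , t)) (inj₁ jk@(_ , q′ , s , u)) with disjoint A q′ q
        ... | refl = inj₁ (r , p , s , τ.trans r t (within⁻ jk q s))
        trans {k = k} (inj₁ ij) (inj₂ j<k) = inj₂ (≡.subst (Fin._< blockOf A k) (≡.sym (within-Eq ij)) j<k)
        trans {i = i} (inj₂ i<j) (inj₁ jk) = inj₂ (≡.subst (blockOf A i Fin.<_) (within-Eq jk) i<j)
        trans (inj₂ i<j) (inj₂ j<k) = inj₂ (Fin.<-trans i<j j<k)
        antisym : ∀ {i j} → Star i j → Star j i → i ≡ j
        antisym (inj₁ ij@(r , p , q , t)) (inj₁ ji) = ≡.cong proj₁ (τ.antisym r t (within⁻ ji q p))
        antisym (inj₁ ij) (inj₂ j<i) = ⊥-elim (Fin.<-irrefl (≡.sym (within-Eq ij)) j<i)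
        antisym (inj₂ i<j) (inj₁ ji) = ⊥-elim (Fin.<-irrefl (≡.sym (within-Eq ji)) i<j)
        antisym (inj₂ i<j) (inj₂ j<i) = ⊥-elim (Fin.<-asym i<j j<i)
        total : ∀ i j → Star i j ⊎ Star j i
        total i j with Fin.<-cmp (blockOf A i) (blockOf A j)
        ... | tri< i<j _ _ = inj₁ (inj₂ i<j)
        ... | tri> _ _ j<i = inj₂ (inj₂ j<i)
        ... | tri≈ _ eq _ = [ (λ t → inj₁ (inj₁ (r , p , q , t))) , (λ t → inj₂ (inj₁ (r , q , p , t))) ]′
                              (τ.total r (i , p) (j , q))
          where
          r = blockOf A i
          p = proj₂ (covers A i)
          q : T (block A r ∋ j)
          q = ≡.subst (λ r → T (block A r ∋ j)) (≡.sym eq) (proj₂ (covers A j))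

    star : TotalOrder I
    star = totalOrder star-dec isTotalOrder-Star

    star⁺ : ∀ {i j} → Star i j → (i , j) ∈ᵀ star
    star⁺ = does⁺ (star-dec _ _)

    star⁻ : ∀ {i j} → (i , j) ∈ᵀ star → Star i j
    star⁻ = does⁻ (star-dec _ _)

  -- (τ₁ ⋆ ⋯ ⋆ τ_ℓ)|_{A_r} = τ_r
  restrict-star : ∀ τ → Setoid._≈_ block-orders (restrictᵀ (star τ)) τ
  restrict-star τ r (i , p) (j , q) = T-ext to′ (λ t → star⁺ τ (inj₁ (r , p , q , t)))
    where
    to′ : (i , j) ∈ᵀ star τ → ((i , p) , (j , q)) ∈ᵀ τ r
    to′ t with star⁻ τ t
    ... | inj₁ ij  = within⁻ τ ij p q
    ... | inj₂ i<j = ⊥-elim (Fin.<-irrefl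
      (≡.trans (blockOf-unique A p) (≡.sym (blockOf-unique A q))) i<j)

  star-cong : ∀ {τ τ′} → Setoid._≈_ block-orders τ τ′ → star τ ≈ᵀ star τ′
  star-cong {τ} {τ′} τ≈τ′ i j =
    T-ext (included τ τ′ τ≈τ′) (included τ′ τ (λ r i j → ≡.sym (τ≈τ′ r i j)))
    where
    included : ∀ τ τ′ → Setoid._≈_ block-orders τ τ′ → (i , j) ∈ᵀ star τ → (i , j) ∈ᵀ star τ′
    included τ τ′ eq t with star⁻ τ t
    ... | inj₁ (r , p , q , u) = star⁺ τ′ (inj₁ (r , p , q , ≡.subst T (eq r (i , p) (j , q)) u))
    ... | inj₂ i<j             = star⁺ τ′ (inj₂ i<j)

  _≈ᵀ?_ : {J : FinSet} (φ ψ : TotalOrder J) → Dec (φ ≈ᵀ ψ)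
  _≈ᵀ?_ {J} φ ψ = ∀? J λ i → ∀? J λ j → TotalOrder.rel φ i j Bool.≟ TotalOrder.rel ψ i j

  restricts-to? : ∀ φ τ → Dec (Setoid._≈_ block-orders (restrictᵀ φ) τ)
  restricts-to? φ τ = Fin.all? λ r → restrictᵀ φ r ≈ᵀ? τ r

  star? : ∀ φ → Dec (∃[ τ ] star τ ≈ᵀ φ)
  star? φ = Dec.map′ (restrictᵀ φ ,_)
    (λ (τ , eq) i j → ≡.trans
      (star-cong {restrictᵀ φ} {τ}
        (λ r i j → ≡.trans (≡.sym (eq (proj₁ i) (proj₁ j))) (restrict-star τ r i j)) i j)
      (eq i j))
    (star (restrictᵀ φ) ≈ᵀ? φ)

  -- τ ∩ Eq(A), {(i , i)} ∪ (τ ∩ Asc(A)) and τ ∩ (Eq(A) ∪ Asc(A))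
  module _ (τ : TotalOrder I) where

    private

      open IsTotalOrder (TotalOrder.isTotalOrder τ) using (reflexive; trans; antisym)

      τ? : ∀ i j → Dec ((i , j) ∈ᵀ τ)
      τ? i j = T? (TotalOrder.rel τ i j)

      Eq? : ∀ i j → Dec (Eq i j)
      Eq? i j = blockOf A i Fin.≟ blockOf A j

      Asc? : ∀ i j → Dec (Asc i j)
      Asc? i j = Fin._<?_ (blockOf A i) (blockOf A j)

    UL-relation UR-relation UP-relation : ∣ I ∣ → ∣ I ∣ → Set
    UL-relation i j = (i , j) ∈ᵀ τ × Eq i j
    UR-relation i j = i ≡ j ⊎ ((i , j) ∈ᵀ τ × Asc i j)
    UP-relation i j = (i , j) ∈ᵀ τ × (Eq i j ⊎ Asc i j)

    UL-dec : ∀ i j → Dec (UL-relation i j)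
    UL-dec i j = τ? i j Dec.×-dec Eq? i j
    UR-dec : ∀ i j → Dec (UR-relation i j)
    UR-dec i j = _≟_ I i j Dec.⊎-dec (τ? i j Dec.×-dec Asc? i j)
    UP-dec : ∀ i j → Dec (UP-relation i j)
    UP-dec i j = τ? i j Dec.×-dec (Eq? i j Dec.⊎-dec Asc? i j)

    UL-order UR-order UP-order : PartialOrder I
    UL-order = partialOrder UL-dec (record
      { isPreorder = record
        { isEquivalence = ≡.isEquivalence
        ; reflexive = λ { refl → reflexive refl , refl }
        ; trans     = λ (p , e) (q , e′) → trans p q , ≡.trans e e′
        }
      ; antisym = λ (p , _) (q , _) → antisym p q
      })
    UR-order = partialOrder UR-dec (record
      { isPreorder = record
        { isEquivalence = ≡.isEquivalence
        ; reflexive = inj₁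
        ; trans     = λ { (inj₁ refl) q → q
                        ; p@(inj₂ _) (inj₁ refl) → p
                        ; (inj₂ (p , a)) (inj₂ (q , b)) → inj₂ (trans p q , Fin.<-trans a b) }
        }
      ; antisym = λ { (inj₁ eq) _ → eq
                    ; (inj₂ _) (inj₁ eq) → ≡.sym eq
                    ; (inj₂ (p , _)) (inj₂ (q , _)) → antisym p q }
      })
    UP-order = partialOrder UP-dec (record
      { isPreorder = record
        { isEquivalence = ≡.isEquivalence
        ; reflexive = λ { refl → reflexive refl , inj₁ refl }
        ; trans     = λ (p , a) (q , b) → trans p q , Eq∪Asc-trans a b
        }
      ; antisym = λ (p , _) (q , _) → antisym p q
      })
      where
      Eq∪Asc-trans : ∀ {i j k} → Eq i j ⊎ Asc i j → Eq j k ⊎ Asc j k → Eq i k ⊎ Asc i k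
      Eq∪Asc-trans (inj₁ e) (inj₁ e′) = inj₁ (≡.trans e e′)
      Eq∪Asc-trans {k = k} (inj₁ e) (inj₂ b) = inj₂ (≡.subst (Fin._< blockOf A k) (≡.sym e) b)
      Eq∪Asc-trans {i = i} (inj₂ a) (inj₁ e) = inj₂ (≡.subst (blockOf A i Fin.<_) e a)
      Eq∪Asc-trans (inj₂ a) (inj₂ b) = inj₂ (Fin.<-trans a b)

module _ {q : ℕ} (𝔽 : FiniteField q) where

  open PatternGroups 𝔽
  open Matrices using (Mat)
  private
    module 𝔽 = FiniteField 𝔽
  open 𝔽 using (_≈_; _+_; _*_; -_; 0#; 1#)
  private
    module 𝔽∑ = FiniteSum 𝔽.+-commutativeMonoid
  open 𝔽∑ using (∑; ∑-reindex; sum-pick)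
  open UTElement using (mat; inv; inverseˡ; inverseʳ; pattern-π)

  module _ {I J : FinSet} {π : PartialOrder I} {ρ : PartialOrder J} where

    private
      module MI = Matrices I
      module MJ = Matrices J

    homomorphism : (f : Mat I → Mat J) → (∀ {X Y} → X MI.≋ Y → f X MJ.≋ f Y) →
                   (∀ {X} → HasPattern π X → HasPattern ρ (f X)) →
                   f MI.𝟙 MJ.≋ MJ.𝟙 →
                   (∀ {X Y} → HasPattern π X → HasPattern π Y → f (X MI.⊡ Y) MJ.≋ f X MJ.⊡ f Y) →
                   UT π ⟶ UT ρ
    homomorphism f f-cong f-pattern f-𝟙 f-⊡ = multiplicative g
      (λ eq → f-cong eq) (λ X Y → f-⊡ (pattern-π X) (pattern-π Y))
      where
      g : UTElement π → UTElement ρ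
      mat (g X) = f (mat X)
      UTElement.invertible (g X) = record
        { inv      = f (inv X)
        ; inverseʳ = MJ.≋.trans (MJ.≋.sym (f-⊡ (pattern-π X) inv-pattern))
                       (MJ.≋.trans (f-cong (inverseʳ X)) f-𝟙)
        ; inverseˡ = MJ.≋.trans (MJ.≋.sym (f-⊡ inv-pattern (pattern-π X)))
                       (MJ.≋.trans (f-cong (inverseˡ X)) f-𝟙)
        }
        where
        inv-pattern : HasPattern π (inv X)
        inv-pattern = Pattern.inv-hasPattern π (UTElement.invertible X) (pattern-π X)
      pattern-π (g X) = f-pattern (pattern-π X)

  inclusion : {I : FinSet} {π ρ : PartialOrder I} → π ⊆ᴾ ρ → UT π ⟶ UT ρ
  inclusion {I} {π} {ρ} π⊆ρ = homomorphism id id (λ X∈ i j neq → Product.map₂ (π⊆ρ i j) (X∈ i j neq))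
    ≋.refl (λ _ _ → ≋.refl)
    where open Matrices I

  -- σ : UT(τ) → UT(στ)
  relabelling : {I J : FinSet} (σ : I ≃ J) (τ : TotalOrder I) →
                UT (toPartial τ) ⟶ UT (toPartial (transportᵀ σ τ))
  relabelling {I} {J} σ τ = homomorphism
    (λ X i j → X (from σ i) (from σ j))
    (λ X≋Y i j → X≋Y (from σ i) (from σ j))
    (λ X∈ i j neq → Product.map₁ (_∘ ≡.cong (from σ)) (X∈ (from σ i) (from σ j)
      (λ eq → neq (𝔽.trans (𝔽.+-congˡ (𝔽.-‿cong (𝔽.sym (𝟙-from i j)))) eq))))
    𝟙-from
    (λ {X} {Y} _ _ i j → 𝔽.sym (∑-reindex (finite J) (finite I) (bijection (sym-≃ σ))
      (λ k → X (from σ i) k * Y k (from σ j)) (λ { refl → 𝔽.refl })))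
    where
    module MI = Matrices I
    module MJ = Matrices J
    𝟙-from : ∀ i j → MI.𝟙 (from σ i) (from σ j) ≈ MJ.𝟙 i j
    𝟙-from i j = 𝔽.reflexive (≡.cong (λ b → if b then 1# else 0#)
      (Dec.does-⇔ (mk⇔ (λ eq → ≡.trans (≡.sym (to-from σ i)) (≡.trans (≡.cong (to σ) eq) (to-from σ j)))
                       (≡.cong (from σ)))
                  (_≟_ I (from σ i) (from σ j)) (_≟_ J i j)))

  module _ {I : FinSet} (A : Composition I) where

    -- The r-th diagonal block of an element of UL(τ₁ ⋆ ⋯ ⋆ τ_ℓ , A)
    diagonal-block : (τ : BlockOrders A) (r : Fin (length A)) →
                     UT (UL-order A (star A τ)) ⟶ UT (toPartial (τ r))
    diagonal-block τ r = homomorphism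
      (λ X (i , _) (j , _) → X i j)
      (λ X≋Y (i , _) (j , _) → X≋Y i j)
      (λ X∈ (i , p) (j , q) neq →
        let (i≢j , t) = X∈ i j (λ eq →
              neq (𝔽.trans (𝔽.+-congˡ (𝔽.-‿cong (𝔽.sym (𝟙-block (i , p) (j , q))))) eq))
        in i≢j ∘ ≡.cong proj₁ , block-pattern i p j q t)
      𝟙-block
      (λ {X} {Y} X∈ Y∈ (i , p) (j , q) → 𝔽.trans
        (∑-cong (λ k → 𝔽.sym (outside X∈ (Y k j) {i} {k} p)))
        (𝔽.sym (sum-pick ((block A r ∋_) ∘ element (finite I)) (λ k → X i (element (finite I) k) * Y (element (finite I) k) j))))
      where
      open Matrices I using (𝟙; ∑-cong)
      module MJ = Matrices ⟦ block A r ⟧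
      block-pattern : ∀ i p j q → (i , j) ∈ᴾ UL-order A (star A τ) → ((i , p) , (j , q)) ∈ᵀ τ r
      block-pattern i p j q t =
        let (u , _) = does⁻ (UL-dec A (star A τ) i j) t
        in ≡.subst T (restrict-star A τ r (i , p) (j , q)) u
      𝟙-block : ∀ i j → 𝟙 (proj₁ i) (proj₁ j) ≈ MJ.𝟙 i j
      𝟙-block i j = 𝔽.reflexive (≡.cong (λ b → if b then 1# else 0#)
        (Dec.does-⇔ (mk⇔ Σ-T-≡ (≡.cong proj₁)) (_≟_ I (proj₁ i) (proj₁ j)) (_≟_ ⟦ block A r ⟧ i j)))
      outside : ∀ {X} → HasPattern (UL-order A (star A τ)) X → ∀ y {i k} → T (block A r ∋ i) →
                (if block A r ∋ k then X i k * y else 0#) ≈ X i k * y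
      outside {X} X∈ y {i} {k} p = go (block A r ∋ k) refl
        where
        go : ∀ b → (block A r ∋ k) ≡ b → (if b then X i k * y else 0#) ≈ X i k * y
        go true  _  = 𝔽.refl
        go false eq = 𝔽.sym (𝔽.trans (𝔽.*-congʳ (Pattern.vanishes (UL-order A (star A τ)) X∈ not-Eq)) (𝔽.zeroˡ y))
          where
          not-Eq : ¬ (i , k) ∈ᴾ UL-order A (star A τ)
          not-Eq t = ≡.subst T eq (≡.subst (λ r → T (block A r ∋ k))
            (≡.trans (≡.sym (proj₂ (does⁻ (UL-dec A (star A τ) i k) t))) (blockOf-unique A p))
            (proj₂ (covers A k)))

    module _ (τ : TotalOrder I) where

      UL UR UP : FiniteGroup
      UL = UT (UL-order A τ)
      UR = UT (UR-order A τ)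
      UP = UT (UP-order A τ)

      UL⊆UP : UL-order A τ ⊆ᴾ UP-order A τ
      UL⊆UP i j t = let (u , e) = does⁻ (UL-dec A τ i j) t in does⁺ (UP-dec A τ i j) (u , inj₁ e)

      UR⊆UP : UR-order A τ ⊆ᴾ UP-order A τ
      UR⊆UP i j t with does⁻ (UR-dec A τ i j) t
      ... | inj₁ refl    = does⁺ (UP-dec A τ i j) (IsTotalOrder.reflexive (TotalOrder.isTotalOrder τ) refl , inj₁ refl)
      ... | inj₂ (u , a) = does⁺ (UP-dec A τ i j) (u , inj₂ a)

      UP⊆τ : UP-order A τ ⊆ᴾ toPartial τ
      UP⊆τ i j t = proj₁ (does⁻ (UP-dec A τ i j) t)

      -- The projection UP → UL keeps the entries indexed by Eq(A).
      diagonal-part : Mat I → Mat I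
      diagonal-part X i j = if does (blockOf A i Fin.≟ blockOf A j) then X i j else 0#

      private
        module M = Matrices I
        open M using (_≋_; _⊡_; 𝟙; 𝟙-off; ∑-zero; ∑-cong)
        module P = Pattern (UP-order A τ)

      diagonal-Eq : ∀ X {i j} → Eq A i j → diagonal-part X i j ≈ X i j
      diagonal-Eq X {i} {j} e = 𝔽.reflexive
        (≡.cong (λ b → if b then X i j else 0#) (Dec.dec-true (blockOf A i Fin.≟ blockOf A j) e))

      diagonal-¬Eq : ∀ X {i j} → ¬ Eq A i j → diagonal-part X i j ≈ 0#
      diagonal-¬Eq X {i} {j} ¬e = 𝔽.reflexive
        (≡.cong (λ b → if b then X i j else 0#) (Dec.dec-false (blockOf A i Fin.≟ blockOf A j) ¬e))

      diagonal-cong : ∀ {X Y} → X ≋ Y → diagonal-part X ≋ diagonal-part Y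
      diagonal-cong {X} {Y} X≋Y i j with Dec.toSum (blockOf A i Fin.≟ blockOf A j)
      ... | inj₁ e = 𝔽.trans (diagonal-Eq X e) (𝔽.trans (X≋Y i j) (𝔽.sym (diagonal-Eq Y e)))
      ... | inj₂ ¬e = 𝔽.trans (diagonal-¬Eq X ¬e) (𝔽.sym (diagonal-¬Eq Y ¬e))

      diagonal-pattern : ∀ {X} → HasPattern (UP-order A τ) X → HasPattern (UL-order A τ) (diagonal-part X)
      diagonal-pattern {X} X∈ = Pattern.hasPattern (UL-order A τ) off
        (λ i → 𝔽.trans (diagonal-Eq X refl) (P.unipotent X∈ i))
        where
        off : ∀ {i j} → ¬ (i , j) ∈ᴾ UL-order A τ → diagonal-part X i j ≈ 0#
        off {i} {j} ∉UL with Dec.toSum (blockOf A i Fin.≟ blockOf A j)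
        ... | inj₂ ¬e = diagonal-¬Eq X ¬e
        ... | inj₁ e = 𝔽.trans (diagonal-Eq X e) (P.vanishes X∈ λ t →
          ∉UL (does⁺ (UL-dec A τ i j) (proj₁ (does⁻ (UP-dec A τ i j) t) , e)))

      diagonal-UL : ∀ {X} → HasPattern (UL-order A τ) X → diagonal-part X ≋ X
      diagonal-UL {X} X∈ i j with Dec.toSum (blockOf A i Fin.≟ blockOf A j)
      ... | inj₁ e = diagonal-Eq X e
      ... | inj₂ ¬e = 𝔽.trans (diagonal-¬Eq X ¬e) (𝔽.sym (Pattern.vanishes (UL-order A τ) X∈ λ t →
          ¬e (proj₂ (does⁻ (UL-dec A τ i j) t))))

      diagonal-UR : ∀ {X} → HasPattern (UR-order A τ) X → diagonal-part X ≋ 𝟙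
      diagonal-UR {X} X∈ i j with Dec.toSum (blockOf A i Fin.≟ blockOf A j)
      ... | inj₂ ¬e = 𝔽.trans (diagonal-¬Eq X ¬e) (𝔽.sym (𝟙-off λ { refl → ¬e refl }))
      ... | inj₁ e = 𝔽.trans (diagonal-Eq X e) (Pattern.agrees (UR-order A τ) X∈ excluded)
        where
        excluded : ¬ (¬ i ≡ j × (i , j) ∈ᴾ UR-order A τ)
        excluded (i≢j , t) with does⁻ (UR-dec A τ i j) t
        ... | inj₁ i≡j     = i≢j i≡j
        ... | inj₂ (_ , a) = Fin.<-irrefl e a

      diagonal-kernel : ∀ {X} → HasPattern (UP-order A τ) X → diagonal-part X ≋ 𝟙 →
                        HasPattern (UR-order A τ) X
      diagonal-kernel {X} X∈ DX≋𝟙 = Pattern.hasPattern (UR-order A τ) off (P.unipotent X∈)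
        where
        off : ∀ {i j} → ¬ (i , j) ∈ᴾ UR-order A τ → X i j ≈ 0#
        off {i} {j} ∉UR with Dec.toSum (blockOf A i Fin.≟ blockOf A j)
        ... | inj₁ e = 𝔽.trans (𝔽.sym (diagonal-Eq X e)) (𝔽.trans (DX≋𝟙 i j)
          (𝟙-off (λ i≡j → ∉UR (does⁺ (UR-dec A τ i j) (inj₁ i≡j)))))
        ... | inj₂ ¬e = P.vanishes X∈ excluded
          where
          excluded : ¬ (i , j) ∈ᴾ UP-order A τ
          excluded t with does⁻ (UP-dec A τ i j) t
          ... | _ , inj₁ e = ¬e e
          ... | u , inj₂ a = ∉UR (does⁺ (UR-dec A τ i j) (inj₂ (u , a)))

      diagonal-𝟙 : diagonal-part 𝟙 ≋ 𝟙
      diagonal-𝟙 = diagonal-UR (Pattern.𝟙-hasPattern (UR-order A τ))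

      diagonal-⊡ : ∀ {X Y} → HasPattern (UP-order A τ) X → HasPattern (UP-order A τ) Y →
                   diagonal-part (X ⊡ Y) ≋ diagonal-part X ⊡ diagonal-part Y
      diagonal-⊡ {X} {Y} X∈ Y∈ i j with Dec.toSum (blockOf A i Fin.≟ blockOf A j)
      ... | inj₂ ¬e = 𝔽.trans (diagonal-¬Eq (X ⊡ Y) ¬e) (𝔽.sym (∑-zero zero-term))
        where
        zero-term : ∀ k → diagonal-part X i k * diagonal-part Y k j ≈ 0#
        zero-term k with Dec.toSum (blockOf A i Fin.≟ blockOf A k)
        ... | inj₂ ¬ik = 𝔽.trans (𝔽.*-congʳ (diagonal-¬Eq X ¬ik)) (𝔽.zeroˡ _)
        ... | inj₁ ik = 𝔽.trans (𝔽.*-congˡ (diagonal-¬Eq Y (¬e ∘ ≡.trans ik))) (𝔽.zeroʳ _)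
      ... | inj₁ e = 𝔽.trans (diagonal-Eq (X ⊡ Y) e) (∑-cong same-term)
        where
        same-term : ∀ k → X i k * Y k j ≈ diagonal-part X i k * diagonal-part Y k j
        same-term k with Dec.toSum (blockOf A i Fin.≟ blockOf A k)
        ... | inj₁ ik = 𝔽.sym (𝔽.*-cong (diagonal-Eq X ik) (diagonal-Eq Y (≡.trans (≡.sym ik) e)))
        ... | inj₂ ¬ik = 𝔽.trans zero-left (𝔽.sym (𝔽.trans (𝔽.*-congʳ (diagonal-¬Eq X ¬ik)) (𝔽.zeroˡ _)))
          where
          zero-left : X i k * Y k j ≈ 0#
          zero-left with T? (PartialOrder.rel (UP-order A τ) i k)
          ... | no ∉UP = 𝔽.trans (𝔽.*-congʳ (P.vanishes X∈ ∉UP)) (𝔽.zeroˡ (Y k j))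
          ... | yes t  = 𝔽.trans (𝔽.*-congˡ (P.vanishes Y∈ (excluded (does⁻ (UP-dec A τ i k) t)))) (𝔽.zeroʳ (X i k))
            where
            excluded : UP-relation A τ i k → ¬ (k , j) ∈ᴾ UP-order A τ
            excluded (_ , inj₁ ik) _ = ¬ik ik
            excluded (_ , inj₂ ik) u with does⁻ (UP-dec A τ k j) u
            ... | _ , inj₁ kj = Fin.<-irrefl (≡.trans e (≡.sym kj)) ik
            ... | _ , inj₂ kj = Fin.<-irrefl e (Fin.<-trans ik kj)

      projection : UP ⟶ UL
      projection = homomorphism diagonal-part diagonal-cong diagonal-pattern diagonal-𝟙 diagonal-⊡

      UP=UL⋉UR : SemidirectProduct UP UL UR
      UP=UL⋉UR = record
        { ι           = inclusion UL⊆UP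
        ; κ           = inclusion UR⊆UP
        ; π           = projection
        ; π-ι         = λ X → diagonal-UL (pattern-π X)
        ; κ-injective = id
        ; π-κ         = λ X → diagonal-UR (pattern-π X)
        ; kernel      = λ X πX≈ε →
            record { mat = mat X ; invertible = UTElement.invertible X
                   ; pattern-π = diagonal-kernel (pattern-π X) πX≈ε } , M.≋.refl
        }

module _ {q : ℕ} (𝔽 : FiniteField q) where

  open PatternGroups 𝔽
  open UTElement using (mat; pattern-π)

  -- Direct sums of spaces of class functions of pattern groups in GL(I), the
  -- index set being finite. Equal indices name the same summand.
  module _ {I : FinSet} (Ω : Setoid 0ℓ 0ℓ) (π : Setoid.Carrier Ω → PartialOrder I) where

    open Matrices I using (_≋_)
    private
      module Ω = Setoid Ω

    record Family : Set where
      no-eta-equality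
      field
        component      : ∀ ω → ClassFunction (UT (π ω))
        component-cong : ∀ {ω ω′} → ω Ω.≈ ω′ → (X : UTElement (π ω)) (X′ : UTElement (π ω′)) →
                         mat X ≋ mat X′ → value (component ω) X ℂ.≈ value (component ω′) X′

    open Family

    DirectSum : Mod
    DirectSum = record
      { Carrierᴹ = Family
      ; _≈ᴹ_     = λ f g → ∀ ω X → value (component f ω) X ℂ.≈ value (component g ω) X
      ; _+ᴹ_     = λ f g → record
        { component      = λ ω → component f ω +ᶠ component g ω
        ; component-cong = λ eq X X′ p → ℂ.+-cong (component-cong f eq X X′ p) (component-cong g eq X X′ p)
        }
      ; _*ₗ_     = λ c f → record
        { component      = λ ω → c ·ᶠ component f ω
        ; component-cong = λ eq X X′ p → ℂ.*-congˡ (component-cong f eq X X′ p)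
        }
      ; 0ᴹ       = record
        { component      = λ ω → 0ᶠ
        ; component-cong = λ _ _ _ _ → ℂ.refl
        }
      ; -ᴹ_      = λ f → record
        { component      = λ ω → -ᶠ component f ω
        ; component-cong = λ eq X X′ p → ℂ.-‿cong (component-cong f eq X X′ p)
        }
      }

  open Family public

  -- ψ ∈ cf(UT(τ)) is sent to ψ ∘ σ⁻¹ ∈ cf(UT(στ)), so the
  -- component of the image at τ comes from the summand of σ⁻¹τ.
  cf : RawSpecies
  RawSpecies.obj cf I = DirectSum (total-orders I) toPartial
  component      (RawSpecies.map cf σ f) τ =
    pullback (relabelling 𝔽 (sym-≃ σ) τ) (component f (transportᵀ (sym-≃ σ) τ))
  component-cong (RawSpecies.map cf σ f) τ≈τ′ X X′ X≋X′ =
    component-cong f (λ i j → τ≈τ′ (to σ i) (to σ j)) _ _ (λ i j → X≋X′ (to σ i) (to σ j))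

  module _ {I : FinSet} (A : Composition I) where

    open Matrices I using (_≋_)

    -- cf(UT(τ₁) ⊕ ⋯ ⊕ UT(τ_ℓ)) summed over all τ₁ , … , τ_ℓ
    cf⊕ : Mod
    cf⊕ = DirectSum (block-orders A) (λ τ → UL-order A (star A τ))

    -- f₁ ⊗ ⋯ ⊗ f_ℓ as the class function X₁ ⊕ ⋯ ⊕ X_ℓ ↦ f₁(X₁) ⋯ f_ℓ(X_ℓ)
    external : Mod.Carrierᴹ (obj⊗ cf A) → Mod.Carrierᴹ cf⊕
    external = extend cf⊕ product
      where
      product : (∀ r → Mod.Carrierᴹ (obj cf ⟦ block A r ⟧)) → Mod.Carrierᴹ cf⊕
      component      (product f) τ = ∏ᶠ (λ r → pullback (diagonal-block 𝔽 A τ r) (component (f r) (τ r)))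
      component-cong (product f) {τ} {τ′} τ≈τ′ X X′ X≋X′ = go
        (λ r → pullback (diagonal-block 𝔽 A τ r) (component (f r) (τ r)))
        (λ r → pullback (diagonal-block 𝔽 A τ′ r) (component (f r) (τ′ r)))
        (λ r → component-cong (f r) (τ≈τ′ r) _ _ (λ (i , _) (j , _) → X≋X′ i j))
        where
        go : ∀ {n} (ψ : Fin n → ClassFunction (UL 𝔽 A (star A τ)))
             (χ : Fin n → ClassFunction (UL 𝔽 A (star A τ′))) →
             (∀ r → value (ψ r) X ℂ.≈ value (χ r) X′) → value (∏ᶠ ψ) X ℂ.≈ value (∏ᶠ χ) X′
        go {zero}  ψ χ eq = ℂ.refl
        go {suc n} ψ χ eq = ℂ.*-cong (eq zero) (go (ψ ∘ suc) (χ ∘ suc) (eq ∘ suc))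

    -- Inf from UL(φ , A) to UT(φ) for φ = τ₁ ⋆ ⋯ ⋆ τ_ℓ, where UT(φ) = UP(φ , A)
    module _ (φ : TotalOrder I) (τ : BlockOrders A) (φ≈⋆ : star A τ ≈ᵀ φ) where

      UT⊆UP : toPartial φ ⊆ᴾ UP-order A (star A τ)
      UT⊆UP i j t = does⁺ (UP-dec A (star A τ) i j) (u , within (star⁻ A τ u))
        where
        u : (i , j) ∈ᵀ star A τ
        u = ≡.subst T (≡.sym (φ≈⋆ i j)) t
        within : Star A τ i j → Eq A i j ⊎ Asc A i j
        within (inj₁ w) = inj₁ (within-Eq A τ w)
        within (inj₂ a) = inj₂ a

      inflate : ClassFunction (UL 𝔽 A (star A τ)) → ClassFunction (UT (toPartial φ))
      inflate ψ = Res (inclusion 𝔽 UT⊆UP) (Inf (UP=UL⋉UR 𝔽 A (star A τ)) ψ)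

    inflation : Mod.Carrierᴹ cf⊕ → Mod.Carrierᴹ (obj cf I)
    inflation f = record { component = comp ; component-cong = comp-cong }
      where
      comp-at : ∀ φ → Dec (∃[ τ ] star A τ ≈ᵀ φ) → ClassFunction (UT (toPartial φ))
      comp-at φ (yes (τ , φ≈⋆)) = inflate φ τ φ≈⋆ (component f τ)
      comp-at φ (no _)          = 0ᶠ
      comp : ∀ φ → ClassFunction (UT (toPartial φ))
      comp φ = comp-at φ (star? A φ)
      comp-cong : ∀ {φ φ′} → φ ≈ᵀ φ′ → ∀ X X′ → mat X ≋ mat X′ → value (comp φ) X ℂ.≈ value (comp φ′) X′
      comp-cong {φ} {φ′} φ≈φ′ X X′ X≋X′ = go (star? A φ) (star? A φ′)
        where
        go : ∀ d d′ → value (comp-at φ d) X ℂ.≈ value (comp-at φ′ d′) X′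
        go (yes (τ , e)) (yes (τ′ , e′)) = component-cong f τ≈τ′ _ _ (diagonal-cong 𝔽 A (star A τ) X≋X′)
          where
          τ≈τ′ : ∀ r → τ r ≈ᵀ τ′ r
          τ≈τ′ r i j = ≡.trans (≡.sym (restrict-star A τ r i j))
            (≡.trans (e (proj₁ i) (proj₁ j)) (≡.trans (φ≈φ′ (proj₁ i) (proj₁ j))
              (≡.trans (≡.sym (e′ (proj₁ i) (proj₁ j))) (restrict-star A τ′ r i j))))
        go (yes (τ , e)) (no ¬e) = ⊥-elim (¬e (τ , λ i j → ≡.trans (e i j) (φ≈φ′ i j)))
        go (no ¬e) (yes (τ , e)) = ⊥-elim (¬e (τ , λ i j → ≡.trans (e i j) (≡.sym (φ≈φ′ i j))))
        go (no _)  (no _)        = ℂ.refl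

    μ : Mod.Carrierᴹ (obj⊗ cf A) → Mod.Carrierᴹ (obj cf I)
    μ t = inflation (external t)

    Resf : (φ : TotalOrder I) → ClassFunction (UT (toPartial φ)) → ClassFunction (UL 𝔽 A φ)
    Resf φ ψ = Def (UP=UL⋉UR 𝔽 A φ) (Res (inclusion 𝔽 (UP⊆τ 𝔽 A φ)) ψ)

    -- If φ|_{A_r} = τ_r for all r, then UL(φ , A) = UT(τ₁) ⊕ ⋯ ⊕ UT(τ_ℓ).
    UL-star⊆UL : (φ : TotalOrder I) (τ : BlockOrders A) → (∀ r → restrictᵀ A φ r ≈ᵀ τ r) →
                 UL-order A (star A τ) ⊆ᴾ UL-order A φ
    UL-star⊆UL φ τ φ∣≈τ i j t =
      let (u , e) = does⁻ (UL-dec A (star A τ) i j) t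
      in does⁺ (UL-dec A φ i j) (within (star⁻ A τ u) e , e)
      where
      within : Star A τ i j → Eq A i j → (i , j) ∈ᵀ φ
      within (inj₁ (r , p , q , u)) e = ≡.subst T (≡.sym (φ∣≈τ r (i , p) (j , q))) u
      within (inj₂ a)               e = ⊥-elim (Fin.<-irrefl e a)

    -- The component at τ collects the images of the summands φ that map to it.
    restriction : Mod.Carrierᴹ (obj cf I) → Mod.Carrierᴹ cf⊕
    restriction f = record { component = comp ; component-cong = comp-cong }
      where
      F = finite-total-orders {I}
      term : ∀ φ τ → Dec (∀ r → restrictᵀ A φ r ≈ᵀ τ r) → ClassFunction (UL 𝔽 A (star A τ))
      term φ τ (yes φ∣≈τ) = Res (inclusion 𝔽 (UL-star⊆UL φ τ φ∣≈τ)) (Resf φ (component f φ))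
      term φ τ (no _)     = 0ᶠ
      comp : ∀ τ → ClassFunction (UL 𝔽 A (star A τ))
      comp τ = ∑ᶠ (λ k → term (element F k) τ (restricts-to? A (element F k) τ))
      term-cong : ∀ φ {τ τ′} → (∀ r → τ r ≈ᵀ τ′ r) → ∀ X X′ → mat X ≋ mat X′ → ∀ d d′ →
                  value (term φ τ d) X ℂ.≈ value (term φ τ′ d′) X′
      term-cong φ {τ} {τ′} τ≈τ′ X X′ X≋X′ (yes e) (yes e′) =
        value-cong (Resf φ (component f φ)) {fun (inclusion 𝔽 (UL-star⊆UL φ τ e)) X}
          {fun (inclusion 𝔽 (UL-star⊆UL φ τ′ e′)) X′} X≋X′
      term-cong φ τ≈τ′ X X′ X≋X′ (yes e) (no ¬e) = ⊥-elim (¬e λ r i j → ≡.trans (e r i j) (τ≈τ′ r i j))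
      term-cong φ τ≈τ′ X X′ X≋X′ (no ¬e) (yes e) = ⊥-elim (¬e λ r i j → ≡.trans (e r i j) (≡.sym (τ≈τ′ r i j)))
      term-cong φ τ≈τ′ X X′ X≋X′ (no _)  (no _)  = ℂ.refl
      comp-cong : ∀ {τ τ′} → (∀ r → τ r ≈ᵀ τ′ r) → ∀ X X′ → mat X ≋ mat X′ →
                  value (comp τ) X ℂ.≈ value (comp τ′) X′
      comp-cong {τ} {τ′} τ≈τ′ X X′ X≋X′ = go _ _
        (λ k → term-cong (element F k) τ≈τ′ X X′ X≋X′ (restricts-to? A (element F k) τ) (restricts-to? A (element F k) τ′))
        where
        go : ∀ {n} (ψ : Fin n → ClassFunction (UL 𝔽 A (star A τ)))
             (χ : Fin n → ClassFunction (UL 𝔽 A (star A τ′))) →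
             (∀ k → value (ψ k) X ℂ.≈ value (χ k) X′) → value (∑ᶠ ψ) X ℂ.≈ value (∑ᶠ χ) X′
        go {zero}  ψ χ eq = ℂ.refl
        go {suc n} ψ χ eq = ℂ.+-cong (eq zero) (go (ψ ∘ suc) (χ ∘ suc) (eq ∘ suc))

  -- The identification cf[A₁] ⊗ ⋯ ⊗ cf[A_ℓ] = ⊕ cf(UT(τ₁) ⊕ ⋯ ⊕ UT(τ_ℓ)); its
  -- inverse turns restriction, which lands in the right side, into Δ_A.
  ExternalIso : Set₁
  ExternalIso = ∀ {I} (A : Composition I) → IsLinearIso (obj⊗ cf A) (cf⊕ A) (external A)

  Δ : ExternalIso → ∀ {I} (A : Composition I) → Mod.Carrierᴹ (obj cf I) → Mod.Carrierᴹ (obj⊗ cf A)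
  Δ iso A f = proj₁ (LeftModuleMorphisms.IsLeftModuleIsomorphism.surjective (iso A) (restriction A f))

{-# OPTIONS --safe #-}
module Submission where

-- An element of cf[I] is determined by its values at the pairs (φ , X) with X ∈ UT(φ), and an element of cf(A)
-- by the products of the values of its tensor factors at (φ|_{A_r} , X|_{A_r}): expand the factors in indicator
-- functions of conjugacy classes. In these terms (μ_A t)(φ , X) is the value of t at the blocks of φ and X if
-- Asc(A) ⊆ φ, and 0 otherwise, while (Δ_A f)(φ , X) is the sum, over the orders φ′ that agree with φ within the
-- blocks of A, of the mean of f(φ′ , X′) over the X′ with the diagonal blocks of X and arbitrary entries at
-- φ′ ∩ Asc(A). Associativity and coassociativity hold because the conditions on orders for A ∧ B split into those
-- for A and those within its blocks, and the means are iterated. Compatibility compares conditions: if Asc(A) ⊆ φ′,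
-- then φ′ agrees with φ within the blocks of B if and only if it does so within those of A ∧ B and Asc(A) is
-- contained in φ within the blocks of B.

open import Algebra.Bundles using (CommutativeMonoid; Group)
open import Algebra.Module.Bundles using (LeftModule)
import Algebra.Module.Construct.TensorUnit as TensorUnit
open import Algebra.Module.Morphism.Structures using (module LeftModuleMorphisms)
open import Algebra.Module.Structures using (IsLeftModule)
import Algebra.Properties.CommutativeMonoid.Sum as Sum
import Algebra.Properties.CommutativeSemigroup as CommutativeSemigroupProperties
import Algebra.Properties.Group as GroupProperties
import Algebra.Properties.Ring as RingProperties
import Algebra.Properties.Semiring.Sum as SemiringSum
open import Data.Bool.Base using (Bool; true; if_then_else_; T; _∧_)
import Data.Bool.Properties as Bool
open import Data.Empty using (⊥-elim; ⊥)
open import Data.Fin.Base as Fin using (Fin; zero; suc)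
import Data.Fin.Induction as Fin
open import Data.Fin.Permutation using (Permutation)
import Data.Fin.Properties as Fin
import Data.Integer.Base as ℤ
import Data.Integer.Properties as ℤ
open import Data.List.Base as List using (List; []; _∷_; allFin; concatMap)
open import Data.List.Membership.Propositional using (_∈_)
open import Data.List.Membership.Propositional.Properties using (∈-lookup; ∈-filter⁺; ∈-allFin)
import Data.List.Relation.Unary.All as All
import Data.List.Relation.Unary.All.Properties as All
open import Data.List.Relation.Unary.AllPairs as AllPairs using (AllPairs; []; _∷_)
import Data.List.Relation.Unary.AllPairs.Properties as AllPairs
import Data.List.Relation.Unary.Any as Any
import Data.List.Relation.Unary.Any.Properties as Any
open import Data.Nat using (ℕ; _^_; _≥_)
open import Data.Nat.Base as ℕ using (zero; suc)
open import Data.Nat.Primality using (Prime)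
import Data.Nat.Properties as ℕ
open import Data.Product using (Σ-syntax)
open import Data.Product.Base as Product using (Σ; ∃-syntax; _×_; _,_; proj₁; proj₂)
open import Data.Product.Relation.Binary.Pointwise.NonDependent using (×-setoid)
open import Data.Rational.Base as ℚ using (ℚ; 0ℚ; 1ℚ)
import Data.Rational.Properties as ℚ
import Data.Rational.Unnormalised.Base as ℚᵘ
import Data.Rational.Unnormalised.Properties as ℚᵘ
open import Data.Sum.Base using (_⊎_; inj₁; inj₂; map₂)
open import Data.Unit.Base using (tt)
open import Data.Vec.Functional using (removeAt)
open import Function.Base using (_∘_; id; flip)
open import Function.Bundles using (Inverse; mk↔ₛ′; Equivalence)
open import Function.Construct.Identity using (↔-id)
open import Induction.WellFounded using (Acc; acc)
open import Level using (0ℓ)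
open import Relation.Binary.Bundles using (Setoid)
import Relation.Binary.Construct.NonStrictToStrict as ToStrict
open import Relation.Binary.Definitions using (tri<; tri≈; tri>; Tri)
open import Relation.Binary.PropositionalEquality as ≡ using (_≡_; refl)
import Relation.Binary.Reasoning.Setoid as SetoidReasoning
open import Relation.Binary.Structures using (IsPartialOrder; IsTotalOrder; IsEquivalence)
open import Relation.Nullary.Decidable as Dec using (Dec; yes; no; does; T?)
open import Relation.Nullary.Negation using (¬_)
open import Defs

-- Finite sums and means

-- Two obstacles shape the proof. `Def` averages over UR(φ , A), a group that changes with order and
-- composition, so the means on the two sides of an axiom run over unrelated sets. They are all
-- replaced by means over a full set of matrices, of which the averaged function reads only the
-- entries it needs. Involutions of a product of two sets then give uniformity and independence of
-- entries without counting. For this, a matrix with unit diagonal and a given pattern must be shown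
-- invertible, as the matrices built this way are known only by their entries.
--
-- Secondly, Δ_A f is an unspecified preimage under `external` in a tensor product given by
-- generators and relations. Its tensors are compared through their values only, and a value is a
-- functional on terms that is computed on pure tensors. Class functions are extended by 0 to all
-- matrices, which keeps most membership proofs out of these computations. Evaluating at one order
-- and one matrix on all of I makes the canonical maps between the spaces cf(A) invisible.

module _ {S T : Setoid 0ℓ 0ℓ} (F : Finite S) (G : Finite T) where

  private
    module S = Setoid S
    module T = Setoid T

  finite-× : Finite (×-setoid S T)
  finite-× = record
    { size        = size F ℕ.* size G
    ; enumeration = record
      { to        = fwd
      ; from      = bwd
      ; to-cong   = fwd-cong
      ; from-cong = λ { refl → S.refl , T.refl }
      ; inverse   = (λ {k} eq → ≡.trans (fwd-cong eq) (fwd-bwd k))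
                  , (λ { {x} refl → bwd-fwd x })
      }
    }
    where
    fwd : S.Carrier × T.Carrier → Fin (size F ℕ.* size G)
    fwd (x , y) = Fin.combine (index F x) (index G y)
    bwd : Fin (size F ℕ.* size G) → S.Carrier × T.Carrier
    bwd k = element F (proj₁ (Fin.remQuot (size G) k)) , element G (proj₂ (Fin.remQuot {size F} (size G) k))
    fwd-cong : ∀ {p q} → Setoid._≈_ (×-setoid S T) p q → fwd p ≡ fwd q
    fwd-cong (e , e′) = ≡.cong₂ Fin.combine (index-cong F e) (index-cong G e′)
    fwd-bwd : ∀ k → fwd (bwd k) ≡ k
    fwd-bwd k = ≡.trans (≡.cong₂ Fin.combine (index-element F _) (index-element G _))
      (Fin.combine-remQuot {size F} (size G) k)
    bwd-fwd : ∀ p → Setoid._≈_ (×-setoid S T) (bwd (fwd p)) p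
    bwd-fwd (x , y) =
      S.trans (S.reflexive (≡.cong (element F ∘ proj₁) (Fin.remQuot-combine {size F} (index F x) (index G y)))) (element-index F x) ,
      T.trans (T.reflexive (≡.cong (element G ∘ proj₂) (Fin.remQuot-combine {size F} (index F x) (index G y)))) (element-index G y)

Π-setoid : ∀ {n} → (Fin n → Setoid 0ℓ 0ℓ) → Setoid 0ℓ 0ℓ
Π-setoid S = record
  { Carrier       = ∀ r → Setoid.Carrier (S r)
  ; _≈_           = λ f g → ∀ r → Setoid._≈_ (S r) (f r) (g r)
  ; isEquivalence = record
    { refl  = λ r → Setoid.refl (S r)
    ; sym   = λ p r → Setoid.sym (S r) (p r)
    ; trans = λ p q r → Setoid.trans (S r) (p r) (q r)
    }
  }

infixr 5 _∷ᵈ_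

_∷ᵈ_ : ∀ {a n} {P : Fin (suc n) → Set a} → P zero → (∀ r → P (suc r)) → ∀ r → P r
(x ∷ᵈ f) zero    = x
(x ∷ᵈ f) (suc r) = f r

module _ {n} (S : Fin (suc n) → Setoid 0ℓ 0ℓ) where

  Π-cons : Inverse (×-setoid (S zero) (Π-setoid (S ∘ suc))) (Π-setoid S)
  Π-cons = record
    { to        = λ (x , f) → x ∷ᵈ f
    ; from      = λ f → f zero , f ∘ suc
    ; to-cong   = cons-cong
    ; from-cong = λ e → e zero , e ∘ suc
    ; inverse   = (λ e → λ { zero → proj₁ e ; (suc r) → proj₂ e r }) , (λ e → e zero , e ∘ suc)
    }
    where
    cons-cong : ∀ {p q} → Setoid._≈_ (×-setoid (S zero) (Π-setoid (S ∘ suc))) p q →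
              Setoid._≈_ (Π-setoid S) (proj₁ p ∷ᵈ proj₂ p) (proj₁ q ∷ᵈ proj₂ q)
    cons-cong (e , e′) zero    = e
    cons-cong (e , e′) (suc r) = e′ r

finite-↔ : {S T : Setoid 0ℓ 0ℓ} → Inverse S T → Finite S → Finite T
size (finite-↔ e F) = size F
enumeration (finite-↔ e F) = Compose.inverse (Symmetry.inverse e) (enumeration F)
  where
  import Function.Construct.Composition as Compose
  import Function.Construct.Symmetry as Symmetry

finite-Π : ∀ {n} {S : Fin n → Setoid 0ℓ 0ℓ} → (∀ r → Finite (S r)) → Finite (Π-setoid S)
size        (finite-Π {zero} F) = 1
enumeration (finite-Π {zero} F) = record
  { to        = λ _ → zero
  ; from      = λ _ ()
  ; to-cong   = λ _ → refl
  ; from-cong = λ _ ()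
  ; inverse   = (λ { {zero} _ → refl }) , (λ _ ())
  }
finite-Π {suc n} {S} F = finite-↔ (Π-cons S) (finite-× (F zero) (finite-Π (F ∘ suc)))

module FiniteSums (M : CommutativeMonoid 0ℓ 0ℓ) where

  open CommutativeMonoid M renaming (Carrier to A; _≈_ to _≈ᴬ_; refl to reflᴬ; sym to symᴬ; trans to transᴬ)
  import Algebra.Properties.CommutativeMonoid.Sum M as Σᴹ
  open FiniteSum M public
  open Σᴹ public using (sum-replicate-zero; sum-cong-≗)

  when : {P : Set} → Dec P → A → A
  when d x = if does d then x else ε

  when-yes : {P : Set} (d : Dec P) {x : A} → P → when d x ≈ᴬ x
  when-yes (yes _) p = reflᴬ
  when-yes (no ¬p) p = ⊥-elim (¬p p)

  when-no : {P : Set} (d : Dec P) {x : A} → ¬ P → when d x ≈ᴬ ε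
  when-no (yes p) ¬p = ⊥-elim (¬p p)
  when-no (no _)  ¬p = reflᴬ

  when-cong : {P Q : Set} (d : Dec P) (e : Dec Q) {x y : A} → (P → Q) → (Q → P) → (P → x ≈ᴬ y) →
              when d x ≈ᴬ when e y
  when-cong (yes p) (yes q) to from eq = eq p
  when-cong (yes p) (no ¬q) to from eq = ⊥-elim (¬q (to p))
  when-cong (no ¬p) (yes q) to from eq = ⊥-elim (¬p (from q))
  when-cong (no ¬p) (no ¬q) to from eq = reflᴬ

  when-congʳ : {P : Set} (d : Dec P) {x y : A} → (P → x ≈ᴬ y) → when d x ≈ᴬ when d y
  when-congʳ d = when-cong d d id id

  when-× : {P Q R : Set} (d : Dec P) (e : Dec Q) (f : Dec R) {x : A} →
           (P → Q → R) → (R → P × Q) → when d (when e x) ≈ᴬ when f x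
  when-× (yes p) e f to from = when-cong e f (to p) (proj₂ ∘ from) (λ _ → reflᴬ)
  when-× (no ¬p) e f to from = symᴬ (when-no f (¬p ∘ proj₁ ∘ from))

  sum-zero : ∀ {n} {f : Fin n → A} → (∀ k → f k ≈ᴬ ε) → sum f ≈ᴬ ε
  sum-zero {n} f≈ε = transᴬ (sum-cong-≋ f≈ε) (sum-replicate-zero n)

  sum-single : ∀ {n} (f : Fin n → A) k → (∀ l → ¬ l ≡ k → f l ≈ᴬ ε) → sum f ≈ᴬ f k
  sum-single {suc n} f k f≈ε = transᴬ (Σᴹ.sum-remove {i = k} f)
    (transᴬ (∙-congˡ (sum-zero λ l → f≈ε (Fin.punchIn k l) (Fin.punchInᵢ≢i k l))) (identityʳ (f k)))

  when-sum : ∀ {n} {P : Set} (d : Dec P) (f : Fin n → A) → when d (sum f) ≈ᴬ sum (λ k → when d (f k))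
  when-sum     (yes _) f = reflᴬ
  when-sum {n} (no _)  f = symᴬ (sum-replicate-zero n)

  module _ {S : Setoid 0ℓ 0ℓ} (F : Finite S) where

    private
      module S = Setoid S

    ∑-cong : {f g : S.Carrier → A} → (∀ x → f x ≈ᴬ g x) → ∑ F f ≈ᴬ ∑ F g
    ∑-cong f≈g = sum-cong-≋ λ k → f≈g (element F k)

    ∑-zero : {f : S.Carrier → A} → (∀ x → f x ≈ᴬ ε) → ∑ F f ≈ᴬ ε
    ∑-zero f≈ε = sum-zero λ k → f≈ε (element F k)

    ∑-∙ : (f g : S.Carrier → A) → ∑ F (λ x → f x ∙ g x) ≈ᴬ ∑ F f ∙ ∑ F g
    ∑-∙ f g = ∑-distrib-+ (f ∘ element F) (g ∘ element F)

    ∑-when : {P : Set} (d : Dec P) (f : S.Carrier → A) → when d (∑ F f) ≈ᴬ ∑ F (λ x → when d (f x))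
    ∑-when d f = when-sum d (f ∘ element F)

    ∑-kronecker : (f : S.Carrier → A) → (∀ {x y} → x S.≈ y → f x ≈ᴬ f y) → ∀ y →
                  (d : ∀ x → Dec (x S.≈ y)) → ∑ F (λ x → when (d x) (f x)) ≈ᴬ f y
    ∑-kronecker f f-cong y d = transᴬ
      (sum-single _ (index F y) (λ k k≢ → when-no (d (element F k)) (λ eq →
        k≢ (≡.trans (≡.sym (index-element F k)) (index-cong F eq)))))
      (transᴬ (when-yes (d _) (element-index F y)) (f-cong (element-index F y)))

  ∑-swap : {S T : Setoid 0ℓ 0ℓ} (F : Finite S) (G : Finite T)
           (f : Setoid.Carrier S → Setoid.Carrier T → A) →
           ∑ F (λ x → ∑ G (f x)) ≈ᴬ ∑ G (λ y → ∑ F (λ x → f x y))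
  ∑-swap F G f = ∑-comm (λ k l → f (element F k) (element G l))

  module _ {S T : Setoid 0ℓ 0ℓ} (F : Finite S) (G : Finite T) where

    private
      module S = Setoid S
      module T = Setoid T

    -- Insert Σ_{x , y} [p = (x , y)] = 1: H is an arbitrary enumeration.
    ∑-× : (H : Finite (×-setoid S T)) (f : S.Carrier × T.Carrier → A) →
          (∀ {p q} → Setoid._≈_ (×-setoid S T) p q → f p ≈ᴬ f q) →
          ∑ H f ≈ᴬ ∑ F (λ x → ∑ G (λ y → f (x , y)))
    ∑-× H f f-cong = begin
      ∑ H f
        ≈⟨ ∑-cong H (λ (x , y) → symᴬ (transᴬ
             (∑-cong F λ x′ → symᴬ (∑-when G (_≈ˢ?_ x′ x) (λ y′ → when (_≈ᵗ?_ y′ y) (f (x′ , y′)))))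
             (transᴬ (∑-kronecker F (λ x′ → ∑ G (λ y′ → when (_≈ᵗ?_ y′ y) (f (x′ , y′))))
                       (λ e → ∑-cong G λ y′ → when-congʳ (_≈ᵗ?_ y′ y) λ _ → f-cong {_ , y′} {_ , y′} (e , T.refl)) x λ x′ → _≈ˢ?_ x′ x)
               (∑-kronecker G (λ y′ → f (x , y′)) (λ {y′} {y″} e → f-cong {x , y′} {x , y″} (S.refl , e)) y λ y′ → _≈ᵗ?_ y′ y)))) ⟩
      ∑ H (λ p → ∑ F (λ x → ∑ G (λ y → t x y p)))
        ≈⟨ ∑-swap H F (λ p x → ∑ G (λ y → t x y p)) ⟩
      ∑ F (λ x → ∑ H (λ p → ∑ G (λ y → t x y p)))
        ≈⟨ ∑-cong F (λ x → ∑-swap H G (λ p y → t x y p)) ⟩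
      ∑ F (λ x → ∑ G (λ y → ∑ H (λ p → t x y p)))
        ≈⟨ ∑-cong F (λ x → ∑-cong G λ y → transᴬ
             (∑-cong H λ p → when-× (_≈ˢ?_ x (proj₁ p)) (_≈ᵗ?_ y (proj₂ p)) (pair? p (x , y))
               (λ e e′ → S.sym e , T.sym e′) (λ (e , e′) → S.sym e , T.sym e′))
             (∑-kronecker H (λ _ → f (x , y)) (λ _ → reflᴬ) (x , y) (λ p → pair? p (x , y)))) ⟩
      ∑ F (λ x → ∑ G (λ y → f (x , y))) ∎
      where
      open SetoidReasoning setoid
      _≈ˢ?_ = Finite._≈?_ F
      _≈ᵗ?_ = Finite._≈?_ G
      pair? : ∀ p q → Dec (Setoid._≈_ (×-setoid S T) p q)
      pair? (x , y) (x′ , y′) = (_≈ˢ?_ x x′) Dec.×-dec (_≈ᵗ?_ y y′)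
      t : S.Carrier → T.Carrier → S.Carrier × T.Carrier → A
      t x y p = when (_≈ˢ?_ x (proj₁ p)) (when (_≈ᵗ?_ y (proj₂ p)) (f (x , y)))

  ∑-Π : ∀ {n} {S : Fin (suc n) → Setoid 0ℓ 0ℓ} (F : ∀ r → Finite (S r))
        (f : (∀ r → Setoid.Carrier (S r)) → A) → (∀ {p q} → Setoid._≈_ (Π-setoid S) p q → f p ≈ᴬ f q) →
        ∑ (finite-Π F) f ≈ᴬ ∑ (F zero) (λ x → ∑ (finite-Π (F ∘ suc)) (λ g → f (x ∷ᵈ g)))
  ∑-Π {S = S} F f f-cong = transᴬ
    (symᴬ (∑-reindex H (finite-Π F) (Π-cons S) f f-cong))
    (∑-× (F zero) (finite-Π (F ∘ suc)) H _ (f-cong ∘ Inverse.to-cong (Π-cons S)))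
    where
    H = finite-× (F zero) (finite-Π (F ∘ suc))

module ℂ∑ = FiniteSums ℂ.+-commutativeMonoid
module ℂ∏ = FiniteSum ℂ.*-commutativeMonoid

open ℂ∑ using (when; when-yes; when-no; when-cong; when-congʳ; when-×)

module ℂΣ = SemiringSum ℂ.semiring

∏ : ∀ {n} → (Fin n → ℂ.Carrier) → ℂ.Carrier
∏ = ℂ∏.sum

∏-cong : ∀ {n} {f g : Fin n → ℂ.Carrier} → (∀ r → f r ℂ.≈ g r) → ∏ f ℂ.≈ ∏ g
∏-cong = ℂ∏.sum-cong-≋

∑-*ˡ : {S : Setoid 0ℓ 0ℓ} (F : Finite S) → ∀ c f → c ℂ.* ℂ∑.∑ F f ℂ.≈ ℂ∑.∑ F (λ x → c ℂ.* f x)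
∑-*ˡ F c f = ℂΣ.*-distribˡ-sum c (f ∘ element F)

∑-*ʳ : {S : Setoid 0ℓ 0ℓ} (F : Finite S) → ∀ c f → ℂ∑.∑ F f ℂ.* c ℂ.≈ ℂ∑.∑ F (λ x → f x ℂ.* c)
∑-*ʳ F c f = ℂΣ.*-distribʳ-sum c (f ∘ element F)

when-*ˡ : {P : Set} (d : Dec P) → ∀ c x → c ℂ.* when d x ℂ.≈ when d (c ℂ.* x)
when-*ˡ (yes _) c x = ℂ.refl
when-*ˡ (no _)  c x = ℂ.zeroʳ c

when-*ʳ : {P : Set} (d : Dec P) → ∀ c x → when d x ℂ.* c ℂ.≈ when d (x ℂ.* c)
when-*ʳ (yes _) c x = ℂ.refl
when-*ʳ (no _)  c x = ℂ.zeroˡ c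

-- Distributivity, one factor at a time. The functions must respect equality because `∑-Π` reindexes
-- the product, which reaches each point only up to equality.
∏-∑ : ∀ {n} {S : Fin n → Setoid 0ℓ 0ℓ} (F : ∀ r → Finite (S r)) (f : ∀ r → Setoid.Carrier (S r) → ℂ.Carrier) →
      (∀ r {x y} → Setoid._≈_ (S r) x y → f r x ℂ.≈ f r y) →
      ∏ (λ r → ℂ∑.∑ (F r) (f r)) ℂ.≈ ℂ∑.∑ (finite-Π F) (λ x → ∏ (λ r → f r (x r)))
∏-∑ {zero}  F f f-cong = ℂ.sym (ℂ.+-identityʳ ℂ.1#)
∏-∑ {suc n} F f f-cong = begin
  ℂ∑.∑ (F zero) (f zero) ℂ.* ∏ (λ r → ℂ∑.∑ (F (suc r)) (f (suc r)))
    ≈⟨ ℂ.*-congˡ (∏-∑ (F ∘ suc) (λ r → f (suc r)) (λ r → f-cong (suc r))) ⟩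
  ℂ∑.∑ (F zero) (f zero) ℂ.* ℂ∑.∑ (finite-Π (F ∘ suc)) (λ x → ∏ (λ r → f (suc r) (x r)))
    ≈⟨ ∑-*ʳ (F zero) _ (f zero) ⟩
  ℂ∑.∑ (F zero) (λ x → f zero x ℂ.* ℂ∑.∑ (finite-Π (F ∘ suc)) (λ y → ∏ (λ r → f (suc r) (y r))))
    ≈⟨ ℂ∑.∑-cong (F zero) (λ x → ∑-*ˡ (finite-Π (F ∘ suc)) (f zero x) (λ y → ∏ (λ r → f (suc r) (y r)))) ⟩
  ℂ∑.∑ (F zero) (λ x → ℂ∑.∑ (finite-Π (F ∘ suc)) (λ y → f zero x ℂ.* ∏ (λ r → f (suc r) (y r))))
    ≈⟨ ℂ∑.∑-Π F (λ x → ∏ (λ r → f r (x r))) (λ e → ∏-cong λ r → f-cong r (e r)) ⟨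
  ℂ∑.∑ (finite-Π F) (λ x → ∏ (λ r → f r (x r))) ∎
  where open SetoidReasoning ℂ.setoid

-- Serves to turn conditions on the separate blocks into one condition on an order of the whole set;
-- any decision of an equivalent condition may be used for the result.
∏-when : ∀ {n} {P : Fin n → Set} (d : ∀ r → Dec (P r)) {Q : Set} (e : Dec Q) → ((∀ r → P r) → Q) → (Q → ∀ r → P r) →
         (f : Fin n → ℂ.Carrier) → ∏ (λ r → when (d r) (f r)) ℂ.≈ when e (∏ f)
∏-when {zero}  d e to from f = ℂ.sym (when-yes e (to λ ()))
∏-when {suc n} d e to from f = begin
  when (d zero) (f zero) ℂ.* ∏ (λ r → when (d (suc r)) (f (suc r)))
    ≈⟨ ℂ.*-congˡ (∏-when (d ∘ suc) (Fin.all? (d ∘ suc)) id id (f ∘ suc)) ⟩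
  when (d zero) (f zero) ℂ.* when (Fin.all? (d ∘ suc)) (∏ (f ∘ suc))
    ≈⟨ when-*ʳ (d zero) _ _ ⟩
  when (d zero) (f zero ℂ.* when (Fin.all? (d ∘ suc)) (∏ (f ∘ suc)))
    ≈⟨ when-congʳ (d zero) (λ _ → when-*ˡ (Fin.all? (d ∘ suc)) _ _) ⟩
  when (d zero) (when (Fin.all? (d ∘ suc)) (∏ f))
    ≈⟨ when-× (d zero) (Fin.all? (d ∘ suc)) e
         (λ p q → to λ { zero → p ; (suc r) → q r }) (λ q → from q zero , λ r → from q (suc r)) ⟩
  when e (∏ f) ∎
  where open SetoidReasoning ℂ.setoid

-- Rational scalars and uniform means

private

  rational-cong : ∀ {p q} → p ≡ q → rational p ℂ.≈ rational q
  rational-cong refl = ℂ.refl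

  termwise : ∀ {x y} → (∀ n → ℝ.seq x n ≡ ℝ.seq y n) → x ≈ᴿ y
  termwise {x} {y} eq = mk≈ᴿ λ ε 0<ε → 0 , λ n _ → ≡.subst (ℚ._< ε)
    (≡.sym (≡.trans (≡.cong (λ z → dist z (ℝ.seq y n)) (eq n)) (≡.cong ℚ.∣_∣ (ℚ.+-inverseʳ (ℝ.seq y n))))) 0<ε

  rational-+ : ∀ p q → rational p ℂ.+ rational q ℂ.≈ rational (p ℚ.+ q)
  rational-+ p q = termwise (λ _ → refl) , termwise (λ _ → refl)

  rational-* : ∀ p q → rational p ℂ.* rational q ℂ.≈ rational (p ℚ.* q)
  rational-* p q =
    termwise (λ _ → ≡.trans (≡.cong (λ r → p ℚ.* q ℚ.+ ℚ.- r) (ℚ.*-zeroˡ 0ℚ)) (ℚ.+-identityʳ (p ℚ.* q))) ,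
    termwise (λ _ → ≡.cong₂ ℚ._+_ (ℚ.*-zeroʳ p) (ℚ.*-zeroˡ q))

  -- Defined by repeated addition of 1, the form that a sum of n equal terms produces in
  -- `sum-const`.
  ofℕ : ℕ → ℚ
  ofℕ zero    = 0ℚ
  ofℕ (suc n) = 1ℚ ℚ.+ ofℕ n

  ofℕ-≃ : ∀ n → ℚ.toℚᵘ (ofℕ n) ℚᵘ.≃ ℚᵘ.mkℚᵘ (ℤ.+ n) 0
  ofℕ-≃ zero    = ℚᵘ.≃-refl
  ofℕ-≃ (suc n) = ℚᵘ.≃-trans (ℚ.toℚᵘ-homo-+ 1ℚ (ofℕ n))
    (ℚᵘ.≃-trans (ℚᵘ.+-congʳ (ℚ.toℚᵘ 1ℚ) (ofℕ-≃ n))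
      (ℚᵘ.*≡* (≡.cong (λ m → (ℤ.1ℤ ℤ.+ m) ℤ.* ℤ.1ℤ) (ℤ.*-identityʳ (ℤ.+ n)))))

  -- Among unnormalised rationals no reduction to lowest terms intervenes, and an identity of
  -- natural numbers is left. It makes the weight in a mean cancel a sum of equal terms.
  inverse-ofℕ : ∀ n .{{_ : ℕ.NonZero n}} → (ℤ.+ 1 ℚ./ n) ℚ.* ofℕ n ≡ 1ℚ
  inverse-ofℕ n@(suc n-1) = ℚ.toℚᵘ-injective (begin
    ℚ.toℚᵘ ((ℤ.+ 1 ℚ./ n) ℚ.* ofℕ n)            ≈⟨ ℚ.toℚᵘ-homo-* (ℤ.+ 1 ℚ./ n) (ofℕ n) ⟩
    ℚ.toℚᵘ (ℤ.+ 1 ℚ./ n) ℚᵘ.* ℚ.toℚᵘ (ofℕ n)    ≈⟨ ℚᵘ.*-cong (ℚ.toℚᵘ-fromℚᵘ (ℚᵘ.mkℚᵘ (ℤ.+ 1) n-1)) (ofℕ-≃ n) ⟩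
    ℚᵘ.mkℚᵘ (ℤ.+ 1) n-1 ℚᵘ.* ℚᵘ.mkℚᵘ (ℤ.+ n) 0  ≈⟨ ℚᵘ.*≡* (≡.cong ℤ.+_ (eq n-1)) ⟩
    ℚᵘ.1ℚᵘ                                      ∎)
    where
    open SetoidReasoning ℚᵘ.≃-setoid
    eq : ∀ k → (suc k ℕ.+ 0) ℕ.* 1 ≡ suc k ℕ.* 1 ℕ.+ 0
    eq k = ≡.trans (ℕ.*-identityʳ (suc k ℕ.+ 0)) (≡.cong (ℕ._+ 0) (≡.sym (ℕ.*-identityʳ (suc k))))

-- The uniform mean, with its weight written as in `Def`, so that `Def-E` holds by reflexivity. The
-- evidence that the size is nonzero is irrelevant, so means with different evidence coincide.
E : {S : Setoid 0ℓ 0ℓ} (F : Finite S) .(nz : ℕ.NonZero (size F)) → (Setoid.Carrier S → ℂ.Carrier) → ℂ.Carrier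
E F nz f = (1/_ (size F) {{nz}}) ℂ.* ℂ∑.∑ F f

private

  sum-const : ∀ n c → ℂ∑.sum {n} (λ _ → c) ℂ.≈ rational (ofℕ n) ℂ.* c
  sum-const zero    c = ℂ.sym (ℂ.zeroˡ c)
  sum-const (suc n) c = begin
    c ℂ.+ ℂ∑.sum {n} (λ _ → c)                       ≈⟨ ℂ.+-cong (ℂ.sym (ℂ.*-identityˡ c)) (sum-const n c) ⟩
    ℂ.1# ℂ.* c ℂ.+ rational (ofℕ n) ℂ.* c            ≈⟨ ℂ.distribʳ c ℂ.1# (rational (ofℕ n)) ⟨
    (ℂ.1# ℂ.+ rational (ofℕ n)) ℂ.* c                ≈⟨ ℂ.*-congʳ (rational-+ 1ℚ (ofℕ n)) ⟩
    rational (ofℕ (suc n)) ℂ.* c                     ∎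
    where open SetoidReasoning ℂ.setoid

module _ {S : Setoid 0ℓ 0ℓ} (F : Finite S) .(nz : ℕ.NonZero (size F)) where

  private
    module S = Setoid S
    w = 1/_ (size F) {{nz}}

  E-cong : {f g : S.Carrier → ℂ.Carrier} → (∀ x → f x ℂ.≈ g x) → E F nz f ℂ.≈ E F nz g
  E-cong f≈g = ℂ.*-congˡ (ℂ∑.∑-cong F f≈g)

  E-const : ∀ c → E F nz (λ _ → c) ℂ.≈ c
  E-const c = begin
    w ℂ.* ℂ∑.sum {size F} (λ _ → c)              ≈⟨ ℂ.*-congˡ (sum-const (size F) c) ⟩
    w ℂ.* (rational (ofℕ (size F)) ℂ.* c)        ≈⟨ ℂ.*-assoc _ _ c ⟨
    w ℂ.* rational (ofℕ (size F)) ℂ.* c          ≈⟨ ℂ.*-congʳ (rational-* p (ofℕ (size F))) ⟩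
    rational (p ℚ.* ofℕ (size F)) ℂ.* c   ≈⟨ ℂ.*-congʳ (rational-cong (inverse-ofℕ (size F) {{nz}})) ⟩
    ℂ.1# ℂ.* c                                             ≈⟨ ℂ.*-identityˡ c ⟩
    c                                                      ∎
    where
    open SetoidReasoning ℂ.setoid
    p = ℚ._/_ (ℤ.+ 1) (size F) {{nz}}

  E-+ : ∀ f g → E F nz (λ x → f x ℂ.+ g x) ℂ.≈ E F nz f ℂ.+ E F nz g
  E-+ f g = ℂ.trans (ℂ.*-congˡ (ℂ∑.∑-∙ F f g)) (ℂ.distribˡ _ _ _)

  E-*ˡ : ∀ c f → c ℂ.* E F nz f ℂ.≈ E F nz (λ x → c ℂ.* f x)
  E-*ˡ c f = begin
    c ℂ.* (w ℂ.* ℂ∑.∑ F f)       ≈⟨ x∙yz≈y∙xz c w (ℂ∑.∑ F f) ⟩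
    w ℂ.* (c ℂ.* ℂ∑.∑ F f)       ≈⟨ ℂ.*-congˡ (∑-*ˡ F c f) ⟩
    E F nz (λ x → c ℂ.* f x)                  ∎
    where
    open SetoidReasoning ℂ.setoid
    open import Algebra.Properties.CommutativeSemigroup ℂ.*-commutativeSemigroup using (x∙yz≈y∙xz)

  E-*ʳ : ∀ c f → E F nz f ℂ.* c ℂ.≈ E F nz (λ x → f x ℂ.* c)
  E-*ʳ c f = ℂ.trans (ℂ.*-comm _ c) (ℂ.trans (E-*ˡ c f) (E-cong λ x → ℂ.*-comm c (f x)))

  E-when : {P : Set} (d : Dec P) (f : S.Carrier → ℂ.Carrier) → when d (E F nz f) ℂ.≈ E F nz (λ x → when d (f x))
  E-when (yes _) f = ℂ.refl
  E-when (no _)  f = ℂ.sym (E-const ℂ.0#)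

  E-∑ : {T : Setoid 0ℓ 0ℓ} (G : Finite T) (f : Setoid.Carrier T → S.Carrier → ℂ.Carrier) →
        ℂ∑.∑ G (λ y → E F nz (f y)) ℂ.≈ E F nz (λ x → ℂ∑.∑ G (λ y → f y x))
  E-∑ G f = ℂ.trans (ℂ.sym (∑-*ˡ G w (λ y → ℂ∑.∑ F (f y)))) (ℂ.*-congˡ (ℂ∑.∑-swap G F f))

module _ {S T : Setoid 0ℓ 0ℓ} (F : Finite S) .(nzF : ℕ.NonZero (size F)) (G : Finite T) .(nzG : ℕ.NonZero (size G)) where

  private
    module S = Setoid S
    module T = Setoid T
    w = 1/_ (size F) {{nzF}}
    v = 1/_ (size G) {{nzG}}

  private

    E-× : (f : S.Carrier → T.Carrier → ℂ.Carrier) →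
          (∀ {x x′ y y′} → x S.≈ x′ → y T.≈ y′ → f x y ℂ.≈ f x′ y′) →
          E F nzF (λ x → E G nzG (f x)) ℂ.≈
          w ℂ.* (v ℂ.* ℂ∑.∑ (finite-× F G) (λ (x , y) → f x y))
    E-× f f-cong = ℂ.*-congˡ (ℂ.trans (ℂ.sym (∑-*ˡ F v (λ x → ℂ∑.∑ G (f x))))
      (ℂ.*-congˡ (ℂ.sym (ℂ∑.∑-× F G (finite-× F G) (λ (x , y) → f x y) (λ (e , e′) → f-cong e e′)))))

  -- An involution (x , y) ↦ (a(x , y) , b(x , y)) of S × T preserves the uniform
  -- distribution, so a(x , y) is uniformly distributed.
  module _ (a : S.Carrier → T.Carrier → S.Carrier) (b : S.Carrier → T.Carrier → T.Carrier)
           (a-cong : ∀ {x x′ y y′} → x S.≈ x′ → y T.≈ y′ → a x y S.≈ a x′ y′)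
           (b-cong : ∀ {x x′ y y′} → x S.≈ x′ → y T.≈ y′ → b x y T.≈ b x′ y′)
           (a-involutive : ∀ x y → a (a x y) (b x y) S.≈ x)
           (b-involutive : ∀ x y → b (a x y) (b x y) T.≈ y) where

    private
      involution : Inverse (×-setoid S T) (×-setoid S T)
      involution = record
        { to        = θ
        ; from      = θ
        ; to-cong   = θ-cong
        ; from-cong = θ-cong
        ; inverse   = θθ , θθ
        }
        where
        θ : S.Carrier × T.Carrier → S.Carrier × T.Carrier
        θ (x , y) = a x y , b x y
        θ-cong : ∀ {p q} → Setoid._≈_ (×-setoid S T) p q → Setoid._≈_ (×-setoid S T) (θ p) (θ q)
        θ-cong (e , e′) = a-cong e e′ , b-cong e e′
        θθ : ∀ {p q} → Setoid._≈_ (×-setoid S T) q (θ p) → Setoid._≈_ (×-setoid S T) (θ q) p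
        θθ {x , y} (e , e′) = S.trans (a-cong e e′) (a-involutive x y) , T.trans (b-cong e e′) (b-involutive x y)

    E-absorb : (f : S.Carrier → ℂ.Carrier) → (∀ {x x′} → x S.≈ x′ → f x ℂ.≈ f x′) →
               E F nzF (λ x → E G nzG (λ y → f (a x y))) ℂ.≈ E F nzF f
    E-absorb f f-cong = begin
      E F nzF (λ x → E G nzG (λ y → f (a x y)))
        ≈⟨ E-× (λ x y → f (a x y)) (λ e e′ → f-cong (a-cong e e′)) ⟩
      w ℂ.* (v ℂ.* ℂ∑.∑ (finite-× F G) (λ (x , y) → f (a x y)))
        ≈⟨ ℂ.*-congˡ (ℂ.*-congˡ (ℂ∑.∑-reindex (finite-× F G) (finite-× F G) involution (f ∘ proj₁) (f-cong ∘ proj₁))) ⟩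
      w ℂ.* (v ℂ.* ℂ∑.∑ (finite-× F G) (λ (x , y) → f x))
        ≈⟨ E-× (λ x _ → f x) (λ e _ → f-cong e) ⟨
      E F nzF (λ x → E G nzG (λ y → f x))
        ≈⟨ E-cong F nzF (λ x → E-const G nzG (f x)) ⟩
      E F nzF f ∎
      where open SetoidReasoning ℂ.setoid

    -- By `E-absorb` the mean of f is that of f ∘ a over S × T, where only y matters. Means over
    -- different sets are thus compared by an involution of the product, with no bijection between S
    -- and T and no comparison of sizes.
    E-transfer : (f : S.Carrier → ℂ.Carrier) → (∀ {x x′} → x S.≈ x′ → f x ℂ.≈ f x′) →
                 (g : T.Carrier → ℂ.Carrier) → (∀ x y → f (a x y) ℂ.≈ g y) → E F nzF f ℂ.≈ E G nzG g
    E-transfer f f-cong g f≈g = begin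
      E F nzF f                                  ≈⟨ E-absorb f f-cong ⟨
      E F nzF (λ x → E G nzG (λ y → f (a x y)))      ≈⟨ E-cong F nzF (λ x → E-cong G nzG (f≈g x)) ⟩
      E F nzF (λ x → E G nzG g)                      ≈⟨ E-const F nzF (E G nzG g) ⟩
      E G nzG g                                  ∎
      where open SetoidReasoning ℂ.setoid

-- Pattern matrices

module _ {q : ℕ} (𝔽 : FiniteField q) where

  open PatternGroups 𝔽
  open Matrices using (Mat)
  private
    module 𝔽 = FiniteField 𝔽
  open 𝔽 using (_≈_; _*_; 0#; 1#)
  open UTElement using (mat; pattern-π)

  private
    module 𝔽∑ = FiniteSums 𝔽.+-commutativeMonoid
    module 𝔽Sum = Sum 𝔽.+-commutativeMonoid

    sum-cancel : ∀ {n} (f g : Fin n → 𝔽.Carrier) k → (∀ l → ¬ l ≡ k → f l ≈ g l) →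
                 𝔽∑.sum f ≈ 𝔽∑.sum g → f k ≈ g k
    sum-cancel {suc n} f g k f≈g eq = ∙-cancelʳ (𝔽∑.sum (removeAt f k)) (f k) (g k)
      (𝔽.trans (𝔽.sym (𝔽Sum.sum-remove {i = k} f)) (𝔽.trans eq (𝔽.trans (𝔽Sum.sum-remove {i = k} g)
        (𝔽.+-congˡ (𝔽∑.sum-cong-≋ λ l → 𝔽.sym (f≈g (Fin.punchIn k l) (Fin.punchInᵢ≢i k l)))))))
      where open GroupProperties 𝔽.+-group using (∙-cancelʳ)

  module _ {I : FinSet} (π : PartialOrder I) where

    open Matrices I hiding (Mat)
    open PartialOrder π

    private

      module P = IsPartialOrder isPartialOrder

      F = finite I

      R : Fin (size F) → Fin (size F) → Set
      R k l = T (rel (element F k) (element F l))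

      R-isPartialOrder : IsPartialOrder _≡_ R
      R-isPartialOrder = record
        { isPreorder = record
          { isEquivalence = ≡.isEquivalence
          ; reflexive = λ { refl → P.reflexive refl }
          ; trans     = P.trans
          }
        ; antisym = λ {k} {l} p r → ≡.trans (≡.sym (index-element F k))
            (≡.trans (≡.cong (index F) (P.antisym p r)) (index-element F l))
        }

    -- Back substitution, starting from the maximal elements of the order.
    pattern-cancel : ∀ {X} → HasPattern π X → ∀ {Y Y′} → X ⊡ Y ≋ X ⊡ Y′ → Y ≋ Y′
    pattern-cancel {X} X∈ {Y} {Y′} eq i j = ≡.subst (λ i → Y i j ≈ Y′ i j) (element-index F i)
      (row (index F i) (Fin.po-noetherian R-isPartialOrder (index F i)))
      where
      _≺_ = ToStrict._<_ _≡_ R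
      row : ∀ k → Acc (flip _≺_) k → Y (element F k) j ≈ Y′ (element F k) j
      row k (acc above) = begin
        Y i′ j          ≈⟨ 𝔽.*-identityˡ _ ⟨
        1# * Y i′ j     ≈⟨ 𝔽.*-congʳ (Pattern.unipotent π X∈ i′) ⟨
        X i′ i′ * Y i′ j ≈⟨ sum-cancel (λ l → X i′ (element F l) * Y (element F l) j)
                              (λ l → X i′ (element F l) * Y′ (element F l) j) k term (eq i′ j) ⟩
        X i′ i′ * Y′ i′ j ≈⟨ 𝔽.*-congʳ (Pattern.unipotent π X∈ i′) ⟩
        1# * Y′ i′ j    ≈⟨ 𝔽.*-identityˡ _ ⟩
        Y′ i′ j         ∎
        where
        open SetoidReasoning 𝔽.setoid
        i′ = element F k
        term : ∀ l → ¬ l ≡ k → X i′ (element F l) * Y (element F l) j ≈ X i′ (element F l) * Y′ (element F l) j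
        term l l≢k with T? (rel i′ (element F l))
        ... | yes t = 𝔽.*-congˡ (row l (above (t , l≢k ∘ ≡.sym)))
        ... | no ¬t = 𝔽.trans (𝔽.*-congʳ X≈0) (𝔽.trans (𝔽.zeroˡ _) (𝔽.sym (𝔽.trans (𝔽.*-congʳ X≈0) (𝔽.zeroˡ _))))
          where
          X≈0 = Pattern.vanishes π X∈ ¬t

    opaque

      -- Left multiplication by X is injective on the finite set of all matrices, hence reaches 𝟙.
      -- The right inverse Y found in this way is also a left inverse, as X(YX) = X = X𝟙 and X can
      -- be cancelled.
      pattern⇒invertible : ∀ X → HasPattern π X → Invertible X
      pattern⇒invertible X X∈ = record
        { inv      = Y
        ; inverseʳ = proj₂ solution
        ; inverseˡ = pattern-cancel X∈ (begin
            X ⊡ (Y ⊡ X)   ≈⟨ ⊡-assoc X Y X ⟨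
            (X ⊡ Y) ⊡ X   ≈⟨ ⊡-cong (proj₂ solution) (≋.refl {X}) ⟩
            𝟙 ⊡ X         ≈⟨ ⊡-identityˡ X ⟩
            X             ≈⟨ ⊡-identityʳ X ⟨
            X ⊡ 𝟙         ∎)
        }
        where
        open SetoidReasoning mat-setoid
        solution : ∃[ Y ] X ⊡ Y ≋ 𝟙
        solution = injective⇒surjective finite-matrices (X ⊡_) (pattern-cancel X∈) 𝟙
        Y : Mat I
        Y = proj₁ solution

    fromPattern : ∀ X → HasPattern π X → UTElement π
    fromPattern X X∈ = record { mat = X ; invertible = pattern⇒invertible X X∈ ; pattern-π = X∈ }

  HasPattern-⊆ : {I : FinSet} (π ρ : PartialOrder I) → π ⊆ᴾ ρ → ∀ {X} → HasPattern π X → HasPattern ρ X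
  HasPattern-⊆ π ρ π⊆ρ X∈ i j neq = Product.map₂ (π⊆ρ i j) (X∈ i j neq)

  -- Means over all matrices of an index set

  matrices-nonZero : (I : FinSet) → ℕ.NonZero (size (Matrices.finite-matrices I))
  matrices-nonZero I = Fin.nonZeroIndex (index (Matrices.finite-matrices I) (Matrices.𝟙 I))

  𝔼 : (I : FinSet) → (Mat I → ℂ.Carrier) → ℂ.Carrier
  𝔼 I = E (Matrices.finite-matrices I) (matrices-nonZero I)

  𝔼-cong : (I : FinSet) {f g : Mat I → ℂ.Carrier} → (∀ Z → f Z ℂ.≈ g Z) → 𝔼 I f ℂ.≈ 𝔼 I g
  𝔼-cong I = E-cong (Matrices.finite-matrices I) (matrices-nonZero I)

  Def-E : {K G H : FiniteGroup} (S : SemidirectProduct K G H) (ψ : ClassFunction K) (g : FiniteGroup.Carrier G) →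
          let open SemidirectProduct S in
          value (Def S ψ) g ℂ.≈ E (FiniteGroup.finiteᴳ H) (FiniteGroup.order-nonZero H)
                                  (λ h → value ψ (FiniteGroup._∙_ K (fun ι g) (fun κ h)))
  Def-E S ψ g = ℂ.refl

  infix 6 _∣ᴹ_

  _∣ᴹ_ : {I : FinSet} → Mat I → (J : Subset I) → Mat ⟦ J ⟧
  (X ∣ᴹ J) (i , _) (j , _) = X i j

  private

    ite-yes : {P : Set} (d : Dec P) {x y : 𝔽.Carrier} → P → (if does d then x else y) ≈ x
    ite-yes (yes _) p = 𝔽.refl
    ite-yes (no ¬p) p = ⊥-elim (¬p p)

    ite-no : {P : Set} (d : Dec P) {x y : 𝔽.Carrier} → ¬ P → (if does d then x else y) ≈ y
    ite-no (yes p) ¬p = ⊥-elim (¬p p)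
    ite-no (no _)  ¬p = 𝔽.refl

    ite-cong : {P : Set} (d : Dec P) {x x′ y y′ : 𝔽.Carrier} → (P → x ≈ x′) → (¬ P → y ≈ y′) →
               (if does d then x else y) ≈ (if does d then x′ else y′)
    ite-cong (yes p) eq _  = eq p
    ite-cong (no ¬p) _  eq = eq ¬p

  module _ {I : FinSet} where

    open Matrices I hiding (Mat)

    module _ {S : ∣ I ∣ → ∣ I ∣ → Set} (S? : ∀ i j → Dec (S i j)) where

      choose : Mat I → Mat I → Mat I
      choose Z Z′ i j = if does (S? i j) then Z i j else Z′ i j

      choose-yes : ∀ Z Z′ {i j} → S i j → choose Z Z′ i j ≈ Z i j
      choose-yes Z Z′ {i} {j} s = ite-yes (S? i j) s

      choose-no : ∀ Z Z′ {i j} → ¬ S i j → choose Z Z′ i j ≈ Z′ i j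
      choose-no Z Z′ {i} {j} ¬s = ite-no (S? i j) ¬s

      choose-cong : ∀ {X X′ Y Y′} → X ≋ X′ → Y ≋ Y′ → choose X Y ≋ choose X′ Y′
      choose-cong p r i j = ite-cong (S? i j) (λ _ → p i j) (λ _ → r i j)

      -- The pair (`choose Z Z′` , `choose Z′ Z`) arises from (Z , Z′) by exchanging the entries
      -- outside S, which is an involution. So the splice of two independent uniform matrices is
      -- uniform.
      𝔼-choose : (f : Mat I → ℂ.Carrier) → (∀ {Z Z′} → Z ≋ Z′ → f Z ℂ.≈ f Z′) →
                 𝔼 I (λ Z → 𝔼 I (λ Z′ → f (choose Z Z′))) ℂ.≈ 𝔼 I f
      𝔼-choose = E-absorb finite-matrices (matrices-nonZero I) finite-matrices (matrices-nonZero I) choose (λ Z Z′ → choose Z′ Z)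
        (λ {X} {X′} {Y} {Y′} → choose-cong {X} {X′} {Y} {Y′}) (λ {X} {X′} {Y} {Y′} p r → choose-cong {Y} {Y′} {X} {X′} r p) involutive (λ Z Z′ → involutive Z′ Z)
        where
        involutive : ∀ Z Z′ → choose (choose Z Z′) (choose Z′ Z) ≋ Z
        involutive Z Z′ i j with S? i j
        ... | yes _ = 𝔽.refl
        ... | no  _ = 𝔽.refl

    -- Exchanging the block of Z at J with W is an involution of Mat(I) × Mat(J), so the block of a
    -- uniform matrix is uniform.
    𝔼-restrict : (J : Subset I) (f : Mat ⟦ J ⟧ → ℂ.Carrier) →
                 (∀ {Z Z′} → Matrices._≋_ ⟦ J ⟧ Z Z′ → f Z ℂ.≈ f Z′) →
                 𝔼 I (λ Z → f (Z ∣ᴹ J)) ℂ.≈ 𝔼 ⟦ J ⟧ f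
    𝔼-restrict J f f-cong = E-transfer finite-matrices (matrices-nonZero I) (Matrices.finite-matrices ⟦ J ⟧) (matrices-nonZero ⟦ J ⟧)
      replace (λ Z _ → Z ∣ᴹ J) (λ p r i j → replaceAt-cong (T? (J ∋ i)) (T? (J ∋ j)) (p i j) r) (λ p _ i j → p (proj₁ i) (proj₁ j))
      (λ Z W i j → involutive Z W (T? (J ∋ i)) (T? (J ∋ j)))
      (λ Z W i j → replace-in Z W i j)
      (λ Z → f (Z ∣ᴹ J)) (λ p → f-cong λ i j → p (proj₁ i) (proj₁ j))
      f (λ Z W → f-cong (replace-in Z W))
      where
      module MJ = Matrices ⟦ J ⟧
      replaceAt : 𝔽.Carrier → Mat ⟦ J ⟧ → ∀ {i j} → Dec (T (J ∋ i)) → Dec (T (J ∋ j)) → 𝔽.Carrier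
      replaceAt z W {i} {j} (yes p) (yes r) = W (i , p) (j , r)
      replaceAt z W _       _       = z
      replace : Mat I → Mat ⟦ J ⟧ → Mat I
      replace Z W i j = replaceAt (Z i j) W (T? (J ∋ i)) (T? (J ∋ j))
      replaceAt-cong : ∀ {z z′ W W′ i j} (d : Dec (T (J ∋ i))) (e : Dec (T (J ∋ j))) → z ≈ z′ → W MJ.≋ W′ →
                       replaceAt z W d e ≈ replaceAt z′ W′ d e
      replaceAt-cong (yes p) (yes r) eq W≋W′ = W≋W′ _ _
      replaceAt-cong (yes _) (no _)  eq W≋W′ = eq
      replaceAt-cong (no _)  _       eq W≋W′ = eq
      replace-in : ∀ Z W i j → replace Z W (proj₁ i) (proj₁ j) ≈ W i j
      replace-in Z W (i , p) (j , r) with T? (J ∋ i) | T? (J ∋ j)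
      ... | yes p′ | yes r′ = 𝔽.reflexive (≡.cong₂ W (Σ-T-≡ refl) (Σ-T-≡ refl))
      ... | yes _  | no ¬r  = ⊥-elim (¬r r)
      ... | no ¬p  | _      = ⊥-elim (¬p p)
      involutive : ∀ Z W {i j} (d : Dec (T (J ∋ i))) (e : Dec (T (J ∋ j))) →
                   replaceAt (replaceAt (Z i j) W d e) (Z ∣ᴹ J) d e ≈ Z i j
      involutive Z W (yes _) (yes _) = 𝔽.refl
      involutive Z W (yes _) (no _)  = 𝔽.refl
      involutive Z W (no _)  _       = 𝔽.refl

    -- Independence of disjoint sets of entries. The first factor reads only entries of Z in
    -- `S zero`, the others only entries of Z′ outside it; both may therefore read the splice of Z
    -- and Z′ along `S zero`, which `𝔼-choose` replaces by one matrix.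
    𝔼-∏ : ∀ {n} (S : Fin n → ∣ I ∣ → ∣ I ∣ → Set) → (∀ r i j → Dec (S r i j)) →
          (∀ {r s i j} → S r i j → S s i j → r ≡ s) →
          (f : Fin n → Mat I → ℂ.Carrier) →
          (∀ r {Z Z′} → (∀ i j → S r i j → Z i j ≈ Z′ i j) → f r Z ℂ.≈ f r Z′) →
          ∏ (λ r → 𝔼 I (f r)) ℂ.≈ 𝔼 I (λ Z → ∏ (λ r → f r Z))
    𝔼-∏ {zero}  S S? disj f f-local = ℂ.sym (E-const finite-matrices (matrices-nonZero I) ℂ.1#)
    𝔼-∏ {suc n} S S? disj f f-local = begin
      𝔼 I (f zero) ℂ.* ∏ (λ r → 𝔼 I (f (suc r)))
        ≈⟨ ℂ.*-congˡ (𝔼-∏ (S ∘ suc) (S? ∘ suc) (λ s t → Fin.suc-injective (disj s t)) (f ∘ suc) (λ r → f-local (suc r))) ⟩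
      𝔼 I (f zero) ℂ.* 𝔼 I g
        ≈⟨ E-*ʳ finite-matrices (matrices-nonZero I) (𝔼 I g) (f zero) ⟩
      𝔼 I (λ Z → f zero Z ℂ.* 𝔼 I g)
        ≈⟨ 𝔼-cong I (λ Z → E-*ˡ finite-matrices (matrices-nonZero I) (f zero Z) g) ⟩
      𝔼 I (λ Z → 𝔼 I (λ Z′ → f zero Z ℂ.* g Z′))
        ≈⟨ 𝔼-cong I (λ Z → 𝔼-cong I λ Z′ → ℂ.*-cong
             (f-local zero λ i j s → 𝔽.sym (choose-yes (S? zero) Z Z′ s))
             (∏-cong λ r → f-local (suc r) λ i j s → 𝔽.sym (choose-no (S? zero) Z Z′ λ s₀ → Fin.0≢1+n (disj s₀ s)))) ⟩
      𝔼 I (λ Z → 𝔼 I (λ Z′ → f zero (choose (S? zero) Z Z′) ℂ.* g (choose (S? zero) Z Z′)))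
        ≈⟨ 𝔼-choose (S? zero) (λ Z → ∏ (λ r → f r Z)) (λ e → ∏-cong λ r → f-local r λ i j _ → e i j) ⟩
      𝔼 I (λ Z → ∏ (λ r → f r Z)) ∎
      where
      open SetoidReasoning ℂ.setoid
      g : Mat I → ℂ.Carrier
      g Z = ∏ (λ r → f (suc r) Z)

    -- Deflation as a mean over free entries

    module _ (A : Composition I) (φ : TotalOrder I) where

      Free : ∣ I ∣ → ∣ I ∣ → Set
      Free i j = (i , j) ∈ᵀ φ × Asc A i j

      free? : ∀ i j → Dec (Free i j)
      free? i j = T? (TotalOrder.rel φ i j) Dec.×-dec Fin._<?_ (blockOf A i) (blockOf A j)

      private
        eq? : ∀ i j → Dec (Eq A i j)
        eq? i j = blockOf A i Fin.≟ blockOf A j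

      -- UP = UL ⋉ UR: the elements X h, for h ∈ UR(φ , A), are those with the
      -- diagonal blocks of X and arbitrary entries Z in the free positions.
      patch : Mat I → Mat I → Mat I
      patch X Z i j = if does (eq? i j) then X i j else (if does (free? i j) then Z i j else 0#)

      patch-Eq : ∀ {X Z i j} → Eq A i j → patch X Z i j ≈ X i j
      patch-Eq {i = i} {j} e = ite-yes (eq? i j) e

      patch-free : ∀ {X Z i j} → Free i j → patch X Z i j ≈ Z i j
      patch-free {X} {Z} {i} {j} f = 𝔽.trans (ite-no (eq? i j) λ e → Fin.<-irrefl e (proj₂ f)) (ite-yes (free? i j) f)

      patch-off : ∀ {X Z i j} → ¬ Eq A i j → ¬ Free i j → patch X Z i j ≈ 0#
      patch-off {X} {Z} {i} {j} ¬e ¬f = 𝔽.trans (ite-no (eq? i j) ¬e) (ite-no (free? i j) ¬f)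

      patch-pattern : ∀ {X} Z → HasPattern (UL-order A φ) X → HasPattern (UP-order A φ) (patch X Z)
      patch-pattern {X} Z X∈ = Pattern.hasPattern (UP-order A φ) off
        (λ i → 𝔽.trans (patch-Eq {X} {Z} {i} {i} refl) (Pattern.unipotent (UL-order A φ) X∈ i))
        where
        off : ∀ {i j} → ¬ (i , j) ∈ᴾ UP-order A φ → patch X Z i j ≈ 0#
        off {i} {j} ∉UP with Dec.toSum (eq? i j)
        ... | inj₁ e = 𝔽.trans (patch-Eq {X} {Z} e) (Pattern.vanishes (UL-order A φ) X∈ λ t → ∉UP (UL⊆UP 𝔽 A φ i j t))
        ... | inj₂ ¬e = patch-off {X} {Z} ¬e λ (t , a) → ∉UP (does⁺ (UP-dec A φ i j) (t , inj₂ a))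

      patch-cong : ∀ {X X′ Z Z′} → (∀ i j → Eq A i j → X i j ≈ X′ i j) → (∀ i j → Free i j → Z i j ≈ Z′ i j) →
                   patch X Z ≋ patch X′ Z′
      patch-cong p r i j = ite-cong (eq? i j) (p i j) λ _ → ite-cong (free? i j) (r i j) λ _ → 𝔽.refl

      patchᵁ : UTElement (UL-order A φ) → Mat I → UTElement (UP-order A φ)
      patchᵁ X Z = fromPattern (UP-order A φ) (patch (mat X) Z) (patch-pattern {mat X} Z (pattern-π {π = UL-order A φ} X))

      -- The involution of UR × Mat(I) exchanges the free entries of X h with those of Z and keeps
      -- the other entries of Z. Its first component a satisfies X a = `patch X Z`, so the term
      -- under `Def` becomes a function of Z alone, as `E-transfer` requires.
      Def-patch : (ψ : ClassFunction (UP 𝔽 A φ)) (X : UTElement (UL-order A φ)) →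
                  value (Def (UP=UL⋉UR 𝔽 A φ) ψ) X ℂ.≈
                  𝔼 I (λ Z → value ψ (patchᵁ X Z))
      Def-patch ψ X = final
        where
        S = UP=UL⋉UR 𝔽 A φ
        module K = FiniteGroup (UP 𝔽 A φ)
        open SemidirectProduct S using (ι; κ)
        open FiniteGroup (UR 𝔽 A φ) using (order-nonZero)
        M = mat X
        N = UTElement.inv X
        f : UTElement (UR-order A φ) → ℂ.Carrier
        f h = value ψ (fun ι X K.∙ fun κ h)
        g : Mat I → ℂ.Carrier
        g Z = value ψ (patchᵁ X Z)
        M∈ : HasPattern (UP-order A φ) M
        M∈ = HasPattern-⊆ (UL-order A φ) (UP-order A φ) (UL⊆UP 𝔽 A φ) (pattern-π X)
        N∈UL : HasPattern (UL-order A φ) N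
        N∈UL = Pattern.inv-hasPattern (UL-order A φ) (UTElement.invertible X) (pattern-π X)
        N∈ : HasPattern (UP-order A φ) N
        N∈ = HasPattern-⊆ (UL-order A φ) (UP-order A φ) (UL⊆UP 𝔽 A φ) N∈UL
        diagonal-patch : ∀ Z → diagonal-part 𝔽 A φ (patch M Z) ≋ M
        diagonal-patch Z i j with Dec.toSum (eq? i j)
        ... | inj₁ e = 𝔽.trans (diagonal-Eq 𝔽 A φ (patch M Z) e) (patch-Eq {M} {Z} e)
        ... | inj₂ ¬e = 𝔽.trans (diagonal-¬Eq 𝔽 A φ (patch M Z) ¬e) (𝔽.sym (Pattern.vanishes (UL-order A φ) (pattern-π X) λ t → ¬e (proj₂ (does⁻ (UL-dec A φ i j) t))))
        -- The projection to UL is multiplicative and sends `patch M Z` to M, so it sends the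
        -- product to N M = 𝟙; its kernel is UR.
        N⊡patch∈ : ∀ Z → HasPattern (UR-order A φ) (N ⊡ patch M Z)
        N⊡patch∈ Z = diagonal-kernel 𝔽 A φ {N ⊡ patch M Z}
          (Pattern.⊡-hasPattern (UP-order A φ) {N} {patch M Z} N∈ (patch-pattern {M} Z (pattern-π X)))
          (≋.trans (diagonal-⊡ 𝔽 A φ {N} {patch M Z} N∈ (patch-pattern {M} Z (pattern-π X)))
            (≋.trans (⊡-cong (diagonal-UL 𝔽 A φ {N} N∈UL) (diagonal-patch Z)) (UTElement.inverseˡ X)))
        a : UTElement (UR-order A φ) → Mat I → UTElement (UR-order A φ)
        a _ Z = fromPattern (UR-order A φ) (N ⊡ patch M Z) (N⊡patch∈ Z)
        b : UTElement (UR-order A φ) → Mat I → Mat I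
        b h Z = choose free? (M ⊡ mat h) Z
        a-cong : ∀ {h h′ Z Z′} → mat {π = UR-order A φ} h ≋ mat {π = UR-order A φ} h′ → Z ≋ Z′ → N ⊡ patch M Z ≋ N ⊡ patch M Z′
        a-cong {h} {h′} {Z} {Z′} _ e = ⊡-cong (≋.refl {N}) (patch-cong {M} {M} {Z} {Z′} (λ i j _ → 𝔽.refl) (λ i j _ → e i j))
        b-cong : ∀ {h h′ Z Z′} → mat {π = UR-order A φ} h ≋ mat {π = UR-order A φ} h′ → Z ≋ Z′ → b h Z ≋ b h′ Z′
        b-cong {h} {h′} {Z} {Z′} e e′ = choose-cong free? {M ⊡ mat h} {M ⊡ mat h′} {Z} {Z′} (⊡-cong (≋.refl {M}) e) e′
        X⊡a : ∀ h Z → M ⊡ mat (a h Z) ≋ patch M Z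
        X⊡a h Z = begin
          M ⊡ (N ⊡ patch M Z)   ≈⟨ ⊡-assoc M N (patch M Z) ⟨
          (M ⊡ N) ⊡ patch M Z   ≈⟨ ⊡-cong (UTElement.inverseʳ X) (≋.refl {patch M Z}) ⟩
          𝟙 ⊡ patch M Z         ≈⟨ ⊡-identityˡ (patch M Z) ⟩
          patch M Z             ∎
          where open SetoidReasoning mat-setoid
        -- M h has the diagonal blocks of M, because h projects to 𝟙, and it vanishes outside Eq(A)
        -- and the free positions. Its free entries therefore determine it.
        patch-b : ∀ h Z → patch M (b h Z) ≋ M ⊡ mat h
        patch-b h Z i j with Dec.toSum (eq? i j) | Dec.toSum (free? i j)
        ... | inj₁ e | _ = begin
          patch M (b h Z) i j                                    ≈⟨ patch-Eq {M} {b h Z} e ⟩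
          M i j                                                  ≈⟨ diagonal-UL 𝔽 A φ {M} (pattern-π X) i j ⟨
          diagonal-part 𝔽 A φ M i j                              ≈⟨ ⊡-identityʳ (diagonal-part 𝔽 A φ M) i j ⟨
          (diagonal-part 𝔽 A φ M ⊡ 𝟙) i j                        ≈⟨ ⊡-cong (≋.refl {diagonal-part 𝔽 A φ M}) (diagonal-UR 𝔽 A φ {mat h} (pattern-π h)) i j ⟨
          (diagonal-part 𝔽 A φ M ⊡ diagonal-part 𝔽 A φ (mat h)) i j
            ≈⟨ diagonal-⊡ 𝔽 A φ {M} {mat h} M∈ (HasPattern-⊆ (UR-order A φ) (UP-order A φ) (UR⊆UP 𝔽 A φ) (pattern-π h)) i j ⟨
          diagonal-part 𝔽 A φ (M ⊡ mat h) i j                    ≈⟨ diagonal-Eq 𝔽 A φ (M ⊡ mat h) e ⟩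
          (M ⊡ mat h) i j                                        ∎
          where open SetoidReasoning 𝔽.setoid
        ... | inj₂ _  | inj₁ f = 𝔽.trans (patch-free {M} {b h Z} f) (choose-yes free? (M ⊡ mat h) Z f)
        ... | inj₂ ¬e | inj₂ ¬f = 𝔽.trans (patch-off {M} {b h Z} ¬e ¬f) (𝔽.sym (Pattern.vanishes (UP-order A φ)
            (Pattern.⊡-hasPattern (UP-order A φ) {M} {mat h} M∈ (HasPattern-⊆ (UR-order A φ) (UP-order A φ) (UR⊆UP 𝔽 A φ) (pattern-π h))) excluded))
          where
          excluded : ¬ (i , j) ∈ᴾ UP-order A φ
          excluded t with does⁻ (UP-dec A φ i j) t
          ... | _ , inj₁ e = ¬e e
          ... | u , inj₂ a = ¬f (u , a)
        a-involutive : ∀ h Z → N ⊡ patch M (b h Z) ≋ mat h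
        a-involutive h Z = begin
          N ⊡ patch M (b h Z)   ≈⟨ ⊡-cong (≋.refl {N}) (patch-b h Z) ⟩
          N ⊡ (M ⊡ mat h)       ≈⟨ ⊡-assoc N M (mat h) ⟨
          (N ⊡ M) ⊡ mat h       ≈⟨ ⊡-cong (UTElement.inverseˡ X) (≋.refl {mat h}) ⟩
          𝟙 ⊡ mat h             ≈⟨ ⊡-identityˡ (mat h) ⟩
          mat h                 ∎
          where open SetoidReasoning mat-setoid
        b-involutive : ∀ h Z → b (a h Z) (b h Z) ≋ Z
        b-involutive h Z i j = go (free? i j)
          where
          go : Dec (Free i j) → b (a h Z) (b h Z) i j ≈ Z i j
          go (yes f) = 𝔽.trans (choose-yes free? (M ⊡ mat (a h Z)) (b h Z) f)
            (𝔽.trans (X⊡a h Z i j) (patch-free {M} {Z} f))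
          go (no ¬f) = 𝔽.trans (choose-no free? (M ⊡ mat (a h Z)) (b h Z) ¬f) (choose-no free? (M ⊡ mat h) Z ¬f)
        f-cong : ∀ {h h′} → mat {π = UR-order A φ} h ≋ mat {π = UR-order A φ} h′ → f h ℂ.≈ f h′
        f-cong {h} {h′} e = value-cong ψ {fun ι X K.∙ fun κ h} {fun ι X K.∙ fun κ h′} (⊡-cong (≋.refl {M}) e)
        f-a : ∀ h Z → f (a h Z) ℂ.≈ g Z
        f-a h Z = value-cong ψ {fun ι X K.∙ fun κ (a h Z)} {patchᵁ X Z} (X⊡a h Z)
        transfer : E (FiniteGroup.finiteᴳ (UR 𝔽 A φ)) order-nonZero f ℂ.≈ 𝔼 I g
        transfer = E-transfer {FiniteGroup.setoid (UR 𝔽 A φ)} {mat-setoid} (FiniteGroup.finiteᴳ (UR 𝔽 A φ)) order-nonZero finite-matrices (matrices-nonZero I) a b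
          (λ {h} {h′} → a-cong {h} {h′}) (λ {h} {h′} → b-cong {h} {h′}) a-involutive b-involutive f f-cong g f-a
        step₁ : value (Def S ψ) X ℂ.≈ E (FiniteGroup.finiteᴳ (UR 𝔽 A φ)) order-nonZero (λ h → value ψ (FiniteGroup._∙_ (UP 𝔽 A φ) (fun ι X) (fun κ h)))
        step₁ = Def-E {UP 𝔽 A φ} {UL 𝔽 A φ} {UR 𝔽 A φ} S ψ X
        step₂ : value (Def S ψ) X ℂ.≈ E (FiniteGroup.finiteᴳ (UR 𝔽 A φ)) order-nonZero f
        step₂ = step₁
        final : value (Def S ψ) X ℂ.≈ 𝔼 I g
        final = ℂ.trans {value (Def S ψ) X} {E (FiniteGroup.finiteᴳ (UR 𝔽 A φ)) order-nonZero f} {𝔼 I g} step₂ transfer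

-- Vector spaces and tensor products

module _ (M : Mod) where

  open Mod M

  -- The laws for zero and the right-hand laws of addition follow by cancellation and commutativity.
  -- What remains is the list of relations imposed on `Tensor`.
  isVectorSpace : IsEquivalence _≈ᴹ_ →
    (∀ {x x′ y y′} → x ≈ᴹ x′ → y ≈ᴹ y′ → x +ᴹ y ≈ᴹ x′ +ᴹ y′) →
    (∀ {c d x y} → c ℂ.≈ d → x ≈ᴹ y → c *ₗ x ≈ᴹ d *ₗ y) →
    (∀ {x y} → x ≈ᴹ y → -ᴹ x ≈ᴹ -ᴹ y) →
    (∀ x y z → (x +ᴹ y) +ᴹ z ≈ᴹ x +ᴹ (y +ᴹ z)) →
    (∀ x y → x +ᴹ y ≈ᴹ y +ᴹ x) →
    (∀ x → 0ᴹ +ᴹ x ≈ᴹ x) →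
    (∀ x → (-ᴹ x) +ᴹ x ≈ᴹ 0ᴹ) →
    (∀ c x y → c *ₗ (x +ᴹ y) ≈ᴹ (c *ₗ x) +ᴹ (c *ₗ y)) →
    (∀ c d x → (c ℂ.+ d) *ₗ x ≈ᴹ (c *ₗ x) +ᴹ (d *ₗ x)) →
    (∀ c d x → (c ℂ.* d) *ₗ x ≈ᴹ c *ₗ (d *ₗ x)) →
    (∀ x → ℂ.1# *ₗ x ≈ᴹ x) →
    IsVectorSpace M
  isVectorSpace equiv +-cong *-cong neg-cong +-assoc +-comm +-identityˡ +-inverseˡ
                distribˡ distribʳ *-assoc *-identityˡ = record
    { isLeftSemimodule = record
      { +ᴹ-isCommutativeMonoid = record { isMonoid = Group.isMonoid group ; comm = +-comm }
      ; isPreleftSemimodule = record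
        { *ₗ-cong      = *-cong
        ; *ₗ-zeroˡ     = λ x → identityʳ-unique (ℂ.0# *ₗ x) (ℂ.0# *ₗ x)
            (trans (sym (distribʳ ℂ.0# ℂ.0# x)) (*-cong (ℂ.+-identityˡ ℂ.0#) refl′))
        ; *ₗ-distribʳ  = λ x c d → distribʳ c d x
        ; *ₗ-identityˡ = *-identityˡ
        ; *ₗ-assoc     = *-assoc
        ; *ₗ-zeroʳ     = λ c → identityʳ-unique (c *ₗ 0ᴹ) (c *ₗ 0ᴹ)
            (trans (sym (distribˡ c 0ᴹ 0ᴹ)) (*-cong ℂ.refl (+-identityˡ 0ᴹ)))
        ; *ₗ-distribˡ  = distribˡ
        }
      }
    ; -ᴹ‿cong    = neg-cong
    ; -ᴹ‿inverse = +-inverseˡ , inverseʳ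
    }
    where
    open IsEquivalence equiv using (sym; trans) renaming (refl to refl′)
    inverseʳ : ∀ x → x +ᴹ (-ᴹ x) ≈ᴹ 0ᴹ
    inverseʳ x = trans (+-comm x (-ᴹ x)) (+-inverseˡ x)
    group : Group 0ℓ 0ℓ
    group = record
      { Carrier = Carrierᴹ
      ; _≈_     = _≈ᴹ_
      ; isGroup = record
        { isMonoid = record
          { isSemigroup = record
            { isMagma = record { isEquivalence = equiv ; ∙-cong = +-cong }
            ; assoc   = +-assoc
            }
          ; identity = +-identityˡ , λ x → trans (+-comm x 0ᴹ) (+-identityˡ x)
          }
        ; inverse = +-inverseˡ , inverseʳ
        ; ⁻¹-cong = neg-cong
        }
      }
    open GroupProperties group using (identityʳ-unique)

module _ {M : Mod} (V : IsVectorSpace M) where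

  additive : CommutativeMonoid 0ℓ 0ℓ
  additive = record { isCommutativeMonoid = IsLeftModule.+ᴹ-isCommutativeMonoid V }

module _ {M N : Mod} (V : IsVectorSpace M) (W : IsVectorSpace N)
         (f : Mod.Carrierᴹ M → Mod.Carrierᴹ N) where

  private
    module M = Mod M
    module N = Mod N
    module V = IsLeftModule V
    module W = IsLeftModule W

  isLinear : (∀ {x y} → x M.≈ᴹ y → f x N.≈ᴹ f y) →
             (∀ x y → f (x M.+ᴹ y) N.≈ᴹ f x N.+ᴹ f y) →
             (∀ c x → f (c M.*ₗ x) N.≈ᴹ c N.*ₗ f x) → IsLinear M N f
  isLinear f-cong f-+ f-* = record
    { +ᴹ-isGroupHomomorphism = record
      { isMonoidHomomorphism = record
        { isMagmaHomomorphism = record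
          { isRelHomomorphism = record { cong = f-cong }
          ; homo              = f-+
          }
        ; ε-homo = f-0
        }
      ; ⁻¹-homo = λ x → W.uniqueˡ‿-ᴹ (f (M.-ᴹ x)) (f x)
          (W.≈ᴹ-trans (W.≈ᴹ-sym (f-+ (M.-ᴹ x) x)) (W.≈ᴹ-trans (f-cong (V.-ᴹ‿inverseˡ x)) f-0))
      }
    ; *ₗ-homo = f-*
    }
    where
    f-0 : f M.0ᴹ N.≈ᴹ N.0ᴹ
    f-0 = W.≈ᴹ-trans (f-cong (V.≈ᴹ-sym (V.*ₗ-zeroˡ M.0ᴹ)))
            (W.≈ᴹ-trans (f-* ℂ.0# M.0ᴹ) (W.*ₗ-zeroˡ (f M.0ᴹ)))

  module _ (L : IsLinear M N f) where

    private
      module L = LeftModuleMorphisms.IsLeftModuleHomomorphism L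
      module ∑M = FiniteSums (additive V)
      module ∑N = FiniteSums (additive W)

    linear-sum : ∀ {n} (g : Fin n → M.Carrierᴹ) → f (∑M.sum g) N.≈ᴹ ∑N.sum (f ∘ g)
    linear-sum {zero}  g = L.0ᴹ-homo
    linear-sum {suc n} g = W.≈ᴹ-trans (L.+ᴹ-homo (g zero) (∑M.sum (g ∘ suc)))
      (W.+ᴹ-congˡ (linear-sum (g ∘ suc)))

    linear-∑ : {S : Setoid 0ℓ 0ℓ} (F : Finite S) (g : Setoid.Carrier S → M.Carrierᴹ) →
               f (∑M.∑ F g) N.≈ᴹ ∑N.∑ F (f ∘ g)
    linear-∑ F g = linear-sum (g ∘ element F)

ℂ¹-isVectorSpace : IsVectorSpace ℂ¹
ℂ¹-isVectorSpace = LeftModule.isLeftModule (TensorUnit.leftModule {R = ℂ.ring})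

module _ {X : Set} (M : X → Mod) where

  ⨂-isVectorSpace : IsVectorSpace (⨂ M)
  ⨂-isVectorSpace = isVectorSpace (⨂ M) (record { refl = ∼-refl ; sym = ∼-sym ; trans = ∼-trans })
    ⊕-cong ·-cong ⊖-cong ⊕-assoc ⊕-comm ⊕-identityˡ ⊖-inverseˡ ·-distribˡ ·-distribʳ ·-assoc ·-identityˡ

  -- The conditions have the shape of `pure-+` and `pure-·`: a change in slot x is described by its
  -- effect on all slots, so that no family has to be updated and X needs no decidable equality.
  record Multilinear (N : Mod) (p : (∀ x → Mod.Carrierᴹ (M x)) → Mod.Carrierᴹ N) : Set where
    private module N = Mod N
    field
      cong : ∀ {m n} → (∀ x → Mod._≈ᴹ_ (M x) (m x) (n x)) → p m N.≈ᴹ p n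
      +-homo : ∀ x (m n q : ∀ x → Mod.Carrierᴹ (M x)) →
               Mod._≈ᴹ_ (M x) (q x) (Mod._+ᴹ_ (M x) (m x) (n x)) →
               (∀ y → ¬ y ≡ x → Mod._≈ᴹ_ (M y) (q y) (m y) × Mod._≈ᴹ_ (M y) (q y) (n y)) →
               p q N.≈ᴹ p m N.+ᴹ p n
      ·-homo : ∀ x c (m q : ∀ x → Mod.Carrierᴹ (M x)) →
               Mod._≈ᴹ_ (M x) (q x) (Mod._*ₗ_ (M x) c (m x)) →
               (∀ y → ¬ y ≡ x → Mod._≈ᴹ_ (M y) (q y) (m y)) →
               p q N.≈ᴹ c N.*ₗ p m

  module _ {N : Mod} (V : IsVectorSpace N) {p : (∀ x → Mod.Carrierᴹ (M x)) → Mod.Carrierᴹ N}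
           (P : Multilinear N p) where

    private
      module N = Mod N
      module V = IsLeftModule V
      module P = Multilinear P

    extend-cong : ∀ {t u} → _∼_ M t u → extend N p t N.≈ᴹ extend N p u
    extend-cong ∼-refl              = V.≈ᴹ-refl
    extend-cong (∼-sym e)           = V.≈ᴹ-sym (extend-cong e)
    extend-cong (∼-trans e e′)      = V.≈ᴹ-trans (extend-cong e) (extend-cong e′)
    extend-cong (⊕-cong e e′)       = V.+ᴹ-cong (extend-cong e) (extend-cong e′)
    extend-cong (·-cong c e)        = V.*ₗ-cong c (extend-cong e)
    extend-cong (⊖-cong e)          = V.-ᴹ‿cong (extend-cong e)
    extend-cong (⊕-assoc t u v)     = V.+ᴹ-assoc _ _ _
    extend-cong (⊕-comm t u)        = V.+ᴹ-comm _ _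
    extend-cong (⊕-identityˡ t)     = V.+ᴹ-identityˡ _
    extend-cong (⊖-inverseˡ t)      = V.-ᴹ‿inverseˡ _
    extend-cong (·-distribˡ c t u)  = V.*ₗ-distribˡ c _ _
    extend-cong (·-distribʳ c d t)  = V.*ₗ-distribʳ _ c d
    extend-cong (·-assoc c d t)     = V.*ₗ-assoc c d _
    extend-cong (·-identityˡ t)     = V.*ₗ-identityˡ _
    extend-cong (pure-cong e)       = P.cong e
    extend-cong (pure-+ x m n q e f) = P.+-homo x m n q e f
    extend-cong (pure-· x c m q e f) = P.·-homo x c m q e f

    extend-linear : IsLinear (⨂ M) N (extend N p)
    extend-linear = isLinear ⨂-isVectorSpace V (extend N p) extend-cong
      (λ _ _ → V.≈ᴹ-refl) (λ _ _ → V.≈ᴹ-refl)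

  -- Linear for the syntactic operations; ∼ need not be respected.
  record IsFunctional (ℓ : Tensor M → ℂ.Carrier) : Set where
    field
      ⊕-homo : ∀ t u → ℓ (t ⊕ u) ℂ.≈ ℓ t ℂ.+ ℓ u
      ·-homo : ∀ c t → ℓ (c · t) ℂ.≈ c ℂ.* ℓ t
      ⊖-homo : ∀ t → ℓ (⊖ t) ℂ.≈ ℂ.- ℓ t
      𝟘-homo : ℓ 𝟘 ℂ.≈ ℂ.0#

  module _ {ℓ ℓ′ : Tensor M → ℂ.Carrier} (L : IsFunctional ℓ) (L′ : IsFunctional ℓ′) where

    private
      module L = IsFunctional L
      module L′ = IsFunctional L′

    -- Induction on terms, without recourse to the relations. Values of composites of `merge`,
    -- `split` and `β` can therefore be computed on pure tensors before anything is known about how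
    -- these maps treat `_∼_`.
    agree : (∀ m → ℓ (pure m) ℂ.≈ ℓ′ (pure m)) → ∀ t → ℓ t ℂ.≈ ℓ′ t
    agree eq (pure m) = eq m
    agree eq (t ⊕ u)  = ℂ.trans (L.⊕-homo t u) (ℂ.trans (ℂ.+-cong (agree eq t) (agree eq u)) (ℂ.sym (L′.⊕-homo t u)))
    agree eq (c · t)  = ℂ.trans (L.·-homo c t) (ℂ.trans (ℂ.*-congˡ (agree eq t)) (ℂ.sym (L′.·-homo c t)))
    agree eq (⊖ t)    = ℂ.trans (L.⊖-homo t) (ℂ.trans (ℂ.-‿cong (agree eq t)) (ℂ.sym (L′.⊖-homo t)))
    agree eq 𝟘        = ℂ.trans L.𝟘-homo (ℂ.sym L′.𝟘-homo)

  extend-functional : (p : (∀ x → Mod.Carrierᴹ (M x)) → ℂ.Carrier) → IsFunctional (extend ℂ¹ p)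
  extend-functional p = record
    { ⊕-homo = λ _ _ → ℂ.refl ; ·-homo = λ _ _ → ℂ.refl ; ⊖-homo = λ _ → ℂ.refl ; 𝟘-homo = ℂ.refl }

  open RingProperties ℂ.ring using (-‿distribʳ-*; -‿distribˡ-*)
  open CommutativeSemigroupProperties ℂ.*-commutativeSemigroup using (x∙yz≈y∙xz)

  *-functional : ∀ c {ℓ} → IsFunctional ℓ → IsFunctional (λ t → c ℂ.* ℓ t)
  *-functional c {ℓ} L = record
    { ⊕-homo = λ t u → ℂ.trans (ℂ.*-congˡ (L.⊕-homo t u)) (ℂ.distribˡ c (ℓ t) (ℓ u))
    ; ·-homo = λ d t → ℂ.trans (ℂ.*-congˡ (L.·-homo d t)) (x∙yz≈y∙xz c d (ℓ t))
    ; ⊖-homo = λ t → ℂ.trans (ℂ.*-congˡ (L.⊖-homo t)) (ℂ.sym (-‿distribʳ-* c (ℓ t)))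
    ; 𝟘-homo = ℂ.trans (ℂ.*-congˡ L.𝟘-homo) (ℂ.zeroʳ c)
    }
    where module L = IsFunctional L

  *ʳ-functional : ∀ c {ℓ} → IsFunctional ℓ → IsFunctional (λ t → ℓ t ℂ.* c)
  *ʳ-functional c {ℓ} L = record
    { ⊕-homo = λ t u → ℂ.trans (ℂ.*-congʳ (L.⊕-homo t u)) (ℂ.distribʳ c (ℓ t) (ℓ u))
    ; ·-homo = λ d t → ℂ.trans (ℂ.*-congʳ (L.·-homo d t)) (ℂ.*-assoc d (ℓ t) c)
    ; ⊖-homo = λ t → ℂ.trans (ℂ.*-congʳ (L.⊖-homo t)) (ℂ.sym (-‿distribˡ-* (ℓ t) c))
    ; 𝟘-homo = ℂ.trans (ℂ.*-congʳ L.𝟘-homo) (ℂ.zeroˡ c)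
    }
    where module L = IsFunctional L

  sum-functional : ∀ {n} (ℓ : Fin n → Tensor M → ℂ.Carrier) → (∀ k → IsFunctional (ℓ k)) →
                   IsFunctional (λ t → ℂ∑.sum (λ k → ℓ k t))
  sum-functional ℓ L = record
    { ⊕-homo = λ t u → ℂ.trans (ℂ∑.sum-cong-≋ λ k → IsFunctional.⊕-homo (L k) t u)
                         (ℂ∑.∑-distrib-+ (λ k → ℓ k t) (λ k → ℓ k u))
    ; ·-homo = λ c t → ℂ.trans (ℂ∑.sum-cong-≋ λ k → IsFunctional.·-homo (L k) c t)
                         (ℂ.sym (ℂΣ.*-distribˡ-sum c (λ k → ℓ k t)))
    ; ⊖-homo = λ t → ℂ.trans (ℂ∑.sum-cong-≋ λ k → ℂ.trans (IsFunctional.⊖-homo (L k) t) (ℂ.sym (-1*x≈-x (ℓ k t))))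
                         (ℂ.trans (ℂ.sym (ℂΣ.*-distribˡ-sum (ℂ.- ℂ.1#) (λ k → ℓ k t))) (-1*x≈-x _))
    ; 𝟘-homo = ℂ∑.sum-zero λ k → IsFunctional.𝟘-homo (L k)
    }
    where open RingProperties ℂ.ring using (-1*x≈-x)

  ∑-functional : {S : Setoid 0ℓ 0ℓ} (F : Finite S) (ℓ : Setoid.Carrier S → Tensor M → ℂ.Carrier) →
                 (∀ x → IsFunctional (ℓ x)) → IsFunctional (λ t → ℂ∑.∑ F (λ x → ℓ x t))
  ∑-functional F ℓ L = sum-functional (ℓ ∘ element F) (L ∘ element F)

  E-functional : {S : Setoid 0ℓ 0ℓ} (F : Finite S) .(nz : ℕ.NonZero (size F))
                 (ℓ : Setoid.Carrier S → Tensor M → ℂ.Carrier) →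
                 (∀ x → IsFunctional (ℓ x)) → IsFunctional (λ t → E F nz (λ x → ℓ x t))
  E-functional F nz ℓ L = *-functional (1/_ (size F) {{nz}}) (∑-functional F ℓ L)

  when-functional : {P : Set} (d : Dec P) {ℓ : Tensor M → ℂ.Carrier} → IsFunctional ℓ →
                    IsFunctional (λ t → ℂ∑.when d (ℓ t))
  when-functional (yes _) L = L
  when-functional (no _)  L = record
    { ⊕-homo = λ _ _ → ℂ.sym (ℂ.+-identityˡ ℂ.0#)
    ; ·-homo = λ c _ → ℂ.sym (ℂ.zeroʳ c)
    ; ⊖-homo = λ _ → ℂ.sym -0#≈0#
    ; 𝟘-homo = ℂ.refl
    }
    where open RingProperties ℂ.ring using (-0#≈0#)

extend-∘-functional : {X Y : Set} {M : X → Mod} {N : Y → Mod} {ℓ : Tensor N → ℂ.Carrier} → IsFunctional N ℓ →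
                      (p : (∀ x → Mod.Carrierᴹ (M x)) → Tensor N) → IsFunctional M (ℓ ∘ extend (⨂ N) p)
extend-∘-functional L p = record
  { ⊕-homo = λ t u → L.⊕-homo _ _
  ; ·-homo = λ c t → L.·-homo c _
  ; ⊖-homo = λ t → L.⊖-homo _
  ; 𝟘-homo = L.𝟘-homo
  }
  where module L = IsFunctional L

-- Products of functionals and expansion of pure tensors

∏-remove : ∀ {n} (f : Fin (suc n) → ℂ.Carrier) r → ∏ f ℂ.≈ f r ℂ.* ∏ (removeAt f r)
∏-remove f r = Sum.sum-remove ℂ.*-commutativeMonoid {i = r} f

module _ {n} (M : Fin n → Mod) (g : ∀ r → Mod.Carrierᴹ (M r) → ℂ.Carrier)
         (L : ∀ r → IsLinear (M r) ℂ¹ (g r)) where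

  private
    module L r = LeftModuleMorphisms.IsLeftModuleHomomorphism (L r)

  ∏-multilinear : Multilinear M ℂ¹ (λ m → ∏ (λ r → g r (m r)))
  ∏-multilinear = record
    { cong   = λ e → ∏-cong λ r → L.⟦⟧-cong r (e r)
    ; +-homo = λ r m m′ q e f → at-slot r (λ r → g r (q r)) (λ r → g r (m r)) (λ r → g r (m′ r))
        (ℂ.trans (L.⟦⟧-cong r e) (L.+ᴹ-homo r (m r) (m′ r)))
        (λ s s≢r → L.⟦⟧-cong s (proj₁ (f s s≢r)) , L.⟦⟧-cong s (proj₂ (f s s≢r)))
    ; ·-homo = λ r c m q e f → scaled r c (λ r → g r (q r)) (λ r → g r (m r))
        (ℂ.trans (L.⟦⟧-cong r e) (L.*ₗ-homo r c (m r)))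
        (λ s s≢r → L.⟦⟧-cong s (f s s≢r))
    }
    where
    at-slot : ∀ {n} (r : Fin n) (a b c : Fin n → ℂ.Carrier) → a r ℂ.≈ b r ℂ.+ c r →
              (∀ s → ¬ s ≡ r → a s ℂ.≈ b s × a s ℂ.≈ c s) → ∏ a ℂ.≈ ∏ b ℂ.+ ∏ c
    at-slot {suc n} r a b c e f = begin
      ∏ a                                                     ≈⟨ ∏-remove a r ⟩
      a r ℂ.* ∏ a′                                            ≈⟨ ℂ.*-congʳ e ⟩
      (b r ℂ.+ c r) ℂ.* ∏ a′                                  ≈⟨ ℂ.distribʳ (∏ a′) (b r) (c r) ⟩
      b r ℂ.* ∏ a′ ℂ.+ c r ℂ.* ∏ a′
        ≈⟨ ℂ.+-cong (ℂ.*-congˡ (∏-cong λ s → proj₁ (f _ (Fin.punchInᵢ≢i r s))))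
                    (ℂ.*-congˡ (∏-cong λ s → proj₂ (f _ (Fin.punchInᵢ≢i r s)))) ⟩
      b r ℂ.* ∏ (removeAt b r) ℂ.+ c r ℂ.* ∏ (removeAt c r)   ≈⟨ ℂ.+-cong (∏-remove b r) (∏-remove c r) ⟨
      ∏ b ℂ.+ ∏ c                                             ∎
      where
      open SetoidReasoning ℂ.setoid
      a′ = removeAt a r
    scaled : ∀ {n} (r : Fin n) c (a b : Fin n → ℂ.Carrier) → a r ℂ.≈ c ℂ.* b r →
             (∀ s → ¬ s ≡ r → a s ℂ.≈ b s) → ∏ a ℂ.≈ c ℂ.* ∏ b
    scaled {suc n} r c a b e f = begin
      ∏ a                                 ≈⟨ ∏-remove a r ⟩
      a r ℂ.* ∏ (removeAt a r)            ≈⟨ ℂ.*-cong e (∏-cong λ s → f _ (Fin.punchInᵢ≢i r s)) ⟩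
      c ℂ.* b r ℂ.* ∏ (removeAt b r)      ≈⟨ ℂ.*-assoc c (b r) _ ⟩
      c ℂ.* (b r ℂ.* ∏ (removeAt b r))    ≈⟨ ℂ.*-congˡ (∏-remove b r) ⟨
      c ℂ.* ∏ b                           ∎
      where open SetoidReasoning ℂ.setoid

-- `join` is a nested linear extension, so `agree` in each argument reduces this to pure tensors,
-- where the product over all rows splits off its first row by computation.
extend-join : ∀ {n} {S : Fin (suc n) → Set} (M : ∀ r → S r → Mod) (p : ∀ r → (∀ s → Mod.Carrierᴹ (M r s)) → ℂ.Carrier)
              (t : Tensor (M zero)) (u : Tensor (Flat (λ r → M (suc r)))) →
              extend ℂ¹ (λ m → ∏ (λ r → p r (λ s → m (r , s)))) (join M t u) ℂ.≈
              extend ℂ¹ (p zero) t ℂ.* extend ℂ¹ (λ m → ∏ (λ r → p (suc r) (λ s → m (r , s)))) u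
extend-join M p t u = agree (M zero)
  (extend-∘-functional (extend-functional (Flat M) (λ m → ∏ (λ r → p r (λ s → m (r , s))))) _)
  (*ʳ-functional (M zero) (extend ℂ¹ (λ m → ∏ (λ r → p (suc r) (λ s → m (r , s)))) u) (extend-functional (M zero) (p zero)))
  (λ m → agree (Flat (λ r → M (suc r)))
    (extend-∘-functional (extend-functional (Flat M) (λ m → ∏ (λ r → p r (λ s → m (r , s))))) _)
    (*-functional (Flat (λ r → M (suc r))) (p zero m) (extend-functional _ (λ m → ∏ (λ r → p (suc r) (λ s → m (r , s))))))
    (λ _ → ℂ.refl) u)
  t

extend-flatten : ∀ {n} {S : Fin n → Set} (M : ∀ r → S r → Mod) (p : ∀ r → (∀ s → Mod.Carrierᴹ (M r s)) → ℂ.Carrier)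
                 (t : ∀ r → Tensor (M r)) →
                 extend ℂ¹ (λ m → ∏ (λ r → p r (λ s → m (r , s)))) (flattenPure M t) ℂ.≈
                 ∏ (λ r → extend ℂ¹ (p r) (t r))
extend-flatten {zero}  M p t = ℂ.refl
extend-flatten {suc n} M p t = ℂ.trans
  (extend-join M p (t zero) (flattenPure (λ r → M (suc r)) (λ r → t (suc r))))
  (ℂ.*-congˡ (extend-flatten (λ r → M (suc r)) (λ r → p (suc r)) (λ r → t (suc r))))

-- Multilinearity, by induction on the number of factors: the tail is expanded behind a fixed first
-- factor, then the first factor in each resulting term, and the two sums are exchanged. The e's
-- will be indicators of conjugacy classes and the c's values of class functions.
pure-expand : ∀ {n} (M : Fin n → Mod) (V : ∀ r → IsVectorSpace (M r))
  {S : Fin n → Setoid 0ℓ 0ℓ} (F : ∀ r → Finite (S r))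
  (e : ∀ r → Setoid.Carrier (S r) → Mod.Carrierᴹ (M r))
  (e-cong : ∀ r {k l} → Setoid._≈_ (S r) k l → Mod._≈ᴹ_ (M r) (e r k) (e r l))
  (c : ∀ r → Setoid.Carrier (S r) → ℂ.Carrier)
  (c-cong : ∀ r {k l} → Setoid._≈_ (S r) k l → c r k ℂ.≈ c r l)
  (m : ∀ r → Mod.Carrierᴹ (M r)) →
  (∀ r → Mod._≈ᴹ_ (M r) (m r) (FiniteSums.∑ (additive (V r)) (F r) (λ k → Mod._*ₗ_ (M r) (c r k) (e r k)))) →
  _∼_ M (pure m) (FiniteSums.∑ (additive (⨂-isVectorSpace M)) (finite-Π F)
                    (λ κ → ∏ (λ r → c r (κ r)) · pure (λ r → e r (κ r))))
pure-expand {zero} M V F e e-cong c c-cong m eq = ∼-sym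
  (∼-trans (⊕-comm _ _) (∼-trans (⊕-identityˡ _) (∼-trans (·-identityˡ _) (pure-cong λ ()))))
pure-expand {suc n} M V {S} F e e-cong c c-cong m eq = begin
  pure m
    ≈⟨ pure-cong (λ { zero → V.≈ᴹ-refl zero ; (suc r) → V.≈ᴹ-refl (suc r) }) ⟩
  cons (m zero) (pure (m ∘ suc))
    ≈⟨ extend-cong M′ (⨂-isVectorSpace M) (cons-multilinear (m zero))
         (pure-expand M′ (V ∘ suc) (F ∘ suc) (λ r → e (suc r)) (λ r → e-cong (suc r)) (λ r → c (suc r)) (λ r → c-cong (suc r))
           (m ∘ suc) (eq ∘ suc)) ⟩
  cons (m zero) (∑T′.∑ F′ (λ κ → c′ κ · pure (λ r → e (suc r) (κ r))))
    ≈⟨ linear-∑ (⨂-isVectorSpace M′) (⨂-isVectorSpace M) (cons (m zero))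
         (extend-linear M′ (⨂-isVectorSpace M) (cons-multilinear (m zero))) F′ (λ κ → c′ κ · pure (λ r → e (suc r) (κ r))) ⟩
  ∑T.∑ F′ (λ κ → c′ κ · pure (m zero ∷ᵈ λ r → e (suc r) (κ r)))
    ≈⟨ ∑T.∑-cong F′ (λ κ → ·-cong (ℂ.refl {c′ κ}) (head-expand κ)) ⟩
  ∑T.∑ F′ (λ κ → c′ κ · ∑T.∑ (F zero) (λ k → c zero k · pure (e zero k ∷ᵈ λ r → e (suc r) (κ r))))
    ≈⟨ ∑T.∑-cong F′ (λ κ → ∼-trans
         (linear-∑ (⨂-isVectorSpace M) (⨂-isVectorSpace M) (c′ κ ·_) (scale-linear (c′ κ)) (F zero)
           (λ k → c zero k · pure (e zero k ∷ᵈ λ r → e (suc r) (κ r))))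
         (∑T.∑-cong (F zero) λ k → regroup k κ)) ⟩
  ∑T.∑ F′ (λ κ → ∑T.∑ (F zero) (λ k → g (k ∷ᵈ κ)))
    ≈⟨ ∑T.∑-swap F′ (F zero) (λ κ k → g (k ∷ᵈ κ)) ⟩
  ∑T.∑ (F zero) (λ k → ∑T.∑ F′ (λ κ → g (k ∷ᵈ κ)))
    ≈⟨ ∑T.∑-Π F g (λ κ≈ → ·-cong (∏-cong λ r → c-cong r (κ≈ r)) (pure-cong λ r → e-cong r (κ≈ r))) ⟨
  ∑T.∑ (finite-Π F) g ∎
  where
  M′ = λ r → M (suc r)
  F′ = finite-Π (F ∘ suc)
  module V r = IsLeftModule (V r)
  module ∑T = FiniteSums (additive (⨂-isVectorSpace M))
  module ∑T′ = FiniteSums (additive (⨂-isVectorSpace M′))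
  module ∑M = FiniteSums (additive (V zero))
  open SetoidReasoning (CommutativeMonoid.setoid (additive (⨂-isVectorSpace M)))
  c′ : (∀ r → Setoid.Carrier (S (suc r))) → ℂ.Carrier
  c′ κ = ∏ (λ r → c (suc r) (κ r))
  g : (∀ r → Setoid.Carrier (S r)) → Tensor M
  g κ = ∏ (λ r → c r (κ r)) · pure (λ r → e r (κ r))
  cons : Mod.Carrierᴹ (M zero) → Tensor M′ → Tensor M
  cons x = extend (⨂ M) (λ m → pure (x ∷ᵈ m))
  refl∷ : ∀ x {m n} → (∀ r → Mod._≈ᴹ_ (M′ r) (m r) (n r)) → ∀ r → Mod._≈ᴹ_ (M r) (_∷ᵈ_ {P = λ r → Mod.Carrierᴹ (M r)} x m r) (_∷ᵈ_ {P = λ r → Mod.Carrierᴹ (M r)} x n r)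
  refl∷ x e zero    = V.≈ᴹ-refl zero
  refl∷ x e (suc r) = e r
  cons-multilinear : ∀ x → Multilinear M′ (⨂ M) (λ m → pure (x ∷ᵈ m))
  cons-multilinear x = record
    { cong   = λ {m} {n} e → pure-cong (refl∷ x {m} {n} e)
    ; +-homo = λ r m n q e f → pure-+ (suc r) (x ∷ᵈ m) (x ∷ᵈ n) (x ∷ᵈ q) e
        λ { zero _ → V.≈ᴹ-refl zero , V.≈ᴹ-refl zero ; (suc s) s≢r → f s (s≢r ∘ ≡.cong suc) }
    ; ·-homo = λ r c m q e f → pure-· (suc r) c (x ∷ᵈ m) (x ∷ᵈ q) e
        λ { zero _ → V.≈ᴹ-refl zero ; (suc s) s≢r → f s (s≢r ∘ ≡.cong suc) }
    }
  slot-linear : ∀ m → IsLinear (M zero) (⨂ M) (λ x → pure (x ∷ᵈ m))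
  slot-linear m = isLinear (V zero) (⨂-isVectorSpace M) (λ x → pure (x ∷ᵈ m))
    (λ e → pure-cong λ { zero → e ; (suc r) → V.≈ᴹ-refl (suc r) })
    (λ x y → pure-+ zero _ _ _ (V.≈ᴹ-refl zero)
      λ { zero 0≢0 → ⊥-elim (0≢0 refl) ; (suc s) _ → V.≈ᴹ-refl (suc s) , V.≈ᴹ-refl (suc s) })
    (λ c x → pure-· zero c _ _ (V.≈ᴹ-refl zero)
      λ { zero 0≢0 → ⊥-elim (0≢0 refl) ; (suc s) _ → V.≈ᴹ-refl (suc s) })
  scale-linear : ∀ c → IsLinear (⨂ M) (⨂ M) (c ·_)
  scale-linear c = isLinear (⨂-isVectorSpace M) (⨂-isVectorSpace M) (c ·_) (·-cong ℂ.refl) (·-distribˡ c)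
    (λ d t → ∼-trans (∼-sym (·-assoc c d t)) (∼-trans (·-cong (ℂ.*-comm c d) ∼-refl) (·-assoc d c t)))
  head-expand : ∀ κ → _∼_ M (pure (m zero ∷ᵈ λ r → e (suc r) (κ r)))
                  (∑T.∑ (F zero) (λ k → c zero k · pure (e zero k ∷ᵈ λ r → e (suc r) (κ r))))
  head-expand κ = begin
    h (m zero)                                                        ≈⟨ H.⟦⟧-cong (eq zero) ⟩
    h (∑M.∑ (F zero) (λ k → Mod._*ₗ_ (M zero) (c zero k) (e zero k)))
      ≈⟨ linear-∑ (V zero) (⨂-isVectorSpace M) h (slot-linear _) (F zero) (λ k → Mod._*ₗ_ (M zero) (c zero k) (e zero k)) ⟩
    ∑T.∑ (F zero) (λ k → h (Mod._*ₗ_ (M zero) (c zero k) (e zero k)))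
      ≈⟨ ∑T.∑-cong (F zero) (λ k → H.*ₗ-homo (c zero k) (e zero k)) ⟩
    ∑T.∑ (F zero) (λ k → c zero k · h (e zero k))                     ∎
    where
    h : Mod.Carrierᴹ (M zero) → Tensor M
    h x = pure (x ∷ᵈ λ r → e (suc r) (κ r))
    h-linear : IsLinear (M zero) (⨂ M) h
    h-linear = slot-linear (λ r → e (suc r) (κ r))
    module H = LeftModuleMorphisms.IsLeftModuleHomomorphism {M₁ = M zero} {M₂ = ⨂ M} h-linear
  regroup : ∀ k κ → _∼_ M (c′ κ · (c zero k · pure (e zero k ∷ᵈ λ r → e (suc r) (κ r)))) (g (k ∷ᵈ κ))
  regroup k κ = ∼-trans (∼-sym (·-assoc _ _ _))
    (·-cong (ℂ.*-comm (c′ κ) (c zero k)) (pure-cong λ { zero → V.≈ᴹ-refl zero ; (suc r) → V.≈ᴹ-refl (suc r) }))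

-- The vector species cf

≈ᵀ-refl : {I : FinSet} {τ : TotalOrder I} → τ ≈ᵀ τ
≈ᵀ-refl i j = refl

≈ᵀ-sym : {I : FinSet} {τ τ′ : TotalOrder I} → τ ≈ᵀ τ′ → τ′ ≈ᵀ τ
≈ᵀ-sym p i j = ≡.sym (p i j)

≈ᵀ-trans : {I : FinSet} {τ τ′ τ″ : TotalOrder I} → τ ≈ᵀ τ′ → τ′ ≈ᵀ τ″ → τ ≈ᵀ τ″
≈ᵀ-trans p r i j = ≡.trans (p i j) (r i j)

module _ {q : ℕ} (𝔽 : FiniteField q) where

  open PatternGroups 𝔽
  open Matrices using (Mat)
  open UTElement using (mat; pattern-π)
  private module 𝔽 = FiniteField 𝔽

  DirectSum-isVectorSpace : {I : FinSet} (Ω : Setoid 0ℓ 0ℓ) (π : Setoid.Carrier Ω → PartialOrder I) →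
                            IsVectorSpace (DirectSum 𝔽 Ω π)
  DirectSum-isVectorSpace Ω π = isVectorSpace (DirectSum 𝔽 Ω π)
    (record { refl = λ ω X → ℂ.refl ; sym = λ e ω X → ℂ.sym (e ω X) ; trans = λ e e′ ω X → ℂ.trans (e ω X) (e′ ω X) })
    (λ e e′ ω X → ℂ.+-cong (e ω X) (e′ ω X))
    (λ c e ω X → ℂ.*-cong c (e ω X))
    (λ e ω X → ℂ.-‿cong (e ω X))
    (λ f g h ω X → ℂ.+-assoc _ _ _)
    (λ f g ω X → ℂ.+-comm _ _)
    (λ f ω X → ℂ.+-identityˡ _)
    (λ f ω X → ℂ.-‿inverseˡ _)
    (λ c f g ω X → ℂ.distribˡ c _ _)
    (λ c d f ω X → ℂ.distribʳ _ c d)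
    (λ c d f ω X → ℂ.*-assoc c d _)
    (λ f ω X → ℂ.*-identityˡ _)

  cf-isVectorSpace : ∀ I → IsVectorSpace (obj (cf 𝔽) I)
  cf-isVectorSpace I = DirectSum-isVectorSpace (total-orders I) toPartial

  ClassFunctions : FinSet → Set
  ClassFunctions I = Mod.Carrierᴹ (obj (cf 𝔽) I)

  cf-map : {I J : FinSet} → I ≃ J → ClassFunctions I → ClassFunctions J
  cf-map = RawSpecies.map (cf 𝔽)

  cf-map-linear : {I J : FinSet} (σ : I ≃ J) → IsLinear (obj (cf 𝔽) I) (obj (cf 𝔽) J) (cf-map σ)
  cf-map-linear {I} {J} σ = isLinear (cf-isVectorSpace I) (cf-isVectorSpace J) (cf-map σ)
    (λ e τ X → e (transportᵀ (sym-≃ σ) τ) (fun (relabelling 𝔽 (sym-≃ σ) τ) X)) (λ f g τ X → ℂ.refl) (λ c f τ X → ℂ.refl)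

  cf-map-cong : {I J : FinSet} {σ σ′ : I ≃ J} → (∀ i → to σ i ≡ to σ′ i) → ∀ f →
                Mod._≈ᴹ_ (obj (cf 𝔽) J) (cf-map σ f) (cf-map σ′ f)
  cf-map-cong {σ = σ} {σ′} e f τ X = component-cong f (λ i j → ≡.cong₂ (TotalOrder.rel τ) (e i) (e j))
    (fun (relabelling 𝔽 (sym-≃ σ) τ) X) (fun (relabelling 𝔽 (sym-≃ σ′) τ) X)
    (λ i j → 𝔽.reflexive (≡.cong₂ (mat X) (e i) (e j)))

  cf-map-id : {I : FinSet} → ∀ f → Mod._≈ᴹ_ (obj (cf 𝔽) I) (cf-map id-≃ f) f
  cf-map-id {I} f τ X = component-cong f (λ i j → refl) (fun (relabelling 𝔽 (sym-≃ (id-≃ {I})) τ) X) X (λ i j → 𝔽.refl)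

  cf-map-∘ : {I J K : FinSet} (σ : J ≃ K) (ρ : I ≃ J) → ∀ f →
             Mod._≈ᴹ_ (obj (cf 𝔽) K) (cf-map (σ ∘-≃ ρ) f) (cf-map σ (cf-map ρ f))
  cf-map-∘ σ ρ f τ X = component-cong f (λ i j → refl) (fun (relabelling 𝔽 (sym-≃ (σ ∘-≃ ρ)) τ) X)
    (fun (relabelling 𝔽 (sym-≃ ρ) (transportᵀ (sym-≃ σ) τ)) (fun (relabelling 𝔽 (sym-≃ σ) τ) X)) (λ i j → 𝔽.refl)

  -- On the empty set all orders are equal and all matrices are equal, so an element is determined
  -- by a single value.
  cf-connected : IsConnected (cf 𝔽)
  cf-connected I empty = record
    { fun = constant
    ; isLeftModuleIsomorphism = record
      { isLeftModuleMonomorphism = record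
        { isLeftModuleHomomorphism = isLinear ℂ¹-isVectorSpace (cf-isVectorSpace I) constant
            (λ e τ X → e) (λ c d τ X → ℂ.refl) (λ c d τ X → ℂ.refl)
        ; injective = λ e → e discrete 𝟙
        }
      ; surjective = λ f → value (component f discrete) 𝟙 , λ e τ X →
          ℂ.trans e (component-cong f (λ i → ⊥-elim (empty i)) 𝟙 X (λ i → ⊥-elim (empty i)))
      }
    }
    where
    constant : ℂ.Carrier → ClassFunctions I
    constant c = record
      { component      = λ τ → record { value = λ _ → c ; cong = λ _ → ℂ.refl ; invariant = λ _ _ → ℂ.refl }
      ; component-cong = λ _ _ _ _ → ℂ.refl
      }
    discrete : TotalOrder I
    discrete = record
      { rel = λ _ _ → true
      ; isTotalOrder = record
        { isPartialOrder = record
          { isPreorder = record { isEquivalence = ≡.isEquivalence ; reflexive = λ _ → tt ; trans = λ _ _ → tt }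
          ; antisym    = λ {i} _ _ → ⊥-elim (empty i)
          }
        ; total = λ i → ⊥-elim (empty i)
        }
      }
    𝟙 : UTElement (toPartial discrete)
    𝟙 = FiniteGroup.ε (UT (toPartial discrete))

  module _ {I : FinSet} where

    open Matrices I using (_≋_; module ≋)

    HasPattern-resp : (π ρ : PartialOrder I) → π ⊆ᴾ ρ → ∀ X Y → X ≋ Y → HasPattern π X → HasPattern ρ Y
    HasPattern-resp π ρ π⊆ρ X Y X≋Y X∈ = Pattern.hasPattern-cong ρ {X} {Y} X≋Y (HasPattern-⊆ 𝔽 π ρ π⊆ρ {X} X∈)

    ≈ᵀ⇒⊆ᴾ : {τ τ′ : TotalOrder I} → τ ≈ᵀ τ′ → toPartial τ ⊆ᴾ toPartial τ′
    ≈ᵀ⇒⊆ᴾ e i j = ≡.subst (λ b → Data.Bool.Base.T b) (e i j)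
      where import Data.Bool.Base

    private

      ev-at : ClassFunctions I → (τ : TotalOrder I) (X : Mat I) → Dec (HasPattern (toPartial τ) X) → ℂ.Carrier
      ev-at f τ X (yes X∈) = value (component f τ) (fromPattern 𝔽 (toPartial τ) X X∈)
      ev-at f τ X (no _)   = ℂ.0#

    opaque

      -- 0 if X ∉ UT(τ)
      ev : ClassFunctions I → TotalOrder I → Mat I → ℂ.Carrier
      ev f τ X = ev-at f τ X (Pattern.hasPattern? (toPartial τ) X)

      ev-value : ∀ f {τ X} (g : UTElement (toPartial τ)) → mat {π = toPartial τ} g ≋ X → ev f τ X ℂ.≈ value (component f τ) g
      ev-value f {τ} {X} g e = go (Pattern.hasPattern? (toPartial τ) X)
        where
        go : ∀ d → ev-at f τ X d ℂ.≈ value (component f τ) g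
        go (yes X∈) = value-cong (component f τ) {fromPattern 𝔽 (toPartial τ) X X∈} {g} (≋.sym {mat {π = toPartial τ} g} {X} e)
        go (no X∉)  = ⊥-elim (X∉ (Pattern.hasPattern-cong (toPartial τ) {mat {π = toPartial τ} g} {X} e (pattern-π {π = toPartial τ} g)))

      ev-0 : ∀ f τ X → ¬ HasPattern (toPartial τ) X → ev f τ X ℂ.≈ ℂ.0#
      ev-0 f τ X X∉ = go (Pattern.hasPattern? (toPartial τ) X)
        where
        go : ∀ d → ev-at f τ X d ℂ.≈ ℂ.0#
        go (yes X∈) = ⊥-elim (X∉ X∈)
        go (no _)   = ℂ.refl

      pattern? : (τ : TotalOrder I) (X : Mat I) → Dec (HasPattern (toPartial τ) X)
      pattern? τ X = Pattern.hasPattern? (toPartial τ) X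

    ev-fromPattern : ∀ f τ X (X∈ : HasPattern (toPartial τ) X) →
                     ev f τ X ℂ.≈ value (component f τ) (fromPattern 𝔽 (toPartial τ) X X∈)
    ev-fromPattern f τ X X∈ = ev-value f {τ} {X} (fromPattern 𝔽 (toPartial τ) X X∈) (≋.refl {X})

    ev-cong : ∀ f {τ τ′ X X′} → τ ≈ᵀ τ′ → X ≋ X′ → ev f τ X ℂ.≈ ev f τ′ X′
    ev-cong f {τ} {τ′} {X} {X′} τ≈τ′ X≋X′ with pattern? τ X | pattern? τ′ X′
    ... | yes p | yes r = ℂ.trans (ev-fromPattern f τ X p) (ℂ.trans
      (component-cong f τ≈τ′ (fromPattern 𝔽 (toPartial τ) X p) (fromPattern 𝔽 (toPartial τ′) X′ r) X≋X′)
      (ℂ.sym (ev-fromPattern f τ′ X′ r)))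
    ... | yes p | no ¬r = ⊥-elim (¬r (HasPattern-resp (toPartial τ) (toPartial τ′) (≈ᵀ⇒⊆ᴾ {τ} {τ′} τ≈τ′) X X′ X≋X′ p))
    ... | no ¬p | yes r = ⊥-elim (¬p (HasPattern-resp (toPartial τ′) (toPartial τ)
                            (≈ᵀ⇒⊆ᴾ {τ′} {τ} (≈ᵀ-sym {τ = τ} {τ′} τ≈τ′)) X′ X (≋.sym {X} {X′} X≋X′) r))
    ... | no ¬p | no ¬r = ℂ.trans (ev-0 f τ X ¬p) (ℂ.sym (ev-0 f τ′ X′ ¬r))

    ev-linear : ∀ τ X → IsLinear (obj (cf 𝔽) I) ℂ¹ (λ f → ev f τ X)
    ev-linear τ X = isLinear (cf-isVectorSpace I) ℂ¹-isVectorSpace (λ f → ev f τ X) (λ {f} {g} → ev-≈ {f} {g}) ev-+ ev-·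
      where
      module M = Mod (obj (cf 𝔽) I)
      ev-≈ : ∀ {f g} → f M.≈ᴹ g → ev f τ X ℂ.≈ ev g τ X
      ev-≈ {f} {g} e with pattern? τ X
      ... | yes p = ℂ.trans (ev-fromPattern f τ X p) (ℂ.trans (e τ (fromPattern 𝔽 (toPartial τ) X p)) (ℂ.sym (ev-fromPattern g τ X p)))
      ... | no ¬p = ℂ.trans (ev-0 f τ X ¬p) (ℂ.sym (ev-0 g τ X ¬p))
      ev-+ : ∀ f g → ev (f M.+ᴹ g) τ X ℂ.≈ ev f τ X ℂ.+ ev g τ X
      ev-+ f g = go (pattern? τ X)
        where
        go : Dec (HasPattern (toPartial τ) X) → ev (f M.+ᴹ g) τ X ℂ.≈ ev f τ X ℂ.+ ev g τ X
        go (yes p) = ℂ.trans (ev-fromPattern (f M.+ᴹ g) τ X p)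
          (ℂ.sym {ev f τ X ℂ.+ ev g τ X} (ℂ.+-cong (ev-fromPattern f τ X p) (ev-fromPattern g τ X p)))
        go (no ¬p) = ℂ.trans (ev-0 (f M.+ᴹ g) τ X ¬p)
          (ℂ.sym {ev f τ X ℂ.+ ev g τ X} (ℂ.trans (ℂ.+-cong (ev-0 f τ X ¬p) (ev-0 g τ X ¬p)) (ℂ.+-identityˡ ℂ.0#)))
      ev-· : ∀ c f → ev (c M.*ₗ f) τ X ℂ.≈ c ℂ.* ev f τ X
      ev-· c f = go (pattern? τ X)
        where
        go : Dec (HasPattern (toPartial τ) X) → ev (c M.*ₗ f) τ X ℂ.≈ c ℂ.* ev f τ X
        go (yes p) = ℂ.trans (ev-fromPattern (c M.*ₗ f) τ X p) (ℂ.sym {c ℂ.* ev f τ X} (ℂ.*-congˡ (ev-fromPattern f τ X p)))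
        go (no ¬p) = ℂ.trans (ev-0 (c M.*ₗ f) τ X ¬p)
          (ℂ.sym {c ℂ.* ev f τ X} (ℂ.trans (ℂ.*-congˡ (ev-0 f τ X ¬p)) (ℂ.zeroʳ c)))

    ev-injective : ∀ f g → (∀ τ X → HasPattern (toPartial τ) X → ev f τ X ℂ.≈ ev g τ X) →
                   Mod._≈ᴹ_ (obj (cf 𝔽) I) f g
    ev-injective f g e τ X = ℂ.trans (ℂ.sym (ev-value f {τ} {mat {π = toPartial τ} X} X (≋.refl {mat {π = toPartial τ} X})))
      (ℂ.trans (e τ (mat {π = toPartial τ} X) (pattern-π {π = toPartial τ} X)) (ev-value g {τ} {mat {π = toPartial τ} X} X (≋.refl {mat {π = toPartial τ} X})))

  infix 8 _^ᴹ_

  _^ᴹ_ : {I J : FinSet} → Mat J → I ≃ J → Mat I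
  (X ^ᴹ σ) i j = X (to σ i) (to σ j)

  -- Within the group this is how `cf-map` is defined. Outside it both sides are 0: if the
  -- relabelled matrix had its pattern, relabelling back along σ would give X the pattern of τ.
  ev-map : {I J : FinSet} (σ : I ≃ J) → ∀ f τ X → ev (cf-map σ f) τ X ℂ.≈ ev f (transportᵀ (sym-≃ σ) τ) (X ^ᴹ σ)
  ev-map {I} {J} σ f τ X with pattern? τ X
  ... | yes p = ℂ.trans (ev-fromPattern (cf-map σ f) τ X p)
    (ℂ.sym (ev-value f {transportᵀ (sym-≃ σ) τ} {X ^ᴹ σ} (fun (relabelling 𝔽 (sym-≃ σ) τ) (fromPattern 𝔽 (toPartial τ) X p)) (λ i j → 𝔽.refl)))
  ... | no ¬p = ℂ.trans (ev-0 (cf-map σ f) τ X ¬p) (ℂ.sym (ev-0 f σ⁻¹τ (X ^ᴹ σ) λ r → ¬p (back r)))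
    where
    σ⁻¹τ = transportᵀ (sym-≃ σ) τ
    back : HasPattern (toPartial σ⁻¹τ) (X ^ᴹ σ) → HasPattern (toPartial τ) X
    back r = HasPattern-resp (toPartial (transportᵀ σ σ⁻¹τ)) (toPartial τ)
      (≈ᵀ⇒⊆ᴾ {τ = transportᵀ σ σ⁻¹τ} {τ} λ i j → ≡.cong₂ (TotalOrder.rel τ) (to-from σ i) (to-from σ j))
      (mat {π = toPartial (transportᵀ σ σ⁻¹τ)} e) X
      (λ i j → 𝔽.reflexive (≡.cong₂ X (to-from σ i) (to-from σ j)))
      (pattern-π {π = toPartial (transportᵀ σ σ⁻¹τ)} e)
      where
      e : UTElement (toPartial (transportᵀ σ σ⁻¹τ))
      e = fun (relabelling 𝔽 σ σ⁻¹τ) (fromPattern 𝔽 (toPartial σ⁻¹τ) (X ^ᴹ σ) r)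

-- Conjugacy classes

least : ∀ {n} {P : Fin n → Set} → (∀ k → Dec (P k)) → ∃[ k ] P k → ∃[ k ] P k × (∀ l → l Fin.< k → ¬ P l)
least {suc n} P? (k , p) with P? zero
... | yes p₀ = zero , p₀ , λ _ ()
least {suc n} P? (zero , p)  | no ¬p₀ = ⊥-elim (¬p₀ p)
least {suc n} P? (suc k , p) | no ¬p₀ =
  let (l , pₗ , below) = least (P? ∘ suc) (k , p)
  in suc l , pₗ , λ { zero _ → ¬p₀ ; (suc l′) (ℕ.s≤s l′<l) → below l′ l′<l }

module _ (S : Setoid 0ℓ 0ℓ) (_≟ˢ_ : ∀ x y → Dec (Setoid._≈_ S x y))
         {n} (cover : Fin n → Setoid.Carrier S) (onto : ∀ x → ∃[ k ] Setoid._≈_ S (cover k) x) where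

  private
    module S = Setoid S

    first : ∀ x → ∃[ k ] cover k S.≈ x × (∀ l → l Fin.< k → ¬ cover l S.≈ x)
    first x = least (λ k → cover k ≟ˢ x) (onto x)

    first-unique : ∀ x k → cover k S.≈ x → (∀ l → l Fin.< k → ¬ cover l S.≈ x) → proj₁ (first x) ≡ k
    first-unique x k e below with Fin.<-cmp (proj₁ (first x)) k
    ... | tri< l<k _ _ = ⊥-elim (below _ l<k (proj₁ (proj₂ (first x))))
    ... | tri≈ _ eq _  = eq
    ... | tri> _ _ k<l = ⊥-elim (proj₂ (proj₂ (first x)) k k<l e)

    minimal? : ∀ k → Dec (∀ l → l Fin.< k → ¬ cover l S.≈ cover k)
    minimal? k = Fin.all? λ l → (l Fin.<? k) Dec.→-dec Dec.¬? (cover l ≟ˢ cover k)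

  -- The first representatives in the cover enumerate the classes.
  finite-quotient : Finite S
  finite-quotient = finite-subset {≡.setoid (Fin n)} {S} (record { size = n ; enumeration = ↔-id (Fin n) })
    (λ k → does (minimal? k)) (≡.cong _) (proj₁ ∘ first)
    (λ {x} {y} e → ≡.sym (first-unique y (proj₁ (first x)) (S.trans (proj₁ (proj₂ (first x))) e)
       (λ l l< e′ → proj₂ (proj₂ (first x)) l l< (S.trans e′ (S.sym e)))))
    (λ {x} {y} e → S.trans (S.sym (proj₁ (proj₂ (first x))))
       (S.trans (S.reflexive (≡.cong cover e)) (proj₁ (proj₂ (first y)))))
    (λ x → does⁺ (minimal? (proj₁ (first x)))
       (λ l l< e → proj₂ (proj₂ (first x)) l l< (S.trans e (proj₁ (proj₂ (first x))))))
    (λ k _ → cover k)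
    (λ k m → first-unique (cover k) k S.refl (does⁻ (minimal? k) m))

-- Conjugacy is taken in the form w x = y w, which can be checked on diagonal blocks without
-- computing an inverse.
class-function-conjugate : {G : FiniteGroup} (ψ : ClassFunction G) → let open FiniteGroup G in
                           ∀ w x y → w ∙ x ≈ y ∙ w → value ψ x ℂ.≈ value ψ y
class-function-conjugate {G} ψ w x y e = ℂ.trans (ℂ.sym (invariant ψ w x)) (value-cong ψ (begin
  w ∙ x ∙ w ⁻¹     ≈⟨ ∙-congʳ e ⟩
  y ∙ w ∙ w ⁻¹     ≈⟨ assoc y w (w ⁻¹) ⟩
  y ∙ (w ∙ w ⁻¹)   ≈⟨ ∙-congˡ (inverseʳ w) ⟩
  y ∙ ε            ≈⟨ identityʳ y ⟩
  y                ∎))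
  where
  open FiniteGroup G
  open SetoidReasoning setoid

ℂ^-isVectorSpace : ∀ n → IsVectorSpace (ℂ^ n)
ℂ^-isVectorSpace n = isVectorSpace (ℂ^ n)
  (record { refl = λ k → ℂ.refl ; sym = λ e k → ℂ.sym (e k) ; trans = λ e e′ k → ℂ.trans (e k) (e′ k) })
  (λ e e′ k → ℂ.+-cong (e k) (e′ k)) (λ c e k → ℂ.*-cong c (e k)) (λ e k → ℂ.-‿cong (e k))
  (λ u v w k → ℂ.+-assoc (u k) (v k) (w k)) (λ u v k → ℂ.+-comm (u k) (v k)) (λ u k → ℂ.+-identityˡ (u k))
  (λ u k → ℂ.-‿inverseˡ (u k)) (λ c u v k → ℂ.distribˡ c (u k) (v k)) (λ c d u k → ℂ.distribʳ (u k) c d)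
  (λ c d u k → ℂ.*-assoc c d (u k)) (λ u k → ℂ.*-identityˡ (u k))

module _ {q : ℕ} (𝔽 : FiniteField q) where

  open PatternGroups 𝔽
  open Matrices using (Mat)
  open UTElement using (mat; pattern-π)
  private module 𝔽 = FiniteField 𝔽

  module _ (I : FinSet) where

    open Matrices I hiding (Mat)

    record Point : Set where
      no-eta-equality
      constructor point
      field
        order  : TotalOrder I
        matrix : Mat I
        within : HasPattern (toPartial order) matrix

    open Point

    element-at : (x : Point) → UTElement (toPartial (order x))
    element-at x = fromPattern 𝔽 (toPartial (order x)) (matrix x) (within x)

    -- Conjugacy in UT(τ), without reference to inverses
    record _~_ (x y : Point) : Set where
      no-eta-equality
      constructor conjugate
      field
        order-≈ : order x ≈ᵀ order y
        by      : Mat I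
        by∈     : HasPattern (toPartial (order x)) by
        eq      : by ⊡ matrix x ≋ matrix y ⊡ by

    open _~_

    private

      along : ∀ {τ τ′ : TotalOrder I} → τ ≈ᵀ τ′ → ∀ X → HasPattern (toPartial τ) X → HasPattern (toPartial τ′) X
      along {τ} {τ′} e X = HasPattern-resp 𝔽 (toPartial τ) (toPartial τ′) (≈ᵀ⇒⊆ᴾ 𝔽 {τ = τ} {τ′} e) X X (≋.refl {X})

    same-order : ∀ x y → order x ≈ᵀ order y → matrix x ≋ matrix y → x ~ y
    same-order x y e e′ = conjugate e 𝟙 (Pattern.𝟙-hasPattern (toPartial (order x))) (begin
      𝟙 ⊡ matrix x   ≈⟨ ⊡-identityˡ (matrix x) ⟩
      matrix x       ≈⟨ e′ ⟩
      matrix y       ≈⟨ ⊡-identityʳ (matrix y) ⟨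
      matrix y ⊡ 𝟙   ∎)
      where open SetoidReasoning mat-setoid

    ~-sym : ∀ {x y} → x ~ y → y ~ x
    ~-sym {x} {y} c = conjugate (≈ᵀ-sym {τ = order x} {order y} (order-≈ c)) W
      (along {order x} {order y} (order-≈ c) W (Pattern.inv-hasPattern (toPartial (order x)) Y⁻¹ (by∈ c))) (begin
        W ⊡ matrix y               ≈⟨ ⊡-identityʳ (W ⊡ matrix y) ⟨
        W ⊡ matrix y ⊡ 𝟙           ≈⟨ ⊡-cong (≋.refl {W ⊡ matrix y}) (Y⁻¹.inverseʳ) ⟨
        W ⊡ matrix y ⊡ (Y ⊡ W)     ≈⟨ ⊡-assoc (W ⊡ matrix y) Y W ⟨
        W ⊡ matrix y ⊡ Y ⊡ W       ≈⟨ ⊡-cong (⊡-assoc W (matrix y) Y) (≋.refl {W}) ⟩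
        W ⊡ (matrix y ⊡ Y) ⊡ W     ≈⟨ ⊡-cong (⊡-cong (≋.refl {W}) (eq c)) (≋.refl {W}) ⟨
        W ⊡ (Y ⊡ matrix x) ⊡ W     ≈⟨ ⊡-cong (⊡-assoc W Y (matrix x)) (≋.refl {W}) ⟨
        W ⊡ Y ⊡ matrix x ⊡ W       ≈⟨ ⊡-cong (⊡-cong (Y⁻¹.inverseˡ) (≋.refl {matrix x})) (≋.refl {W}) ⟩
        𝟙 ⊡ matrix x ⊡ W           ≈⟨ ⊡-cong (⊡-identityˡ (matrix x)) (≋.refl {W}) ⟩
        matrix x ⊡ W               ∎)
      where
      open SetoidReasoning mat-setoid
      Y = by c
      Y⁻¹ = pattern⇒invertible 𝔽 (toPartial (order x)) Y (by∈ c)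
      module Y⁻¹ = Invertible Y⁻¹
      W = Y⁻¹.inv

    ~-trans : ∀ {x y z} → x ~ y → y ~ z → x ~ z
    ~-trans {x} {y} {z} c d = conjugate (≈ᵀ-trans {τ = order x} {order y} {order z} (order-≈ c) (order-≈ d)) (by d ⊡ by c)
      (Pattern.⊡-hasPattern (toPartial (order x)) {by d} {by c}
        (along {order y} {order x} (≈ᵀ-sym {τ = order x} {order y} (order-≈ c)) (by d) (by∈ d)) (by∈ c)) (begin
        by d ⊡ by c ⊡ matrix x     ≈⟨ ⊡-assoc (by d) (by c) (matrix x) ⟩
        by d ⊡ (by c ⊡ matrix x)   ≈⟨ ⊡-cong (≋.refl {by d}) (eq c) ⟩
        by d ⊡ (matrix y ⊡ by c)   ≈⟨ ⊡-assoc (by d) (matrix y) (by c) ⟨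
        by d ⊡ matrix y ⊡ by c     ≈⟨ ⊡-cong (eq d) (≋.refl {by c}) ⟩
        matrix z ⊡ by d ⊡ by c     ≈⟨ ⊡-assoc (matrix z) (by d) (by c) ⟩
        matrix z ⊡ (by d ⊡ by c)   ∎)
      where open SetoidReasoning mat-setoid

    classes : Setoid 0ℓ 0ℓ
    classes = record
      { Carrier       = Point
      ; _≈_           = _~_
      ; isEquivalence = record
        { refl  = λ {x} → same-order x x (≈ᵀ-refl {τ = order x}) (≋.refl {matrix x})
        ; sym   = ~-sym
        ; trans = ~-trans
        }
      }

    private

      _~?_ : ∀ x y → Dec (x ~ y)
      x ~? y = Dec.map′ (λ (e , Y , Y∈ , e′) → conjugate e Y Y∈ e′) (λ c → order-≈ c , by c , by∈ c , eq c)
        (Finite._≈?_ finite-total-orders (order x) (order y) Dec.×-dec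
         Finite.any? finite-matrices
           (λ {Y} {Y′} Y≋Y′ (Y∈ , e) → Pattern.hasPattern-cong (toPartial (order x)) {Y} {Y′} Y≋Y′ Y∈ ,
              ≋.trans {Y′ ⊡ matrix x} (⊡-cong (≋.sym {Y} {Y′} Y≋Y′) (≋.refl {matrix x}))
                (≋.trans {Y ⊡ matrix x} e (⊡-cong (≋.refl {matrix y}) Y≋Y′)))
           (λ Y → Pattern.hasPattern? (toPartial (order x)) Y Dec.×-dec
                  Finite._≈?_ finite-matrices (Y ⊡ matrix x) (matrix y ⊡ Y)))

      pairs-setoid : Setoid 0ℓ 0ℓ
      pairs-setoid = ×-setoid (total-orders I) mat-setoid

      finite-pairs : Finite pairs-setoid
      finite-pairs = finite-× finite-total-orders finite-matrices

      -- The cover is indexed by all pairs of an order and a matrix. A matrix outside UT(τ) is sent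
      -- to the identity, which is harmless because the cover only has to be onto.
      clamp : ∀ τ X → Dec (HasPattern (toPartial τ) X) → Point
      clamp τ X (yes X∈) = point τ X X∈
      clamp τ X (no _)   = point τ 𝟙 (Pattern.𝟙-hasPattern (toPartial τ))

      cover : Fin (size finite-pairs) → Point
      cover k = let (τ , X) = element finite-pairs k in clamp τ X (Pattern.hasPattern? (toPartial τ) X)

      onto : ∀ x → ∃[ k ] cover k ~ x
      onto x = k , go (Pattern.hasPattern? (toPartial τ) X)
        where
        k = index finite-pairs (order x , matrix x)
        τ = proj₁ (element finite-pairs k)
        X = proj₂ (element finite-pairs k)
        e : Setoid._≈_ pairs-setoid (τ , X) (order x , matrix x)
        e = element-index finite-pairs (order x , matrix x)
        go : ∀ d → clamp τ X d ~ x
        go (yes X∈) = same-order (point τ X X∈) x (proj₁ e) (proj₂ e)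
        go (no X∉)  = ⊥-elim (X∉ (HasPattern-resp 𝔽 (toPartial (order x)) (toPartial τ)
          (≈ᵀ⇒⊆ᴾ 𝔽 {τ = order x} {τ} (≈ᵀ-sym {τ = τ} {order x} (proj₁ e))) (matrix x) X (≋.sym {X} {matrix x} (proj₂ e)) (within x)))

    opaque

      finite-classes : Finite classes
      finite-classes = finite-quotient classes _~?_ cover onto

    point-of : (τ : TotalOrder I) → UTElement (toPartial τ) → Point
    point-of τ X = point τ (mat {π = toPartial τ} X) (pattern-π {π = toPartial τ} X)

    private

      component-rebuild : ∀ (f : ClassFunctions 𝔽 I) τ (X : UTElement (toPartial τ)) →
        value (component f τ) (fromPattern 𝔽 (toPartial τ) (mat {π = toPartial τ} X) (pattern-π {π = toPartial τ} X)) ℂ.≈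
        value (component f τ) X
      component-rebuild f τ X = value-cong (component f τ)
        {fromPattern 𝔽 (toPartial τ) (mat {π = toPartial τ} X) (pattern-π {π = toPartial τ} X)} {X} (λ i j → 𝔽.refl)

      component-conjugate : ∀ (f : ClassFunctions 𝔽 I) {x y} (c : x ~ y) → value (component f (order x)) (element-at x) ℂ.≈ value (component f (order y)) (element-at y)
      component-conjugate f {x} {y} c = ℂ.trans
        (class-function-conjugate (component f (order x)) (fromPattern 𝔽 (toPartial (order x)) (by c) (by∈ c)) (element-at x) y′ (eq c))
        (component-cong f (order-≈ c) y′ (element-at y) (≋.refl {matrix y}))
        where
        y′ : UTElement (toPartial (order x))
        y′ = fromPattern 𝔽 (toPartial (order x)) (matrix y)
          (along {order y} {order x} (≈ᵀ-sym {τ = order x} {order y} (order-≈ c)) (matrix y) (within y))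

    opaque

      from-classes : (v : Point → ℂ.Carrier) → (∀ {x y} → x ~ y → v x ℂ.≈ v y) → ClassFunctions 𝔽 I
      from-classes v v-cong = record
        { component      = λ τ → record
          { value     = λ X → v (point-of τ X)
          ; cong      = λ {X} {Y} e → v-cong (same-order (point-of τ X) (point-of τ Y) (≈ᵀ-refl {τ = τ}) e)
          ; invariant = λ Y X → v-cong (~-sym (conj τ Y X))
          }
        ; component-cong = λ {τ} {τ′} e X X′ e′ → v-cong (same-order (point-of τ X) (point-of τ′ X′) e e′)
        }
        where
        conj : ∀ τ (Y X : UTElement (toPartial τ)) → let open FiniteGroup (UT (toPartial τ)) in
               point-of τ X ~ point-of τ (Y ∙ X ∙ Y ⁻¹)
        conj τ Y X = conjugate (≈ᵀ-refl {τ = τ}) (mat {π = toPartial τ} Y) (pattern-π {π = toPartial τ} Y) (begin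
          Y ∙ X                    ≈⟨ identityʳ (Y ∙ X) ⟨
          Y ∙ X ∙ ε                ≈⟨ ∙-congˡ {Y ∙ X} {Y ⁻¹ ∙ Y} {ε} (inverseˡ Y) ⟨
          Y ∙ X ∙ (Y ⁻¹ ∙ Y)       ≈⟨ assoc (Y ∙ X) (Y ⁻¹) Y ⟨
          Y ∙ X ∙ Y ⁻¹ ∙ Y         ∎)
          where
          open FiniteGroup (UT (toPartial τ))
          open SetoidReasoning setoid

      at : ClassFunctions 𝔽 I → Point → ℂ.Carrier
      at f x = value (component f (order x)) (element-at x)

      at-cong : ∀ f {x y} → x ~ y → at f x ℂ.≈ at f y
      at-cong f {x} {y} c = component-conjugate f {x} {y} c

      at-value : ∀ f τ (X : UTElement (toPartial τ)) → at f (point-of τ X) ℂ.≈ value (component f τ) X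
      at-value f τ X = component-rebuild f τ X

      at-linear : ∀ x → IsLinear (obj (cf 𝔽) I) ℂ¹ (λ f → at f x)
      at-linear x = isLinear (cf-isVectorSpace 𝔽 I) ℂ¹-isVectorSpace (λ f → at f x)
        (λ {f} {g} e → e (order x) (element-at x)) (λ f g → ℂ.refl) (λ c f → ℂ.refl)

      at-from-classes : ∀ v (v-cong : ∀ {x y} → x ~ y → v x ℂ.≈ v y) x → at (from-classes v v-cong) x ℂ.≈ v x
      at-from-classes v v-cong x = v-cong (same-order (point-of (order x) (element-at x)) x (≈ᵀ-refl {τ = order x}) (≋.refl {matrix x}))

      ev-at-point : ∀ f x → ev 𝔽 f (order x) (matrix x) ℂ.≈ at f x
      ev-at-point f x = ev-fromPattern 𝔽 f (order x) (matrix x) (within x)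

    at-injective : ∀ f g → (∀ x → at f x ℂ.≈ at g x) → Mod._≈ᴹ_ (obj (cf 𝔽) I) f g
    at-injective f g e τ X = ℂ.trans (ℂ.sym (at-value f τ X)) (ℂ.trans (e (point-of τ X)) (at-value g τ X))

    private

      n = size finite-classes
      f-cong : (v : Fin n → ℂ.Carrier) → ∀ {x y} → x ~ y → v (index finite-classes x) ℂ.≈ v (index finite-classes y)
      f-cong v c = ℂ.reflexive (≡.cong v (index-cong finite-classes c))
      f : (Fin n → ℂ.Carrier) → ClassFunctions 𝔽 I
      f v = from-classes (v ∘ index finite-classes) (f-cong v)
      f-at′ : ∀ v x → at (f v) x ℂ.≈ v (index finite-classes x)
      f-at′ v x = at-from-classes (v ∘ index finite-classes) (f-cong v) x
      f-≈ : ∀ {v w} → (∀ k → v k ℂ.≈ w k) → Mod._≈ᴹ_ (obj (cf 𝔽) I) (f v) (f w)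
      f-≈ {v} {w} e = at-injective (f v) (f w) λ x → ℂ.trans (f-at′ v x) (ℂ.trans (e (index finite-classes x)) (ℂ.sym (f-at′ w x)))
      f-at : ∀ v k → at (f v) (element finite-classes k) ℂ.≈ v k
      f-at v k = ℂ.trans (f-at′ v (element finite-classes k))
        (ℂ.reflexive (≡.cong v (index-element finite-classes k)))
      module L x = LeftModuleMorphisms.IsLeftModuleHomomorphism (at-linear x)
      f-+ : ∀ v w → Mod._≈ᴹ_ (obj (cf 𝔽) I) (f (λ k → v k ℂ.+ w k)) (Mod._+ᴹ_ (obj (cf 𝔽) I) (f v) (f w))
      f-+ v w = at-injective (f (λ k → v k ℂ.+ w k)) (Mod._+ᴹ_ (obj (cf 𝔽) I) (f v) (f w)) λ x →
        ℂ.trans (f-at′ (λ k → v k ℂ.+ w k) x) (ℂ.sym (ℂ.trans (L.+ᴹ-homo x (f v) (f w)) (ℂ.+-cong (f-at′ v x) (f-at′ w x))))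
      f-· : ∀ c v → Mod._≈ᴹ_ (obj (cf 𝔽) I) (f (λ k → c ℂ.* v k)) (Mod._*ₗ_ (obj (cf 𝔽) I) c (f v))
      f-· c v = at-injective (f (λ k → c ℂ.* v k)) (Mod._*ₗ_ (obj (cf 𝔽) I) c (f v)) λ x →
        ℂ.trans (f-at′ (λ k → c ℂ.* v k) x) (ℂ.sym (ℂ.trans (L.*ₗ-homo x c (f v)) (ℂ.*-congˡ (f-at′ v x))))
      at-≈ : ∀ {v w} → Mod._≈ᴹ_ (obj (cf 𝔽) I) (f v) (f w) → ∀ k → at (f v) (element finite-classes k) ℂ.≈ at (f w) (element finite-classes k)
      at-≈ {v} {w} e k = LeftModuleMorphisms.IsLeftModuleHomomorphism.⟦⟧-cong (at-linear (element finite-classes k)) {f v} {f w} e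

    -- The coordinates are the values at representatives of the classes, so the dimension is the
    -- number of conjugacy classes in all the groups UT(τ) together.
    cf-finiteDimensional : FiniteDimensional (obj (cf 𝔽) I)
    cf-finiteDimensional = size finite-classes , record
      { fun                     = f
      ; isLeftModuleIsomorphism = record
        { isLeftModuleMonomorphism = record
          { isLeftModuleHomomorphism = isLinear (ℂ^-isVectorSpace n) (cf-isVectorSpace 𝔽 I) f
              (λ {v} {w} → f-≈ {v} {w}) f-+ f-·
          ; injective = λ {v} {w} e k → ℂ.trans (ℂ.sym (f-at v k)) (ℂ.trans (at-≈ {v} {w} e k) (f-at w k))
          }
        ; surjective = λ g → (λ k → at g (element finite-classes k)) , λ {v} e →
            at-injective (f v) g λ x → ℂ.trans (f-at′ v x)
              (ℂ.trans (e (index finite-classes x)) (at-cong g (element-index finite-classes x)))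
        }
      }

    _≟ᶜ_ : ∀ x y → Dec (x ~ y)
    _≟ᶜ_ = Finite._≈?_ finite-classes

    private
      indicator-cong : ∀ k {x y} → x ~ y → ℂ∑.when (k ≟ᶜ x) ℂ.1# ℂ.≈ ℂ∑.when (k ≟ᶜ y) ℂ.1#
      indicator-cong k {x} {y} c = ℂ∑.when-cong (k ≟ᶜ x) (k ≟ᶜ y) (λ d → ~-trans d c) (λ d → ~-trans d (~-sym c)) (λ _ → ℂ.refl)

    indicator : Point → ClassFunctions 𝔽 I
    indicator k = from-classes (λ x → ℂ∑.when (k ≟ᶜ x) ℂ.1#) (indicator-cong k)

    at-indicator : ∀ k x → at (indicator k) x ℂ.≈ ℂ∑.when (k ≟ᶜ x) ℂ.1#
    at-indicator k x = at-from-classes (λ x → ℂ∑.when (k ≟ᶜ x) ℂ.1#) (indicator-cong k) x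

    indicator-≈ : ∀ {k l} → k ~ l → Mod._≈ᴹ_ (obj (cf 𝔽) I) (indicator k) (indicator l)
    indicator-≈ {k} {l} c = at-injective (indicator k) (indicator l) λ x → ℂ.trans (at-indicator k x)
      (ℂ.trans (ℂ∑.when-cong (k ≟ᶜ x) (l ≟ᶜ x) (λ d → ~-trans (~-sym c) d) (λ d → ~-trans c d) (λ _ → ℂ.refl)) (ℂ.sym (at-indicator l x)))

    cf-expand : ∀ f → Mod._≈ᴹ_ (obj (cf 𝔽) I) f
                  (FiniteSums.∑ (additive (cf-isVectorSpace 𝔽 I)) finite-classes (λ k → Mod._*ₗ_ (obj (cf 𝔽) I) (at f k) (indicator k)))
    cf-expand f = at-injective f rhs λ x → ℂ.sym {at rhs x} {at f x} (begin
      at rhs x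
        ≈⟨ linear-∑ (cf-isVectorSpace 𝔽 I) ℂ¹-isVectorSpace (λ g → at g x) (at-linear x) finite-classes term ⟩
      ℂ∑.∑ finite-classes (λ k → at (term k) x)
        ≈⟨ ℂ∑.∑-cong finite-classes (λ k → L.*ₗ-homo x (at f k) (indicator k)) ⟩
      ℂ∑.∑ finite-classes (λ k → at f k ℂ.* at (indicator k) x)
        ≈⟨ ℂ∑.∑-cong finite-classes (λ k → ℂ.trans (ℂ.*-congˡ {at f k} (at-indicator k x))
             (ℂ.trans (when-*ˡ (k ≟ᶜ x) (at f k) ℂ.1#) (ℂ∑.when-congʳ (k ≟ᶜ x) λ _ → ℂ.*-identityʳ (at f k)))) ⟩
      ℂ∑.∑ finite-classes (λ k → ℂ∑.when (k ≟ᶜ x) (at f k))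
        ≈⟨ ℂ∑.∑-kronecker finite-classes (at f) (at-cong f) x (λ k → k ≟ᶜ x) ⟩
      at f x ∎)
      where
      open SetoidReasoning ℂ.setoid
      term : Point → ClassFunctions 𝔽 I
      term k = Mod._*ₗ_ (obj (cf 𝔽) I) (at f k) (indicator k)
      rhs : ClassFunctions 𝔽 I
      rhs = FiniteSums.∑ (additive (cf-isVectorSpace 𝔽 I)) finite-classes term

  open Point public

-- Tensors as class functions of block diagonal groups

module _ {q : ℕ} (𝔽 : FiniteField q) where

  open PatternGroups 𝔽
  open Matrices using (Mat)
  open UTElement using (mat; pattern-π)
  private module 𝔽 = FiniteField 𝔽

  value-∏ᶠ : {G : FiniteGroup} {n : ℕ} (ψ : Fin n → ClassFunction G) → ∀ g → value (∏ᶠ ψ) g ℂ.≈ ∏ (λ r → value (ψ r) g)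
  value-∏ᶠ {n = zero}  ψ g = ℂ.refl
  value-∏ᶠ {n = suc n} ψ g = ℂ.*-congˡ (value-∏ᶠ (ψ ∘ suc) g)

  value-∑ᶠ : {G : FiniteGroup} {n : ℕ} (ψ : Fin n → ClassFunction G) → ∀ g → value (∑ᶠ ψ) g ℂ.≈ ℂ∑.sum (λ r → value (ψ r) g)
  value-∑ᶠ {n = zero}  ψ g = ℂ.refl
  value-∑ᶠ {n = suc n} ψ g = ℂ.+-congˡ (value-∑ᶠ (ψ ∘ suc) g)

  module _ {I : FinSet} (A : Composition I) where

    open Matrices I using (_≋_; module ≋)

    Factors : Fin (length A) → Mod
    Factors = RawSpecies.factors (cf 𝔽) A

    BlockMatrices : Set
    BlockMatrices = ∀ r → Mat ⟦ block A r ⟧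

    infix 6 _∥_

    _∥_ : Mat I → BlockMatrices
    _∥_ X r = _∣ᴹ_ 𝔽 X (block A r)

    -- The orders and matrices of the blocks are separate arguments, because the formula for
    -- coproducts patches each block along its own order.
    evᵗ : Tensor Factors → BlockOrders A → BlockMatrices → ℂ.Carrier
    evᵗ t τ Y = extend ℂ¹ (λ m → ∏ (λ r → ev 𝔽 (m r) (τ r) (Y r))) t

    evᵗ-functional : ∀ τ Y → IsFunctional Factors (λ t → evᵗ t τ Y)
    evᵗ-functional τ Y = extend-functional Factors (λ m → ∏ (λ r → ev 𝔽 (m r) (τ r) (Y r)))

    evᵗ-linear : ∀ τ Y → IsLinear (obj⊗ (cf 𝔽) A) ℂ¹ (λ t → evᵗ t τ Y)
    evᵗ-linear τ Y = extend-linear Factors ℂ¹-isVectorSpace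
      (∏-multilinear Factors (λ r f → ev 𝔽 f (τ r) (Y r)) (λ r → ev-linear 𝔽 (τ r) (Y r)))

    evᵗ-cong : ∀ t {τ τ′ Y Y′} → (∀ r → τ r ≈ᵀ τ′ r) → (∀ r → Matrices._≋_ ⟦ block A r ⟧ (Y r) (Y′ r)) →
               evᵗ t τ Y ℂ.≈ evᵗ t τ′ Y′
    evᵗ-cong t {τ} {τ′} {Y} {Y′} e e′ = agree Factors (evᵗ-functional τ Y) (evᵗ-functional τ′ Y′)
      (λ m → ∏-cong λ r → ev-cong 𝔽 (m r) {τ r} {τ′ r} {Y r} {Y′ r} (e r) (e′ r)) t

    external-functional : ∀ τ X → IsFunctional Factors (λ t → value (component (external 𝔽 A t) τ) X)
    external-functional τ X = record
      { ⊕-homo = λ _ _ → ℂ.refl ; ·-homo = λ _ _ → ℂ.refl ; ⊖-homo = λ _ → ℂ.refl ; 𝟘-homo = ℂ.refl }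

    external-value : ∀ t τ (X : UTElement (UL-order A (star A τ))) →
                     value (component (external 𝔽 A t) τ) X ℂ.≈ evᵗ t τ (_∥_ (mat {π = UL-order A (star A τ)} X))
    external-value t τ X = agree Factors (external-functional τ X) (evᵗ-functional τ (_∥_ M)) pure-value t
      where
      M = mat {π = UL-order A (star A τ)} X
      pure-value : ∀ m → value (component (external 𝔽 A (pure m)) τ) X ℂ.≈ ∏ (λ r → ev 𝔽 (m r) (τ r) (_∣ᴹ_ 𝔽 M (block A r)))
      pure-value m = ℂ.trans (value-∏ᶠ (λ r → pullback (diagonal-block 𝔽 A τ r) (component (m r) (τ r))) X)
        (∏-cong λ r → ℂ.sym (ev-value 𝔽 (m r) {τ r} {_∣ᴹ_ 𝔽 M (block A r)} (fun (diagonal-block 𝔽 A τ r) X) (λ i j → 𝔽.refl)))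

    external-linear : IsLinear (obj⊗ (cf 𝔽) A) (cf⊕ 𝔽 A) (external 𝔽 A)
    external-linear = isLinear (⨂-isVectorSpace Factors)
      (DirectSum-isVectorSpace 𝔽 (block-orders A) (λ τ → UL-order A (star A τ))) (external 𝔽 A)
      (λ {t} {u} e τ X → ℂ.trans (external-value t τ X) (ℂ.trans
        (LeftModuleMorphisms.IsLeftModuleHomomorphism.⟦⟧-cong (evᵗ-linear τ (_∥_ (mat {π = UL-order A (star A τ)} X))) {t} {u} e)
        (ℂ.sym (external-value u τ X))))
      (λ t u τ X → ℂ.refl) (λ c t τ X → ℂ.refl)

    private

      entry : BlockMatrices → ∀ {r} i j → T (block A r ∋ i) → Dec (T (block A r ∋ j)) → 𝔽.Carrier
      entry Y {r} i j p (yes p′) = Y r (i , p) (j , p′)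
      entry Y i j p (no _)   = 𝔽.0#

    ⨁ : BlockMatrices → Mat I
    ⨁ Y i j = entry Y i j (proj₂ (covers A i)) (T? (block A (blockOf A i) ∋ j))

    private

      entry-in : ∀ Y {r s} i j (p : T (block A s ∋ i)) (d : Dec (T (block A s ∋ j))) (p′ : T (block A r ∋ i)) (p″ : T (block A r ∋ j)) →
                 entry Y i j p d ≡ Y r (i , p′) (j , p″)
      entry-in Y {r} {s} i j p d p′ p″ with disjoint A p p′
      entry-in Y i j p (yes p₁) p′ p″ | refl = ≡.cong₂ (Y _) (Σ-T-≡ refl) (Σ-T-≡ refl)
      entry-in Y i j p (no ¬p)  p′ p″ | refl = ⊥-elim (¬p p″)

    ⨁-in : ∀ Y r (i j : ∣ ⟦ block A r ⟧ ∣) → ⨁ Y (proj₁ i) (proj₁ j) ≡ Y r i j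
    ⨁-in Y r (i , p) (j , p′) = entry-in Y i j (proj₂ (covers A i)) (T? (block A (blockOf A i) ∋ j)) p p′

    ⨁-off : ∀ Y {i j} → ¬ Eq A i j → ⨁ Y i j ≡ 𝔽.0#
    ⨁-off Y {i} {j} ¬e = go (T? (block A (blockOf A i) ∋ j))
      where
      go : ∀ d → entry Y i j (proj₂ (covers A i)) d ≡ 𝔽.0#
      go (yes p) = ⊥-elim (¬e (≡.sym (blockOf-unique A p)))
      go (no _)  = refl

    in-block : ∀ {i j} → Eq A i j → T (block A (blockOf A i) ∋ j)
    in-block {i} {j} e = ≡.subst (λ r → T (block A r ∋ j)) (≡.sym e) (proj₂ (covers A j))

    module _ (τ : BlockOrders A) (Y : BlockMatrices) (Y∈ : ∀ r → HasPattern (toPartial (τ r)) (Y r)) where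

      ⨁-pattern : HasPattern (UL-order A (star A τ)) (⨁ Y)
      ⨁-pattern = Pattern.hasPattern (UL-order A (star A τ)) off diagonal
        where
        off : ∀ {i j} → ¬ (i , j) ∈ᴾ UL-order A (star A τ) → ⨁ Y i j 𝔽.≈ 𝔽.0#
        off {i} {j} ∉UL with Dec.toSum (blockOf A i Fin.≟ blockOf A j)
        ... | inj₂ ¬e = 𝔽.reflexive (⨁-off Y ¬e)
        ... | inj₁ e  = 𝔽.trans (𝔽.reflexive (⨁-in Y (blockOf A i) (i , proj₂ (covers A i)) (j , in-block e)))
          (Pattern.vanishes (toPartial (τ (blockOf A i))) {Y (blockOf A i)} (Y∈ (blockOf A i))
            λ t → ∉UL (does⁺ (UL-dec A (star A τ) i j) (star⁺ A τ (inj₁ (blockOf A i , proj₂ (covers A i) , in-block e , t)) , e)))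
        diagonal : ∀ i → ⨁ Y i i 𝔽.≈ 𝔽.1#
        diagonal i = 𝔽.trans (𝔽.reflexive (⨁-in Y (blockOf A i) (i , proj₂ (covers A i)) (i , proj₂ (covers A i))))
          (Pattern.unipotent (toPartial (τ (blockOf A i))) {Y (blockOf A i)} (Y∈ (blockOf A i)) (i , proj₂ (covers A i)))

      ⨁ᵁ : UTElement (UL-order A (star A τ))
      ⨁ᵁ = fromPattern 𝔽 (UL-order A (star A τ)) (⨁ Y) ⨁-pattern

    UL-≋ : ∀ φ X X′ → HasPattern (UL-order A φ) X → HasPattern (UL-order A φ) X′ →
           (∀ r → Matrices._≋_ ⟦ block A r ⟧ (_∣ᴹ_ 𝔽 X (block A r)) (_∣ᴹ_ 𝔽 X′ (block A r))) → X ≋ X′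
    UL-≋ φ X X′ X∈ X′∈ e i j with Dec.toSum (blockOf A i Fin.≟ blockOf A j)
    ... | inj₁ eq = e (blockOf A i) (i , proj₂ (covers A i)) (j , in-block eq)
    ... | inj₂ ¬e = 𝔽.trans (off X X∈) (𝔽.sym (off X′ X′∈))
      where
      off : ∀ X → HasPattern (UL-order A φ) X → X i j 𝔽.≈ 𝔽.0#
      off X X∈ = Pattern.vanishes (UL-order A φ) {X} X∈ λ t → ¬e (proj₂ (does⁻ (UL-dec A φ i j) t))

    block-pattern : ∀ τ {X} → HasPattern (UL-order A (star A τ)) X → ∀ r → HasPattern (toPartial (τ r)) (_∣ᴹ_ 𝔽 X (block A r))
    block-pattern τ {X} X∈ r = pattern-π {π = toPartial (τ r)} (fun (diagonal-block 𝔽 A τ r) (fromPattern 𝔽 (UL-order A (star A τ)) X X∈))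

    private

      Points : Set
      Points = ∀ r → Point 𝔽 ⟦ block A r ⟧

      F : ∀ r → Finite (classes 𝔽 ⟦ block A r ⟧)
      F r = finite-classes 𝔽 ⟦ block A r ⟧

      V : ∀ r → IsVectorSpace (Factors r)
      V r = cf-isVectorSpace 𝔽 ⟦ block A r ⟧

      orders : Points → BlockOrders A
      orders κ r = order (κ r)

      matrices : Points → BlockMatrices
      matrices κ r = matrix (κ r)

      indicators : Points → Tensor Factors
      indicators κ = pure (λ r → indicator 𝔽 ⟦ block A r ⟧ (κ r))

      module ∑T = FiniteSums (additive (⨂-isVectorSpace Factors))
      open RingProperties ℂ.ring using (-1*x≈-x)
      module VT = IsLeftModule (⨂-isVectorSpace Factors)

      scale-linear : ∀ c → IsLinear (⨂ Factors) (⨂ Factors) (c ·_)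
      scale-linear c = isLinear (⨂-isVectorSpace Factors) (⨂-isVectorSpace Factors) (c ·_) (·-cong ℂ.refl) (·-distribˡ c)
        (λ d t → ∼-trans (∼-sym (·-assoc c d t)) (∼-trans (·-cong (ℂ.*-comm c d) ∼-refl) (·-assoc d c t)))

      coefficient : Tensor Factors → Points → ℂ.Carrier
      coefficient t κ = evᵗ t (orders κ) (matrices κ)

      expansion : Tensor Factors → Tensor Factors
      expansion t = ∑T.∑ (finite-Π F) (λ κ → coefficient t κ · indicators κ)

      expand-scale : ∀ c t u → _∼_ Factors t (expansion t) → (∀ κ → coefficient u κ ℂ.≈ c ℂ.* coefficient t κ) →
                     _∼_ Factors (c · t) (expansion u)
      expand-scale c t u t∼ eq = ∼-trans (·-cong ℂ.refl t∼) (∼-trans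
        (linear-∑ (⨂-isVectorSpace Factors) (⨂-isVectorSpace Factors) (c ·_) (scale-linear c) (finite-Π F)
          (λ κ → coefficient t κ · indicators κ))
        (∑T.∑-cong (finite-Π F) λ κ → ∼-trans (∼-sym (·-assoc c (coefficient t κ) (indicators κ)))
          (·-cong (ℂ.sym (eq κ)) ∼-refl)))

      -- Each t is recovered from its values alone. For pure tensors this is multilinear expansion
      -- in class indicators; `coefficient` is linear in t, which carries it over to the other
      -- terms.
      expand : ∀ t → _∼_ Factors t (expansion t)
      expand (pure m) = ∼-trans
        (pure-expand Factors V F (λ r → indicator 𝔽 ⟦ block A r ⟧) (λ r {k} {l} c → indicator-≈ 𝔽 ⟦ block A r ⟧ {k} {l} c)
          (λ r → at 𝔽 ⟦ block A r ⟧ (m r)) (λ r {k} {l} c → at-cong 𝔽 ⟦ block A r ⟧ (m r) {k} {l} c) m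
          (λ r → cf-expand 𝔽 ⟦ block A r ⟧ (m r)))
        (∑T.∑-cong (finite-Π F) λ κ → ·-cong {t = indicators κ}
          (∏-cong {f = λ r → at 𝔽 ⟦ block A r ⟧ (m r) (κ r)} λ r → ℂ.sym (ev-at-point 𝔽 ⟦ block A r ⟧ (m r) (κ r))) ∼-refl)
      expand (t ⊕ u) = ∼-trans (⊕-cong (expand t) (expand u)) (∼-sym (∼-trans
        (∑T.∑-cong (finite-Π F) λ κ → ·-distribʳ (coefficient t κ) (coefficient u κ) (indicators κ))
        (∑T.∑-∙ (finite-Π F) (λ κ → coefficient t κ · indicators κ) (λ κ → coefficient u κ · indicators κ))))
      expand (c · t) = expand-scale c t (c · t) (expand t) (λ κ → ℂ.refl)
      -- By uniqueness of additive inverses ⊖ t equals (-1) · t, which reduces this case to scaling.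
      expand (⊖ t)   = ∼-trans (∼-sym (VT.uniqueˡ‿-ᴹ ((ℂ.- ℂ.1#) · t) t
          (∼-trans (⊕-cong ∼-refl (∼-sym (·-identityˡ t)))
            (∼-trans (∼-sym (·-distribʳ (ℂ.- ℂ.1#) ℂ.1# t)) (∼-trans (·-cong (ℂ.-‿inverseˡ ℂ.1#) ∼-refl) (VT.*ₗ-zeroˡ t))))))
        (expand-scale (ℂ.- ℂ.1#) t (⊖ t) (expand t) (λ κ → ℂ.sym (-1*x≈-x (coefficient t κ))))
      expand 𝟘 = ∼-sym (∑T.∑-zero (finite-Π F) λ κ → VT.*ₗ-zeroˡ (indicators κ))

    -- Each family of points consists of the blocks of one element of UL, their block sum. Equal
    -- values there make the coefficients equal, and with them the two expansions.
    evᵗ-injective : ∀ t u → (∀ τ X → HasPattern (UL-order A (star A τ)) X → evᵗ t τ (_∥_ X) ℂ.≈ evᵗ u τ (_∥_ X)) → _∼_ Factors t u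
    evᵗ-injective t u eq = ∼-trans (expand t) (∼-trans
      (∑T.∑-cong (finite-Π F) λ κ → ·-cong {t = indicators κ} (same κ) ∼-refl) (∼-sym (expand u)))
      where
      blocks : ∀ κ r → Matrices._≋_ ⟦ block A r ⟧ (matrices κ r) (_∣ᴹ_ 𝔽 (⨁ (matrices κ)) (block A r))
      blocks κ r i j = 𝔽.sym (𝔽.reflexive (⨁-in (matrices κ) r i j))
      same : ∀ κ → coefficient t κ ℂ.≈ coefficient u κ
      same κ = ℂ.trans (evᵗ-cong t {orders κ} {orders κ} (λ r → ≈ᵀ-refl {τ = orders κ r}) (blocks κ))
        (ℂ.trans (eq (orders κ) (⨁ (matrices κ)) (⨁-pattern (orders κ) (matrices κ) (λ r → within (κ r))))
          (ℂ.sym (evᵗ-cong u {orders κ} {orders κ} (λ r → ≈ᵀ-refl {τ = orders κ r}) (blocks κ))))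

    private

      module Onto (f : Mod.Carrierᴹ (cf⊕ 𝔽 A)) where

        element-of : (κ : Points) → UTElement (UL-order A (star A (orders κ)))
        element-of κ = ⨁ᵁ (orders κ) (matrices κ) (λ r → within (κ r))

        v : Points → ℂ.Carrier
        v κ = value (component f (orders κ)) (element-of κ)

        -- If w_r conjugates the r-th block, then the block sum of the w_r conjugates the block sum;
        -- as elements of UL are determined by their diagonal blocks, this is checked there. `X′` is
        -- the block sum for κ′ regarded in the group of κ, whose order is equal to that of κ′ only
        -- pointwise.
        v-cong : ∀ {κ κ′} → (∀ r → _~_ 𝔽 ⟦ block A r ⟧ (κ r) (κ′ r)) → v κ ℂ.≈ v κ′
        v-cong {κ} {κ′} c = ℂ.trans
          (class-function-conjugate {UL 𝔽 A (star A (orders κ))} (component f (orders κ)) W (element-of κ) X′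
            (UL-≋ (star A τ) (mat {π = π} (W ∙ element-of κ)) (mat {π = π} (X′ ∙ W))
              (pattern-π {π = π} (W ∙ element-of κ)) (pattern-π {π = π} (X′ ∙ W)) λ r → conjugated r))
          (component-cong f (λ r → _~_.order-≈ (c r)) X′ (element-of κ′) (λ i j → 𝔽.refl))
          where
          τ = orders κ
          π = UL-order A (star A τ)
          open FiniteGroup (UL 𝔽 A (star A τ)) using (_∙_)
          within′ : ∀ r → HasPattern (toPartial (τ r)) (matrices κ′ r)
          within′ r = HasPattern-resp 𝔽 (toPartial (orders κ′ r)) (toPartial (τ r))
            (≈ᵀ⇒⊆ᴾ 𝔽 {τ = orders κ′ r} {τ r} (≈ᵀ-sym {τ = τ r} {orders κ′ r} (_~_.order-≈ (c r)))) (matrices κ′ r) (matrices κ′ r)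
            (λ i j → 𝔽.refl) (within (κ′ r))
          W X′ : UTElement π
          W  = ⨁ᵁ τ (λ r → _~_.by (c r)) (λ r → _~_.by∈ (c r))
          X′ = ⨁ᵁ τ (matrices κ′) within′
          conjugated : ∀ r → Matrices._≋_ ⟦ block A r ⟧ (_∣ᴹ_ 𝔽 (mat {π = π} (W ∙ element-of κ)) (block A r))
                                                        (_∣ᴹ_ 𝔽 (mat {π = π} (X′ ∙ W)) (block A r))
          conjugated r = begin
            _∣ᴹ_ 𝔽 (mat {π = π} (W ∙ element-of κ)) (block A r)
              ≈⟨ _⟶_.homo (diagonal-block 𝔽 A τ r) W (element-of κ) ⟩
            _∣ᴹ_ 𝔽 (⨁ (λ r → _~_.by (c r))) (block A r) ⊡ _∣ᴹ_ 𝔽 (⨁ (matrices κ)) (block A r)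
              ≈⟨ ⊡-cong (≡-≋ (⨁-in (λ r → _~_.by (c r)) r)) (≡-≋ (⨁-in (matrices κ) r)) ⟩
            _~_.by (c r) ⊡ matrices κ r
              ≈⟨ _~_.eq (c r) ⟩
            matrices κ′ r ⊡ _~_.by (c r)
              ≈⟨ ⊡-cong (≡-≋ (⨁-in (matrices κ′) r)) (≡-≋ (⨁-in (λ r → _~_.by (c r)) r)) ⟨
            _∣ᴹ_ 𝔽 (⨁ (matrices κ′)) (block A r) ⊡ _∣ᴹ_ 𝔽 (⨁ (λ r → _~_.by (c r))) (block A r)
              ≈⟨ _⟶_.homo (diagonal-block 𝔽 A τ r) X′ W ⟨
            _∣ᴹ_ 𝔽 (mat {π = π} (X′ ∙ W)) (block A r) ∎
            where
            open Matrices ⟦ block A r ⟧ using (_⊡_; ⊡-cong; mat-setoid) renaming (_≋_ to _≋ʳ_)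
            open SetoidReasoning mat-setoid
            ≡-≋ : ∀ {M N : Mat ⟦ block A r ⟧} → (∀ i j → M i j ≡ N i j) → M ≋ʳ N
            ≡-≋ e i j = 𝔽.reflexive (e i j)

        preimage : Tensor Factors
        preimage = ∑T.∑ (finite-Π F) (λ κ → v κ · indicators κ)

        -- At the blocks of X the product of indicators vanishes except for the family of their
        -- classes. The Kronecker sum leaves the value of f at the block sum of the blocks of X,
        -- which is X since X lies in UL.
        preimage-value : ∀ τ (X : UTElement (UL-order A (star A τ))) →
                         evᵗ preimage τ (_∥_ (mat {π = UL-order A (star A τ)} X)) ℂ.≈ value (component f τ) X
        preimage-value τ X = begin
          evᵗ preimage τ Y
            ≈⟨ linear-∑ (⨂-isVectorSpace Factors) ℂ¹-isVectorSpace (λ t → evᵗ t τ Y) (evᵗ-linear τ Y) (finite-Π F) (λ κ → v κ · indicators κ) ⟩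
          ℂ∑.∑ (finite-Π F) (λ κ → v κ ℂ.* ∏ (λ r → ev 𝔽 (indicator 𝔽 ⟦ block A r ⟧ (κ r)) (τ r) (Y r)))
            ≈⟨ ℂ∑.∑-cong (finite-Π F) (λ κ → ℂ.trans (ℂ.*-congˡ {v κ} (delta κ))
                 (ℂ.trans (when-*ˡ (d κ) (v κ) _) (ℂ∑.when-congʳ (d κ) λ _ → ℂ.trans (ℂ.*-congˡ {v κ} (∏-one (length A))) (ℂ.*-identityʳ (v κ))))) ⟩
          ℂ∑.∑ (finite-Π F) (λ κ → ℂ∑.when (d κ) (v κ))
            ≈⟨ ℂ∑.∑-kronecker (finite-Π F) v (λ {κ} {κ′} → v-cong {κ} {κ′}) x d ⟩
          v x
            ≈⟨ value-cong (component f τ) {element-of x} {X}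
                 (UL-≋ (star A τ) (mat {π = UL-order A (star A τ)} (element-of x)) (mat {π = UL-order A (star A τ)} X)
                   (pattern-π {π = UL-order A (star A τ)} (element-of x)) (pattern-π {π = UL-order A (star A τ)} X)
                   λ r i j → 𝔽.reflexive (⨁-in (matrices x) r i j)) ⟩
          value (component f τ) X ∎
          where
          open SetoidReasoning ℂ.setoid
          Y : BlockMatrices
          Y = _∥_ (mat {π = UL-order A (star A τ)} X)
          x : Points
          x r = point (τ r) (Y r) (block-pattern τ {mat {π = UL-order A (star A τ)} X} (pattern-π {π = UL-order A (star A τ)} X) r)
          d : ∀ κ → Dec (∀ r → _~_ 𝔽 ⟦ block A r ⟧ (κ r) (x r))
          d κ = Fin.all? (λ r → _≟ᶜ_ 𝔽 ⟦ block A r ⟧ (κ r) (x r))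
          ∏-one : ∀ n → ∏ {n} (λ _ → ℂ.1#) ℂ.≈ ℂ.1#
          ∏-one zero    = ℂ.refl
          ∏-one (suc n) = ℂ.trans (ℂ.*-identityˡ (∏ {n} (λ _ → ℂ.1#))) (∏-one n)
          delta : ∀ κ → ∏ (λ r → ev 𝔽 (indicator 𝔽 ⟦ block A r ⟧ (κ r)) (τ r) (Y r)) ℂ.≈ ℂ∑.when (d κ) (∏ {length A} (λ _ → ℂ.1#))
          delta κ = ℂ.trans
            (∏-cong λ r → ℂ.trans (ev-at-point 𝔽 ⟦ block A r ⟧ (indicator 𝔽 ⟦ block A r ⟧ (κ r)) (x r)) (at-indicator 𝔽 ⟦ block A r ⟧ (κ r) (x r)))
            (∏-when (λ r → _≟ᶜ_ 𝔽 ⟦ block A r ⟧ (κ r) (x r)) (d κ) id id (λ _ → ℂ.1#))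

    opaque

      external-iso : IsLinearIso (obj⊗ (cf 𝔽) A) (cf⊕ 𝔽 A) (external 𝔽 A)
      external-iso = record
        { isLeftModuleMonomorphism = record
          { isLeftModuleHomomorphism = external-linear
          ; injective = λ {t} {u} e → evᵗ-injective t u λ τ X X∈ →
              let x = fromPattern 𝔽 (UL-order A (star A τ)) X X∈
              in ℂ.trans (ℂ.sym (external-value t τ x)) (ℂ.trans (e τ x) (external-value u τ x))
          }
        ; surjective = λ f → Onto.preimage f , λ {t} e τ X → ℂ.trans
            (LeftModuleMorphisms.IsLeftModuleHomomorphism.⟦⟧-cong external-linear {t} {Onto.preimage f} e τ X)
            (ℂ.trans (external-value (Onto.preimage f) τ X) (Onto.preimage-value f τ X))
        }

-- Values of products and coproducts

module _ {I : FinSet} (A : Composition I) where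

  Ascending : TotalOrder I → Set
  Ascending φ = ∀ i j → Asc A i j → (i , j) ∈ᵀ φ

  opaque

    ascending? : ∀ φ → Dec (Ascending φ)
    ascending? φ = ∀? I λ i → ∀? I λ j → (blockOf A i Fin.<? blockOf A j) Dec.→-dec T? (TotalOrder.rel φ i j)

  star-ascending : ∀ φ τ → star A τ ≈ᵀ φ → Ascending φ
  star-ascending φ τ e i j a = ≡.subst T (e i j) (star⁺ A τ (inj₂ a))

  -- Together with `star-ascending` this replaces the existence of τ with φ = τ₁ ⋆ ⋯ ⋆ τ_ℓ, on which
  -- `inflation` branches, by a condition on pairs.
  ascending-star : ∀ φ → Ascending φ → star A (restrictᵀ A φ) ≈ᵀ φ
  ascending-star φ asc i j = T-ext fwd bwd
    where
    τ = restrictᵀ A φ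
    fwd : (i , j) ∈ᵀ star A τ → (i , j) ∈ᵀ φ
    fwd t with star⁻ A τ t
    ... | inj₁ (r , p , p′ , u) = u
    ... | inj₂ a                = asc i j a
    bwd : (i , j) ∈ᵀ φ → (i , j) ∈ᵀ star A τ
    bwd t with Fin.<-cmp (blockOf A i) (blockOf A j)
    ... | tri< a _ _ = star⁺ A τ (inj₂ a)
    ... | tri≈ _ e _ = star⁺ A τ (inj₁ (blockOf A i , proj₂ (covers A i) , ≡.subst (λ r → T (block A r ∋ j)) (≡.sym e) (proj₂ (covers A j)) , t))
    ... | tri> _ _ a = ⊥-elim (Fin.<-irrefl (≡.cong (blockOf A) (IsTotalOrder.antisym (TotalOrder.isTotalOrder φ) (asc j i a) t)) a)

module _ {q : ℕ} (𝔽 : FiniteField q) where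

  open PatternGroups 𝔽
  open Matrices using (Mat)
  open UTElement using (mat; pattern-π)
  private module 𝔽 = FiniteField 𝔽

  restrict-pattern : {I : FinSet} (J : Subset I) (φ : TotalOrder I) (X : Mat I) →
                     HasPattern (toPartial φ) X → HasPattern (toPartial (φ ∣ᵀ J)) (_∣ᴹ_ 𝔽 X J)
  restrict-pattern J φ X X∈ = Pattern.hasPattern (toPartial (φ ∣ᵀ J))
    (λ ∉φ → Pattern.vanishes (toPartial φ) {X} X∈ ∉φ)
    (λ i → Pattern.unipotent (toPartial φ) {X} X∈ (proj₁ i))

  module _ {I : FinSet} (A : Composition I) where

    open Matrices I using (_≋_; module ≋)

    private
      inflate-value : ∀ t φ τ (e : star A τ ≈ᵀ φ) (X : UTElement (toPartial φ)) →
        value (inflate 𝔽 A φ τ e (component (external 𝔽 A t) τ)) X ℂ.≈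
        evᵗ 𝔽 A t (restrictᵀ A φ) (_∥_ 𝔽 A (mat {π = toPartial φ} X))
      inflate-value t φ τ e X = ℂ.trans (external-value 𝔽 A t τ D)
        (evᵗ-cong 𝔽 A t {τ} {restrictᵀ A φ} {_∥_ 𝔽 A (mat {π = UL-order A (star A τ)} D)} {_∥_ 𝔽 A (mat {π = toPartial φ} X)}
          (λ r i j → ≡.trans (≡.sym (restrict-star A τ r i j)) (e (proj₁ i) (proj₁ j)))
          (λ r i j → diagonal-Eq 𝔽 A (star A τ) (mat {π = toPartial φ} X)
            (≡.trans (blockOf-unique A (proj₂ i)) (≡.sym (blockOf-unique A (proj₂ j))))))
        where
        D : UTElement (UL-order A (star A τ))
        D = fun (projection 𝔽 A (star A τ)) (fun (inclusion 𝔽 (UT⊆UP 𝔽 A φ τ e)) X)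

      inflation-cases : ∀ f φ (X : UTElement (toPartial φ)) (z : ℂ.Carrier) →
        (∀ τ e → value (inflate 𝔽 A φ τ e (component f τ)) X ℂ.≈ z) → (¬ (∃[ τ ] star A τ ≈ᵀ φ) → ℂ.0# ℂ.≈ z) →
        value (component (inflation 𝔽 A f) φ) X ℂ.≈ z
      inflation-cases f φ X z if-star if-not with star? A φ
      ... | yes (τ , e) = if-star τ e
      ... | no ¬e       = if-not ¬e

    μ-ev : ∀ t φ X → HasPattern (toPartial φ) X →
           ev 𝔽 (μ 𝔽 A t) φ X ℂ.≈ ℂ∑.when (ascending? A φ) (evᵗ 𝔽 A t (restrictᵀ A φ) (_∥_ 𝔽 A X))
    μ-ev t φ X X∈ = ℂ.trans (ev-fromPattern 𝔽 (μ 𝔽 A t) φ X X∈) (inflation-cases (external 𝔽 A t) φ (fromPattern 𝔽 (toPartial φ) X X∈)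
      (ℂ∑.when (ascending? A φ) (evᵗ 𝔽 A t (restrictᵀ A φ) (_∥_ 𝔽 A X)))
      (λ τ e → ℂ.trans (inflate-value t φ τ e (fromPattern 𝔽 (toPartial φ) X X∈)) (ℂ.sym (ℂ∑.when-yes (ascending? A φ) (star-ascending A φ τ e))))
      (λ ¬e → ℂ.sym (ℂ∑.when-no (ascending? A φ) λ asc → ¬e (restrictᵀ A φ , ascending-star A φ asc))))

    mean : ClassFunctions 𝔽 I → TotalOrder I → Mat I → ℂ.Carrier
    mean f φ X = 𝔼 𝔽 I (λ Z → ev 𝔽 f φ (patch 𝔽 A φ X Z))

    private

      restricted : ∀ (f : ClassFunctions 𝔽 I) φ τ (e : ∀ r → restrictᵀ A φ r ≈ᵀ τ r) → ClassFunction (UL 𝔽 A (star A τ))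
      restricted f φ τ e = Res (inclusion 𝔽 {π = UL-order A (star A τ)} {ρ = UL-order A φ} (UL-star⊆UL 𝔽 A φ τ e)) (Resf 𝔽 A φ (component f φ))

      restricted-value : ∀ f φ τ e (X : UTElement (UL-order A (star A τ))) →
        value (restricted f φ τ e) X ℂ.≈ mean f φ (mat {π = UL-order A (star A τ)} X)
      restricted-value f φ τ e X = ℂ.trans (Def-patch 𝔽 A φ (Res ι (component f φ)) X′)
        (𝔼-cong 𝔽 I λ Z → ℂ.sym (ev-value 𝔽 f {φ} {patch 𝔽 A φ (mat {π = UL-order A (star A τ)} X) Z}
          (fun ι (patchᵁ 𝔽 A φ X′ Z)) (λ i j → 𝔽.refl)))
        where
        ι : UP 𝔽 A φ ⟶ UT (toPartial φ)
        ι = inclusion 𝔽 (UP⊆τ 𝔽 A φ)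
        X′ : UTElement (UL-order A φ)
        X′ = fun (inclusion 𝔽 {π = UL-order A (star A τ)} {ρ = UL-order A φ} (UL-star⊆UL 𝔽 A φ τ e)) X

      opaque

        summand : ClassFunctions 𝔽 I → (τ : BlockOrders A) → UTElement (UL-order A (star A τ)) → TotalOrder I → ℂ.Carrier
        summand f τ X φ = ℂ∑.when (restricts-to? A φ τ) (mean f φ (mat {π = UL-order A (star A τ)} X))

        summand-yes : ∀ f τ X φ e → summand f τ X φ ℂ.≈ value (restricted f φ τ e) X
        summand-yes f τ X φ e = ℂ.trans (ℂ∑.when-yes (restricts-to? A φ τ) e) (ℂ.sym (restricted-value f φ τ e X))

        summand-no : ∀ f τ X φ → ¬ (∀ r → restrictᵀ A φ r ≈ᵀ τ r) → summand f τ X φ ℂ.≈ ℂ.0#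
        summand-no f τ X φ ¬e = ℂ∑.when-no (restricts-to? A φ τ) ¬e

        summand-≈ : ∀ f τ X φ → summand f τ X φ ℂ.≈ ℂ∑.when (restricts-to? A φ τ) (mean f φ (mat {π = UL-order A (star A τ)} X))
        summand-≈ f τ X φ = ℂ.refl

      value-∑ᶠ-∑ : {G : FiniteGroup} {S : Setoid 0ℓ 0ℓ} (F : Finite S) (ψ : Fin (size F) → ClassFunction G) (X : FiniteGroup.Carrier G)
                   (y : Setoid.Carrier S → ℂ.Carrier) →
                   (∀ k → value (ψ k) X ℂ.≈ y (element F k)) → value (∑ᶠ ψ) X ℂ.≈ ℂ∑.∑ F y
      value-∑ᶠ-∑ F ψ X y e = ℂ.trans (value-∑ᶠ 𝔽 ψ X) (ℂ∑.sum-cong-≋ e)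

      mutual

        restriction-summands : ∀ f τ X → value (component (restriction 𝔽 A f) τ) X ℂ.≈
                               ℂ∑.∑ (finite-total-orders {I}) (summand f τ X)

        restriction-summand : ∀ f (τ : BlockOrders A) (X : UTElement (UL-order A (star A τ))) (k : Fin (size (finite-total-orders {I}))) → _

        picked-order : _ → TotalOrder I

        picked-summand : ∀ f (τ : BlockOrders A) (X : UTElement (UL-order A (star A τ))) x → _ ℂ.≈ summand f τ X (picked-order x)

        picked-order x = _

        restriction-summands f τ X = value-∑ᶠ-∑ (finite-total-orders {I}) _ X (summand f τ X) (restriction-summand f τ X)

        -- With n elements in I there are `(2 ^ n) ^ n` Boolean relations, from which the
        -- enumeration picks the total orders. Abstracting the picked relation x exposes the
        -- decision made in `restriction` to a case distinction.
        restriction-summand f τ X k with pick {(2 ℕ.^ size (finite I)) ℕ.^ size (finite I)} _ k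
        ... | x = picked-summand f τ X x

        picked-summand f τ X x with restricts-to? A (picked-order x) τ
        ... | yes e = ℂ.sym (summand-yes f τ X _ e)
        ... | no ¬e = ℂ.sym (summand-no f τ X _ ¬e)

    restriction-value : ∀ f τ (X : UTElement (UL-order A (star A τ))) →
      value (component (restriction 𝔽 A f) τ) X ℂ.≈
      ℂ∑.∑ (finite-total-orders {I}) (λ φ → ℂ∑.when (restricts-to? A φ τ) (mean f φ (mat {π = UL-order A (star A τ)} X)))
    restriction-value f τ X = ℂ.trans (restriction-summands f τ X) (ℂ∑.∑-cong (finite-total-orders {I}) (summand-≈ f τ X))

    opaque

      δ : ClassFunctions 𝔽 I → Tensor (Factors 𝔽 A)
      δ = Δ 𝔽 (external-iso 𝔽) A

      -- The coproduct is a chosen preimage of the restriction; this property is how its values are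
      -- obtained.
      external-δ : ∀ f → Mod._≈ᴹ_ (cf⊕ 𝔽 A) (external 𝔽 A (δ f)) (restriction 𝔽 A f)
      external-δ f = proj₂ (LeftModuleMorphisms.IsLeftModuleIsomorphism.surjective (external-iso 𝔽 A) (restriction 𝔽 A f)) {δ f} ∼-refl

    -- `patch` reads X only at positions in Eq(A) and φ only as a relation.
    mean-cong : ∀ f {φ φ′ X X′} → φ ≈ᵀ φ′ → (∀ i j → Eq A i j → X i j 𝔽.≈ X′ i j) → mean f φ X ℂ.≈ mean f φ′ X′
    mean-cong f {φ} {φ′} {X} {X′} e e′ = 𝔼-cong 𝔽 I λ Z → ev-cong 𝔽 f {φ} {φ′} {patch 𝔽 A φ X Z} {patch 𝔽 A φ′ X′ Z} e
      (≋.trans {patch 𝔽 A φ X Z} {patch 𝔽 A φ X′ Z} (patch-cong 𝔽 A φ {X} {X′} {Z} {Z} e′ (λ i j _ → 𝔽.refl))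
        (patch-order Z))
      where
      patch-order : ∀ Z → patch 𝔽 A φ X′ Z ≋ patch 𝔽 A φ′ X′ Z
      patch-order Z i j with Dec.toSum (blockOf A i Fin.≟ blockOf A j) | Dec.toSum (free? 𝔽 A φ i j)
      ... | inj₁ eq | _ = 𝔽.trans (patch-Eq 𝔽 A φ {X′} {Z} eq) (𝔽.sym (patch-Eq 𝔽 A φ′ {X′} {Z} eq))
      ... | inj₂ _ | inj₁ (t , a) = 𝔽.trans (patch-free 𝔽 A φ {X′} {Z} (t , a)) (𝔽.sym (patch-free 𝔽 A φ′ {X′} {Z} (≡.subst T (e i j) t , a)))
      ... | inj₂ ¬e | inj₂ ¬f = 𝔽.trans (patch-off 𝔽 A φ {X′} {Z} ¬e ¬f) (𝔽.sym (patch-off 𝔽 A φ′ {X′} {Z} ¬e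
                                λ (t , a) → ¬f (≡.subst T (≡.sym (e i j)) t , a)))

    evᵗ-0 : ∀ t τ Y r → ¬ HasPattern (toPartial (τ r)) (Y r) → evᵗ 𝔽 A t τ Y ℂ.≈ ℂ.0#
    evᵗ-0 t τ Y r ∉ = agree (Factors 𝔽 A) (evᵗ-functional 𝔽 A τ Y) zero-functional
      (λ m → ∏-zero r (λ s → ev 𝔽 (m s) (τ s) (Y s)) (ev-0 𝔽 (m r) (τ r) (Y r) ∉)) t
      where
      zero-functional : IsFunctional (Factors 𝔽 A) (λ _ → ℂ.0#)
      zero-functional = when-functional (Factors 𝔽 A) never {λ t → evᵗ 𝔽 A t τ Y} (evᵗ-functional 𝔽 A τ Y)
        where
        never : Dec ⊥
        never = no λ ()
      ∏-zero : ∀ {n} (r : Fin n) (g : Fin n → ℂ.Carrier) → g r ℂ.≈ ℂ.0# → ∏ g ℂ.≈ ℂ.0#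
      ∏-zero zero    g e = ℂ.trans (ℂ.*-congʳ e) (ℂ.zeroˡ (∏ (g ∘ suc)))
      ∏-zero (suc r) g e = ℂ.trans (ℂ.*-congˡ {g zero} (∏-zero r (g ∘ suc) e)) (ℂ.zeroʳ (g zero))

    -- X may be any matrix with the diagonal blocks Y, which leaves its other entries to be chosen
    -- later. If some Y_r lies outside UT(τ_r), both sides are 0: for an order that restricts to τ,
    -- all matrices averaged have the blocks Y and so lie outside its group.
    δ-ev : ∀ f τ Y X → (∀ r → Matrices._≋_ ⟦ block A r ⟧ (_∣ᴹ_ 𝔽 X (block A r)) (Y r)) →
           evᵗ 𝔽 A (δ f) τ Y ℂ.≈ ℂ∑.∑ finite-total-orders (λ φ → ℂ∑.when (restricts-to? A φ τ) (mean f φ X))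
    δ-ev f τ Y X X∥≋Y = go (Fin.all? λ r → pattern? 𝔽 (τ r) (Y r))
      where
      ⨁∥ : ∀ r → Matrices._≋_ ⟦ block A r ⟧ (Y r) (_∣ᴹ_ 𝔽 (⨁ 𝔽 A Y) (block A r))
      ⨁∥ r i j = 𝔽.sym (𝔽.reflexive (⨁-in 𝔽 A Y r i j))
      ⨁≈X : ∀ i j → Eq A i j → ⨁ 𝔽 A Y i j 𝔽.≈ X i j
      ⨁≈X i j e = 𝔽.trans (𝔽.reflexive (⨁-in 𝔽 A Y (blockOf A i) (i , proj₂ (covers A i)) (j , in-block 𝔽 A e)))
        (𝔽.sym (X∥≋Y (blockOf A i) (i , proj₂ (covers A i)) (j , in-block 𝔽 A e)))
      go : Dec (∀ r → HasPattern (toPartial (τ r)) (Y r)) →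
           evᵗ 𝔽 A (δ f) τ Y ℂ.≈ ℂ∑.∑ finite-total-orders (λ φ → ℂ∑.when (restricts-to? A φ τ) (mean f φ X))
      go (yes Y∈) = begin
        evᵗ 𝔽 A (δ f) τ Y
          ≈⟨ evᵗ-cong 𝔽 A (δ f) {τ} {τ} {Y} {_∥_ 𝔽 A (⨁ 𝔽 A Y)} (λ r → ≈ᵀ-refl {τ = τ r}) ⨁∥ ⟩
        evᵗ 𝔽 A (δ f) τ (_∥_ 𝔽 A (⨁ 𝔽 A Y))
          ≈⟨ external-value 𝔽 A (δ f) τ (⨁ᵁ 𝔽 A τ Y Y∈) ⟨
        value (component (external 𝔽 A (δ f)) τ) (⨁ᵁ 𝔽 A τ Y Y∈)
          ≈⟨ external-δ f τ (⨁ᵁ 𝔽 A τ Y Y∈) ⟩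
        value (component (restriction 𝔽 A f) τ) (⨁ᵁ 𝔽 A τ Y Y∈)
          ≈⟨ restriction-value f τ (⨁ᵁ 𝔽 A τ Y Y∈) ⟩
        ℂ∑.∑ finite-total-orders (λ φ → ℂ∑.when (restricts-to? A φ τ) (mean f φ (⨁ 𝔽 A Y)))
          ≈⟨ ℂ∑.∑-cong finite-total-orders (λ φ → ℂ∑.when-congʳ (restricts-to? A φ τ) λ _ → mean-cong f {φ} {φ} {⨁ 𝔽 A Y} {X} (≈ᵀ-refl {τ = φ}) ⨁≈X) ⟩
        ℂ∑.∑ finite-total-orders (λ φ → ℂ∑.when (restricts-to? A φ τ) (mean f φ X)) ∎
        where open SetoidReasoning ℂ.setoid
      go (no ∉) = ℂ.trans (evᵗ-0 (δ f) τ Y r Y∉) (ℂ.sym (ℂ∑.∑-zero finite-total-orders λ φ → vanish φ (restricts-to? A φ τ)))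
        where
        bad : ∃[ r ] ¬ HasPattern (toPartial (τ r)) (Y r)
        bad = Fin.¬∀⟶∃¬ (length A) _ (λ r → pattern? 𝔽 (τ r) (Y r)) ∉
        r : Fin (length A)
        r = proj₁ bad
        Y∉ : ¬ HasPattern (toPartial (τ r)) (Y r)
        Y∉ = proj₂ bad
        vanish : ∀ φ → (d : Dec (∀ r → restrictᵀ A φ r ≈ᵀ τ r)) → ℂ∑.when d (mean f φ X) ℂ.≈ ℂ.0#
        vanish φ (no _)  = ℂ.refl
        vanish φ (yes e) = ℂ.trans (𝔼-cong 𝔽 I {λ Z → ev 𝔽 f φ (patch 𝔽 A φ X Z)} {λ _ → ℂ.0#} λ Z → ev-0 𝔽 f φ (patch 𝔽 A φ X Z) (excluded Z))
            (E-const (Matrices.finite-matrices I) (matrices-nonZero 𝔽 I) ℂ.0#)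
          where
          excluded : ∀ Z → ¬ HasPattern (toPartial φ) (patch 𝔽 A φ X Z)
          excluded Z ∈φ = Y∉ (HasPattern-resp 𝔽 (toPartial (φ ∣ᵀ block A r)) (toPartial (τ r)) (≈ᵀ⇒⊆ᴾ 𝔽 {τ = φ ∣ᵀ block A r} {τ r} (e r))
            (_∣ᴹ_ 𝔽 (patch 𝔽 A φ X Z) (block A r)) (Y r)
            (λ i j → 𝔽.trans (patch-Eq 𝔽 A φ {X} {Z} (≡.trans (blockOf-unique A (proj₂ i)) (≡.sym (blockOf-unique A (proj₂ j))))) (X∥≋Y r i j))
            (restrict-pattern (block A r) φ (patch 𝔽 A φ X Z) ∈φ))

-- Regrouping tensor factors

module _ {X : Set} where

  -- The blocks of a concatenation are indexed by positions in a list made by `concatMap`, so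
  -- products over them are computed by recursion on lists.
  ∏ˡ : List X → (X → ℂ.Carrier) → ℂ.Carrier
  ∏ˡ xs g = ∏ (λ k → g (List.lookup xs k))

  ∏ˡ-++ : ∀ xs ys g → ∏ˡ (xs List.++ ys) g ℂ.≈ ∏ˡ xs g ℂ.* ∏ˡ ys g
  ∏ˡ-++ []       ys g = ℂ.sym (ℂ.*-identityˡ (∏ˡ ys g))
  ∏ˡ-++ (x ∷ xs) ys g = ℂ.trans (ℂ.*-congˡ {g x} (∏ˡ-++ xs ys g)) (ℂ.sym (ℂ.*-assoc (g x) (∏ˡ xs g) (∏ˡ ys g)))

∏ˡ-tabulate : ∀ {X : Set} {n} (f : Fin n → X) g → ∏ˡ (List.tabulate f) g ℂ.≈ ∏ (g ∘ f)
∏ˡ-tabulate {n = zero}  f g = ℂ.refl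
∏ˡ-tabulate {n = suc n} f g = ℂ.*-congˡ {g (f zero)} (∏ˡ-tabulate (f ∘ suc) g)

∏ˡ-map : ∀ {X Y : Set} (f : X → Y) xs g → ∏ˡ (List.map f xs) g ℂ.≈ ∏ˡ xs (g ∘ f)
∏ˡ-map f []       g = ℂ.refl
∏ˡ-map f (x ∷ xs) g = ℂ.*-congˡ {g (f x)} (∏ˡ-map f xs g)

∏ˡ-concatMap : ∀ {X Y : Set} (h : X → List Y) xs g → ∏ˡ (concatMap h xs) g ℂ.≈ ∏ˡ xs (λ x → ∏ˡ (h x) g)
∏ˡ-concatMap h []       g = ℂ.refl
∏ˡ-concatMap h (x ∷ xs) g = ℂ.trans (∏ˡ-++ (h x) (concatMap h xs) g) (ℂ.*-congˡ {∏ˡ (h x) g} (∏ˡ-concatMap h xs g))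

∏-cong-≡ : ∀ {n} {f g : Fin n → ℂ.Carrier} → (∀ r → f r ≡ g r) → ∏ f ℂ.≈ ∏ g
∏-cong-≡ e = ∏-cong λ r → ℂ.reflexive (e r)

module _ {I : FinSet} (A : Composition I) (D : ∀ r → Composition ⟦ block A r ⟧) where

  ∏-position : ∀ (g : Position A D → ℂ.Carrier) → ∏ (λ k → g (position A D k)) ℂ.≈ ∏ (λ r → ∏ (λ s → g (r , s)))
  ∏-position g = begin
    ∏ˡ (pairs A D) g
      ≈⟨ ∏ˡ-concatMap (λ r → List.map (r ,_) (allFin (length (D r)))) (allFin (length A)) g ⟩
    ∏ˡ (allFin (length A)) (λ r → ∏ˡ (List.map (r ,_) (allFin (length (D r)))) g)
      ≈⟨ ∏ˡ-tabulate id (λ r → ∏ˡ (List.map (r ,_) (allFin (length (D r)))) g) ⟩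
    ∏ (λ r → ∏ˡ (List.map (r ,_) (allFin (length (D r)))) g)
      ≈⟨ ∏-cong (λ r → ℂ.trans (∏ˡ-map (r ,_) (allFin (length (D r))) g) (∏ˡ-tabulate id (λ s → g (r , s)))) ⟩
    ∏ (λ r → ∏ (λ s → g (r , s))) ∎
    where open SetoidReasoning ℂ.setoid

  index-of-position : ∀ k → index-of A D (position A D k) ≡ k
  index-of-position k = lookup-injective (pairs-unique A D) (≡.sym (position-index-of A D (position A D k)))

  ∏-index-of : ∀ (g : Fin (length (concatenation A D)) → ℂ.Carrier) → ∏ (λ r → ∏ (λ s → g (index-of A D (r , s)))) ℂ.≈ ∏ g
  ∏-index-of g = ℂ.trans (ℂ.sym (∏-position (λ x → g (index-of A D x)))) (∏-cong-≡ λ k → ≡.cong g (index-of-position k))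

module _ {q : ℕ} (𝔽 : FiniteField q) where

  open PatternGroups 𝔽
  open Matrices using (Mat)
  open Rearrangement (cf 𝔽)
  private module 𝔽 = FiniteField 𝔽

  private
    _⇂_ : {I : FinSet} → Mat I → (J : Subset I) → Mat ⟦ J ⟧
    _⇂_ = _∣ᴹ_ 𝔽

    _⇊_ : {I : FinSet} → Mat I → (A : Composition I) → BlockMatrices 𝔽 A
    X ⇊ A = _∥_ 𝔽 A X

  opaque

    -- With one order and one matrix on all of I, tensors over different compositions can be
    -- compared: permuting or regrouping the factors leaves this value unchanged.
    evʳ : {I : FinSet} (A : Composition I) → Tensor (Factors 𝔽 A) → TotalOrder I → Mat I → ℂ.Carrier
    evʳ A t φ X = evᵗ 𝔽 A t (restrictᵀ A φ) (X ⇊ A)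

    evʳ-linear : {I : FinSet} (A : Composition I) (φ : TotalOrder I) (X : Mat I) →
                 IsLinear (obj⊗ (cf 𝔽) A) ℂ¹ (λ t → evʳ A t φ X)
    evʳ-linear A φ X = evᵗ-linear 𝔽 A (restrictᵀ A φ) (X ⇊ A)

    μ-evʳ : {I : FinSet} (A : Composition I) → ∀ t φ X → HasPattern (toPartial φ) X →
            ev 𝔽 (μ 𝔽 A t) φ X ℂ.≈ ℂ∑.when (ascending? A φ) (evʳ A t φ X)
    μ-evʳ A = μ-ev 𝔽 A

    evʳ-functional : {I : FinSet} (A : Composition I) (φ : TotalOrder I) (X : Mat I) →
                     IsFunctional (Factors 𝔽 A) (λ t → evʳ A t φ X)
    evʳ-functional A φ X = evᵗ-functional 𝔽 A (restrictᵀ A φ) (X ⇊ A)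

    -- Every family of block orders is the restriction of its ordinal sum, so nothing is lost by
    -- evaluating at orders of I only.
    evʳ-injective : {I : FinSet} (A : Composition I) → ∀ t u →
      (∀ φ X → (∀ r → HasPattern (toPartial (φ ∣ᵀ block A r)) (X ⇂ block A r)) → evʳ A t φ X ℂ.≈ evʳ A u φ X) →
      _∼_ (Factors 𝔽 A) t u
    evʳ-injective A t u e = evᵗ-injective 𝔽 A t u λ τ X X∈ → ℂ.trans
      (evᵗ-cong 𝔽 A t {τ} {restrictᵀ A (star A τ)} {X ⇊ A} {X ⇊ A} (back τ) (λ r i j → 𝔽.refl))
      (ℂ.trans (e (star A τ) X (λ r → HasPattern-resp 𝔽 (toPartial (τ r)) (toPartial (star A τ ∣ᵀ block A r))
          (≈ᵀ⇒⊆ᴾ 𝔽 {τ = τ r} {star A τ ∣ᵀ block A r} (back τ r)) (X ⇂ block A r) (X ⇂ block A r) (λ i j → 𝔽.refl)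
          (block-pattern 𝔽 A τ {X} X∈ r)))
        (ℂ.sym (evᵗ-cong 𝔽 A u {τ} {restrictᵀ A (star A τ)} {X ⇊ A} {X ⇊ A} (back τ) (λ r i j → 𝔽.refl))))
      where
      back : ∀ τ r → τ r ≈ᵀ restrictᵀ A (star A τ) r
      back τ r i j = ≡.sym (restrict-star A τ r i j)

  module _ {I : FinSet} (A B : Composition I) (match : ∀ l → ∃[ k ] block A k ≐ block B l) where

    private
      partner : Fin (length B) → Fin (length A)
      partner l = proj₁ (match l)

      partner⁻¹ : Fin (length A) → Fin (length B)
      partner⁻¹ k = blockOf B (proj₁ (nonempty A k))

      same-index : ∀ {k l i} → T (block A k ∋ i) → T (block B l ∋ i) → partner l ≡ k
      same-index {k} {l} {i} p p′ = disjoint A (≡.subst T (≡.sym (proj₂ (match l) i)) p′) p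

      -- Blocks are nonempty and disjoint: the block of B that contains a given element of the k-th
      -- block of A can be matched only with k. Thus `match`, given as a function in one direction,
      -- is a bijection.
      permutation : Permutation (length B) (length A)
      permutation = mk↔ₛ′ partner partner⁻¹
        (λ k → same-index (proj₂ (nonempty A k)) (proj₂ (covers B (proj₁ (nonempty A k)))))
        (λ l → blockOf-unique B (≡.subst T (proj₂ (match l) (proj₁ (nonempty A (partner l)))) (proj₂ (nonempty A (partner l)))))

      same : ∀ l → ⟦ block A (partner l) ⟧ ≃ ⟦ block B l ⟧
      same l = same-≃ {S = block A (partner l)} {S′ = block B l} (proj₂ (match l))

    opaque
      unfolding evʳ

      rearrange-ev : ∀ t φ X → evʳ B (rearrange A B match t) φ X ℂ.≈ evʳ A t φ X
      rearrange-ev t φ X = agree (Factors 𝔽 A)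
        (extend-∘-functional (evʳ-functional B φ X) (λ m → pure (λ l → cf-map 𝔽 (same l) (m (partner l)))))
        (evʳ-functional A φ X) on-pure t
        where
        on-pure : ∀ (m : ∀ k → ClassFunctions 𝔽 ⟦ block A k ⟧) → ∏ (λ l → ev 𝔽 (cf-map 𝔽 (same l) (m (partner l))) (φ ∣ᵀ block B l) (X ⇂ block B l)) ℂ.≈
                        ∏ (λ k → ev 𝔽 (m k) (φ ∣ᵀ block A k) (X ⇂ block A k))
        on-pure m = ℂ.trans
          (∏-cong λ l → ℂ.trans (ev-map 𝔽 (same l) (m (partner l)) (φ ∣ᵀ block B l) (X ⇂ block B l))
            (ev-cong 𝔽 (m (partner l)) {transportᵀ (sym-≃ (same l)) (φ ∣ᵀ block B l)} {φ ∣ᵀ block A (partner l)}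
               {_^ᴹ_ 𝔽 (X ⇂ block B l) (same l)} {X ⇂ block A (partner l)}
               (λ i j → refl) (λ i j → 𝔽.refl)))
          (ℂ.sym (ℂ∏.sum-permute (λ k → ev 𝔽 (m k) (φ ∣ᵀ block A k) (X ⇂ block A k)) permutation))

  module _ {I : FinSet} (A : Composition I) (D : ∀ r → Composition ⟦ block A r ⟧) where

    private
      C = concatenation A D

    nestedʳ : (∀ r → Tensor (Factors 𝔽 (D r))) → TotalOrder I → Mat I → ℂ.Carrier
    nestedʳ u φ X = ∏ (λ r → evʳ (D r) (u r) (φ ∣ᵀ block A r) (X ⇂ block A r))

    private
      M : ∀ r → Fin (length (D r)) → Mod
      M r = Factors 𝔽 (D r)

      at-block : ∀ φ X (x : Position A D) → ClassFunctions 𝔽 ⟦ block (D (proj₁ x)) (proj₂ x) ⟧ → ℂ.Carrier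
      at-block φ X (r , s) f = ev 𝔽 f ((φ ∣ᵀ block A r) ∣ᵀ block (D r) s) ((X ⇂ block A r) ⇂ block (D r) s)

      at-image : ∀ φ X (x : Position A D) → ClassFunctions 𝔽 ⟦ image (block A (proj₁ x)) (block (D (proj₁ x)) (proj₂ x)) ⟧ → ℂ.Carrier
      at-image φ X (r , s) f = ev 𝔽 f (φ ∣ᵀ image (block A r) (block (D r) s)) (X ⇂ image (block A r) (block (D r) s))

      map-image : ∀ φ X (x : Position A D) f →
        at-image φ X x (cf-map 𝔽 (image-≃ (block A (proj₁ x)) (block (D (proj₁ x)) (proj₂ x))) f) ℂ.≈ at-block φ X x f
      map-image φ X (r , s) f = ℂ.trans (ev-map 𝔽 σ f φ′ X′)
        (ev-cong 𝔽 f {transportᵀ (sym-≃ σ) φ′} {(φ ∣ᵀ block A r) ∣ᵀ block (D r) s} {_^ᴹ_ 𝔽 X′ σ} {(X ⇂ block A r) ⇂ block (D r) s}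
          (λ i j → refl) (λ i j → 𝔽.refl))
        where
        σ = image-≃ (block A r) (block (D r) s)
        φ′ = φ ∣ᵀ image (block A r) (block (D r) s)
        X′ = X ⇂ image (block A r) (block (D r) s)

      -- `split` transports along an equality between a position and the position of its index. With
      -- both ends variable the equality can be matched with `refl` and the transport disappears.
      map-image⁻¹ : ∀ φ X (x y : Position A D) (e : x ≡ y)
        (f : ClassFunctions 𝔽 ⟦ image (block A (proj₁ y)) (block (D (proj₁ y)) (proj₂ y)) ⟧) →
        at-block φ X x (cf-map 𝔽 (sym-≃ (image-≃ (block A (proj₁ x)) (block (D (proj₁ x)) (proj₂ x))))
          (≡.subst (λ (r , s) → ClassFunctions 𝔽 ⟦ image (block A r) (block (D r) s) ⟧) (≡.sym e) f)) ℂ.≈ at-image φ X y f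
      map-image⁻¹ φ X (r , s) .(r , s) refl f = ℂ.trans
        (ev-map 𝔽 (sym-≃ σ) f ((φ ∣ᵀ block A r) ∣ᵀ block (D r) s) ((X ⇂ block A r) ⇂ block (D r) s))
        (ev-cong 𝔽 f {transportᵀ (sym-≃ (sym-≃ σ)) ((φ ∣ᵀ block A r) ∣ᵀ block (D r) s)} {φ ∣ᵀ image (block A r) (block (D r) s)}
          {_^ᴹ_ 𝔽 ((X ⇂ block A r) ⇂ block (D r) s) (sym-≃ σ)} {X ⇂ image (block A r) (block (D r) s)}
          (λ i j → refl) (λ i j → 𝔽.refl))
        where
        σ = image-≃ (block A r) (block (D r) s)

      merge-flat : (∀ x → Mod.Carrierᴹ (Flat M x)) → Tensor (Factors 𝔽 C)
      merge-flat m = pure (λ k → let (r , s) = position A D k in cf-map 𝔽 (image-≃ (block A r) (block (D r) s)) (m (r , s)))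

    ⨂μ : Tensor (λ r → ⨂ (M r)) → Tensor (Factors 𝔽 A)
    ⨂μ = ⨂-map {M = λ r → ⨂ (M r)} {N = Factors 𝔽 A} (λ r → μ 𝔽 (D r))

    opaque
      unfolding evʳ

      merge-functional : ∀ φ X → IsFunctional (λ r → ⨂ (M r)) (λ t → evʳ C (merge A D t) φ X)
      merge-functional φ X = extend-∘-functional
        (extend-∘-functional (evʳ-functional C φ X) merge-flat) (flattenPure M)

      merge-ev : ∀ u φ X → evʳ C (merge A D (pure u)) φ X ℂ.≈ nestedʳ u φ X
      merge-ev u φ X = ℂ.trans
        (agree (Flat M) (extend-∘-functional (evʳ-functional C φ X) merge-flat)
          (extend-functional (Flat M) (λ m → ∏ (λ r → ∏ (λ s → at-block φ X (r , s) (m (r , s))))))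
          (λ m → ℂ.trans (∏-cong λ k → map-image φ X (position A D k) (m (position A D k)))
                         (∏-position A D (λ x → at-block φ X x (m x))))
          (flattenPure M u))
        (extend-flatten M (λ r n → ∏ (λ s → at-block φ X (r , s) (n s))) u)

      -- In compatibility `split` is followed by products of the factors, whose values `⨂μ-ev`
      -- expresses through `merge`; there this composite cancels.
      merge-split-ev : ∀ u φ X → evʳ C (merge A D (split A D u)) φ X ℂ.≈ evʳ C u φ X
      merge-split-ev u φ X = agree (Factors 𝔽 C)
        (extend-∘-functional (merge-functional φ X) splitPure)
        (evʳ-functional C φ X)
        (λ m → ℂ.trans (merge-ev (splits m) φ X)
          (ℂ.trans (∏-cong λ r → ∏-cong λ s →
              map-image⁻¹ φ X (r , s) (position A D (index-of A D (r , s))) (position-index-of A D (r , s)) (m (index-of A D (r , s))))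
            (∏-index-of A D (λ k → at-image φ X (position A D k) (m k)))))
        u
        where
        splits : (∀ k → Mod.Carrierᴹ (Factors 𝔽 C k)) → ∀ r → Tensor (M r)
        splits m r = pure (λ s → cf-map 𝔽 (sym-≃ (image-≃ (block A r) (block (D r) s)))
          (≡.subst (λ (r , s) → ClassFunctions 𝔽 ⟦ image (block A r) (block (D r) s) ⟧)
            (≡.sym (position-index-of A D (r , s))) (m (index-of A D (r , s)))))
        splitPure : (∀ k → Mod.Carrierᴹ (Factors 𝔽 C k)) → Tensor (λ r → ⨂ (M r))
        splitPure m = pure (splits m)

      ⨂μ-ev : ∀ t φ X → (∀ r → HasPattern (toPartial (φ ∣ᵀ block A r)) (X ⇂ block A r)) →
        evʳ A (⨂μ t) φ X ℂ.≈
        ℂ∑.when (Fin.all? (λ r → ascending? (D r) (φ ∣ᵀ block A r))) (evʳ C (merge A D t) φ X)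
      ⨂μ-ev t φ X X∈ = agree (λ r → ⨂ (M r))
        (extend-∘-functional (evʳ-functional A φ X) (λ u → pure (λ r → μ 𝔽 (D r) (u r))))
        (when-functional (λ r → ⨂ (M r)) (Fin.all? (λ r → ascending? (D r) (φ ∣ᵀ block A r))) (merge-functional φ X))
        (λ u → ℂ.trans (∏-cong λ r → μ-evʳ (D r) (u r) (φ ∣ᵀ block A r) (X ⇂ block A r) (X∈ r))
          (ℂ.trans (∏-when (λ r → ascending? (D r) (φ ∣ᵀ block A r)) (Fin.all? (λ r → ascending? (D r) (φ ∣ᵀ block A r))) id id
              (λ r → evʳ (D r) (u r) (φ ∣ᵀ block A r) (X ⇂ block A r)))
            (ℂ∑.when-congʳ (Fin.all? (λ r → ascending? (D r) (φ ∣ᵀ block A r))) λ _ → ℂ.sym (merge-ev u φ X))))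
        t

-- Coproducts of the factors of a tensor

opaque

  finite-block-orders : {I : FinSet} (A : Composition I) → Finite (block-orders A)
  finite-block-orders A = finite-Π (λ r → finite-total-orders {⟦ block A r ⟧})

  ∏-block-orders : {I : FinSet} (A : Composition I) (f : ∀ r → TotalOrder ⟦ block A r ⟧ → ℂ.Carrier) →
    (∀ r {ψ ψ′} → ψ ≈ᵀ ψ′ → f r ψ ℂ.≈ f r ψ′) →
    ∏ (λ r → ℂ∑.∑ (finite-total-orders {⟦ block A r ⟧}) (f r)) ℂ.≈ ℂ∑.∑ (finite-block-orders A) (λ ψ → ∏ (λ r → f r (ψ r)))
  ∏-block-orders A f f-cong = ∏-∑ (λ r → finite-total-orders {⟦ block A r ⟧}) f (λ r {ψ} {ψ′} e → f-cong r {ψ} {ψ′} e)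

module _ {q : ℕ} (𝔽 : FiniteField q) where

  open PatternGroups 𝔽
  open Matrices using (Mat)
  open Rearrangement (cf 𝔽)
  private module 𝔽 = FiniteField 𝔽

  private
    _⇂_ : {I : FinSet} → Mat I → (J : Subset I) → Mat ⟦ J ⟧
    _⇂_ = _∣ᴹ_ 𝔽

    _⇊_ : {I : FinSet} → Mat I → (A : Composition I) → BlockMatrices 𝔽 A
    X ⇊ A = _∥_ 𝔽 A X

  module _ {I : FinSet} (A : Composition I) (D : ∀ r → Composition ⟦ block A r ⟧) where

    private
      C = concatenation A D

    Restricts : BlockOrders A → TotalOrder I → Set
    Restricts ψ φ = ∀ r → ∀ s → restrictᵀ (D r) (ψ r) s ≈ᵀ restrictᵀ (D r) (φ ∣ᵀ block A r) s

    restricts? : ∀ ψ φ → Dec (Restricts ψ φ)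
    restricts? ψ φ = Fin.all? (λ r → restricts-to? (D r) (ψ r) (restrictᵀ (D r) (φ ∣ᵀ block A r)))

    patches : BlockOrders A → Mat I → Mat I → BlockMatrices 𝔽 A
    patches ψ X Z r = patch 𝔽 (D r) (ψ r) (X ⇂ block A r) (Z ⇂ block A r)

    private

      means-functional : ∀ φ X → IsFunctional (Factors 𝔽 A)
        (λ t → ℂ∑.∑ (finite-block-orders A) (λ ψ → ℂ∑.when (restricts? ψ φ) (𝔼 𝔽 I (λ Z → evᵗ 𝔽 A t ψ (patches ψ X Z)))))
      means-functional φ X = ∑-functional (Factors 𝔽 A) (finite-block-orders A)
        (λ ψ t → ℂ∑.when (restricts? ψ φ) (𝔼 𝔽 I (λ Z → evᵗ 𝔽 A t ψ (patches ψ X Z))))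
        λ ψ → when-functional (Factors 𝔽 A) (restricts? ψ φ)
          (E-functional (Factors 𝔽 A) (Matrices.finite-matrices I) (matrices-nonZero 𝔽 I)
            (λ Z t → evᵗ 𝔽 A t ψ (patches ψ X Z)) (λ Z → evᵗ-functional 𝔽 A ψ (patches ψ X Z)))

      module _ (φ : TotalOrder I) (X : Mat I) (m : ∀ r → ClassFunctions 𝔽 ⟦ block A r ⟧) where

        J : ∀ r → FinSet
        J r = ⟦ block A r ⟧

        τ : ∀ r → BlockOrders (D r)
        τ r = restrictᵀ (D r) (φ ∣ᵀ block A r)

        meanʳ : ∀ r → TotalOrder (J r) → ℂ.Carrier
        meanʳ r ψ = mean 𝔽 (D r) (m r) ψ (X ⇂ block A r)

        integrand : ∀ r → TotalOrder (J r) → Mat I → ℂ.Carrier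
        integrand r ψ Z = ev 𝔽 (m r) ψ (patch 𝔽 (D r) ψ (X ⇂ block A r) (Z ⇂ block A r))

        patch-local : ∀ r ψ {Z Z′ : Mat (J r)} → Matrices._≋_ (J r) Z Z′ →
          ev 𝔽 (m r) ψ (patch 𝔽 (D r) ψ (X ⇂ block A r) Z) ℂ.≈ ev 𝔽 (m r) ψ (patch 𝔽 (D r) ψ (X ⇂ block A r) Z′)
        patch-local r ψ {Z} {Z′} e = ev-cong 𝔽 (m r) {ψ} {ψ} {patch 𝔽 (D r) ψ (X ⇂ block A r) Z} {patch 𝔽 (D r) ψ (X ⇂ block A r) Z′}
          (≈ᵀ-refl {τ = ψ}) (patch-cong 𝔽 (D r) ψ {X ⇂ block A r} {X ⇂ block A r} {Z} {Z′} (λ i j _ → 𝔽.refl) (λ i j _ → e i j))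

        -- `𝔼-restrict` turns each mean over Mat(A_r) into one over Mat(I), and `𝔼-∏` multiplies
        -- these, as the r-th factor reads only entries in A_r × A_r. One matrix Z then serves all
        -- blocks.
        independent : ∀ (ψ : BlockOrders A) → ∏ (λ r → meanʳ r (ψ r)) ℂ.≈ 𝔼 𝔽 I (λ Z → ∏ (λ r → integrand r (ψ r) Z))
        independent ψ = ℂ.trans
          (∏-cong λ r → ℂ.sym (𝔼-restrict 𝔽 {I} (block A r) (λ Z → ev 𝔽 (m r) (ψ r) (patch 𝔽 (D r) (ψ r) (X ⇂ block A r) Z))
            (λ {Z} {Z′} → patch-local r (ψ r) {Z} {Z′})))
          (𝔼-∏ 𝔽 {I} (λ r i j → T (block A r ∋ i) × T (block A r ∋ j)) (λ r i j → T? (block A r ∋ i) Dec.×-dec T? (block A r ∋ j))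
            (λ (p , _) (p′ , _) → disjoint A p p′) (λ r → integrand r (ψ r))
            (λ r {Z} {Z′} e → patch-local r (ψ r) {Z ⇂ block A r} {Z′ ⇂ block A r} λ (i , p) (j , p′) → e i j (p , p′)))

        opaque
          unfolding evʳ

          pure-mean : ∏ (λ r → evʳ 𝔽 (D r) (δ 𝔽 (D r) (m r)) (φ ∣ᵀ block A r) (X ⇂ block A r)) ℂ.≈
            ℂ∑.∑ (finite-block-orders A) (λ ψ → ℂ∑.when (restricts? ψ φ) (𝔼 𝔽 I (λ Z → ∏ (λ r → integrand r (ψ r) Z))))
          pure-mean = begin
            ∏ (λ r → evʳ 𝔽 (D r) (δ 𝔽 (D r) (m r)) (φ ∣ᵀ block A r) (X ⇂ block A r))
              ≈⟨ ∏-cong (λ r → δ-ev 𝔽 (D r) (m r) (τ r) ((X ⇂ block A r) ⇊ D r) (X ⇂ block A r) (λ s i j → 𝔽.refl)) ⟩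
            ∏ (λ r → ℂ∑.∑ (finite-total-orders {J r}) (λ ψ → ℂ∑.when (restricts-to? (D r) ψ (τ r)) (meanʳ r ψ)))
              ≈⟨ ∏-block-orders A (λ r ψ → ℂ∑.when (restricts-to? (D r) ψ (τ r)) (meanʳ r ψ)) summand-cong ⟩
            ℂ∑.∑ (finite-block-orders A) (λ ψ → ∏ (λ r → ℂ∑.when (restricts-to? (D r) (ψ r) (τ r)) (meanʳ r (ψ r))))
              ≈⟨ ℂ∑.∑-cong (finite-block-orders A) (λ ψ → ℂ.trans
                   (∏-when (λ r → restricts-to? (D r) (ψ r) (τ r)) (restricts? ψ φ) id id (λ r → meanʳ r (ψ r)))
                   (ℂ∑.when-congʳ (restricts? ψ φ) λ _ → independent ψ)) ⟩
            ℂ∑.∑ (finite-block-orders A) (λ ψ → ℂ∑.when (restricts? ψ φ) (𝔼 𝔽 I (λ Z → ∏ (λ r → integrand r (ψ r) Z)))) ∎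
            where
            open SetoidReasoning ℂ.setoid
            summand-cong : ∀ r {ψ ψ′} → ψ ≈ᵀ ψ′ →
              ℂ∑.when (restricts-to? (D r) ψ (τ r)) (meanʳ r ψ) ℂ.≈ ℂ∑.when (restricts-to? (D r) ψ′ (τ r)) (meanʳ r ψ′)
            summand-cong r {ψ} {ψ′} e = ℂ∑.when-cong (restricts-to? (D r) ψ (τ r)) (restricts-to? (D r) ψ′ (τ r))
              (λ p s i j → ≡.trans (≡.sym (e (proj₁ i) (proj₁ j))) (p s i j))
              (λ p s i j → ≡.trans (e (proj₁ i) (proj₁ j)) (p s i j))
              (λ _ → mean-cong 𝔽 (D r) (m r) {ψ} {ψ′} {X ⇂ block A r} {X ⇂ block A r} e (λ i j _ → 𝔽.refl))

    ⨂δ : Tensor (Factors 𝔽 A) → Tensor (λ r → ⨂ (Factors 𝔽 (D r)))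
    ⨂δ = ⨂-map {M = Factors 𝔽 A} {N = λ r → ⨂ (Factors 𝔽 (D r))} (λ r → δ 𝔽 (D r))

    opaque
      unfolding evʳ

      -- The sums over orders of the separate blocks multiply to a sum over families ψ, and t is
      -- evaluated by `evᵗ` at ψ rather than at an order of I.
      ⨂δ-ev : ∀ t φ X → evʳ 𝔽 C (merge A D (⨂δ t)) φ X ℂ.≈
        ℂ∑.∑ (finite-block-orders A) (λ ψ → ℂ∑.when (restricts? ψ φ) (𝔼 𝔽 I (λ Z → evᵗ 𝔽 A t ψ (patches ψ X Z))))
      ⨂δ-ev t φ X = agree (Factors 𝔽 A)
        (extend-∘-functional (merge-functional 𝔽 A D φ X) (λ m → pure (λ r → δ 𝔽 (D r) (m r))))
        (means-functional φ X)
        (λ m → ℂ.trans (merge-ev 𝔽 A D (λ r → δ 𝔽 (D r) (m r)) φ X) (pure-mean φ X m))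
        t

-- Compositions and orders

lookup-sorted : ∀ {A : Set} {R : A → A → Set} {xs : List A} → AllPairs R xs →
                ∀ {k l} → k Fin.< l → R (List.lookup xs k) (List.lookup xs l)
lookup-sorted (x≺ ∷ _)  {zero}  {suc l} _          = All.lookup x≺ (∈-lookup l)
lookup-sorted (_ ∷ xs≺) {suc k} {suc l} (ℕ.s≤s k<l) = lookup-sorted xs≺ k<l

allFin-sorted : ∀ n → AllPairs Fin._<_ (allFin n)
allFin-sorted n = AllPairs.tabulate⁺-< id

module _ {I : FinSet} where

  Eq-blocks : (A : Composition I) → ∀ {r i j} → T (block A r ∋ i) → T (block A r ∋ j) → Eq A i j
  Eq-blocks A p p′ = ≡.trans (blockOf-unique A p) (≡.sym (blockOf-unique A p′))

  Eq-member : (A : Composition I) → ∀ {i j} → Eq A i j → T (block A (blockOf A i) ∋ j)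
  Eq-member A {i} {j} e = ≡.subst (λ r → T (block A r ∋ j)) (≡.sym e) (proj₂ (covers A j))

  module _ (B : Composition I) (J : Subset I) where

    private
      lookup-blockOf : ∀ i → List.lookup (meeting B J) (blockOf (B ∣ J) i) ≡ blockOf B (proj₁ i)
      lookup-blockOf (i , i∈J) = ≡.sym (Any.lookup-index
        (∈-filter⁺ (meets? B J) (∈-allFin (blockOf B i)) ((i , i∈J) , proj₂ (covers B i))))

      ∣-monotone : ∀ {k l} → k Fin.< l → List.lookup (meeting B J) k Fin.< List.lookup (meeting B J) l
      ∣-monotone = lookup-sorted (AllPairs.filter⁺ (meets? B J) (allFin-sorted (length B)))

    -- The list `meeting` of surviving blocks is increasing, so deleting empty intersections keeps
    -- the remaining blocks in order.
    Asc-∣⁻ : ∀ i j → Asc (B ∣ J) i j → Asc B (proj₁ i) (proj₁ j)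
    Asc-∣⁻ i j a = ≡.subst₂ Fin._<_ (lookup-blockOf i) (lookup-blockOf j) (∣-monotone a)

    Eq-∣⁻ : ∀ i j → Eq (B ∣ J) i j → Eq B (proj₁ i) (proj₁ j)
    Eq-∣⁻ i j e = ≡.trans (≡.sym (lookup-blockOf i)) (≡.trans (≡.cong (List.lookup (meeting B J)) e) (lookup-blockOf j))

    Asc-∣⁺ : ∀ i j → Asc B (proj₁ i) (proj₁ j) → Asc (B ∣ J) i j
    Asc-∣⁺ i j a = go (Fin.<-cmp (blockOf (B ∣ J) i) (blockOf (B ∣ J) j))
      where
      go : Tri (Asc (B ∣ J) i j) (Eq (B ∣ J) i j) (Asc (B ∣ J) j i) → Asc (B ∣ J) i j
      go (tri< b _ _) = b
      go (tri≈ _ e _) = ⊥-elim (Fin.<-irrefl (Eq-∣⁻ i j e) a)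
      go (tri> _ _ b) = ⊥-elim (Fin.<-asym a (Asc-∣⁻ j i b))

    Eq-∣⁺ : ∀ i j → Eq B (proj₁ i) (proj₁ j) → Eq (B ∣ J) i j
    Eq-∣⁺ i j e = go (Fin.<-cmp (blockOf (B ∣ J) i) (blockOf (B ∣ J) j))
      where
      go : Tri (Asc (B ∣ J) i j) (Eq (B ∣ J) i j) (Asc (B ∣ J) j i) → Eq (B ∣ J) i j
      go (tri< b _ _)  = ⊥-elim (Fin.<-irrefl e (Asc-∣⁻ i j b))
      go (tri≈ _ e′ _) = e′
      go (tri> _ _ b)  = ⊥-elim (Fin.<-irrefl (≡.sym e) (Asc-∣⁻ j i b))

  module _ (A : Composition I) (D : ∀ r → Composition ⟦ block A r ⟧) where

    data _≺_ : Position A D → Position A D → Set where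
      outer : ∀ {r r′ s s′} → r Fin.< r′ → (r , s) ≺ (r′ , s′)
      inner : ∀ {r s s′} → s Fin.< s′ → (r , s) ≺ (r , s′)

    pairs-sorted : AllPairs _≺_ (pairs A D)
    pairs-sorted = AllPairs.concat⁺
      (All.map⁺ (All.universal (λ r → AllPairs.map⁺ (AllPairs.map inner (allFin-sorted (length (D r))))) (allFin (length A))))
      (AllPairs.map⁺ (AllPairs.map (λ r<r′ → All.map⁺ (All.universal (λ s → All.map⁺ (All.universal (λ s′ → outer r<r′) _)) _))
        (allFin-sorted (length A))))

    Asc-concatenation⁻ : ∀ {i j} → Asc (concatenation A D) i j →
      Asc A i j ⊎ Σ[ e ∈ Eq A i j ] Asc (D (blockOf A i)) (i , proj₂ (covers A i)) (j , Eq-member A e)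
    Asc-concatenation⁻ {i} {j} a = go (blockOf A j) (proj₂ (covers A j))
      (≡.subst₂ _≺_ (≡.sym (position-index-of A D _)) (≡.sym (position-index-of A D _)) (lookup-sorted pairs-sorted a)) refl
      where
      -- The block of j is generalised to r, so that `inner`, which identifies it with the block of
      -- i, can be matched.
      go : ∀ r (p : T (block A r ∋ j)) → (blockOf A i , blockOf (D (blockOf A i)) (i , proj₂ (covers A i))) ≺ (r , blockOf (D r) (j , p)) →
           blockOf A j ≡ r → Asc A i j ⊎ Σ[ e ∈ Eq A i j ] Asc (D (blockOf A i)) (i , proj₂ (covers A i)) (j , Eq-member A e)
      go r p (outer i<j) eq = inj₁ (≡.subst (blockOf A i Fin.<_) (≡.sym eq) i<j)
      go r p (inner i<j) eq = inj₂ (≡.sym eq ,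
        ≡.subst (λ p → blockOf (D r) (i , proj₂ (covers A i)) Fin.< blockOf (D r) (j , p)) (Bool.T-irrelevant p _) i<j)

  module _ (A B : Composition I) where

    Eq-∧⁻ : ∀ {i j} → Eq (A ∧ᵗ B) i j → Eq A i j × Eq B i j
    Eq-∧⁻ {i} {j} e = Eq-blocks A (proj₁ i∈) (proj₁ j∈) , Eq-blocks B (proj₂ i∈) (proj₂ j∈)
      where
      k = blockOf (A ∧ᵗ B) i
      split∈ : ∀ {i} → T (block (A ∧ᵗ B) k ∋ i) →
               T (block A (proj₁ (∧ᵗ-block⁻ A B k)) ∋ i) × T (block B (proj₁ (proj₂ (∧ᵗ-block⁻ A B k))) ∋ i)
      split∈ {i} t = Equivalence.to Bool.T-∧ (≡.subst T (proj₂ (proj₂ (∧ᵗ-block⁻ A B k)) i) t)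
      i∈ = split∈ (proj₂ (covers (A ∧ᵗ B) i))
      j∈ = split∈ (Eq-member (A ∧ᵗ B) e)

    Eq-∧⁺ : ∀ {i j} → Eq A i j → Eq B i j → Eq (A ∧ᵗ B) i j
    Eq-∧⁺ {i} {j} e e′ = Eq-blocks (A ∧ᵗ B) {proj₁ found} (in-k (proj₂ (covers A i)) (proj₂ (covers B i))) (in-k (Eq-member A e) (Eq-member B e′))
      where
      found : ∃[ k ] (∀ j → (block (A ∧ᵗ B) k ∋ j) ≡ (block A (blockOf A i) ∋ j) ∧ (block B (blockOf B i) ∋ j))
      found = ∧ᵗ-block⁺ A B (proj₂ (covers A i)) (proj₂ (covers B i))
      in-k : ∀ {j} → T (block A (blockOf A i) ∋ j) → T (block B (blockOf B i) ∋ j) → T (block (A ∧ᵗ B) (proj₁ found) ∋ j)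
      in-k {j} p p′ = ≡.subst T (≡.sym (proj₂ found j)) (Equivalence.from Bool.T-∧ (p , p′))

    Asc-∧⁻ : ∀ {i j} → Asc (A ∧ᵗ B) i j → Asc A i j ⊎ (Eq A i j × Asc B i j)
    Asc-∧⁻ a = map₂ (λ (e , b) → e , Asc-∣⁻ B (block A _) _ _ b) (Asc-concatenation⁻ A (λ r → B ∣ block A r) a)

    -- The lexicographic condition is irreflexive and asymmetric, so by trichotomy of the blocks of
    -- A ∧ B the converse directions `Eq-∧⁻` and `Asc-∧⁻` suffice.
    Asc-∧⁺ : ∀ {i j} → Asc A i j ⊎ (Eq A i j × Asc B i j) → Asc (A ∧ᵗ B) i j
    Asc-∧⁺ {i} {j} a = go (Fin.<-cmp (blockOf (A ∧ᵗ B) i) (blockOf (A ∧ᵗ B) j))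
      where
      irreflexive : Asc A i j ⊎ (Eq A i j × Asc B i j) → Eq A i j × Eq B i j → ⊥
      irreflexive (inj₁ a)       (e , _) = Fin.<-irrefl e a
      irreflexive (inj₂ (_ , a)) (_ , e) = Fin.<-irrefl e a
      asymmetric : Asc A i j ⊎ (Eq A i j × Asc B i j) → Asc A j i ⊎ (Eq A j i × Asc B j i) → ⊥
      asymmetric (inj₁ a)       (inj₁ b)       = Fin.<-asym a b
      asymmetric (inj₁ a)       (inj₂ (e , _)) = Fin.<-irrefl (≡.sym e) a
      asymmetric (inj₂ (e , _)) (inj₁ b)       = Fin.<-irrefl (≡.sym e) b
      asymmetric (inj₂ (_ , a)) (inj₂ (_ , b)) = Fin.<-asym a b
      go : Tri (Asc (A ∧ᵗ B) i j) (Eq (A ∧ᵗ B) i j) (Asc (A ∧ᵗ B) j i) → Asc (A ∧ᵗ B) i j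
      go (tri< b _ _) = b
      go (tri≈ _ e _) = ⊥-elim (irreflexive a (Eq-∧⁻ e))
      go (tri> _ _ b) = ⊥-elim (asymmetric a (Asc-∧⁻ b))

  module _ {A B : Composition I} (e : A ≈ᴷ B) where

    private
      blockOf-≈ᴷ : ∀ i → Fin.toℕ (blockOf B i) ≡ Fin.toℕ (blockOf A i)
      blockOf-≈ᴷ i = ≡.trans
        (≡.cong Fin.toℕ (blockOf-unique B (≡.subst T (block-≐ e (blockOf A i) i) (proj₂ (covers A i)))))
        (Fin.toℕ-cast (length-≡ e) (blockOf A i))

    Asc-≈ᴷ : ∀ {i j} → Asc A i j → Asc B i j
    Asc-≈ᴷ {i} {j} = ≡.subst₂ ℕ._<_ (≡.sym (blockOf-≈ᴷ i)) (≡.sym (blockOf-≈ᴷ j))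

    Asc-≈ᴷ⁻ : ∀ {i j} → Asc B i j → Asc A i j
    Asc-≈ᴷ⁻ {i} {j} = ≡.subst₂ ℕ._<_ (blockOf-≈ᴷ i) (blockOf-≈ᴷ j)

    Eq-≈ᴷ : ∀ {i j} → Eq A i j → Eq B i j
    Eq-≈ᴷ {i} {j} eq = Fin.toℕ-injective (≡.trans (blockOf-≈ᴷ i) (≡.trans (≡.cong Fin.toℕ eq) (≡.sym (blockOf-≈ᴷ j))))

    Eq-≈ᴷ⁻ : ∀ {i j} → Eq B i j → Eq A i j
    Eq-≈ᴷ⁻ {i} {j} eq = Fin.toℕ-injective (≡.trans (≡.sym (blockOf-≈ᴷ i)) (≡.trans (≡.cong Fin.toℕ eq) (blockOf-≈ᴷ j)))

    Ascending-≈ᴷ : ∀ φ → Ascending A φ → Ascending B φ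
    Ascending-≈ᴷ φ asc i j a = asc i j (Asc-≈ᴷ⁻ a)

    Ascending-≈ᴷ⁻ : ∀ φ → Ascending B φ → Ascending A φ
    Ascending-≈ᴷ⁻ φ asc i j a = asc i j (Asc-≈ᴷ a)

  Restricts-to : Composition I → TotalOrder I → TotalOrder I → Set
  Restricts-to A φ′ φ = ∀ r → restrictᵀ A φ′ r ≈ᵀ restrictᵀ A φ r

  -- Restrictions to the blocks of different compositions are orders of different sets. Expressed
  -- through pairs of I, the conditions for A, B and A ∧ B are compared by inclusions between their
  -- relations `Eq`.
  AgreeOn : (∣ I ∣ → ∣ I ∣ → Set) → TotalOrder I → TotalOrder I → Set
  AgreeOn R φ′ φ = ∀ i j → R i j → TotalOrder.rel φ′ i j ≡ TotalOrder.rel φ i j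

  restricts⇒agree : (A : Composition I) → ∀ φ′ φ → Restricts-to A φ′ φ → AgreeOn (Eq A) φ′ φ
  restricts⇒agree A φ′ φ p i j e = p (blockOf A i) (i , proj₂ (covers A i)) (j , Eq-member A e)

  agree⇒restricts : (A : Composition I) → ∀ φ′ φ → AgreeOn (Eq A) φ′ φ → Restricts-to A φ′ φ
  agree⇒restricts A φ′ φ p r i j = p (proj₁ i) (proj₁ j) (Eq-blocks A (proj₂ i) (proj₂ j))

  module _ (A B : Composition I) where

    ascending-∧ : ∀ φ → Ascending A φ → (∀ r → Ascending (B ∣ block A r) (φ ∣ᵀ block A r)) →
                  Ascending (concatenation A (λ r → B ∣ block A r)) φ
    ascending-∧ φ asc asc′ i j a = go (Asc-∧⁻ A B a)
      where
      go : Asc A i j ⊎ (Eq A i j × Asc B i j) → (i , j) ∈ᵀ φ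
      go (inj₁ b)       = asc i j b
      go (inj₂ (q , b)) = asc′ (blockOf A i) (i , proj₂ (covers A i)) (j , Eq-member A q) (Asc-∣⁺ B (block A (blockOf A i)) _ _ b)

    ascending-∧⁻ : ∀ φ → Ascending (concatenation A (λ r → B ∣ block A r)) φ →
                   Ascending A φ × (∀ r → Ascending (B ∣ block A r) (φ ∣ᵀ block A r))
    ascending-∧⁻ φ asc = (λ i j a → asc i j (Asc-∧⁺ A B (inj₁ a))) ,
      λ r i j a → asc (proj₁ i) (proj₁ j) (Asc-∧⁺ A B (inj₂ (Eq-blocks A (proj₂ i) (proj₂ j) , Asc-∣⁻ B (block A r) i j a)))

-- Linearity, extensionality and associativity

∑-bijection : {S T : Setoid 0ℓ 0ℓ} (F : Finite S) (G : Finite T)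
  (to : Setoid.Carrier S → Setoid.Carrier T) (from : Setoid.Carrier T → Setoid.Carrier S) →
  (∀ {x y} → Setoid._≈_ S x y → Setoid._≈_ T (to x) (to y)) →
  (∀ {x y} → Setoid._≈_ T x y → Setoid._≈_ S (from x) (from y)) →
  (∀ y → Setoid._≈_ T (to (from y)) y) → (∀ x → Setoid._≈_ S (from (to x)) x) →
  (f : Setoid.Carrier T → ℂ.Carrier) → (∀ {x y} → Setoid._≈_ T x y → f x ℂ.≈ f y) →
  ℂ∑.∑ F (f ∘ to) ℂ.≈ ℂ∑.∑ G f
∑-bijection {S} {T} F G to from to-cong from-cong to-from from-to f f-cong = ℂ∑.∑-reindex F G (record
  { to = to ; from = from ; to-cong = to-cong ; from-cong = from-cong
  ; inverse = (λ {x} {y} e → Setoid.trans T (to-cong e) (to-from x)) , (λ {x} {y} e → Setoid.trans S (from-cong e) (from-to x))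
  }) f f-cong

module _ {q : ℕ} (𝔽 : FiniteField q) where

  open PatternGroups 𝔽
  open Matrices using (Mat)
  open Rearrangement (cf 𝔽)
  private module 𝔽 = FiniteField 𝔽

  private
    _⇊_ : {I : FinSet} → Mat I → (A : Composition I) → BlockMatrices 𝔽 A
    X ⇊ A = _∥_ 𝔽 A X

  module _ {I : FinSet} (A : Composition I) where

    opaque
      unfolding evʳ

      δ-sum : ClassFunctions 𝔽 I → TotalOrder I → Mat I → ℂ.Carrier
      δ-sum f φ X = ℂ∑.∑ (finite-total-orders {I}) (λ φ′ → ℂ∑.when (restricts-to? A φ′ (restrictᵀ A φ)) (mean 𝔽 A f φ′ X))

      δ-sum-≈ : ∀ f φ X → δ-sum f φ X ℂ.≈ ℂ∑.∑ (finite-total-orders {I}) (λ φ′ → ℂ∑.when (restricts-to? A φ′ (restrictᵀ A φ)) (mean 𝔽 A f φ′ X))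
      δ-sum-≈ f φ X = ℂ∑.∑-cong (finite-total-orders {I}) {t} {t} λ φ′ → ℂ.refl
        where
        t : TotalOrder I → ℂ.Carrier
        t φ′ = ℂ∑.when (restricts-to? A φ′ (restrictᵀ A φ)) (mean 𝔽 A f φ′ X)

      δ-evʳ : ∀ f φ X → evʳ 𝔽 A (δ 𝔽 A f) φ X ℂ.≈ δ-sum f φ X
      δ-evʳ f φ X = δ-ev 𝔽 A f (restrictᵀ A φ) (X ⇊ A) X (λ r i j → 𝔽.refl)

    mean-linear : ∀ φ X → IsLinear (obj (cf 𝔽) I) ℂ¹ (λ f → mean 𝔽 A f φ X)
    mean-linear φ X = isLinear (cf-isVectorSpace 𝔽 I) ℂ¹-isVectorSpace (λ f → mean 𝔽 A f φ X)
      (λ {f} {g} e → 𝔼-cong 𝔽 I λ Z → L.⟦⟧-cong Z {f} {g} e)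
      (λ f g → ℂ.trans (𝔼-cong 𝔽 I λ Z → L.+ᴹ-homo Z f g)
        (E-+ (Matrices.finite-matrices I) (matrices-nonZero 𝔽 I) (λ Z → ev 𝔽 f φ (patch 𝔽 A φ X Z)) (λ Z → ev 𝔽 g φ (patch 𝔽 A φ X Z))))
      (λ c f → ℂ.trans (𝔼-cong 𝔽 I λ Z → L.*ₗ-homo Z c f)
        (ℂ.sym (E-*ˡ (Matrices.finite-matrices I) (matrices-nonZero 𝔽 I) c (λ Z → ev 𝔽 f φ (patch 𝔽 A φ X Z)))))
      where
      module L Z = LeftModuleMorphisms.IsLeftModuleHomomorphism (ev-linear 𝔽 φ (patch 𝔽 A φ X Z))

    δ-sum-linear : ∀ φ X → IsLinear (obj (cf 𝔽) I) ℂ¹ (λ f → δ-sum f φ X)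
    δ-sum-linear φ X = isLinear (cf-isVectorSpace 𝔽 I) ℂ¹-isVectorSpace (λ f → δ-sum f φ X)
      (λ {f} {g} e → ℂ.trans (δ-sum-≈ f φ X) (ℂ.trans
        (ℂ∑.∑-cong (finite-total-orders {I}) λ φ′ → ℂ∑.when-congʳ (d φ′) λ _ → L.⟦⟧-cong φ′ {f} {g} e) (ℂ.sym (δ-sum-≈ g φ X))))
      (λ f g → ℂ.trans (δ-sum-≈ _ φ X) (ℂ.trans
        (ℂ∑.∑-cong (finite-total-orders {I}) λ φ′ → ℂ.trans (ℂ∑.when-congʳ (d φ′) λ _ → L.+ᴹ-homo φ′ f g) (when-+ (d φ′) (mean 𝔽 A f φ′ X) (mean 𝔽 A g φ′ X)))
        (ℂ.trans (ℂ∑.∑-∙ (finite-total-orders {I}) (t f) (t g)) (ℂ.sym (ℂ.+-cong (δ-sum-≈ f φ X) (δ-sum-≈ g φ X))))))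
      (λ c f → ℂ.trans (δ-sum-≈ _ φ X) (ℂ.trans
        (ℂ∑.∑-cong (finite-total-orders {I}) λ φ′ → ℂ.trans (ℂ∑.when-congʳ (d φ′) λ _ → L.*ₗ-homo φ′ c f) (ℂ.sym (when-*ˡ (d φ′) c (mean 𝔽 A f φ′ X))))
        (ℂ.trans (ℂ.sym (∑-*ˡ (finite-total-orders {I}) c (t f))) (ℂ.sym (ℂ.*-congˡ {c} (δ-sum-≈ f φ X))))))
      where
      module L φ′ = LeftModuleMorphisms.IsLeftModuleHomomorphism (mean-linear φ′ X)
      d : ∀ φ′ → Dec (∀ r → restrictᵀ A φ′ r ≈ᵀ restrictᵀ A φ r)
      d φ′ = restricts-to? A φ′ (restrictᵀ A φ)
      t : ClassFunctions 𝔽 I → TotalOrder I → ℂ.Carrier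
      t f φ′ = ℂ∑.when (d φ′) (mean 𝔽 A f φ′ X)
      when-+ : {P : Set} (d : Dec P) → ∀ x y → ℂ∑.when d (x ℂ.+ y) ℂ.≈ ℂ∑.when d x ℂ.+ ℂ∑.when d y
      when-+ (yes _) x y = ℂ.refl
      when-+ (no _)  x y = ℂ.sym (ℂ.+-identityˡ ℂ.0#)

    μ-linear : IsLinear (obj⊗ (cf 𝔽) A) (obj (cf 𝔽) I) (μ 𝔽 A)
    μ-linear = isLinear (⨂-isVectorSpace (Factors 𝔽 A)) (cf-isVectorSpace 𝔽 I) (μ 𝔽 A)
      (λ {t} {u} e → ev-injective 𝔽 (μ 𝔽 A t) (μ 𝔽 A u) λ φ X X∈ → ℂ.trans (μ-evʳ 𝔽 A t φ X X∈)
        (ℂ.trans (ℂ∑.when-congʳ (ascending? A φ) λ _ → T.⟦⟧-cong φ X {t} {u} e) (ℂ.sym (μ-evʳ 𝔽 A u φ X X∈))))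
      (λ t u → ev-injective 𝔽 (μ 𝔽 A (t ⊕ u)) (M._+ᴹ_ (μ 𝔽 A t) (μ 𝔽 A u)) λ φ X X∈ → ℂ.trans (μ-evʳ 𝔽 A (t ⊕ u) φ X X∈)
        (ℂ.trans (W.⊕-homo φ X t u) (ℂ.sym (ℂ.trans (L.+ᴹ-homo φ X (μ 𝔽 A t) (μ 𝔽 A u)) (ℂ.+-cong (μ-evʳ 𝔽 A t φ X X∈) (μ-evʳ 𝔽 A u φ X X∈))))))
      (λ c t → ev-injective 𝔽 (μ 𝔽 A (c · t)) (M._*ₗ_ c (μ 𝔽 A t)) λ φ X X∈ → ℂ.trans (μ-evʳ 𝔽 A (c · t) φ X X∈)
        (ℂ.trans (W.·-homo φ X c t) (ℂ.sym (ℂ.trans (L.*ₗ-homo φ X c (μ 𝔽 A t)) (ℂ.*-congˡ {c} (μ-evʳ 𝔽 A t φ X X∈))))))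
      where
      module M = Mod (obj (cf 𝔽) I)
      module L φ X = LeftModuleMorphisms.IsLeftModuleHomomorphism (ev-linear 𝔽 φ X)
      module T φ X = LeftModuleMorphisms.IsLeftModuleHomomorphism (evʳ-linear 𝔽 A φ X)
      module W φ X = IsFunctional (when-functional (Factors 𝔽 A) (ascending? A φ) (evʳ-functional 𝔽 A φ X))

    δ-linear : IsLinear (obj (cf 𝔽) I) (obj⊗ (cf 𝔽) A) (δ 𝔽 A)
    δ-linear = isLinear (cf-isVectorSpace 𝔽 I) (⨂-isVectorSpace (Factors 𝔽 A)) (δ 𝔽 A)
      (λ {f} {g} e → evʳ-injective 𝔽 A (δ 𝔽 A f) (δ 𝔽 A g) λ φ X _ → ℂ.trans (δ-evʳ f φ X)
        (ℂ.trans (L.⟦⟧-cong φ X {f} {g} e) (ℂ.sym (δ-evʳ g φ X))))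
      (λ f g → evʳ-injective 𝔽 A (δ 𝔽 A (M._+ᴹ_ f g)) (δ 𝔽 A f ⊕ δ 𝔽 A g) λ φ X _ → ℂ.trans (δ-evʳ (M._+ᴹ_ f g) φ X)
        (ℂ.trans (L.+ᴹ-homo φ X f g) (ℂ.sym (ℂ.trans (F.⊕-homo φ X (δ 𝔽 A f) (δ 𝔽 A g)) (ℂ.+-cong (δ-evʳ f φ X) (δ-evʳ g φ X))))))
      (λ c f → evʳ-injective 𝔽 A (δ 𝔽 A (M._*ₗ_ c f)) (c · δ 𝔽 A f) λ φ X _ → ℂ.trans (δ-evʳ (M._*ₗ_ c f) φ X)
        (ℂ.trans (L.*ₗ-homo φ X c f) (ℂ.sym (ℂ.trans (F.·-homo φ X c (δ 𝔽 A f)) (ℂ.*-congˡ {c} (δ-evʳ f φ X))))))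
      where
      module M = Mod (obj (cf 𝔽) I)
      module L φ X = LeftModuleMorphisms.IsLeftModuleHomomorphism (δ-sum-linear φ X)
      module F φ X = IsFunctional (evʳ-functional 𝔽 A φ X)

  private
    patch-≋ : {I : FinSet} (A B : Composition I) (φ : TotalOrder I) →
      (∀ {i j} → Eq A i j → Eq B i j) → (∀ {i j} → Eq B i j → Eq A i j) →
      (∀ {i j} → Asc A i j → Asc B i j) → (∀ {i j} → Asc B i j → Asc A i j) →
      ∀ X Z → Matrices._≋_ I (patch 𝔽 A φ X Z) (patch 𝔽 B φ X Z)
    patch-≋ A B φ eq⁺ eq⁻ asc⁺ asc⁻ X Z i j with Dec.toSum (blockOf A i Fin.≟ blockOf A j) | Dec.toSum (free? 𝔽 A φ i j)
    ... | inj₁ e | _ = 𝔽.trans (patch-Eq 𝔽 A φ {X} {Z} e) (𝔽.sym (patch-Eq 𝔽 B φ {X} {Z} (eq⁺ e)))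
    ... | inj₂ _ | inj₁ (t , a) = 𝔽.trans (patch-free 𝔽 A φ {X} {Z} (t , a)) (𝔽.sym (patch-free 𝔽 B φ {X} {Z} (t , asc⁺ a)))
    ... | inj₂ ¬e | inj₂ ¬f = 𝔽.trans (patch-off 𝔽 A φ {X} {Z} ¬e ¬f)
                                (𝔽.sym (patch-off 𝔽 B φ {X} {Z} (¬e ∘ eq⁻) λ (t , a) → ¬f (t , asc⁻ a)))

  module _ {I : FinSet} {A B : Composition I} (e : A ≈ᴷ B) where

    mean-≈ᴷ : ∀ f φ X → mean 𝔽 A f φ X ℂ.≈ mean 𝔽 B f φ X
    mean-≈ᴷ f φ X = 𝔼-cong 𝔽 I λ Z → ev-cong 𝔽 f {φ} {φ} {patch 𝔽 A φ X Z} {patch 𝔽 B φ X Z} (≈ᵀ-refl {τ = φ})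
      (patch-≋ A B φ (Eq-≈ᴷ e) (Eq-≈ᴷ⁻ e) (Asc-≈ᴷ e) (Asc-≈ᴷ⁻ e) X Z)

    δ-sum-≈ᴷ : ∀ f φ X → δ-sum A f φ X ℂ.≈ δ-sum B f φ X
    δ-sum-≈ᴷ f φ X = ℂ.trans (δ-sum-≈ A f φ X) (ℂ.trans (ℂ∑.∑-cong (finite-total-orders {I}) λ φ′ →
      ℂ∑.when-cong (restricts-to? A φ′ (restrictᵀ A φ)) (restricts-to? B φ′ (restrictᵀ B φ))
        (λ p → agree⇒restricts B φ′ φ λ i j eq → restricts⇒agree A φ′ φ p i j (Eq-≈ᴷ⁻ e eq))
        (λ p → agree⇒restricts A φ′ φ λ i j eq → restricts⇒agree B φ′ φ p i j (Eq-≈ᴷ e eq))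
        (λ _ → mean-≈ᴷ f φ′ X)) (ℂ.sym (δ-sum-≈ B f φ X)))

    relabel-ev : ∀ t φ X → evʳ 𝔽 A (relabel e t) φ X ℂ.≈ evʳ 𝔽 B t φ X
    relabel-ev = rearrange-ev 𝔽 B A (λ k → Fin.cast (length-≡ e) k , λ i → ≡.sym (block-≐ e k i))

    μ-relabel : ∀ t → Mod._≈ᴹ_ (obj (cf 𝔽) I) (μ 𝔽 A (relabel e t)) (μ 𝔽 B t)
    μ-relabel t = ev-injective 𝔽 (μ 𝔽 A (relabel e t)) (μ 𝔽 B t) λ φ X X∈ → ℂ.trans (μ-evʳ 𝔽 A (relabel e t) φ X X∈)
      (ℂ.trans (ℂ∑.when-cong (ascending? A φ) (ascending? B φ) (Ascending-≈ᴷ e φ) (Ascending-≈ᴷ⁻ e φ) (λ _ → relabel-ev t φ X))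
        (ℂ.sym (μ-evʳ 𝔽 B t φ X X∈)))

    δ-relabel : ∀ f → _∼_ (Factors 𝔽 A) (δ 𝔽 A f) (relabel e (δ 𝔽 B f))
    δ-relabel f = evʳ-injective 𝔽 A (δ 𝔽 A f) (relabel e (δ 𝔽 B f)) λ φ X _ → ℂ.trans (δ-evʳ A f φ X)
      (ℂ.trans (δ-sum-≈ᴷ f φ X) (ℂ.sym (ℂ.trans (relabel-ev (δ 𝔽 B f) φ X) (δ-evʳ B f φ X))))

  cf-extensional : Extensional (cf 𝔽) (μ 𝔽) (δ 𝔽)
  cf-extensional e = μ-relabel e , δ-relabel e

  module _ {I : FinSet} (A : Composition I) (D : ∀ r → Composition ⟦ block A r ⟧)
           (ascending⁺ : ∀ φ → Ascending A φ → (∀ r → Ascending (D r) (φ ∣ᵀ block A r)) → Ascending (concatenation A D) φ)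
           (ascending⁻ : ∀ φ → Ascending (concatenation A D) φ → Ascending A φ × (∀ r → Ascending (D r) (φ ∣ᵀ block A r))) where

    μ-μ-ev : ∀ t φ X → HasPattern (toPartial φ) X →
      ev 𝔽 (μ 𝔽 A (⨂μ 𝔽 A D t)) φ X ℂ.≈ ev 𝔽 (μ 𝔽 (concatenation A D) (merge A D t)) φ X
    μ-μ-ev t φ X X∈ = begin
      ev 𝔽 (μ 𝔽 A (⨂μ 𝔽 A D t)) φ X
        ≈⟨ μ-evʳ 𝔽 A (⨂μ 𝔽 A D t) φ X X∈ ⟩
      ℂ∑.when (ascending? A φ) (evʳ 𝔽 A (⨂μ 𝔽 A D t) φ X)
        ≈⟨ ℂ∑.when-congʳ (ascending? A φ) (λ _ → ⨂μ-ev 𝔽 A D t φ X (λ r → restrict-pattern 𝔽 (block A r) φ X X∈)) ⟩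
      ℂ∑.when (ascending? A φ) (ℂ∑.when all (evʳ 𝔽 (concatenation A D) (merge A D t) φ X))
        ≈⟨ ℂ∑.when-× (ascending? A φ) all (ascending? (concatenation A D) φ) (ascending⁺ φ) (ascending⁻ φ) ⟩
      ℂ∑.when (ascending? (concatenation A D) φ) (evʳ 𝔽 (concatenation A D) (merge A D t) φ X)
        ≈⟨ μ-evʳ 𝔽 (concatenation A D) (merge A D t) φ X X∈ ⟨
      ev 𝔽 (μ 𝔽 (concatenation A D) (merge A D t)) φ X ∎
      where
      open SetoidReasoning ℂ.setoid
      all : Dec (∀ r → Ascending (D r) (φ ∣ᵀ block A r))
      all = Fin.all? (λ r → ascending? (D r) (φ ∣ᵀ block A r))

    μ-μ : ∀ t → Mod._≈ᴹ_ (obj (cf 𝔽) I) (μ 𝔽 A (⨂μ 𝔽 A D t)) (μ 𝔽 (concatenation A D) (merge A D t))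
    μ-μ t = ev-injective 𝔽 (μ 𝔽 A (⨂μ 𝔽 A D t)) (μ 𝔽 (concatenation A D) (merge A D t)) (μ-μ-ev t)

  -- Refinement says that B equals A ∧ B as a composition, so the law is proved for A ∧ B and
  -- carried over by `μ-relabel`.
  cf-associative : Associative (cf 𝔽) (μ 𝔽) (δ 𝔽)
  cf-associative A B e t ω X = ℂ.trans
    (μ-μ A (λ r → B ∣ block A r) (ascending-∧ A B) (ascending-∧⁻ A B) t ω X)
    (ℂ.sym (μ-relabel e (merge A (λ r → B ∣ block A r) t) ω X))

-- Coassociativity

when-swap : {P Q : Set} (d : Dec P) (e : Dec Q) → ∀ x → ℂ∑.when d (ℂ∑.when e x) ℂ.≈ ℂ∑.when e (ℂ∑.when d x)
when-swap (yes _) e       x = ℂ.refl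
when-swap (no _)  (yes _) x = ℂ.refl
when-swap (no _)  (no _)  x = ℂ.refl

module _ {I : FinSet} (A : Composition I) where

  -- φ restricts to exactly one family of orders of the blocks.
  ∑-restriction : ∀ φ (h : BlockOrders A → ℂ.Carrier) → (∀ {ψ ψ′} → (∀ r → ψ r ≈ᵀ ψ′ r) → h ψ ℂ.≈ h ψ′) →
    ℂ∑.∑ (finite-block-orders A) (λ ψ → ℂ∑.when (restricts-to? A φ ψ) (h ψ)) ℂ.≈ h (restrictᵀ A φ)
  ∑-restriction φ h h-cong = ℂ.trans
    (ℂ∑.∑-cong (finite-block-orders A) {λ ψ → ℂ∑.when (restricts-to? A φ ψ) (h ψ)} {λ ψ → ℂ∑.when (d ψ) (h ψ)} λ ψ → ℂ∑.when-cong (restricts-to? A φ ψ) (d ψ)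
      (λ p r i j → ≡.sym (p r i j)) (λ p r i j → ≡.sym (p r i j)) (λ _ → ℂ.refl {h ψ}))
    (ℂ∑.∑-kronecker (finite-block-orders A) h (λ {ψ} {ψ′} → h-cong {ψ} {ψ′}) (restrictᵀ A φ) d)
    where
    d : ∀ ψ → Dec (∀ r → ψ r ≈ᵀ restrictᵀ A φ r)
    d ψ = Dec.map′ (λ p r i j → ≡.sym (p r i j)) (λ p r i j → ≡.sym (p r i j)) (restricts-to? A φ ψ)

  -- Star is a bijection from block orders to the orders in which the blocks ascend.
  ∑-ascending : (h : BlockOrders A → ℂ.Carrier) → (∀ {ψ ψ′} → (∀ r → ψ r ≈ᵀ ψ′ r) → h ψ ℂ.≈ h ψ′) →
    ℂ∑.∑ (finite-total-orders {I}) (λ φ → ℂ∑.when (ascending? A φ) (h (restrictᵀ A φ))) ℂ.≈ ℂ∑.∑ (finite-block-orders A) h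
  ∑-ascending h h-cong = begin
    ℂ∑.∑ F (λ φ → ℂ∑.when (ascending? A φ) (h (restrictᵀ A φ)))
      -- The value at the restriction of φ is written as a sum over all families ψ. After the
      -- exchange of sums, ψ leaves exactly one ascending order, its ordinal sum.
      ≈⟨ ℂ∑.∑-cong F (λ φ → ℂ∑.when-congʳ (ascending? A φ) λ _ → ∑-restriction φ h (λ {ψ} {ψ′} → h-cong {ψ} {ψ′})) ⟨
    ℂ∑.∑ F (λ φ → ℂ∑.when (ascending? A φ) (ℂ∑.∑ G (λ ψ → ℂ∑.when (restricts-to? A φ ψ) (h ψ))))
      ≈⟨ ℂ∑.∑-cong F (λ φ → ℂ∑.∑-when G (ascending? A φ) (λ ψ → ℂ∑.when (restricts-to? A φ ψ) (h ψ))) ⟩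
    ℂ∑.∑ F (λ φ → ℂ∑.∑ G (λ ψ → ℂ∑.when (ascending? A φ) (ℂ∑.when (restricts-to? A φ ψ) (h ψ))))
      ≈⟨ ℂ∑.∑-swap F G (λ φ ψ → ℂ∑.when (ascending? A φ) (ℂ∑.when (restricts-to? A φ ψ) (h ψ))) ⟩
    ℂ∑.∑ G (λ ψ → ℂ∑.∑ F (λ φ → ℂ∑.when (ascending? A φ) (ℂ∑.when (restricts-to? A φ ψ) (h ψ))))
      ≈⟨ ℂ∑.∑-cong G (λ ψ → ℂ.trans
           (ℂ∑.∑-cong F {λ φ → ℂ∑.when (ascending? A φ) (ℂ∑.when (restricts-to? A φ ψ) (h ψ))} {λ φ → ℂ∑.when (φ ≟ᵀ star A ψ) (h ψ)}
             λ φ → ℂ∑.when-× (ascending? A φ) (restricts-to? A φ ψ) (φ ≟ᵀ star A ψ) (unique φ ψ) (ascends φ ψ))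
           (ℂ∑.∑-kronecker F (λ _ → h ψ) (λ _ → ℂ.refl {h ψ}) (star A ψ) (λ φ → φ ≟ᵀ star A ψ))) ⟩
    ℂ∑.∑ G h ∎
    where
    open SetoidReasoning ℂ.setoid
    F = finite-total-orders {I}
    G = finite-block-orders A
    _≟ᵀ_ : (φ φ′ : TotalOrder I) → Dec (φ ≈ᵀ φ′)
    _≟ᵀ_ = Finite._≈?_ F
    unique : ∀ φ ψ → Ascending A φ → (∀ r → restrictᵀ A φ r ≈ᵀ ψ r) → φ ≈ᵀ star A ψ
    unique φ ψ asc p = ≈ᵀ-trans {τ = φ} {star A (restrictᵀ A φ)} {star A ψ}
      (≈ᵀ-sym {τ = star A (restrictᵀ A φ)} {φ} (ascending-star A φ asc)) (star-cong A {restrictᵀ A φ} {ψ} p)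
    ascends : ∀ φ ψ → φ ≈ᵀ star A ψ → Ascending A φ × (∀ r → restrictᵀ A φ r ≈ᵀ ψ r)
    ascends φ ψ e = star-ascending A φ ψ (≈ᵀ-sym {τ = φ} {star A ψ} e) ,
      λ r i j → ≡.trans (e (proj₁ i) (proj₁ j)) (restrict-star A ψ r i j)

module _ {q : ℕ} (𝔽 : FiniteField q) where

  open PatternGroups 𝔽
  open Matrices using (Mat)
  open Rearrangement (cf 𝔽)
  private module 𝔽 = FiniteField 𝔽

  private
    _⇂_ : {I : FinSet} → Mat I → (J : Subset I) → Mat ⟦ J ⟧
    _⇂_ = _∣ᴹ_ 𝔽

  module _ {I : FinSet} (A B : Composition I) where

    open Matrices I using (_≋_; module ≋)

    private
      D : ∀ r → Composition ⟦ block A r ⟧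
      D r = B ∣ block A r

      C : Composition I
      C = A ∧ᵗ B

      F = finite-total-orders {I}
      G = finite-block-orders A

      Free-∧⁻ : ∀ φ {i j} → ¬ Eq A i j → Free 𝔽 C φ i j → Free 𝔽 A φ i j
      Free-∧⁻ φ {i} {j} ¬e (t , a) = t , go (Asc-∧⁻ A B a)
        where
        go : Asc A i j ⊎ (Eq A i j × Asc B i j) → Asc A i j
        go (inj₁ b)       = b
        go (inj₂ (e , _)) = ⊥-elim (¬e e)

      eqA? : ∀ i j → Dec (Eq A i j)
      eqA? i j = blockOf A i Fin.≟ blockOf A j

      -- The free entries of A ∧ B are those within the blocks of A and those between them.
      patch-patch : ∀ φ (X Z Z′ : Mat I) → patch 𝔽 A φ (patch 𝔽 C φ X Z) Z′ ≋ patch 𝔽 C φ X (choose 𝔽 {I} eqA? Z Z′)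
      patch-patch φ X Z Z′ i j = go (Dec.toSum (eqA? i j)) (Dec.toSum (free? 𝔽 C φ i j)) (Dec.toSum (blockOf C i Fin.≟ blockOf C j))
        where
        W : Mat I
        W = choose 𝔽 {I} eqA? Z Z′
        go : Eq A i j ⊎ ¬ Eq A i j → Free 𝔽 C φ i j ⊎ ¬ Free 𝔽 C φ i j → Eq C i j ⊎ ¬ Eq C i j →
             patch 𝔽 A φ (patch 𝔽 C φ X Z) Z′ i j 𝔽.≈ patch 𝔽 C φ X W i j
        go (inj₁ e) f (inj₁ c) = 𝔽.trans (patch-Eq 𝔽 A φ {patch 𝔽 C φ X Z} {Z′} e)
          (𝔽.trans (patch-Eq 𝔽 C φ {X} {Z} c) (𝔽.sym (patch-Eq 𝔽 C φ {X} {W} c)))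
        go (inj₁ e) (inj₁ f) (inj₂ ¬c) = 𝔽.trans (patch-Eq 𝔽 A φ {patch 𝔽 C φ X Z} {Z′} e)
          (𝔽.trans (patch-free 𝔽 C φ {X} {Z} f) (𝔽.sym (𝔽.trans (patch-free 𝔽 C φ {X} {W} f) (choose-yes 𝔽 {I} eqA? Z Z′ e))))
        go (inj₁ e) (inj₂ ¬f) (inj₂ ¬c) = 𝔽.trans (patch-Eq 𝔽 A φ {patch 𝔽 C φ X Z} {Z′} e)
          (𝔽.trans (patch-off 𝔽 C φ {X} {Z} ¬c ¬f) (𝔽.sym (patch-off 𝔽 C φ {X} {W} ¬c ¬f)))
        go (inj₂ ¬e) f (inj₁ c) = ⊥-elim (¬e (proj₁ (Eq-∧⁻ A B c)))
        go (inj₂ ¬e) (inj₁ f) (inj₂ ¬c) = 𝔽.trans (patch-free 𝔽 A φ {patch 𝔽 C φ X Z} {Z′} (Free-∧⁻ φ ¬e f))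
          (𝔽.sym (𝔽.trans (patch-free 𝔽 C φ {X} {W} f) (choose-no 𝔽 {I} eqA? Z Z′ ¬e)))
        go (inj₂ ¬e) (inj₂ ¬f) (inj₂ ¬c) = 𝔽.trans
          (patch-off 𝔽 A φ {patch 𝔽 C φ X Z} {Z′} ¬e λ (t , a) → ¬f (t , Asc-∧⁺ A B (inj₁ a)))
          (𝔽.sym (patch-off 𝔽 C φ {X} {W} ¬c ¬f))

      -- The free entries within the blocks of A come from Z, those between the blocks from Z′, and
      -- by `𝔼-choose` their splice is uniform again.
      mean-mean : ∀ f φ (X : Mat I) → 𝔼 𝔽 I (λ Z → mean 𝔽 A f φ (patch 𝔽 C φ X Z)) ℂ.≈ mean 𝔽 C f φ X
      mean-mean f φ X = ℂ.trans
        (𝔼-cong 𝔽 I λ Z → 𝔼-cong 𝔽 I λ Z′ → ev-cong 𝔽 f {φ} {φ} {patch 𝔽 A φ (patch 𝔽 C φ X Z) Z′} {patch 𝔽 C φ X (choose 𝔽 {I} eqA? Z Z′)}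
          (≈ᵀ-refl {τ = φ}) (patch-patch φ X Z Z′))
        (𝔼-choose 𝔽 {I} eqA? (λ Z → ev 𝔽 f φ (patch 𝔽 C φ X Z))
          (λ {Z} {Z′} e → ev-cong 𝔽 f {φ} {φ} {patch 𝔽 C φ X Z} {patch 𝔽 C φ X Z′} (≈ᵀ-refl {τ = φ})
            (patch-cong 𝔽 C φ {X} {X} {Z} {Z′} (λ i j _ → 𝔽.refl) (λ i j _ → e i j))))

    -- On A_r the relations Eq and Asc of B ∣ A_r are those of B, so patching commutes with cutting
    -- out blocks of A. Since φ can be any order restricting to ψ, patches along two such orders
    -- agree within the blocks of A.
    patch-block : ∀ φ (ψ : BlockOrders A) → (∀ r → restrictᵀ A φ r ≈ᵀ ψ r) → ∀ (X Z : Mat I) r i j →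
                  patch 𝔽 B φ X Z (proj₁ i) (proj₁ j) 𝔽.≈ patches 𝔽 A D ψ X Z r i j
    patch-block φ ψ p X Z r i j = go (Dec.toSum (blockOf B (proj₁ i) Fin.≟ blockOf B (proj₁ j))) (Dec.toSum (free? 𝔽 B φ (proj₁ i) (proj₁ j)))
      where
      go : Eq B (proj₁ i) (proj₁ j) ⊎ ¬ Eq B (proj₁ i) (proj₁ j) → Free 𝔽 B φ (proj₁ i) (proj₁ j) ⊎ ¬ Free 𝔽 B φ (proj₁ i) (proj₁ j) →
           patch 𝔽 B φ X Z (proj₁ i) (proj₁ j) 𝔽.≈ patches 𝔽 A D ψ X Z r i j
      go (inj₁ e) _ = 𝔽.trans (patch-Eq 𝔽 B φ {X} {Z} e)
        (𝔽.sym (patch-Eq 𝔽 (D r) (ψ r) {X ⇂ block A r} {Z ⇂ block A r} (Eq-∣⁺ B (block A r) i j e)))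
      go (inj₂ ¬e) (inj₁ (t , a)) = 𝔽.trans (patch-free 𝔽 B φ {X} {Z} (t , a))
        (𝔽.sym (patch-free 𝔽 (D r) (ψ r) {X ⇂ block A r} {Z ⇂ block A r} (≡.subst T (p r i j) t , Asc-∣⁺ B (block A r) i j a)))
      go (inj₂ ¬e) (inj₂ ¬f) = 𝔽.trans (patch-off 𝔽 B φ {X} {Z} ¬e ¬f)
        (𝔽.sym (patch-off 𝔽 (D r) (ψ r) {X ⇂ block A r} {Z ⇂ block A r} (¬e ∘ Eq-∣⁻ B (block A r) i j)
          λ (t , a) → ¬f (≡.subst T (≡.sym (p r i j)) t , Asc-∣⁻ B (block A r) i j a)))

    private
      patch-∧ : ∀ φ (X Z : Mat I) i j → Eq A i j → patch 𝔽 C φ X Z i j 𝔽.≈ patch 𝔽 B φ X Z i j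
      patch-∧ φ X Z i j e = go (Dec.toSum (blockOf B i Fin.≟ blockOf B j)) (Dec.toSum (free? 𝔽 B φ i j))
        where
        go : Eq B i j ⊎ ¬ Eq B i j → Free 𝔽 B φ i j ⊎ ¬ Free 𝔽 B φ i j → patch 𝔽 C φ X Z i j 𝔽.≈ patch 𝔽 B φ X Z i j
        go (inj₁ e′) _ = 𝔽.trans (patch-Eq 𝔽 C φ {X} {Z} (Eq-∧⁺ A B e e′)) (𝔽.sym (patch-Eq 𝔽 B φ {X} {Z} e′))
        go (inj₂ ¬e′) (inj₁ (t , a)) = 𝔽.trans (patch-free 𝔽 C φ {X} {Z} (t , Asc-∧⁺ A B (inj₂ (e , a)))) (𝔽.sym (patch-free 𝔽 B φ {X} {Z} (t , a)))
        go (inj₂ ¬e′) (inj₂ ¬f) = 𝔽.trans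
          (patch-off 𝔽 C φ {X} {Z} (¬e′ ∘ proj₂ ∘ Eq-∧⁻ A B) λ (t , a) → ¬f (t , within-A (Asc-∧⁻ A B a)))
          (𝔽.sym (patch-off 𝔽 B φ {X} {Z} ¬e′ ¬f))
          where
          within-A : Asc A i j ⊎ (Eq A i j × Asc B i j) → Asc B i j
          within-A (inj₁ a)       = ⊥-elim (Fin.<-irrefl e a)
          within-A (inj₂ (_ , a)) = a

    restricts-∧⁺ : ∀ φ′ φ → Restricts 𝔽 A D (restrictᵀ A φ′) φ → AgreeOn (Eq C) φ′ φ
    restricts-∧⁺ φ′ φ p i j c = restricts⇒agree (D r) (φ′ ∣ᵀ block A r) (φ ∣ᵀ block A r) (p r) (i , proj₂ (covers A i)) (j , Eq-member A e)
      (Eq-∣⁺ B (block A r) (i , proj₂ (covers A i)) (j , Eq-member A e) (proj₂ (Eq-∧⁻ A B c)))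
      where
      r = blockOf A i
      e : Eq A i j
      e = proj₁ (Eq-∧⁻ A B c)

    restricts-∧⁻ : ∀ φ′ φ → AgreeOn (Eq C) φ′ φ → Restricts 𝔽 A D (restrictᵀ A φ′) φ
    restricts-∧⁻ φ′ φ p r = agree⇒restricts (D r) (φ′ ∣ᵀ block A r) (φ ∣ᵀ block A r)
      λ i j e → p (proj₁ i) (proj₁ j) (Eq-∧⁺ A B (Eq-blocks A (proj₂ i) (proj₂ j)) (Eq-∣⁻ B (block A r) i j e))

    restricts-cong : ∀ {ψ ψ′ : BlockOrders A} φ → (∀ r → ψ r ≈ᵀ ψ′ r) → Restricts 𝔽 A D ψ φ → Restricts 𝔽 A D ψ′ φ
    restricts-cong φ e p r s i j = ≡.trans (≡.sym (e r (proj₁ i) (proj₁ j))) (p r s i j)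

    private
      -- `δ-ev` asks for one matrix with the given blocks, and the patch along `star A ψ` provides
      -- it. On Eq(A), where `mean` reads its argument, this coincides with the patch for A ∧ B
      -- along each φ′ that restricts to ψ.
      double-δ : ∀ f (ψ : BlockOrders A) (X Z : Mat I) → evᵗ 𝔽 A (δ 𝔽 A f) ψ (patches 𝔽 A D ψ X Z) ℂ.≈
        ℂ∑.∑ F (λ φ′ → ℂ∑.when (restricts-to? A φ′ ψ) (mean 𝔽 A f φ′ (patch 𝔽 C φ′ X Z)))
      double-δ f ψ X Z = ℂ.trans
        (δ-ev 𝔽 A f ψ (patches 𝔽 A D ψ X Z) (patch 𝔽 B (star A ψ) X Z) (patch-block (star A ψ) ψ (restrict-star A ψ) X Z))
        (ℂ∑.∑-cong F λ φ′ → ℂ∑.when-congʳ (restricts-to? A φ′ ψ) λ p →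
          mean-cong 𝔽 A f {φ′} {φ′} {patch 𝔽 B (star A ψ) X Z} {patch 𝔽 C φ′ X Z} (≈ᵀ-refl {τ = φ′}) λ i j e →
            𝔽.trans (patch-block (star A ψ) ψ (restrict-star A ψ) X Z (blockOf A i) (i , proj₂ (covers A i)) (j , Eq-member A e))
              (𝔽.trans (𝔽.sym (patch-block φ′ ψ p X Z (blockOf A i) (i , proj₂ (covers A i)) (j , Eq-member A e)))
                (𝔽.sym (patch-∧ φ′ X Z i j e))))

    δ-δ-ev : ∀ f φ (X : Mat I) → evʳ 𝔽 C (merge A D (⨂δ 𝔽 A D (δ 𝔽 A f))) φ X ℂ.≈ δ-sum 𝔽 C f φ X
    δ-δ-ev f φ X = begin
      evʳ 𝔽 C (merge A D (⨂δ 𝔽 A D (δ 𝔽 A f))) φ X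
        ≈⟨ ⨂δ-ev 𝔽 A D (δ 𝔽 A f) φ X ⟩
      ℂ∑.∑ G (λ ψ → ℂ∑.when (R ψ) (𝔼 𝔽 I (λ Z → evᵗ 𝔽 A (δ 𝔽 A f) ψ (patches 𝔽 A D ψ X Z))))
        ≈⟨ ℂ∑.∑-cong G (λ ψ → ℂ.trans (ℂ∑.when-congʳ (R ψ) λ _ → averaged ψ)
             (ℂ∑.∑-when F (R ψ) (λ φ′ → ℂ∑.when (restricts-to? A φ′ ψ) (mean 𝔽 C f φ′ X)))) ⟩
      ℂ∑.∑ G (λ ψ → ℂ∑.∑ F (λ φ′ → ℂ∑.when (R ψ) (ℂ∑.when (restricts-to? A φ′ ψ) (mean 𝔽 C f φ′ X))))
        ≈⟨ ℂ∑.∑-swap G F (λ ψ φ′ → ℂ∑.when (R ψ) (ℂ∑.when (restricts-to? A φ′ ψ) (mean 𝔽 C f φ′ X))) ⟩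
      ℂ∑.∑ F (λ φ′ → ℂ∑.∑ G (λ ψ → ℂ∑.when (R ψ) (ℂ∑.when (restricts-to? A φ′ ψ) (mean 𝔽 C f φ′ X))))
        ≈⟨ ℂ∑.∑-cong F collapse ⟩
      ℂ∑.∑ F (λ φ′ → ℂ∑.when (restricts-to? C φ′ (restrictᵀ C φ)) (mean 𝔽 C f φ′ X))
        ≈⟨ δ-sum-≈ 𝔽 C f φ X ⟨
      δ-sum 𝔽 C f φ X ∎
      where
      open SetoidReasoning ℂ.setoid
      R : ∀ ψ → Dec (Restricts 𝔽 A D ψ φ)
      R ψ = restricts? 𝔽 A D ψ φ
      averaged : ∀ ψ → 𝔼 𝔽 I (λ Z → evᵗ 𝔽 A (δ 𝔽 A f) ψ (patches 𝔽 A D ψ X Z)) ℂ.≈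
                       ℂ∑.∑ F (λ φ′ → ℂ∑.when (restricts-to? A φ′ ψ) (mean 𝔽 C f φ′ X))
      averaged ψ = begin
        𝔼 𝔽 I (λ Z → evᵗ 𝔽 A (δ 𝔽 A f) ψ (patches 𝔽 A D ψ X Z))
          ≈⟨ 𝔼-cong 𝔽 I (double-δ f ψ X) ⟩
        𝔼 𝔽 I (λ Z → ℂ∑.∑ F (λ φ′ → ℂ∑.when (restricts-to? A φ′ ψ) (mean 𝔽 A f φ′ (patch 𝔽 C φ′ X Z))))
          -- The orders φ′ are summed independently of Z, so the mean moves inside the sum, where
          -- `mean-mean` joins it with the mean over the entries between the blocks of A.
          ≈⟨ E-∑ (Matrices.finite-matrices I) (matrices-nonZero 𝔽 I) F
               (λ φ′ Z → ℂ∑.when (restricts-to? A φ′ ψ) (mean 𝔽 A f φ′ (patch 𝔽 C φ′ X Z))) ⟨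
        ℂ∑.∑ F (λ φ′ → 𝔼 𝔽 I (λ Z → ℂ∑.when (restricts-to? A φ′ ψ) (mean 𝔽 A f φ′ (patch 𝔽 C φ′ X Z))))
          ≈⟨ ℂ∑.∑-cong F (λ φ′ → ℂ.trans
               (ℂ.sym (E-when (Matrices.finite-matrices I) (matrices-nonZero 𝔽 I) (restricts-to? A φ′ ψ) (λ Z → mean 𝔽 A f φ′ (patch 𝔽 C φ′ X Z))))
               (ℂ∑.when-congʳ (restricts-to? A φ′ ψ) λ _ → mean-mean f φ′ X)) ⟩
        ℂ∑.∑ F (λ φ′ → ℂ∑.when (restricts-to? A φ′ ψ) (mean 𝔽 C f φ′ X)) ∎
      collapse : ∀ φ′ → ℂ∑.∑ G (λ ψ → ℂ∑.when (R ψ) (ℂ∑.when (restricts-to? A φ′ ψ) (mean 𝔽 C f φ′ X))) ℂ.≈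
                        ℂ∑.when (restricts-to? C φ′ (restrictᵀ C φ)) (mean 𝔽 C f φ′ X)
      collapse φ′ = begin
        ℂ∑.∑ G (λ ψ → ℂ∑.when (R ψ) (ℂ∑.when (restricts-to? A φ′ ψ) (mean 𝔽 C f φ′ X)))
          ≈⟨ ℂ∑.∑-cong G (λ ψ → when-swap (R ψ) (restricts-to? A φ′ ψ) (mean 𝔽 C f φ′ X)) ⟩
        ℂ∑.∑ G (λ ψ → ℂ∑.when (restricts-to? A φ′ ψ) (ℂ∑.when (R ψ) (mean 𝔽 C f φ′ X)))
          ≈⟨ ∑-restriction A φ′ (λ ψ → ℂ∑.when (R ψ) (mean 𝔽 C f φ′ X)) (λ {ψ} {ψ′} e →
               ℂ∑.when-cong (R ψ) (R ψ′) (restricts-cong {ψ} {ψ′} φ e) (restricts-cong {ψ′} {ψ} φ λ r i j → ≡.sym (e r i j)) (λ _ → ℂ.refl)) ⟩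
        ℂ∑.when (R (restrictᵀ A φ′)) (mean 𝔽 C f φ′ X)
          ≈⟨ ℂ∑.when-cong (R (restrictᵀ A φ′)) (restricts-to? C φ′ (restrictᵀ C φ))
               (λ p → agree⇒restricts C φ′ φ (restricts-∧⁺ φ′ φ p)) (λ p → restricts-∧⁻ φ′ φ (restricts⇒agree C φ′ φ p)) (λ _ → ℂ.refl) ⟩
        ℂ∑.when (restricts-to? C φ′ (restrictᵀ C φ)) (mean 𝔽 C f φ′ X) ∎

  cf-coassociative : Coassociative (cf 𝔽) (μ 𝔽) (δ 𝔽)
  cf-coassociative A B e f = evʳ-injective 𝔽 B _ (δ 𝔽 B f) λ φ X _ → ℂ.trans
    (relabel-ev 𝔽 e (merge A (λ r → B ∣ block A r) (⨂δ 𝔽 A (λ r → B ∣ block A r) (δ 𝔽 A f))) φ X)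
    (ℂ.trans (δ-δ-ev A B f φ X)
      (ℂ.trans (ℂ.sym (δ-sum-≈ᴷ 𝔽 e f φ X)) (ℂ.sym (δ-evʳ 𝔽 B f φ X))))

-- Compatibility

module _ {I : FinSet} (A B : Composition I) where

  ascending-restriction : ∀ φ′ φ → Ascending A φ′ → AgreeOn (Eq B) φ′ φ → ∀ s → Ascending (A ∣ block B s) (φ ∣ᵀ block B s)
  ascending-restriction φ′ φ asc p s i j a = ≡.subst T
    (p (proj₁ i) (proj₁ j) (Eq-blocks B (proj₂ i) (proj₂ j)))
    (asc (proj₁ i) (proj₁ j) (Asc-∣⁻ A (block B s) i j a))

  -- Let i and j lie in one block of B. In the same block of A they share a block of A ∧ B, where
  -- agreement is assumed. In different blocks of A both orders are forced: φ′ because Asc(A) is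
  -- contained in it, φ because Asc(A) is contained in it within the blocks of B.
  agree-∧⇒agree : ∀ φ′ φ → Ascending A φ′ → (∀ s → Ascending (A ∣ block B s) (φ ∣ᵀ block B s)) →
                  AgreeOn (Eq (A ∧ᵗ B)) φ′ φ → AgreeOn (Eq B) φ′ φ
  agree-∧⇒agree φ′ φ asc asc′ p i j e = go (Fin.<-cmp (blockOf A i) (blockOf A j))
    where
    s : Fin (length B)
    s = blockOf B i
    φ-ascends : ∀ k l → T (block B s ∋ k) → T (block B s ∋ l) → Asc A k l → (k , l) ∈ᵀ φ
    φ-ascends k l k∈ l∈ a = asc′ s (k , k∈) (l , l∈) (Asc-∣⁺ A (block B s) (k , k∈) (l , l∈) a)
    i∈ : T (block B s ∋ i)
    i∈ = proj₂ (covers B i)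
    descends : ∀ ψ → (j , i) ∈ᵀ ψ → Asc A j i → ¬ (i , j) ∈ᵀ ψ
    descends ψ t a u = Fin.<-irrefl (≡.cong (blockOf A) (IsTotalOrder.antisym (TotalOrder.isTotalOrder ψ) t u)) a
    go : Tri (Asc A i j) (Eq A i j) (Asc A j i) → TotalOrder.rel φ′ i j ≡ TotalOrder.rel φ i j
    go (tri< a _ _)  = T-ext (λ _ → φ-ascends i j i∈ (Eq-member B e) a) (λ _ → asc i j a)
    go (tri≈ _ e′ _) = p i j (Eq-∧⁺ A B e′ e)
    go (tri> _ _ a)  = T-ext (λ t → ⊥-elim (descends φ′ (asc j i a) a t))
      (λ t → ⊥-elim (descends φ (φ-ascends j i (Eq-member B e) i∈ a) a t))

module _ {q : ℕ} (𝔽 : FiniteField q) where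

  open PatternGroups 𝔽
  open Matrices using (Mat)
  open Rearrangement (cf 𝔽)
  private module 𝔽 = FiniteField 𝔽

  private
    _⇂_ : {I : FinSet} → Mat I → (J : Subset I) → Mat ⟦ J ⟧
    _⇂_ = _∣ᴹ_ 𝔽

  module _ {I : FinSet} (A B : Composition I) where

    private
      D : ∀ r → Composition ⟦ block A r ⟧
      D r = B ∣ block A r

      D′ : ∀ s → Composition ⟦ block B s ⟧
      D′ s = A ∣ block B s

      F : Finite (total-orders I)
      F = finite-total-orders {I}

      G : Finite (block-orders A)
      G = finite-block-orders A

    opaque
      unfolding evʳ

      evʳ-patch : ∀ t φ X Z → evʳ 𝔽 A t φ (patch 𝔽 B φ X Z) ℂ.≈ evᵗ 𝔽 A t (restrictᵀ A φ) (patches 𝔽 A D (restrictᵀ A φ) X Z)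
      evʳ-patch t φ X Z = evᵗ-cong 𝔽 A t {restrictᵀ A φ} {restrictᵀ A φ} {_∥_ 𝔽 A (patch 𝔽 B φ X Z)} {patches 𝔽 A D (restrictᵀ A φ) X Z}
        (λ r → ≈ᵀ-refl {τ = restrictᵀ A φ r}) (patch-block 𝔽 A B φ (restrictᵀ A φ) (λ r i j → refl) X Z)

    -- Allows `μ-evʳ` to be applied under the mean. Within the blocks of B the patch has the entries
    -- of X, and φ′ agrees there with φ; other nonzero entries are at free positions, which belong
    -- to φ′.
    patch-agree-pattern : ∀ φ′ φ (X Z : Mat I) → AgreeOn (Eq B) φ′ φ → (∀ s → HasPattern (toPartial (φ ∣ᵀ block B s)) (X ⇂ block B s)) →
                     HasPattern (toPartial φ′) (patch 𝔽 B φ′ X Z)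
    patch-agree-pattern φ′ φ X Z p X∈ = Pattern.hasPattern (toPartial φ′) {patch 𝔽 B φ′ X Z}
      (λ {i} {j} ∉φ′ → off i j ∉φ′ (Dec.toSum (blockOf B i Fin.≟ blockOf B j)))
      (λ i → 𝔽.trans (patch-Eq 𝔽 B φ′ {X} {Z} {i} {i} refl)
        (Pattern.unipotent (toPartial (φ ∣ᵀ block B (blockOf B i))) {X ⇂ block B (blockOf B i)} (X∈ (blockOf B i)) (i , proj₂ (covers B i))))
      where
      off : ∀ i j → ¬ (i , j) ∈ᵀ φ′ → Eq B i j ⊎ ¬ Eq B i j → patch 𝔽 B φ′ X Z i j 𝔽.≈ 𝔽.0#
      off i j ∉φ′ (inj₁ e) = 𝔽.trans (patch-Eq 𝔽 B φ′ {X} {Z} e)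
        (Pattern.vanishes (toPartial (φ ∣ᵀ block B (blockOf B i))) {X ⇂ block B (blockOf B i)} (X∈ (blockOf B i))
          {i , proj₂ (covers B i)} {j , Eq-member B e} (λ t → ∉φ′ (≡.subst T (≡.sym (p i j e)) t)))
      off i j ∉φ′ (inj₂ ¬e) = patch-off 𝔽 B φ′ {X} {Z} ¬e λ (t , _) → ∉φ′ t

    module _ (t : Tensor (Factors 𝔽 A)) (φ : TotalOrder I) (X : Mat I)
             (X∈ : ∀ s → HasPattern (toPartial (φ ∣ᵀ block B s)) (X ⇂ block B s)) where

      private
        K : BlockOrders A → ℂ.Carrier
        K ψ = 𝔼 𝔽 I (λ Z → evᵗ 𝔽 A t ψ (patches 𝔽 A D ψ X Z))

        K-cong : ∀ {ψ ψ′} → (∀ r → ψ r ≈ᵀ ψ′ r) → K ψ ℂ.≈ K ψ′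
        K-cong {ψ} {ψ′} e = 𝔼-cong 𝔽 I λ Z → evᵗ-cong 𝔽 A t {ψ} {ψ′} {patches 𝔽 A D ψ X Z} {patches 𝔽 A D ψ′ X Z} e λ r i j →
          -- Both families of patches consist of the blocks of one matrix, the patch along
          -- `star A ψ`.
          𝔽.trans (𝔽.sym (patch-block 𝔽 A B (star A ψ) ψ (restrict-star A ψ) X Z r i j))
            (patch-block 𝔽 A B (star A ψ) ψ′ (λ r i j → ≡.trans (restrict-star A ψ r i j) (e r i j)) X Z r i j)

        RB : ∀ φ′ → Dec (∀ s → restrictᵀ B φ′ s ≈ᵀ restrictᵀ B φ s)
        RB φ′ = restricts-to? B φ′ (restrictᵀ B φ)

        R : ∀ ψ → Dec (Restricts 𝔽 A D ψ φ)
        R ψ = restricts? 𝔽 A D ψ φ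

        all : Dec (∀ s → Ascending (D′ s) (φ ∣ᵀ block B s))
        all = Fin.all? (λ s → ascending? (D′ s) (φ ∣ᵀ block B s))

        mean-μ : ∀ φ′ → (∀ s → restrictᵀ B φ′ s ≈ᵀ restrictᵀ B φ s) →
          mean 𝔽 B (μ 𝔽 A t) φ′ X ℂ.≈ ℂ∑.when (ascending? A φ′) (K (restrictᵀ A φ′))
        mean-μ φ′ p = begin
          𝔼 𝔽 I (λ Z → ev 𝔽 (μ 𝔽 A t) φ′ (patch 𝔽 B φ′ X Z))
            ≈⟨ 𝔼-cong 𝔽 I (λ Z → ℂ.trans
                 (μ-evʳ 𝔽 A t φ′ (patch 𝔽 B φ′ X Z) (patch-agree-pattern φ′ φ X Z (restricts⇒agree B φ′ φ p) X∈))
                 (ℂ∑.when-congʳ (ascending? A φ′) λ _ → evʳ-patch t φ′ X Z)) ⟩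
          𝔼 𝔽 I (λ Z → ℂ∑.when (ascending? A φ′) (evᵗ 𝔽 A t (restrictᵀ A φ′) (patches 𝔽 A D (restrictᵀ A φ′) X Z)))
            ≈⟨ E-when (Matrices.finite-matrices I) (matrices-nonZero 𝔽 I) (ascending? A φ′)
                 (λ Z → evᵗ 𝔽 A t (restrictᵀ A φ′) (patches 𝔽 A D (restrictᵀ A φ′) X Z)) ⟨
          ℂ∑.when (ascending? A φ′) (K (restrictᵀ A φ′)) ∎
          where open SetoidReasoning ℂ.setoid

        -- Both nestings are brought to a single guard, and `fwd` and `bwd` compare the guards. The
        -- condition that φ′ ascends stays on the right because `∑-ascending` uses it to turn the
        -- sum over φ′ into one over block orders.
        conditions : ∀ φ′ x → ℂ∑.when (RB φ′) (ℂ∑.when (ascending? A φ′) x) ℂ.≈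
                              ℂ∑.when all (ℂ∑.when (ascending? A φ′) (ℂ∑.when (R (restrictᵀ A φ′)) x))
        conditions φ′ x = ℂ.trans
          (ℂ∑.when-× (RB φ′) (ascending? A φ′) (all Dec.×-dec asc×R) {x} fwd bwd)
          (ℂ.sym (ℂ.trans
            (ℂ∑.when-congʳ all {ℂ∑.when (ascending? A φ′) (ℂ∑.when (R (restrictᵀ A φ′)) x)} {ℂ∑.when asc×R x}
              (λ _ → ℂ∑.when-× (ascending? A φ′) (R (restrictᵀ A φ′)) asc×R {x} _,_ id))
            (ℂ∑.when-× all asc×R (all Dec.×-dec asc×R) {x} _,_ id)))
          where
          asc×R : Dec (Ascending A φ′ × Restricts 𝔽 A D (restrictᵀ A φ′) φ)
          asc×R = ascending? A φ′ Dec.×-dec R (restrictᵀ A φ′)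
          fwd : (∀ s → restrictᵀ B φ′ s ≈ᵀ restrictᵀ B φ s) → Ascending A φ′ →
                (∀ s → Ascending (D′ s) (φ ∣ᵀ block B s)) × Ascending A φ′ × Restricts 𝔽 A D (restrictᵀ A φ′) φ
          fwd p asc = ascending-restriction A B φ′ φ asc p′ , asc ,
            restricts-∧⁻ 𝔽 A B φ′ φ λ i j e → p′ i j (proj₂ (Eq-∧⁻ A B e))
            where
            p′ : AgreeOn (Eq B) φ′ φ
            p′ = restricts⇒agree B φ′ φ p
          bwd : (∀ s → Ascending (D′ s) (φ ∣ᵀ block B s)) × Ascending A φ′ × Restricts 𝔽 A D (restrictᵀ A φ′) φ →
                (∀ s → restrictᵀ B φ′ s ≈ᵀ restrictᵀ B φ s) × Ascending A φ′
          bwd (asc′ , asc , p) = agree⇒restricts B φ′ φ (agree-∧⇒agree A B φ′ φ asc asc′ (restricts-∧⁺ 𝔽 A B φ′ φ p)) , asc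

      δ-μ-ev : evʳ 𝔽 B (δ 𝔽 B (μ 𝔽 A t)) φ X ℂ.≈ ℂ∑.when all (ℂ∑.∑ G (λ ψ → ℂ∑.when (R ψ) (K ψ)))
      δ-μ-ev = begin
        evʳ 𝔽 B (δ 𝔽 B (μ 𝔽 A t)) φ X
          ≈⟨ ℂ.trans (δ-evʳ 𝔽 B (μ 𝔽 A t) φ X) (δ-sum-≈ 𝔽 B (μ 𝔽 A t) φ X) ⟩
        ℂ∑.∑ F (λ φ′ → ℂ∑.when (RB φ′) (mean 𝔽 B (μ 𝔽 A t) φ′ X))
          ≈⟨ ℂ∑.∑-cong F (λ φ′ → ℂ.trans (ℂ∑.when-congʳ (RB φ′) (mean-μ φ′)) (conditions φ′ (K (restrictᵀ A φ′)))) ⟩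
        ℂ∑.∑ F (λ φ′ → ℂ∑.when all (h φ′))
          ≈⟨ ℂ∑.∑-when F all h ⟨
        ℂ∑.when all (ℂ∑.∑ F h)
          -- The summand depends on φ′ only through its restrictions to the blocks of A, and only
          -- ascending orders contribute; these correspond to the families ψ.
          ≈⟨ ℂ∑.when-congʳ all (λ _ → ∑-ascending A (λ ψ → ℂ∑.when (R ψ) (K ψ)) λ {ψ} {ψ′} e →
               ℂ∑.when-cong (R ψ) (R ψ′) (restricts-cong 𝔽 A B {ψ} {ψ′} φ e)
                 (restricts-cong 𝔽 A B {ψ′} {ψ} φ λ r i j → ≡.sym (e r i j)) (λ _ → K-cong {ψ} {ψ′} e)) ⟩
        ℂ∑.when all (ℂ∑.∑ G (λ ψ → ℂ∑.when (R ψ) (K ψ))) ∎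
        where
        open SetoidReasoning ℂ.setoid
        h : TotalOrder I → ℂ.Carrier
        h φ′ = ℂ∑.when (ascending? A φ′) (ℂ∑.when (R (restrictᵀ A φ′)) (K (restrictᵀ A φ′)))

      -- Neither the regrouping by `split` nor the permutation β changes the value at (φ , X), so
      -- the products contribute their guard and the coproducts their sum.
      μ-δ-ev : evʳ 𝔽 B (⨂μ 𝔽 B D′ (split B D′ (β A B (merge A D (⨂δ 𝔽 A D t))))) φ X ℂ.≈
               ℂ∑.when all (ℂ∑.∑ G (λ ψ → ℂ∑.when (R ψ) (K ψ)))
      μ-δ-ev = ℂ.trans (⨂μ-ev 𝔽 B D′ (split B D′ v) φ X X∈) (ℂ∑.when-congʳ all λ _ →
        ℂ.trans (merge-split-ev 𝔽 B D′ v φ X)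
          (ℂ.trans (rearrange-ev 𝔽 (A ∧ᵗ B) (B ∧ᵗ A) (∧ᵗ-swap A B) (merge A D (⨂δ 𝔽 A D t)) φ X)
            (⨂δ-ev 𝔽 A D t φ X)))
        where
        v : Tensor (Factors 𝔽 (B ∧ᵗ A))
        v = β A B (merge A D (⨂δ 𝔽 A D t))

  cf-compatible : Compatible (cf 𝔽) (μ 𝔽) (δ 𝔽)
  cf-compatible A B t = evʳ-injective 𝔽 B (δ 𝔽 B (μ 𝔽 A t)) _ λ φ X X∈ →
    ℂ.trans (δ-μ-ev A B t φ X X∈) (ℂ.sym (μ-δ-ev A B t φ X X∈))

-- Naturality

module _ {I J : FinSet} (σ : I ≃ J) (A : Composition I) where

  ascending-transport : ∀ φ → Ascending A (transportᵀ (sym-≃ σ) φ) → Ascending (transport σ A) φ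
  ascending-transport φ asc i j a = ≡.subst T (≡.cong₂ (TotalOrder.rel φ) (to-from σ i) (to-from σ j)) (asc (from σ i) (from σ j) a)

  ascending-transport⁻ : ∀ φ → Ascending (transport σ A) φ → Ascending A (transportᵀ (sym-≃ σ) φ)
  ascending-transport⁻ φ asc i j a = asc (to σ i) (to σ j)
    (≡.subst₂ (Asc A) (≡.sym (from-to σ i)) (≡.sym (from-to σ j)) a)

  Eq-transport⁺ : ∀ {i j} → Eq A i j → Eq (transport σ A) (to σ i) (to σ j)
  Eq-transport⁺ {i} {j} e = ≡.subst₂ (Eq A) (≡.sym (from-to σ i)) (≡.sym (from-to σ j)) e

  Asc-transport⁺ : ∀ {i j} → Asc A i j → Asc (transport σ A) (to σ i) (to σ j)
  Asc-transport⁺ {i} {j} a = ≡.subst₂ (Asc A) (≡.sym (from-to σ i)) (≡.sym (from-to σ j)) a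

  Eq-transport⁻ : ∀ {i j} → Eq (transport σ A) (to σ i) (to σ j) → Eq A i j
  Eq-transport⁻ {i} {j} e = ≡.subst₂ (Eq A) (from-to σ i) (from-to σ j) e

  Asc-transport⁻ : ∀ {i j} → Asc (transport σ A) (to σ i) (to σ j) → Asc A i j
  Asc-transport⁻ {i} {j} a = ≡.subst₂ (Asc A) (from-to σ i) (from-to σ j) a

  agree-transport : ∀ φ′ φ → AgreeOn (Eq (transport σ A)) φ′ φ → AgreeOn (Eq A) (transportᵀ (sym-≃ σ) φ′) (transportᵀ (sym-≃ σ) φ)
  agree-transport φ′ φ p i j e = p (to σ i) (to σ j) (Eq-transport⁺ e)

  agree-transport⁻ : ∀ φ′ φ → AgreeOn (Eq A) (transportᵀ (sym-≃ σ) φ′) (transportᵀ (sym-≃ σ) φ) → AgreeOn (Eq (transport σ A)) φ′ φ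
  agree-transport⁻ φ′ φ p i j e = ≡.subst₂ (λ i j → TotalOrder.rel φ′ i j ≡ TotalOrder.rel φ i j) (to-from σ i) (to-from σ j)
    (p (from σ i) (from σ j) e)

module _ {q : ℕ} (𝔽 : FiniteField q) where

  open PatternGroups 𝔽
  open Matrices using (Mat)
  open UTElement using (pattern-π)
  private module 𝔽 = FiniteField 𝔽

  private
    _⇂_ : {I : FinSet} → Mat I → (J : Subset I) → Mat ⟦ J ⟧
    _⇂_ = _∣ᴹ_ 𝔽

  relabelled-pattern : {I J : FinSet} (σ : I ≃ J) (φ : TotalOrder J) (X : Mat J) → HasPattern (toPartial φ) X →
                       HasPattern (toPartial (transportᵀ (sym-≃ σ) φ)) (_^ᴹ_ 𝔽 X σ)
  relabelled-pattern σ φ X X∈ = pattern-π {π = toPartial (transportᵀ (sym-≃ σ) φ)}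
    (fun (relabelling 𝔽 (sym-≃ σ) φ) (fromPattern 𝔽 (toPartial φ) X X∈))

  module _ {I J : FinSet} (σ : I ≃ J) (A : Composition I) where

    private
      B : Composition J
      B = transport σ A

      σ⁻¹ : TotalOrder J → TotalOrder I
      σ⁻¹ = transportᵀ (sym-≃ σ)

      _^σ : Mat J → Mat I
      X ^σ = _^ᴹ_ 𝔽 X σ

      FI : Finite (total-orders I)
      FI = finite-total-orders {I}

      FJ : Finite (total-orders J)
      FJ = finite-total-orders {J}

    ⨂-transport : Tensor (Factors 𝔽 A) → Tensor (Factors 𝔽 B)
    ⨂-transport = ⨂-map {M = Factors 𝔽 A} {N = Factors 𝔽 B} (λ r → cf-map 𝔽 (transport-≃ σ A r))

    opaque
      unfolding evʳ

      transport-ev : ∀ t φ X → evʳ 𝔽 B (⨂-transport t) φ X ℂ.≈ evʳ 𝔽 A t (σ⁻¹ φ) (X ^σ)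
      transport-ev t φ X = agree (Factors 𝔽 A)
        (extend-∘-functional (evʳ-functional 𝔽 B φ X) (λ m → pure (λ r → cf-map 𝔽 (transport-≃ σ A r) (m r))))
        (evʳ-functional 𝔽 A (σ⁻¹ φ) (X ^σ)) on-pure t
        where
        on-pure : ∀ (m : ∀ r → ClassFunctions 𝔽 ⟦ block A r ⟧) →
          ∏ (λ r → ev 𝔽 (cf-map 𝔽 (transport-≃ σ A r) (m r)) (φ ∣ᵀ block B r) (X ⇂ block B r)) ℂ.≈
          ∏ (λ r → ev 𝔽 (m r) (σ⁻¹ φ ∣ᵀ block A r) ((X ^σ) ⇂ block A r))
        on-pure m = ∏-cong λ r → ℂ.trans (ev-map 𝔽 (transport-≃ σ A r) (m r) (φ ∣ᵀ block B r) (X ⇂ block B r))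
          (ev-cong 𝔽 (m r) {transportᵀ (sym-≃ (transport-≃ σ A r)) (φ ∣ᵀ block B r)} {σ⁻¹ φ ∣ᵀ block A r}
            {_^ᴹ_ 𝔽 (X ⇂ block B r) (transport-≃ σ A r)} {(X ^σ) ⇂ block A r} (λ i j → refl) (λ i j → 𝔽.refl))

    μ-transport : ∀ t → Mod._≈ᴹ_ (obj (cf 𝔽) J) (cf-map 𝔽 σ (μ 𝔽 A t)) (μ 𝔽 B (⨂-transport t))
    μ-transport t = ev-injective 𝔽 (cf-map 𝔽 σ (μ 𝔽 A t)) (μ 𝔽 B (⨂-transport t)) λ φ X X∈ → begin
      ev 𝔽 (cf-map 𝔽 σ (μ 𝔽 A t)) φ X
        ≈⟨ ev-map 𝔽 σ (μ 𝔽 A t) φ X ⟩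
      ev 𝔽 (μ 𝔽 A t) (σ⁻¹ φ) (X ^σ)
        ≈⟨ μ-evʳ 𝔽 A t (σ⁻¹ φ) (X ^σ) (relabelled-pattern σ φ X X∈) ⟩
      ℂ∑.when (ascending? A (σ⁻¹ φ)) (evʳ 𝔽 A t (σ⁻¹ φ) (X ^σ))
        ≈⟨ ℂ∑.when-cong (ascending? A (σ⁻¹ φ)) (ascending? B φ) (ascending-transport σ A φ) (ascending-transport⁻ σ A φ)
             (λ _ → ℂ.sym (transport-ev t φ X)) ⟩
      ℂ∑.when (ascending? B φ) (evʳ 𝔽 B (⨂-transport t) φ X)
        ≈⟨ μ-evʳ 𝔽 B (⨂-transport t) φ X X∈ ⟨
      ev 𝔽 (μ 𝔽 B (⨂-transport t)) φ X ∎
      where open SetoidReasoning ℂ.setoid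

    patch-transport : ∀ φ (X Z : Mat J) → Matrices._≋_ I (patch 𝔽 B φ X Z ^σ) (patch 𝔽 A (σ⁻¹ φ) (X ^σ) (Z ^σ))
    patch-transport φ X Z i j = go (Dec.toSum (blockOf A i Fin.≟ blockOf A j)) (Dec.toSum (free? 𝔽 A (σ⁻¹ φ) i j))
      where
      go : Eq A i j ⊎ ¬ Eq A i j → Free 𝔽 A (σ⁻¹ φ) i j ⊎ ¬ Free 𝔽 A (σ⁻¹ φ) i j →
           patch 𝔽 B φ X Z (to σ i) (to σ j) 𝔽.≈ patch 𝔽 A (σ⁻¹ φ) (X ^σ) (Z ^σ) i j
      go (inj₁ e) _ = 𝔽.trans (patch-Eq 𝔽 B φ {X} {Z} (Eq-transport⁺ σ A e)) (𝔽.sym (patch-Eq 𝔽 A (σ⁻¹ φ) {X ^σ} {Z ^σ} e))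
      go (inj₂ _) (inj₁ (t , a)) = 𝔽.trans (patch-free 𝔽 B φ {X} {Z} (t , Asc-transport⁺ σ A a))
        (𝔽.sym (patch-free 𝔽 A (σ⁻¹ φ) {X ^σ} {Z ^σ} (t , a)))
      go (inj₂ ¬e) (inj₂ ¬f) = 𝔽.trans
        (patch-off 𝔽 B φ {X} {Z} (¬e ∘ Eq-transport⁻ σ A) λ (t , a) → ¬f (t , Asc-transport⁻ σ A a))
        (𝔽.sym (patch-off 𝔽 A (σ⁻¹ φ) {X ^σ} {Z ^σ} ¬e ¬f))

    -- The means run over Mat(J) and Mat(I). Sending (Z , W) to W relabelled by σ and Z relabelled
    -- by σ⁻¹ is an involution of Mat(J) × Mat(I), as `E-transfer` requires.
    mean-transport : ∀ f φ X → mean 𝔽 B (cf-map 𝔽 σ f) φ X ℂ.≈ mean 𝔽 A f (σ⁻¹ φ) (X ^σ)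
    mean-transport f φ X = E-transfer (Matrices.finite-matrices J) (matrices-nonZero 𝔽 J) (Matrices.finite-matrices I) (matrices-nonZero 𝔽 I)
      (λ Z W → _^ᴹ_ 𝔽 W (sym-≃ σ)) (λ Z W → Z ^σ)
      (λ {Z} {Z′} {W} {W′} e e′ i j → e′ (from σ i) (from σ j))
      (λ {Z} {Z′} {W} {W′} e e′ i j → e (to σ i) (to σ j))
      (λ Z W i j → 𝔽.reflexive (≡.cong₂ Z (to-from σ i) (to-from σ j)))
      (λ Z W i j → 𝔽.reflexive (≡.cong₂ W (from-to σ i) (from-to σ j)))
      (λ Z → ev 𝔽 (cf-map 𝔽 σ f) φ (patch 𝔽 B φ X Z))
      (λ {Z} {Z′} e → ev-cong 𝔽 (cf-map 𝔽 σ f) {φ} {φ} {patch 𝔽 B φ X Z} {patch 𝔽 B φ X Z′} (≈ᵀ-refl {τ = φ})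
        (patch-cong 𝔽 B φ {X} {X} {Z} {Z′} (λ i j _ → 𝔽.refl) (λ i j _ → e i j)))
      (λ W → ev 𝔽 f (σ⁻¹ φ) (patch 𝔽 A (σ⁻¹ φ) (X ^σ) W))
      λ Z W → ℂ.trans (ev-map 𝔽 σ f φ (patch 𝔽 B φ X (_^ᴹ_ 𝔽 W (sym-≃ σ))))
        (ev-cong 𝔽 f {σ⁻¹ φ} {σ⁻¹ φ} {patch 𝔽 B φ X (_^ᴹ_ 𝔽 W (sym-≃ σ)) ^σ} {patch 𝔽 A (σ⁻¹ φ) (X ^σ) W} (≈ᵀ-refl {τ = σ⁻¹ φ})
          (Matrices.≋.trans I {patch 𝔽 B φ X (_^ᴹ_ 𝔽 W (sym-≃ σ)) ^σ} {patch 𝔽 A (σ⁻¹ φ) (X ^σ) ((_^ᴹ_ 𝔽 W (sym-≃ σ)) ^σ)} {patch 𝔽 A (σ⁻¹ φ) (X ^σ) W}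
            (patch-transport φ X (_^ᴹ_ 𝔽 W (sym-≃ σ)))
            (patch-cong 𝔽 A (σ⁻¹ φ) {X ^σ} {X ^σ} {(_^ᴹ_ 𝔽 W (sym-≃ σ)) ^σ} {W} (λ i j _ → 𝔽.refl)
              (λ i j _ → 𝔽.reflexive (≡.cong₂ W (from-to σ i) (from-to σ j))))))

    δ-sum-transport : ∀ f φ X → δ-sum 𝔽 B (cf-map 𝔽 σ f) φ X ℂ.≈ δ-sum 𝔽 A f (σ⁻¹ φ) (X ^σ)
    δ-sum-transport f φ X = begin
      δ-sum 𝔽 B (cf-map 𝔽 σ f) φ X
        ≈⟨ δ-sum-≈ 𝔽 B (cf-map 𝔽 σ f) φ X ⟩
      ℂ∑.∑ FJ (λ φ′ → ℂ∑.when (restricts-to? B φ′ (restrictᵀ B φ)) (mean 𝔽 B (cf-map 𝔽 σ f) φ′ X))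
        ≈⟨ ℂ∑.∑-cong FJ (λ φ′ → ℂ∑.when-cong (restricts-to? B φ′ (restrictᵀ B φ)) (restricts-to? A (σ⁻¹ φ′) (restrictᵀ A (σ⁻¹ φ)))
             (λ p → agree⇒restricts A (σ⁻¹ φ′) (σ⁻¹ φ) (agree-transport σ A φ′ φ (restricts⇒agree B φ′ φ p)))
             (λ p → agree⇒restricts B φ′ φ (agree-transport⁻ σ A φ′ φ (restricts⇒agree A (σ⁻¹ φ′) (σ⁻¹ φ) p)))
             (λ _ → mean-transport f φ′ X)) ⟩
      ℂ∑.∑ FJ (λ φ′ → h (σ⁻¹ φ′))
        ≈⟨ ∑-bijection FJ FI σ⁻¹ (transportᵀ σ) (λ e i j → e (to σ i) (to σ j)) (λ e i j → e (from σ i) (from σ j))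
             (λ φ′ i j → ≡.cong₂ (TotalOrder.rel φ′) (from-to σ i) (from-to σ j))
             (λ φ′ i j → ≡.cong₂ (TotalOrder.rel φ′) (to-from σ i) (to-from σ j)) h (λ {φ′} {φ″} → h-cong φ′ φ″) ⟩
      ℂ∑.∑ FI h
        ≈⟨ δ-sum-≈ 𝔽 A f (σ⁻¹ φ) (X ^σ) ⟨
      δ-sum 𝔽 A f (σ⁻¹ φ) (X ^σ) ∎
      where
      open SetoidReasoning ℂ.setoid
      h : TotalOrder I → ℂ.Carrier
      h φ′ = ℂ∑.when (restricts-to? A φ′ (restrictᵀ A (σ⁻¹ φ))) (mean 𝔽 A f φ′ (X ^σ))
      h-cong : ∀ φ′ φ″ → φ′ ≈ᵀ φ″ → h φ′ ℂ.≈ h φ″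
      h-cong φ′ φ″ e = ℂ∑.when-cong (restricts-to? A φ′ (restrictᵀ A (σ⁻¹ φ))) (restricts-to? A φ″ (restrictᵀ A (σ⁻¹ φ)))
        (λ p r i j → ≡.trans (≡.sym (e (proj₁ i) (proj₁ j))) (p r i j))
        (λ p r i j → ≡.trans (e (proj₁ i) (proj₁ j)) (p r i j))
        (λ _ → mean-cong 𝔽 A f {φ′} {φ″} {X ^σ} {X ^σ} e (λ i j _ → 𝔽.refl))

    δ-transport : ∀ f → _∼_ (Factors 𝔽 B) (⨂-transport (δ 𝔽 A f)) (δ 𝔽 B (cf-map 𝔽 σ f))
    δ-transport f = evʳ-injective 𝔽 B (⨂-transport (δ 𝔽 A f)) (δ 𝔽 B (cf-map 𝔽 σ f)) λ φ X _ → ℂ.trans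
      (transport-ev (δ 𝔽 A f) φ X) (ℂ.trans (δ-evʳ 𝔽 A f (σ⁻¹ φ) (X ^σ))
        (ℂ.trans (ℂ.sym (δ-sum-transport f φ X)) (ℂ.sym (δ-evʳ 𝔽 B (cf-map 𝔽 σ f) φ X))))

  cf-μ-natural : μ-Natural (cf 𝔽) (μ 𝔽) (δ 𝔽)
  cf-μ-natural σ A t = μ-transport σ A t

  cf-δ-natural : Δ-Natural (cf 𝔽) (μ 𝔽) (δ 𝔽)
  cf-δ-natural σ A f = δ-transport σ A f

  cf-isVectorSpecies : IsVectorSpecies (cf 𝔽)
  cf-isVectorSpecies = record
    { isVectorSpace     = cf-isVectorSpace 𝔽
    ; finiteDimensional = cf-finiteDimensional 𝔽
    ; map-linear        = cf-map-linear 𝔽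
    ; map-cong          = λ {I} {J} {σ} {τ} → cf-map-cong 𝔽 {I} {J} {σ} {τ}
    ; map-id            = λ {I} → cf-map-id 𝔽 {I}
    ; map-∘             = cf-map-∘ 𝔽
    }

  opaque
    unfolding δ

    cf-isConnectedHopfMonoid : IsConnectedHopfMonoid (cf 𝔽) (μ 𝔽) (Δ 𝔽 (external-iso 𝔽))
    cf-isConnectedHopfMonoid = cf-isVectorSpecies , cf-connected 𝔽 , (λ A → μ-linear 𝔽 A , δ-linear 𝔽 A) , cf-extensional 𝔽 ,
      cf-associative 𝔽 , cf-coassociative 𝔽 , cf-compatible 𝔽 , cf-μ-natural , cf-δ-natural

theorem4p1 : (p k : ℕ) → Prime p → k ≥ 1 → (𝔽 : FiniteField (p ^ k)) →
    Σ[ iso ∈ ExternalIso 𝔽 ] IsConnectedHopfMonoid (cf 𝔽) (μ 𝔽) (Δ 𝔽 iso)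
theorem4p1 p k _ _ 𝔽 = external-iso 𝔽 , cf-isConnectedHopfMonoid 𝔽
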